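{- Let $\mathfrak{s}$ be an unlabeled scheme with $n$ vertices, $\nu$ a consistent naming of its vertices, and $\pi:\{1,\dots,n\}\to V(\mathfrak{s})$ a bijection; let $\overline{\pi}(k)=\pi(n+1-k)$. Then the univariate series $R^{\pi}_{\mathfrak{s},\nu}(t)$, viewed as a function of $D$, is a rational function of $D$, and $R^{\overline{\pi}}_{\mathfrak{s},\nu}(1/D)=R^{\pi}_{\mathfrak{s},\nu}(D)$.
   Context: Blossoming maps: maps (cellular embeddings of connected graphs in compact orientable surfaces, given by counterclockwise cyclic orders at vertices) with extra stems, each a leaf (towards its vertex) or a bud (away); interior degree ignores stems, degree counts them; 4-valent = all degrees $4$. Rooted: a marked root bud; root corner = corner preceding it counterclockwise. For rooted unicellular blossoming maps: clockwise contour = cyclic sequence of corners and stems along the face from the root corner with the face on the right; canonical labeling: root corner $0$, next corner keeps label across an edge traversal, $+1$ across a bud, $-1$ across a leaf. Well-oriented: each edge oriented opposite to its first contour traversal. Well-labeled: corners on the same side of an edge have equal labels, consecutive corners around a vertex differ by $1$ with the larger on the left of the separating edge or stem. $\mathcal{R}$: rooted unicellular blossoming maps, all vertices of interior degree $\ge2$, 4-valent, well-oriented, well-labeled, with root bud at a vertex of interior degree $\ge3$ (scheme vertex). Labeled scheme of $\mathfrak{r}\in\mathcal{R}$: delete the vertices of interior degree $2$ with their stems, replacing each maximal path of them by one edge (inheriting the common orientation); corners at scheme vertices keep their labels. Forgetting labels gives the unlabeled scheme. Height $h(v)$ of a vertex = minimum label of its corners; relative label = label minus height (in $\{0,1,2\}$,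 depending only on the unlabeled scheme). A half-edge has type $0$ if its adjacent corners have relative labels $0,1$, type $1$ if $1,2$. Edge $\{u,v\}$ offset toward $v$: type $0$ at $u$, type $1$ at $v$. A naming is a bijection $\nu:V(\mathfrak{s})\to\{1,\dots,n\}$, consistent if $\nu(u)<\nu(v)$ whenever $\{u,v\}$ is offset toward $v$. Height order: the bijection $\{1,\dots,n\}\to V$ listing vertices by increasing lexicographic $(h(v),\nu(v))$. $\mathcal{R}^{\pi}_{\mathfrak{s},\nu}$: elements of $\mathcal{R}$ with unlabeled scheme $\mathfrak{s}$ and height order $\pi$. Univariate series: $R^{\pi}_{\mathfrak{s},\nu}(t)=\sum_{\mathfrak{r}\in\mathcal{R}^{\pi}_{\mathfrak{s},\nu}}t^{(\text{number of leaves of }\mathfrak{r})+1}$. $D(t)$ is the power series without constant term with $D=t+4tD+tD^2$, so that $t=D/(1+4D+D^2)$; series in $t$ are viewed as functions of $D$ through this substitution. -}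

module Defs where

-- Encoding of rooted unicellular blossoming maps.
-- A rooted unicellular blossoming map with N = suc m half-edges/stems is
-- encoded canonically by numbering its half-edges (edge half-edges and
-- stems) 0,1,...,N-1 in the order of the clockwise contour starting at the
-- root bud (number 0).  The face permutation is then  i ↦ i+1 mod N  and
-- the map is determined by the edge involution α (fixed points = stems)
-- and the kind of every half-edge.  The vertex rotation (counterclockwise
-- order) is  σ = next ∘ α.  Distinct encodings = distinct rooted maps.

open import Data.Nat as ℕ using (ℕ; zero; suc; _≤_; _∸_; _≤ᵇ_; _⊔_)
open import Data.Nat.DivMod using (_mod_)
open import Data.Nat.ListAction using () renaming (sum to sumℕ)
open import Data.Integer as ℤ using (ℤ; +_; -[1+_]; _⊓_)
open import Data.Fin as Fin using (Fin; toℕ)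
open import Data.Vec as Vec using (Vec; lookup; toList)
open import Data.List as List using (List; []; _∷_; map; take; upTo; length; foldr)
open import Data.List.Membership.Propositional using (_∈_)
open import Data.List.Relation.Unary.All using (All)
open import Data.List.Relation.Unary.Unique.Propositional using (Unique)
open import Data.Product using (Σ; Σ-syntax; ∃; ∃-syntax; _×_; _,_)
open import Data.Sum using (_⊎_)
open import Data.Unit using (⊤)
open import Data.Empty using (⊥)
open import Data.Bool using (if_then_else_)
open import Relation.Nullary using (¬_)
open import Relation.Binary.PropositionalEquality using (_≡_; _≢_)

data Kind : Set where
  edge leaf bud : Kind

record BMap : Set where
  constructor bmap
  field
    m     : ℕ
    inv   : Vec (Fin (suc m)) (suc m)
    kinds : Vec Kind (suc m)

-- half-edges (including stems), numbered in contour order, root bud = 0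
HE : BMap → Set
HE M = Fin (suc (BMap.m M))

α : (M : BMap) → HE M → HE M
α M h = lookup (BMap.inv M) h

κ : (M : BMap) → HE M → Kind
κ M h = lookup (BMap.kinds M) h

-- face (contour) permutation
next : (M : BMap) → HE M → HE M
next M h = suc (toℕ h) mod suc (BMap.m M)

-- counterclockwise rotation at vertices
σ : (M : BMap) → HE M → HE M
σ M h = next M (α M h)

iter : {A : Set} → (A → A) → ℕ → A → A
iter f zero    x = x
iter f (suc j) x = f (iter f j x)

SameVertex : (M : BMap) → HE M → HE M → Set
SameVertex M x y = ∃[ j ] iter (σ M) j x ≡ y

Valid : BMap → Set
Valid M = (∀ h → α M (α M h) ≡ h)
        × (∀ h → κ M h ≡ edge → α M h ≢ h)
        × (∀ h → κ M h ≢ edge → α M h ≡ h)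
        × (κ M Fin.zero ≡ bud)

FourValent : BMap → Set
FourValent M = ∀ h → (iter (σ M) 4 h ≡ h)
                   × (∀ j → 0 ℕ.< j → j ℕ.< 4 → iter (σ M) j h ≢ h)

edgeInd : Kind → ℕ
edgeInd edge = 1
edgeInd leaf = 0
edgeInd bud  = 0

leafInd : Kind → ℕ
leafInd edge = 0
leafInd leaf = 1
leafInd bud  = 0

intDeg : (M : BMap) → HE M → ℕ
intDeg M h = sumℕ (map (λ j → edgeInd (κ M (iter (σ M) j h))) (upTo 4))

leaves : BMap → ℕ
leaves M = sumℕ (map leafInd (toList (BMap.kinds M)))

-- Canonical labeling.  Corner h := the corner preceding h counterclockwise
-- (between σ⁻¹ h and h); in the contour the corner h is immediately
-- followed by the half-edge/stem h.  Root corner = corner 0.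

δ : Kind → ℤ
δ edge = + 0
δ leaf = -[1+ 0 ]
δ bud  = + 1

sumℤ : List ℤ → ℤ
sumℤ = foldr ℤ._+_ (+ 0)

label : (M : BMap) → HE M → ℤ
label M h = sumℤ (map δ (take (toℕ h) (toList (BMap.kinds M))))

-- h points away from its vertex, for the well-orientation (each edge is
-- oriented opposite to its first contour traversal: the edge {h, α h} is
-- first traversed at step min(h, α h), from the vertex of that half-edge).
outK : (M : BMap) → HE M → Kind → Set
outK M h edge = α M h Fin.< h
outK M h leaf = ⊥
outK M h bud  = ⊤

Out : (M : BMap) → HE M → Set
Out M h = outK M h (κ M h)

-- well-labeled (corner h is on the clockwise side of h, corner σ h on the
-- counterclockwise side; the left of an outgoing element is its ccw side)
WellLabeled : BMap → Set
WellLabeled M =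
    (∀ h → κ M h ≡ edge → label M h ≡ label M (σ M (α M h)))
  × (∀ h → Out M h → label M (σ M h) ≡ label M h ℤ.+ + 1)
  × (∀ h → ¬ Out M h → label M h ≡ label M (σ M h) ℤ.+ + 1)

InR : BMap → Set
InR M = Valid M × FourValent M × (∀ h → 2 ≤ intDeg M h)
      × (3 ≤ intDeg M Fin.zero) × WellLabeled M

-- Reach M h h' : starting along the edge half-edge h (at a scheme vertex),
-- following the maximal path of interior-degree-2 vertices, one arrives
-- at the half-edge h' of a scheme vertex.
data Reach (M : BMap) : HE M → HE M → Set where
  stop : ∀ {h} → 3 ≤ intDeg M (α M h) → Reach M h (α M h)
  step : ∀ {h z h'} → intDeg M (α M h) ≡ 2 → SameVertex M (α M h) z →
         z ≢ α M h → κ M z ≡ edge → Reach M z h' → Reach M h h'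

-- S is the unlabeled scheme of M, e identifying the half-edges of S with
-- the half-edges of M at scheme vertices (order preserving, so that the
-- contour of S is the restriction of that of M).
SchemeEmb : (M S : BMap) → (HE S → HE M) → Set
SchemeEmb M S e =
    (∀ x y → x Fin.< y → e x Fin.< e y)
  × (∀ h → 3 ≤ intDeg M h → ∃[ x ] e x ≡ h)
  × (∀ x → 3 ≤ intDeg M (e x))
  × (∀ x → κ S x ≡ κ M (e x))
  × (∀ x → κ S x ≡ edge → Reach M (e x) (e (α S x)))
  × (∀ x → κ S x ≢ edge → α S x ≡ x)

height : (M S : BMap) → (HE S → HE M) → HE S → ℤ
height M S e x = ((label M (e x) ⊓ label M (σ M (e x)))
                 ⊓ label M (iter (σ M) 2 (e x))) ⊓ label M (iter (σ M) 3 (e x))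

-- ν : naming of vertices of S (a function on half-edges, constant exactly on
-- vertices, onto Fin n), i.e. a bijection V(S) → {1..n}
Naming : (S : BMap) (n : ℕ) → (HE S → Fin n) → Set
Naming S n ν = (∀ x y → SameVertex S x y → ν x ≡ ν y)
             × (∀ x y → ν x ≡ ν y → SameVertex S x y)
             × (∀ i → ∃[ x ] ν x ≡ i)

-- π : bijection {1..n} → V(S), each vertex given by one of its half-edges
VertexEnum : (S : BMap) (n : ℕ) → (Fin n → HE S) → Set
VertexEnum S n π = (∀ i j → SameVertex S (π i) (π j) → i ≡ j)
                 × (∀ x → ∃[ i ] SameVertex S (π i) x)

HeightOrder : (M S : BMap) → (HE S → HE M) → (n : ℕ) →
              (HE S → Fin n) → (Fin n → HE S) → Set
HeightOrder M S e n ν π = ∀ i j → i Fin.< j →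
    (height M S e (π i) ℤ.< height M S e (π j))
  ⊎ (height M S e (π i) ≡ height M S e (π j) × ν (π i) Fin.< ν (π j))

-- relative labels of the corners of S (label minus height): they obey the
-- well-labeling rule around each vertex and have minimum 0 at each vertex
RelLabeling : (S : BMap) → (HE S → ℤ) → Set
RelLabeling S rl = (∀ x → Out S x → rl (σ S x) ≡ rl x ℤ.+ + 1)
                 × (∀ x → ¬ Out S x → rl x ≡ rl (σ S x) ℤ.+ + 1)
                 × (∀ x → + 0 ℤ.≤ rl x)
                 × (∀ x → ∃[ j ] rl (iter (σ S) j x) ≡ + 0)

-- types of the half-edge x (adjacent corners are x and σ x)
Type0 : (S : BMap) → (HE S → ℤ) → HE S → Set
Type0 S rl x = (rl x ≡ + 0 × rl (σ S x) ≡ + 1) ⊎ (rl x ≡ + 1 × rl (σ S x) ≡ + 0)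

Type1 : (S : BMap) → (HE S → ℤ) → HE S → Set
Type1 S rl x = (rl x ≡ + 1 × rl (σ S x) ≡ + 2) ⊎ (rl x ≡ + 2 × rl (σ S x) ≡ + 1)

-- consistent naming: ν(u) < ν(v) whenever edge {u,v} is offset toward v
Consistent : (S : BMap) (n : ℕ) → (HE S → Fin n) → Set
Consistent S n ν = ∃[ rl ] RelLabeling S rl
  × (∀ x → κ S x ≡ edge → Type0 S rl x → Type1 S rl (α S x) → ν x Fin.< ν (α S x))

RClass : (S : BMap) (n : ℕ) → (HE S → Fin n) → (Fin n → HE S) → ℕ → BMap → Set
RClass S n ν π k M = InR M × (leaves M ℕ.+ 1 ≡ k)
  × Σ[ e ∈ (HE S → HE M) ] (SchemeEmb M S e × HeightOrder M S e n ν π)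

Counts : (BMap → Set) → ℕ → Set
Counts Q c = Σ[ xs ∈ List BMap ] (length xs ≡ c) × Unique xs × All Q xs
           × (∀ M → Q M → M ∈ xs)

Series : Set
Series = ℕ → ℤ

_⋆_ : Series → Series → Series
(f ⋆ g) n = sumℤ (map (λ i → f i ℤ.* g (n ∸ i)) (upTo (suc n)))

oneS : Series
oneS zero    = + 1
oneS (suc _) = + 0

pow : Series → ℕ → Series
pow f zero    = oneS
pow f (suc k) = f ⋆ pow f k

-- 1/(1+4D+D²)
invQ : ℕ → ℤ
invQ zero          = + 1
invQ (suc zero)    = ℤ.- (+ 4)
invQ (suc (suc n)) = (ℤ.- (+ 4) ℤ.* invQ (suc n)) ℤ.- invQ n

-- t = D/(1+4D+D²) as a series in D
tD : Series
tD zero    = + 0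
tD (suc n) = invQ n

subD : (ℕ → ℕ) → Series
subD c n = sumℤ (map (λ k → + (c k) ℤ.* pow tD k n) (upTo (suc n)))

coeff : List ℤ → Series
coeff []      _       = + 0
coeff (a ∷ _) zero    = a
coeff (_ ∷ p) (suc n) = coeff p n

NonZeroPoly : List ℤ → Set
NonZeroPoly Q = ∃[ i ] coeff Q i ≢ + 0

RatRep : List ℤ → List ℤ → Series → Set
RatRep P Q F = NonZeroPoly Q × (∀ n → (coeff Q ⋆ F) n ≡ coeff P n)

-- D^M · P(1/D)
revPoly : ℕ → List ℤ → Series
revPoly M P n = if n ≤ᵇ M then coeff P (M ∸ n) else + 0

-- P₂(1/D)/Q₂(1/D) = P₁(D)/Q₁(D), cleared of denominators
ReflectEq : List ℤ → List ℤ → List ℤ → List ℤ → Set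
ReflectEq P₁ Q₁ P₂ Q₂ =
  ∀ n → (revPoly (length P₂ ⊔ length Q₂) P₂ ⋆ coeff Q₁) n
      ≡ (revPoly (length P₂ ⊔ length Q₂) Q₂ ⋆ coeff P₁) n

{-# OPTIONS --safe #-}

-- Every edge of the scheme of a map is a path of vertices of interior degree 2. Such a vertex has six
-- arrangements, of which four keep the label along the path and one each raises and lowers it, so a path is a
-- walk with steps 4 + z + 1/z, and in the variable D the walks of displacement Δ are counted by
-- D^|Δ| (1+4D+D²)/(1−D²). Conversely, heights of the scheme vertices together with words of arrangements having the
-- prescribed displacements determine exactly one map: inserting the vertices one by one builds it, and two maps
-- with the same words have the same contour. For heights in the order π, consistency of the naming makes every |Δ|
-- an affine function of the gaps between consecutive heights. Summing over the gaps gives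
--   t^(ℓ+1) (1+4D+D²)^E (1−D²)^(−E) D^b ∏ᵢ 1/(1−D^cᵢ),
-- where ℓ counts the leaves and E the edges of the scheme, cᵢ ≥ 1 the edges crossing the i-th cut of π, and b is the
-- sum of the |Δ| when all gaps are minimal.
-- Reversing π keeps the cᵢ and replaces b by Σᵢ cᵢ − b, so replacing D by 1/D yields the same function up to the
-- sign (−1)^(E+n−1). This sign is 1: the contour is a single cycle of length 4n, and it is the product of the
-- rotation, which has n cycles of length 4, and the edge involution.
module Submission where

open import Defs
open import Data.Nat as ℕ using (ℕ; zero; suc; _+_; _*_; _∸_; _≤_; _<_; z≤n; s≤s; _⊔_; _<ᵇ_)
import Data.Nat.Properties as ℕₚ
open import Data.Integer as ℤ using (ℤ; +_; -[1+_]) renaming (_+_ to _+ᶻ_; _*_ to _*ᶻ_)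
import Data.Integer.Properties as ℤₚ
import Data.Integer.Tactic.RingSolver as ℤRing
open import Data.List as List using (List; []; _∷_; map; upTo; applyUpTo; length; _++_; take)
import Data.List.Properties as Listₚ
open import Data.Product using (Σ; Σ-syntax; _×_; _,_; proj₁; proj₂; ∃-syntax)
open import Data.Sum using (_⊎_; inj₁; inj₂)
open import Data.Empty using (⊥-elim; ⊥)
open import Data.Bool using (true; false; if_then_else_; Bool; not; _xor_; _∧_) renaming (T to IsTrue)
import Data.Maybe as Maybe
open import Function using (_∘_; mk↔ₛ′)
open import Level using (0ℓ)
open import Algebra.Bundles using (CommutativeRing)
open import Relation.Nullary using (yes; no; does; Dec; ¬_)
open import Relation.Nullary.Decidable using (dec-true; dec-false; _×-dec_; _⊎-dec_; _→-dec_; ¬?) renaming (dec⇒maybe to decToMaybe; map′ to dec-map)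
open import Relation.Binary.PropositionalEquality hiding (J)
import Algebra.Solver.Ring.AlmostCommutativeRing as ACR
import Algebra.Solver.Ring as Solver
open import Data.Nat.ListAction using () renaming (sum to sumℕ)
import Data.Nat.Tactic.RingSolver as ℕRing
open import Data.List.Membership.Propositional using (_∈_)
open import Data.List.Membership.Propositional.Properties using (∈-++⁺ˡ; ∈-++⁺ʳ; ∈-map⁺; ∈-map⁻; ∈-++⁻)
open import Data.List.Relation.Unary.Any using (here; there)
open import Data.List.Relation.Unary.All as All using (All; []; _∷_)
open import Data.List.Relation.Unary.AllPairs using ([]; _∷_)
open import Data.List.Relation.Unary.Unique.Propositional using (Unique)
import Data.List.Relation.Unary.Unique.Propositional.Properties as Uniqueₚ
open import Data.Vec as Vec using (Vec; []; _∷_; lookup; tabulate; toList)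
import Data.Vec.Properties as Vecₚ
import Algebra.Properties.AbelianGroup ℤₚ.+-0-abelianGroup as ℤ+
open import Data.Fin as Fin using (Fin; zero; suc; toℕ; punchIn; punchOut; fromℕ<; inject₁; opposite)
open import Data.Maybe using (Maybe; just; nothing)
open import Data.Unit using (⊤; tt)
open import Data.Nat.DivMod using (_mod_; _%_; m<n⇒m%n≡m; n%n≡0; m%n<n)
import Data.Fin.Properties as Finₚ
open import Data.Vec.Functional using (insertAt)
open import Data.Vec.Functional.Properties using (insertAt-lookup; insertAt-punchIn; removeAt-insertAt)
open import Algebra.Properties.CommutativeMonoid.Sum ℕₚ.+-0-commutativeMonoid using (sum; sum-remove; sum-cong-≗; ∑-distrib-+; ∑-comm)
open import Relation.Binary.Definitions using (tri<; tri≈; tri>)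
import Data.Bool.Properties as Boolₚ
open import Data.Fin.Permutation using (↔⇒≡)
open import Function.Properties.Inverse using (↔-trans; ↔-sym)

-- Power series in D

open Defs using () renaming (_⋆_ to infixl 7 _⊛_) public

-- The variable D is the small root of the kernel of the walks, t (4 + D + 1/D) = 1. This is why
-- powers of D solve the one-step recursion and every path contributes a rational factor. The
-- obstacle to rationality is the absolute value: |Δ| is affine in the gaps only if the sign of Δ
-- does not depend on them. Neighbours in the height order have minimal gap 0 or 1, according to
-- whether their names ascend or descend. An offset edge shifts Δ by one, and a consistent naming
-- forces a descent in between whenever the shift is downward, so Δ keeps its sign. For the reversed
-- order the names are compared in reverse as well. Every cut is therefore a descent for exactly one
-- of the two orders, which is why the two minimal displacements of an edge add up to the number of
-- cuts it crosses. Maps are numberings of half-edges along the contour, so rooted isomorphism is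
-- equality. The price is that every insertion renumbers the half-edges, hence the order embeddings
-- below.

infix 4 _≈_
_≈_ : Series → Series → Set
f ≈ g = ∀ n → f n ≡ g n

infixl 6 _⊕_
_⊕_ : Series → Series → Series
(f ⊕ g) n = f n +ᶻ g n

⊝_ : Series → Series
(⊝ f) n = ℤ.- f n

0ˢ : Series
0ˢ _ = + 0

tl : Series → Series
tl f n = f (suc n)

∑< : ℕ → (ℕ → ℤ) → ℤ
∑< zero    h = + 0
∑< (suc n) h = h 0 +ᶻ ∑< n (h ∘ suc)

∑<-cong : ∀ n {h h′} → (∀ i → i < n → h i ≡ h′ i) → ∑< n h ≡ ∑< n h′
∑<-cong zero    e = refl
∑<-cong (suc n) e = cong₂ ℤ._+_ (e 0 (s≤s z≤n)) (∑<-cong n (λ i i<n → e (suc i) (s≤s i<n)))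

∑<-zero : ∀ n {h} → (∀ i → i < n → h i ≡ + 0) → ∑< n h ≡ + 0
∑<-zero zero    e = refl
∑<-zero (suc n) e = cong₂ ℤ._+_ (e 0 (s≤s z≤n)) (∑<-zero n (λ i i<n → e (suc i) (s≤s i<n)))

∑<-+ : ∀ n h h′ → ∑< n (λ i → h i +ᶻ h′ i) ≡ ∑< n h +ᶻ ∑< n h′
∑<-+ zero    h h′ = refl
∑<-+ (suc n) h h′ rewrite ∑<-+ n (h ∘ suc) (h′ ∘ suc) =
  lem (h 0) (h′ 0) (∑< n (h ∘ suc)) (∑< n (h′ ∘ suc))
  where
  lem : ∀ a b c d → a +ᶻ b +ᶻ (c +ᶻ d) ≡ a +ᶻ c +ᶻ (b +ᶻ d)
  lem = ℤRing.solve-∀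

∑<-*ˡ : ∀ n c h → ∑< n (λ i → c *ᶻ h i) ≡ c *ᶻ ∑< n h
∑<-*ˡ zero    c h = sym (ℤₚ.*-zeroʳ c)
∑<-*ˡ (suc n) c h rewrite ∑<-*ˡ n c (h ∘ suc) = sym (ℤₚ.*-distribˡ-+ c _ _)

∑<-last : ∀ n h → ∑< (suc n) h ≡ ∑< n h +ᶻ h n
∑<-last zero    h = ℤₚ.+-comm (h 0) (+ 0)
∑<-last (suc n) h rewrite ∑<-last n (h ∘ suc) = sym (ℤₚ.+-assoc (h 0) _ _)

∑<-extend : ∀ n k h → (∀ i → n ≤ i → h i ≡ + 0) → ∑< (n + k) h ≡ ∑< n h
∑<-extend zero    k h e = ∑<-zero k (λ i _ → e i z≤n)
∑<-extend (suc n) k h e = cong (h 0 +ᶻ_) (∑<-extend n k (h ∘ suc) (λ i le → e (suc i) (s≤s le)))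

∑<-swap : ∀ n k (h : ℕ → ℕ → ℤ) →
          ∑< n (λ i → ∑< k (h i)) ≡ ∑< k (λ j → ∑< n (λ i → h i j))
∑<-swap zero    k h = sym (∑<-zero k (λ _ _ → refl))
∑<-swap (suc n) k h rewrite ∑<-swap n k (h ∘ suc) = sym (∑<-+ k (h 0) _)

sumℤ-upTo : ∀ n h → sumℤ (map h (upTo n)) ≡ ∑< n h
sumℤ-upTo n h = trans (cong sumℤ (Listₚ.map-upTo h n)) (go n h)
  where
  go : ∀ n h → sumℤ (applyUpTo h n) ≡ ∑< n h
  go zero    h = refl
  go (suc n) h = cong (h 0 +ᶻ_) (go n (h ∘ suc))

⋆-∑ : ∀ f g n → (f ⊛ g) n ≡ ∑< (suc n) (λ i → f i *ᶻ g (n ∸ i))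
⋆-∑ f g n = sumℤ-upTo (suc n) (λ i → f i *ᶻ g (n ∸ i))

⋆-zero : ∀ f g → (f ⊛ g) 0 ≡ f 0 *ᶻ g 0
⋆-zero f g = ℤₚ.+-identityʳ _

⋆-suc : ∀ f g n → (f ⊛ g) (suc n) ≡ f 0 *ᶻ g (suc n) +ᶻ (tl f ⊛ g) n
⋆-suc f g n rewrite ⋆-∑ f g (suc n) | ⋆-∑ (tl f) g n = refl

⋆-cong< : ∀ f f′ g g′ n → (∀ i → i ≤ n → f i ≡ f′ i) → (∀ i → i ≤ n → g i ≡ g′ i) →
          (f ⊛ g) n ≡ (f′ ⊛ g′) n
⋆-cong< f f′ g g′ n e e′ rewrite ⋆-∑ f g n | ⋆-∑ f′ g′ n =
  ∑<-cong (suc n) (λ i i<n → cong₂ ℤ._*_ (e i (ℕₚ.≤-pred i<n)) (e′ (n ∸ i) (ℕₚ.m∸n≤m n i)))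

⋆-cong : ∀ {f f′ g g′} → f ≈ f′ → g ≈ g′ → f ⊛ g ≈ f′ ⊛ g′
⋆-cong {f} {f′} {g} {g′} e e′ n = ⋆-cong< f f′ g g′ n (λ i _ → e i) (λ i _ → e′ i)

⋆-zeroˡ : ∀ g → 0ˢ ⊛ g ≈ 0ˢ
⋆-zeroˡ g zero    = refl
⋆-zeroˡ g (suc n) = trans (⋆-suc 0ˢ g n) (trans (ℤₚ.+-identityˡ _) (⋆-zeroˡ g n))

⋆-identityˡ : ∀ g → oneS ⊛ g ≈ g
⋆-identityˡ g zero    = trans (⋆-zero oneS g) (ℤₚ.*-identityˡ _)
⋆-identityˡ g (suc n) = trans (⋆-suc oneS g n)
  (trans (cong₂ ℤ._+_ (ℤₚ.*-identityˡ (g (suc n)))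
                      (trans (⋆-cong {f = tl oneS} {g = g} (λ _ → refl) (λ _ → refl) n) (⋆-zeroˡ g n)))
         (ℤₚ.+-identityʳ _))

⋆-distribʳ : ∀ h f g → (f ⊕ g) ⊛ h ≈ (f ⊛ h) ⊕ (g ⊛ h)
⋆-distribʳ h f g zero rewrite ⋆-zero (f ⊕ g) h | ⋆-zero f h | ⋆-zero g h =
  ℤₚ.*-distribʳ-+ (h 0) (f 0) (g 0)
⋆-distribʳ h f g (suc n)
  rewrite ⋆-suc (f ⊕ g) h n | ⋆-suc f h n | ⋆-suc g h n | ⋆-distribʳ h (tl f) (tl g) n =
  lem (f 0) (g 0) (h (suc n)) _ _
  where
  lem : ∀ a b c x y → (a +ᶻ b) *ᶻ c +ᶻ (x +ᶻ y) ≡ a *ᶻ c +ᶻ x +ᶻ (b *ᶻ c +ᶻ y)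
  lem = ℤRing.solve-∀

⋆-scaleˡ : ∀ c f h → (λ n → c *ᶻ f n) ⊛ h ≈ (λ n → c *ᶻ (f ⊛ h) n)
⋆-scaleˡ c f h zero rewrite ⋆-zero (λ n → c *ᶻ f n) h | ⋆-zero f h = ℤₚ.*-assoc c _ _
⋆-scaleˡ c f h (suc n)
  rewrite ⋆-suc (λ n → c *ᶻ f n) h n | ⋆-suc f h n | ⋆-scaleˡ c (tl f) h n =
  lem c (f 0) (h (suc n)) _
  where
  lem : ∀ c x y z → c *ᶻ x *ᶻ y +ᶻ c *ᶻ z ≡ c *ᶻ (x *ᶻ y +ᶻ z)
  lem = ℤRing.solve-∀

-- Peeling the first coefficient off both factors leaves the product of `tl f` and `tl g`, two
-- degrees lower, where the recursive call exchanges them. This explains the two base cases.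
⋆-comm : ∀ f g → f ⊛ g ≈ g ⊛ f
⋆-comm f g zero rewrite ⋆-zero f g | ⋆-zero g f = ℤₚ.*-comm (f 0) (g 0)
⋆-comm f g (suc zero)
  rewrite ⋆-suc f g 0 | ⋆-suc g f 0 | ⋆-zero (tl f) g | ⋆-zero (tl g) f =
  lem (f 0) (g 1) (f 1) (g 0)
  where
  lem : ∀ a b c d → a *ᶻ b +ᶻ c *ᶻ d ≡ d *ᶻ c +ᶻ b *ᶻ a
  lem = ℤRing.solve-∀
⋆-comm f g (suc (suc n)) =
  combine (⋆-comm (tl f) g (suc n)) (⋆-comm (tl g) f (suc n)) (⋆-comm (tl g) (tl f) n)
  where
  lem : ∀ a b c → a +ᶻ (b +ᶻ c) ≡ b +ᶻ (a +ᶻ c)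
  lem = ℤRing.solve-∀
  combine : (tl f ⊛ g) (suc n) ≡ (g ⊛ tl f) (suc n) → (tl g ⊛ f) (suc n) ≡ (f ⊛ tl g) (suc n) →
         (tl g ⊛ tl f) n ≡ (tl f ⊛ tl g) n → (f ⊛ g) (suc (suc n)) ≡ (g ⊛ f) (suc (suc n))
  combine e₁ e₂ e₃
    rewrite ⋆-suc f g (suc n) | ⋆-suc g f (suc n) | e₁ | e₂
          | ⋆-suc g (tl f) n | ⋆-suc f (tl g) n | e₃ =
    lem (f 0 *ᶻ g (suc (suc n))) (g 0 *ᶻ f (suc (suc n))) _

⋆-assoc : ∀ f g h → (f ⊛ g) ⊛ h ≈ f ⊛ (g ⊛ h)
⋆-assoc f g h zero
  rewrite ⋆-zero (f ⊛ g) h | ⋆-zero f g | ⋆-zero f (g ⊛ h) | ⋆-zero g h =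
  ℤₚ.*-assoc (f 0) (g 0) (h 0)
⋆-assoc f g h (suc n)
  rewrite ⋆-suc (f ⊛ g) h n | ⋆-suc f (g ⊛ h) n | ⋆-suc g h n | ⋆-zero f g
        | ⋆-cong {f = tl (f ⊛ g)} {g = h} (⋆-suc f g) (λ _ → refl) n
        | ⋆-distribʳ h (λ i → f 0 *ᶻ g (suc i)) (tl f ⊛ g) n
        | ⋆-scaleˡ (f 0) (tl g) h n | ⋆-assoc (tl f) g h n =
  lem (f 0) (g 0) (h (suc n)) _ _
  where
  lem : ∀ a b c x y → a *ᶻ b *ᶻ c +ᶻ (a *ᶻ x +ᶻ y) ≡ a *ᶻ (b *ᶻ c +ᶻ x) +ᶻ y
  lem = ℤRing.solve-∀

-- The ring of series and its solver

seriesRing : CommutativeRing 0ℓ 0ℓ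
seriesRing = record
  { Carrier = Series ; _≈_ = _≈_ ; _+_ = _⊕_ ; _*_ = _⊛_ ; -_ = ⊝_ ; 0# = 0ˢ ; 1# = oneS
  ; isCommutativeRing = record
    { isRing = record
      { +-isAbelianGroup = record
        { isGroup = record
          { isMonoid = record
            { isSemigroup = record
              { isMagma = record
                { isEquivalence = record
                  { refl = λ _ → refl ; sym = λ e n → sym (e n)
                  ; trans = λ e e′ n → trans (e n) (e′ n) }
                ; ∙-cong = λ e e′ n → cong₂ ℤ._+_ (e n) (e′ n) }
              ; assoc = λ f g h n → ℤₚ.+-assoc (f n) (g n) (h n) }
            ; identity = (λ f n → ℤₚ.+-identityˡ (f n)) , (λ f n → ℤₚ.+-identityʳ (f n)) }
          ; inverse = (λ f n → ℤₚ.+-inverseˡ (f n)) , (λ f n → ℤₚ.+-inverseʳ (f n))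
          ; ⁻¹-cong = λ e n → cong ℤ.-_ (e n) }
        ; comm = λ f g n → ℤₚ.+-comm (f n) (g n) }
      ; *-cong = ⋆-cong
      ; *-assoc = ⋆-assoc
      ; *-identity = ⋆-identityˡ , (λ f n → trans (⋆-comm f oneS n) (⋆-identityˡ f n))
      ; distrib = (λ h f g n → trans (⋆-comm h (f ⊕ g) n) (trans (⋆-distribʳ h f g n)
                      (cong₂ ℤ._+_ (⋆-comm f h n) (⋆-comm g h n)))) , ⋆-distribʳ }
    ; *-comm = ⋆-comm } }

-- The cases 0 and 1 are split off so that the constants of solver expressions evaluate to `0ˢ` and
-- `oneS` themselves, as they occur in the identities to be solved.
constant : ℤ → Series
constant (+ 0) = 0ˢ
constant (+ 1) = oneS
constant c     = λ n → c *ᶻ oneS n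

constant-≈ : ∀ c n → constant c n ≡ c *ᶻ oneS n
constant-≈ (+ 0)           n = sym (ℤₚ.*-zeroˡ (oneS n))
constant-≈ (+ 1)           n = sym (ℤₚ.*-identityˡ (oneS n))
constant-≈ (+ suc (suc _)) n = refl
constant-≈ -[1+ _ ]        n = refl

seriesACR : ACR.AlmostCommutativeRing 0ℓ 0ℓ
seriesACR = ACR.fromCommutativeRing seriesRing

constant-hom : CommutativeRing.rawRing ℤₚ.+-*-commutativeRing ACR.-Raw-AlmostCommutative⟶ seriesACR
constant-hom = record
  { ⟦_⟧ = constant
  ; +-homo = λ a b n → trans (constant-≈ (a +ᶻ b) n) (trans (ℤₚ.*-distribʳ-+ (oneS n) a b)
      (sym (cong₂ _+ᶻ_ (constant-≈ a n) (constant-≈ b n))))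
  ; *-homo = λ a b n → trans (constant-≈ (a *ᶻ b) n) (sym (trans (⋆-cong (constant-≈ a) (constant-≈ b) n)
      (trans (⋆-scaleˡ a oneS (λ n → b *ᶻ oneS n) n)
        (trans (cong (a *ᶻ_) (⋆-identityˡ (λ n → b *ᶻ oneS n) n)) (sym (ℤₚ.*-assoc a b (oneS n)))))))
  ; -‿homo = λ a n → trans (constant-≈ (ℤ.- a) n) (trans (sym (ℤₚ.neg-distribˡ-* a (oneS n)))
      (cong ℤ.-_ (sym (constant-≈ a n))))
  ; 0-homo = λ _ → refl
  ; 1-homo = λ _ → refl }

module S-Solver = Solver (CommutativeRing.rawRing ℤₚ.+-*-commutativeRing) seriesACR constant-hom
  (λ a b → Maybe.map (λ e n → cong (λ c → constant c n) e) (decToMaybe (a ℤ.≟ b)))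
open S-Solver using (solve; _:=_; _:+_; _:*_; :-_; con)

:1 : ∀ {n} → S-Solver.Polynomial n
:1 = con (+ 1)

:0 : ∀ {n} → S-Solver.Polynomial n
:0 = con (+ 0)

open CommutativeRing seriesRing public
  using () renaming (refl to ≈-refl; sym to ≈-sym; trans to ≈-trans; setoid to ≈-setoid
                    ; +-cong to ⊕-cong; -‿cong to ⊝-cong)

D′ : Series → Series
D′ f zero    = + 0
D′ f (suc n) = f n

Dˢ : Series
Dˢ = coeff (+ 0 ∷ + 1 ∷ [])

coeff-[] : ∀ f → coeff [] ⊛ f ≈ 0ˢ
coeff-[] f n = trans (⋆-cong {f = coeff []} {g = f} (λ _ → refl) (λ _ → refl) n) (⋆-zeroˡ f n)

coeff-[1] : ∀ f → coeff (+ 1 ∷ []) ⊛ f ≈ f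
coeff-[1] f zero    = trans (⋆-zero (coeff (+ 1 ∷ [])) f) (ℤₚ.*-identityˡ _)
coeff-[1] f (suc n) = trans (⋆-suc (coeff (+ 1 ∷ [])) f n)
  (trans (cong₂ _+ᶻ_ (ℤₚ.*-identityˡ (f (suc n))) (coeff-[] f n)) (ℤₚ.+-identityʳ _))

D⋆ : ∀ f → Dˢ ⊛ f ≈ D′ f
D⋆ f zero    = ⋆-zero Dˢ f
D⋆ f (suc n) = trans (⋆-suc Dˢ f n) (trans (ℤₚ.+-identityˡ _) (coeff-[1] f n))

quad : Series
quad = coeff (+ 1 ∷ + 4 ∷ + 1 ∷ [])

q-poly : quad ≈ oneS ⊕ (Dˢ ⊕ Dˢ ⊕ Dˢ ⊕ Dˢ) ⊕ Dˢ ⊛ Dˢ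
q-poly n = trans (lem n) (cong (λ z → oneS n +ᶻ (Dˢ n +ᶻ Dˢ n +ᶻ Dˢ n +ᶻ Dˢ n) +ᶻ z) (sym (D⋆ Dˢ n)))
  where
  lem : quad ≈ oneS ⊕ (Dˢ ⊕ Dˢ ⊕ Dˢ ⊕ Dˢ) ⊕ D′ Dˢ
  lem 0 = refl
  lem 1 = refl
  lem 2 = refl
  lem (suc (suc (suc n))) = refl

invQ-q : invQ ⊛ quad ≈ oneS
invQ-q n = trans (⋆-comm invQ quad n) (lem n)
  where
  r : ∀ a b → + 1 *ᶻ (ℤ.- (+ 4) *ᶻ a ℤ.- b) +ᶻ (+ 4 *ᶻ a +ᶻ b) ≡ + 0
  r = ℤRing.solve-∀
  lem : quad ⊛ invQ ≈ oneS
  lem 0 = refl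
  lem 1 = refl
  lem (suc (suc n))
    rewrite ⋆-suc quad invQ (suc n) | ⋆-suc (coeff (+ 4 ∷ + 1 ∷ [])) invQ n | coeff-[1] invQ n =
    r (invQ (suc n)) (invQ n)

tD-D : tD ≈ Dˢ ⊛ invQ
tD-D n = trans (lem n) (sym (D⋆ invQ n))
  where
  lem : tD ≈ D′ invQ
  lem zero    = refl
  lem (suc n) = refl

-- The kernel equation t (4 + D + 1/D) = 1, multiplied by D.
tD-q : tD ⊛ quad ≈ Dˢ
tD-q = ≈-trans (⋆-cong {g = quad} tD-D ≈-refl) (≈-trans (⋆-assoc Dˢ invQ quad)
  (≈-trans (⋆-cong {f = Dˢ} ≈-refl invQ-q) (≈-trans (⋆-comm Dˢ oneS) (⋆-identityˡ Dˢ))))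

geo₂ : Series
geo₂ 0 = + 1
geo₂ 1 = + 0
geo₂ (suc (suc n)) = geo₂ n

geo₂-D² : (oneS ⊕ ⊝ (Dˢ ⊛ Dˢ)) ⊛ geo₂ ≈ oneS
geo₂-D² = ≈-trans (r Dˢ geo₂) (≈-trans (⊕-cong (⋆-identityˡ geo₂) (⊝-cong (≈-trans (⋆-cong {f = Dˢ} ≈-refl (D⋆ geo₂)) (D⋆ _)))) lem)
  where
  r : ∀ d g → (oneS ⊕ ⊝ (d ⊛ d)) ⊛ g ≈ oneS ⊛ g ⊕ ⊝ (d ⊛ (d ⊛ g))
  r = solve 2 (λ d g → (:1 :+ :- (d :* d)) :* g := :1 :* g :+ :- (d :* (d :* g))) ≈-refl
  lem : geo₂ ⊕ ⊝ (D′ (D′ geo₂)) ≈ oneS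
  lem 0 = refl
  lem 1 = refl
  lem (suc (suc n)) = ℤₚ.+-inverseʳ (geo₂ n)

-- By the kernel method the walks of displacement Δ are counted, in the variable D, by D^|Δ| times this series.
bridge : Series
bridge = quad ⊛ geo₂

bridge-D² : (oneS ⊕ ⊝ (Dˢ ⊛ Dˢ)) ⊛ bridge ≈ quad
bridge-D² = ≈-trans (r (oneS ⊕ ⊝ (Dˢ ⊛ Dˢ)) quad geo₂) (≈-trans (⋆-cong {f = quad} ≈-refl geo₂-D²)
  (≈-trans (⋆-comm quad oneS) (⋆-identityˡ quad)))
  where
  r : ∀ a b c → a ⊛ (b ⊛ c) ≈ b ⊛ (a ⊛ c)
  r = solve 3 (λ a b c → a :* (b :* c) := b :* (a :* c)) ≈-refl

mono : ℕ → List ℤ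
mono zero    = + 1 ∷ []
mono (suc k) = + 0 ∷ mono k

Dk : ℕ → Series
Dk k = coeff (mono k)

Dk-zero : Dk 0 ≈ oneS
Dk-zero zero    = refl
Dk-zero (suc n) = refl

Dk-suc : ∀ k → Dk (suc k) ≈ Dˢ ⊛ Dk k
Dk-suc k n = trans (lem n) (sym (D⋆ (Dk k) n))
  where
  lem : Dk (suc k) ≈ D′ (Dk k)
  lem zero    = refl
  lem (suc n) = refl

Dk-+ : ∀ j k → Dk (j + k) ≈ Dk j ⊛ Dk k
Dk-+ zero    k = ≈-sym (coeff-[1] (Dk k))
Dk-+ (suc j) k = ≈-trans (Dk-suc (j + k)) (≈-trans (⋆-cong {f = Dˢ} ≈-refl (Dk-+ j k))
  (≈-trans (≈-sym (⋆-assoc Dˢ (Dk j) (Dk k))) (⋆-cong {g = Dk k} (≈-sym (Dk-suc j)) ≈-refl)))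

-- Here `X Δ` is the series of words that still have to change the label by Δ. Four first
-- arrangements keep Δ, while one lowering or raising the label leaves Δ + 1 or Δ - 1. Nonempty
-- words contribute `tD` times this sum, and the empty word contributes `atZero Y Δ`, where `Y`
-- counts whatever follows.
walkT : (ℤ → Series) → ℤ → Series
walkT X Δ = (X Δ ⊕ X Δ ⊕ X Δ ⊕ X Δ) ⊕ (X (ℤ.suc Δ) ⊕ X (ℤ.pred Δ))

atZero : Series → ℤ → Series
atZero Y (+ zero)  = Y
atZero Y (+ suc _) = 0ˢ
atZero Y -[1+ _ ]  = 0ˢ

tD⋆-cong< : ∀ f g n → (∀ i → i < n → f i ≡ g i) → (tD ⊛ f) n ≡ (tD ⊛ g) n
tD⋆-cong< f g n e rewrite ⋆-∑ tD f n | ⋆-∑ tD g n =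
  cong (+ 0 +ᶻ_) (∑<-cong n (λ i i<n → cong (tD (suc i) *ᶻ_) (e (n ∸ suc i)
    (lt i n i<n))))
  where
  lt : ∀ i n → i < n → n ∸ suc i < n
  lt i (suc n) _ = s≤s (ℕₚ.m∸n≤m n i)

-- Since `tD` has no constant term, coefficient n of the right side involves only coefficients of
-- `X` below n. Strong induction on n, with the bound k as fuel, works for all Δ simultaneously.
walk-unique : ∀ X X′ Y → (∀ Δ → X Δ ≈ atZero Y Δ ⊕ tD ⊛ walkT X Δ) →
              (∀ Δ → X′ Δ ≈ atZero Y Δ ⊕ tD ⊛ walkT X′ Δ) → ∀ Δ → X Δ ≈ X′ Δ
walk-unique X X′ Y eq eq′ Δ n = go (suc n) Δ n ℕₚ.≤-refl
  where
  go : ∀ k Δ n → n < k → X Δ n ≡ X′ Δ n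
  go (suc k) Δ n (s≤s n≤k) = trans (eq Δ n) (trans
    (cong (atZero Y Δ n +ᶻ_) (tD⋆-cong< (walkT X Δ) (walkT X′ Δ) n (λ i i<n →
      let lt = ℕₚ.≤-trans i<n n≤k
          e = go k Δ i lt
      in cong₂ _+ᶻ_ (cong₂ _+ᶻ_ (cong₂ _+ᶻ_ (cong₂ _+ᶻ_ e e) e) e)
                    (cong₂ _+ᶻ_ (go k (ℤ.suc Δ) i lt) (go k (ℤ.pred Δ) i lt)))))
    (sym (eq′ Δ n)))

-- Away from 0 the recursion divided by D^(|Δ|-1) is the kernel equation. At 0 both neighbours have
-- |Δ| = 1 and the recursion becomes 1 + 4D + D² = (1 - D²) + D (4 + 2D); this is the origin of the
-- factor 1/(1 - D²) in `bridge`.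
walk-closed : ∀ Y Δ → let X = λ Δ → Dk ℤ.∣ Δ ∣ ⊛ (bridge ⊛ Y) in
              X Δ ≈ atZero Y Δ ⊕ tD ⊛ walkT X Δ
walk-closed Y Δ = go Δ
  where
  open import Relation.Binary.Reasoning.Setoid ≈-setoid
  W : Series
  W = bridge ⊛ Y
  X : ℤ → Series
  X Δ = Dk ℤ.∣ Δ ∣ ⊛ W
  away : ∀ j → Dk (suc j) ⊛ W ≈ 0ˢ ⊕ tD ⊛ ((Dk (suc j) ⊛ W ⊕ Dk (suc j) ⊛ W ⊕ Dk (suc j) ⊛ W ⊕ Dk (suc j) ⊛ W)
                  ⊕ (Dk (suc (suc j)) ⊛ W ⊕ Dk j ⊛ W))
  away j = begin
    Dk (suc j) ⊛ W                              ≈⟨ ⋆-cong {g = W} (Dk-suc j) ≈-refl ⟩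
    Dˢ ⊛ Dk j ⊛ W                               ≈⟨ ⋆-cong {g = W} (⋆-cong {g = Dk j} tD-q ≈-refl) ≈-refl ⟨
    tD ⊛ quad ⊛ Dk j ⊛ W                           ≈⟨ ⋆-cong {g = W} (⋆-cong {g = Dk j} (⋆-cong {f = tD} ≈-refl q-poly) ≈-refl) ≈-refl ⟩
    tD ⊛ (oneS ⊕ (Dˢ ⊕ Dˢ ⊕ Dˢ ⊕ Dˢ) ⊕ Dˢ ⊛ Dˢ) ⊛ Dk j ⊛ W ≈⟨ r tD Dˢ (Dk j) W ⟩
    0ˢ ⊕ tD ⊛ (let d = Dˢ ⊛ Dk j ⊛ W in (d ⊕ d ⊕ d ⊕ d) ⊕ (Dˢ ⊛ (Dˢ ⊛ Dk j) ⊛ W ⊕ Dk j ⊛ W))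
      ≈⟨ ⊕-cong {0ˢ} ≈-refl (⋆-cong {f = tD} ≈-refl (let e = ⋆-cong {g = W} (≈-sym (Dk-suc j)) ≈-refl in
           ⊕-cong (⊕-cong (⊕-cong (⊕-cong e e) e) e) (⊕-cong (⋆-cong {g = W} (≈-trans (⋆-cong {f = Dˢ} ≈-refl (≈-sym (Dk-suc j))) (≈-sym (Dk-suc (suc j)))) ≈-refl) (≈-refl {Dk j ⊛ W})))) ⟩
    0ˢ ⊕ tD ⊛ ((Dk (suc j) ⊛ W ⊕ Dk (suc j) ⊛ W ⊕ Dk (suc j) ⊛ W ⊕ Dk (suc j) ⊛ W)
                  ⊕ (Dk (suc (suc j)) ⊛ W ⊕ Dk j ⊛ W)) ∎
    where
    r : ∀ t d k w → t ⊛ (oneS ⊕ (d ⊕ d ⊕ d ⊕ d) ⊕ d ⊛ d) ⊛ k ⊛ w ≈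
        0ˢ ⊕ t ⊛ ((d ⊛ k ⊛ w ⊕ d ⊛ k ⊛ w ⊕ d ⊛ k ⊛ w ⊕ d ⊛ k ⊛ w) ⊕ (d ⊛ (d ⊛ k) ⊛ w ⊕ k ⊛ w))
    r = solve 4 (λ t d k w → t :* (:1 :+ (d :+ d :+ d :+ d) :+ d :* d) :* k :* w := :0 :+ t :* ((d :* k :* w :+ d :* k :* w :+ d :* k :* w :+ d :* k :* w) :+ (d :* (d :* k) :* w :+ k :* w))) ≈-refl
  centre : Dk 0 ⊛ W ≈ Y ⊕ tD ⊛ ((Dk 0 ⊛ W ⊕ Dk 0 ⊛ W ⊕ Dk 0 ⊛ W ⊕ Dk 0 ⊛ W) ⊕ (Dk 1 ⊛ W ⊕ Dk 1 ⊛ W))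
  centre = begin
    Dk 0 ⊛ W                       ≈⟨ coeff-[1] W ⟩
    quad ⊛ geo₂ ⊛ Y                   ≈⟨ ⋆-cong {g = Y} (⋆-cong {g = geo₂} q-poly ≈-refl) ≈-refl ⟩
    (oneS ⊕ (Dˢ ⊕ Dˢ ⊕ Dˢ ⊕ Dˢ) ⊕ Dˢ ⊛ Dˢ) ⊛ geo₂ ⊛ Y ≈⟨ r₁ Dˢ geo₂ Y ⟩
    ((oneS ⊕ ⊝ (Dˢ ⊛ Dˢ)) ⊛ geo₂) ⊛ Y ⊕ Dˢ ⊛ ((oneS ⊕ oneS ⊕ oneS ⊕ oneS) ⊕ (Dˢ ⊕ Dˢ)) ⊛ geo₂ ⊛ Y
      ≈⟨ ⊕-cong (≈-trans (⋆-cong {g = Y} geo₂-D² ≈-refl) (⋆-identityˡ Y))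
           (⋆-cong {g = Y} (⋆-cong {g = geo₂} (⋆-cong {g = (oneS ⊕ oneS ⊕ oneS ⊕ oneS) ⊕ (Dˢ ⊕ Dˢ)} (≈-sym tD-q) ≈-refl) ≈-refl) ≈-refl) ⟩
    Y ⊕ tD ⊛ quad ⊛ ((oneS ⊕ oneS ⊕ oneS ⊕ oneS) ⊕ (Dˢ ⊕ Dˢ)) ⊛ geo₂ ⊛ Y ≈⟨ r₂ tD quad Dˢ geo₂ Y ⟩
    Y ⊕ tD ⊛ ((W ⊕ W ⊕ W ⊕ W) ⊕ (Dˢ ⊛ W ⊕ Dˢ ⊛ W))
      ≈⟨ ⊕-cong {Y} ≈-refl (⋆-cong {f = tD} ≈-refl (let e = ≈-sym (coeff-[1] W); e′ = ≈-refl {Dk 1 ⊛ W} in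
           ⊕-cong (⊕-cong (⊕-cong (⊕-cong e e) e) e) (⊕-cong e′ e′))) ⟩
    Y ⊕ tD ⊛ ((Dk 0 ⊛ W ⊕ Dk 0 ⊛ W ⊕ Dk 0 ⊛ W ⊕ Dk 0 ⊛ W) ⊕ (Dk 1 ⊛ W ⊕ Dk 1 ⊛ W)) ∎
    where
    r₁ : ∀ d g y → (oneS ⊕ (d ⊕ d ⊕ d ⊕ d) ⊕ d ⊛ d) ⊛ g ⊛ y ≈
         ((oneS ⊕ ⊝ (d ⊛ d)) ⊛ g) ⊛ y ⊕ d ⊛ ((oneS ⊕ oneS ⊕ oneS ⊕ oneS) ⊕ (d ⊕ d)) ⊛ g ⊛ y
    r₁ = solve 3 (λ d g y → (:1 :+ (d :+ d :+ d :+ d) :+ d :* d) :* g :* y := ((:1 :+ :- (d :* d)) :* g) :* y :+ d :* ((:1 :+ :1 :+ :1 :+ :1) :+ (d :+ d)) :* g :* y) ≈-refl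
    r₂ : ∀ t quad d g y → y ⊕ t ⊛ quad ⊛ ((oneS ⊕ oneS ⊕ oneS ⊕ oneS) ⊕ (d ⊕ d)) ⊛ g ⊛ y ≈
         y ⊕ t ⊛ ((quad ⊛ g ⊛ y ⊕ quad ⊛ g ⊛ y ⊕ quad ⊛ g ⊛ y ⊕ quad ⊛ g ⊛ y) ⊕ (d ⊛ (quad ⊛ g ⊛ y) ⊕ d ⊛ (quad ⊛ g ⊛ y)))
    r₂ = solve 5 (λ t quad d g y → y :+ t :* quad :* ((:1 :+ :1 :+ :1 :+ :1) :+ (d :+ d)) :* g :* y := y :+ t :* ((quad :* g :* y :+ quad :* g :* y :+ quad :* g :* y :+ quad :* g :* y) :+ (d :* (quad :* g :* y) :+ d :* (quad :* g :* y)))) ≈-refl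
  -- For negative Δ the neighbour nearer to 0 is `ℤ.suc Δ`, so the two outer terms change places.
  flip : ∀ j {Z} → (let w = Dk (suc j) ⊛ W; a = w ⊕ w ⊕ w ⊕ w; b = Dk (suc (suc j)) ⊛ W; c = Dk j ⊛ W in
         Z ≈ 0ˢ ⊕ tD ⊛ (a ⊕ (b ⊕ c)) → Z ≈ 0ˢ ⊕ tD ⊛ (a ⊕ (c ⊕ b)))
  flip j e = let w = Dk (suc j) ⊛ W in
    ≈-trans e (r tD (w ⊕ w ⊕ w ⊕ w) (Dk (suc (suc j)) ⊛ W) (Dk j ⊛ W))
    where
    r : ∀ t a b c → 0ˢ ⊕ t ⊛ (a ⊕ (b ⊕ c)) ≈ 0ˢ ⊕ t ⊛ (a ⊕ (c ⊕ b))
    r = solve 4 (λ t a b c → :0 :+ t :* (a :+ (b :+ c)) := :0 :+ t :* (a :+ (c :+ b))) ≈-refl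
  go : ∀ Δ → X Δ ≈ atZero Y Δ ⊕ tD ⊛ walkT X Δ
  go (+ zero)     = centre
  go (+ suc j)    = away j
  go -[1+ zero ]  = flip 0 (away 0)
  go -[1+ suc j ] = flip (suc j) (away (suc j))

walk-series : ∀ X Y → (∀ Δ → X Δ ≈ atZero Y Δ ⊕ tD ⊛ walkT X Δ) → ∀ Δ → X Δ ≈ Dk ℤ.∣ Δ ∣ ⊛ (bridge ⊛ Y)
walk-series X Y eq = walk-unique X _ Y eq (walk-closed Y)

-- The substitution t = D / (1 + 4D + D²) and reversal of polynomials

open S-Solver using (solve; _:=_; _:+_; _:*_; :-_; con)

pow-cong : ∀ {f g} k → f ≈ g → pow f k ≈ pow g k
pow-cong         zero    e = ≈-refl
pow-cong {f} {g} (suc k) e = ⋆-cong {f = f} {g} {pow f k} {pow g k} e (pow-cong k e)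

pow-⊛ : ∀ f g k → pow (f ⊛ g) k ≈ pow f k ⊛ pow g k
pow-⊛ f g zero    = ≈-sym (⋆-identityˡ oneS)
pow-⊛ f g (suc k) = ≈-trans (⋆-cong {f = f ⊛ g} ≈-refl (pow-⊛ f g k)) (r f g (pow f k) (pow g k))
  where
  r : ∀ a b c d → a ⊛ b ⊛ (c ⊛ d) ≈ a ⊛ c ⊛ (b ⊛ d)
  r = solve 4 (λ a b c d → a :* b :* (c :* d) := a :* c :* (b :* d)) ≈-refl

pow-tD-low : ∀ k n → n < k → pow tD k n ≡ + 0
pow-tD-low (suc k) n (s≤s n≤k) = trans (tD⋆-cong< (pow tD k) 0ˢ n
  (λ i i<n → pow-tD-low k i (ℕₚ.≤-trans i<n n≤k))) (trans (⋆-comm tD 0ˢ n) (⋆-zeroˡ tD n))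

subD-∑ : ∀ c n → subD c n ≡ ∑< (suc n) (λ k → + c k *ᶻ pow tD k n)
subD-∑ c n = sumℤ-upTo (suc n) (λ k → + c k *ᶻ pow tD k n)

subD-∑′ : ∀ c n N → n ≤ N → subD c n ≡ ∑< (suc N) (λ k → + c k *ᶻ pow tD k n)
subD-∑′ c n N n≤N = trans (subD-∑ c n) (trans (sym (∑<-extend (suc n) (N ∸ n) (λ k → + c k *ᶻ pow tD k n)
  (λ k n<k → trans (cong (+ c k *ᶻ_) (pow-tD-low k n n<k)) (ℤₚ.*-zeroʳ (+ c k)))))
  (cong (λ z → ∑< (suc z) (λ k → + c k *ᶻ pow tD k n)) (ℕₚ.m+[n∸m]≡n n≤N)))

subD-cong : ∀ {c c′} → (∀ k → c k ≡ c′ k) → subD c ≈ subD c′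
subD-cong {c} {c′} e n = trans (subD-∑ c n) (trans
  (∑<-cong (suc n) (λ k _ → cong (λ z → + z *ᶻ pow tD k n) (e k))) (sym (subD-∑ c′ n)))

subD-0 : subD (λ _ → 0) ≈ 0ˢ
subD-0 n = trans (subD-∑ (λ _ → 0) n) (∑<-zero (suc n) (λ _ _ → refl))

subD-+ : ∀ c c′ → subD (λ k → c k + c′ k) ≈ subD c ⊕ subD c′
subD-+ c c′ n rewrite subD-∑ (λ k → c k + c′ k) n | subD-∑ c n | subD-∑ c′ n =
  trans (∑<-cong (suc n) (λ k _ → ℤₚ.*-distribʳ-+ (pow tD k n) (+ c k) (+ c′ k)))
        (∑<-+ (suc n) (λ k → + c k *ᶻ pow tD k n) (λ k → + c′ k *ᶻ pow tD k n))

-- Horner's rule. For fixed n all inner sums are first extended to the range up to n, so that the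
-- sums over i and k can be exchanged; the surplus term k = n then vanishes because t^(n+1) starts
-- in degree n + 1.
subD-step : ∀ c → subD c ≈ (λ n → + c 0 *ᶻ oneS n) ⊕ tD ⊛ subD (c ∘ suc)
subD-step c n = trans (subD-∑ c n) (cong (+ c 0 *ᶻ oneS n +ᶻ_) (sym (begin
  (tD ⊛ subD (c ∘ suc)) n
    ≡⟨ ⋆-∑ tD (subD (c ∘ suc)) n ⟩
  ∑< (suc n) (λ i → tD i *ᶻ subD (c ∘ suc) (n ∸ i))
    ≡⟨ ∑<-cong (suc n) (λ i _ → trans (cong (tD i *ᶻ_) (subD-∑′ (c ∘ suc) (n ∸ i) n (ℕₚ.m∸n≤m n i)))
         (trans (sym (∑<-*ˡ (suc n) (tD i) (λ k → + c (suc k) *ᶻ pow tD k (n ∸ i)))) (∑<-cong (suc n) (λ k _ → r (tD i) (+ c (suc k)) (pow tD k (n ∸ i)))))) ⟩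
  ∑< (suc n) (λ i → ∑< (suc n) (λ k → + c (suc k) *ᶻ (tD i *ᶻ pow tD k (n ∸ i))))
    ≡⟨ ∑<-swap (suc n) (suc n) (λ i k → + c (suc k) *ᶻ (tD i *ᶻ pow tD k (n ∸ i))) ⟩
  ∑< (suc n) (λ k → ∑< (suc n) (λ i → + c (suc k) *ᶻ (tD i *ᶻ pow tD k (n ∸ i))))
    ≡⟨ ∑<-cong (suc n) (λ k _ → trans (∑<-*ˡ (suc n) (+ c (suc k)) (λ i → tD i *ᶻ pow tD k (n ∸ i))) (cong (+ c (suc k) *ᶻ_) (sym (⋆-∑ tD (pow tD k) n)))) ⟩
  ∑< (suc n) (λ k → + c (suc k) *ᶻ pow tD (suc k) n)
    ≡⟨ ∑<-last n (λ k → + c (suc k) *ᶻ pow tD (suc k) n) ⟩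
  ∑< n (λ k → + c (suc k) *ᶻ pow tD (suc k) n) +ᶻ + c (suc n) *ᶻ pow tD (suc n) n
    ≡⟨ cong (λ z → ∑< n (λ k → + c (suc k) *ᶻ pow tD (suc k) n) +ᶻ + c (suc n) *ᶻ z) (pow-tD-low (suc n) n ℕₚ.≤-refl) ⟩
  ∑< n (λ k → + c (suc k) *ᶻ pow tD (suc k) n) +ᶻ + c (suc n) *ᶻ + 0
    ≡⟨ trans (cong (λ z → ∑< n (λ k → + c (suc k) *ᶻ pow tD (suc k) n) +ᶻ z) (ℤₚ.*-zeroʳ (+ c (suc n)))) (ℤₚ.+-identityʳ _) ⟩
  ∑< n (λ k → + c (suc k) *ᶻ pow tD (suc k) n) ∎)))
  where
  open ≡-Reasoning
  r : ∀ a b c → a *ᶻ (b *ᶻ c) ≡ b *ᶻ (a *ᶻ c)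
  r = ℤRing.solve-∀

delay : ℕ → (ℕ → ℕ) → ℕ → ℕ
delay zero    c k       = c k
delay (suc a) c zero    = 0
delay (suc a) c (suc k) = delay a c k

subD-delay : ∀ a c → subD (delay a c) ≈ pow tD a ⊛ subD c
subD-delay zero    c = ≈-sym (⋆-identityˡ (subD c))
subD-delay (suc a) c = ≈-trans (subD-step (delay (suc a) c))
  (λ n → trans (ℤₚ.+-identityˡ _) (≈-trans (⋆-cong {f = tD} ≈-refl (subD-delay a c)) (≈-sym (⋆-assoc tD (pow tD a) (subD c))) n))

-- Polynomials as coefficient lists

addP : List ℤ → List ℤ → List ℤ
addP []      p       = p
addP (a ∷ p) []      = a ∷ p
addP (a ∷ p) (b ∷ p′) = a +ᶻ b ∷ addP p p′

scaleP : ℤ → List ℤ → List ℤ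
scaleP c = map (c *ᶻ_)

mulP : List ℤ → List ℤ → List ℤ
mulP []      p′ = []
mulP (a ∷ p) p′ = addP (scaleP a p′) (+ 0 ∷ mulP p p′)

powP : List ℤ → ℕ → List ℤ
powP p zero    = + 1 ∷ []
powP p (suc k) = mulP p (powP p k)

coeff-addP : ∀ p p′ → coeff (addP p p′) ≈ coeff p ⊕ coeff p′
coeff-addP []      p′       n       = sym (ℤₚ.+-identityˡ _)
coeff-addP (a ∷ p) []       n       = sym (ℤₚ.+-identityʳ _)
coeff-addP (a ∷ p) (b ∷ p′) zero    = refl
coeff-addP (a ∷ p) (b ∷ p′) (suc n) = coeff-addP p p′ n

coeff-scaleP : ∀ c p → coeff (scaleP c p) ≈ (λ n → c *ᶻ coeff p n)
coeff-scaleP c []      n       = sym (ℤₚ.*-zeroʳ c)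
coeff-scaleP c (a ∷ p) zero    = refl
coeff-scaleP c (a ∷ p) (suc n) = coeff-scaleP c p n

coeff-mulP : ∀ p p′ → coeff (mulP p p′) ≈ coeff p ⊛ coeff p′
coeff-mulP [] p′ n = sym (coeff-[] (coeff p′) n)
coeff-mulP (a ∷ p) p′ zero = trans (coeff-addP (scaleP a p′) (+ 0 ∷ mulP p p′) 0)
  (trans (ℤₚ.+-identityʳ _) (trans (coeff-scaleP a p′ 0) (sym (⋆-zero (coeff (a ∷ p)) (coeff p′)))))
coeff-mulP (a ∷ p) p′ (suc n) = trans (coeff-addP (scaleP a p′) (+ 0 ∷ mulP p p′) (suc n))
  (trans (cong₂ _+ᶻ_ (coeff-scaleP a p′ (suc n)) (coeff-mulP p p′ n)) (sym (⋆-suc (coeff (a ∷ p)) (coeff p′) n)))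

coeff-[1]≈ : coeff (+ 1 ∷ []) ≈ oneS
coeff-[1]≈ zero    = refl
coeff-[1]≈ (suc n) = refl

coeff-powP : ∀ p k → coeff (powP p k) ≈ pow (coeff p) k
coeff-powP p zero    = coeff-[1]≈
coeff-powP p (suc k) = ≈-trans (coeff-mulP p (powP p k)) (⋆-cong {f = coeff p} ≈-refl (coeff-powP p k))

-- The relation g = D^N f(1/D) between polynomials of degree at most N. The bound N is carried
-- instead of the true degree, so that bounds simply add under products and powers of D.
record Rev (N : ℕ) (f g : Series) : Set where
  constructor rev
  field
    mirror : ∀ i → i ≤ N → f (N ∸ i) ≡ g i
    low    : ∀ i → N < i → f i ≡ + 0
    low′   : ∀ i → N < i → g i ≡ + 0
open Rev

Rev-cong : ∀ {N f f′ g g′} → f ≈ f′ → g ≈ g′ → Rev N f g → Rev N f′ g′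
Rev-cong e e′ (rev m l l′) = rev (λ i le → trans (sym (e _)) (trans (m i le) (e′ i)))
  (λ i lt → trans (sym (e i)) (l i lt)) (λ i lt → trans (sym (e′ i)) (l′ i lt))

Rev-⊕ : ∀ {N f f′ g g′} → Rev N f g → Rev N f′ g′ → Rev N (f ⊕ f′) (g ⊕ g′)
Rev-⊕ (rev m l l′) (rev m₁ l₁ l₁′) = rev (λ i le → cong₂ _+ᶻ_ (m i le) (m₁ i le))
  (λ i lt → cong₂ _+ᶻ_ (l i lt) (l₁ i lt)) (λ i lt → cong₂ _+ᶻ_ (l′ i lt) (l₁′ i lt))

Rev-scale : ∀ {N f g} c → Rev N f g → Rev N (λ n → c *ᶻ f n) (λ n → c *ᶻ g n)
Rev-scale c (rev m l l′) = rev (λ i le → cong (c *ᶻ_) (m i le))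
  (λ i lt → trans (cong (c *ᶻ_) (l i lt)) (ℤₚ.*-zeroʳ c))
  (λ i lt → trans (cong (c *ᶻ_) (l′ i lt)) (ℤₚ.*-zeroʳ c))

Rev-⊝ : ∀ {N f g} → Rev N f g → Rev N (⊝ f) (⊝ g)
Rev-⊝ (rev m l l′) = rev (λ i le → cong ℤ.-_ (m i le)) (λ i lt → cong ℤ.-_ (l i lt)) (λ i lt → cong ℤ.-_ (l′ i lt))

Rev-D′ˡ : ∀ {N f g} → Rev N f g → Rev (suc N) (D′ f) g
Rev-D′ˡ {N} {f} {g} (rev m l l′) = rev mir (λ { (suc i) (s≤s lt) → l i lt }) (λ i lt → l′ i (ℕₚ.<-trans (ℕₚ.n<1+n N) lt))
  where
  mir : ∀ i → i ≤ suc N → D′ f (suc N ∸ i) ≡ g i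
  mir i le with i ℕ.≤? N
  ... | yes i≤N rewrite ℕₚ.+-∸-assoc 1 i≤N = m i i≤N
  ... | no i≰N rewrite ℕₚ.≤-antisym le (ℕₚ.≰⇒> i≰N) | ℕₚ.n∸n≡0 N = sym (l′ (suc N) ℕₚ.≤-refl)

Rev-D′ʳ : ∀ {N f g} → Rev N f g → Rev (suc N) f (D′ g)
Rev-D′ʳ {N} (rev m l l′) = rev (λ { zero _ → l (suc N) ℕₚ.≤-refl ; (suc i) (s≤s le) → m i le })
  (λ i lt → l i (ℕₚ.<-trans (ℕₚ.n<1+n N) lt)) (λ { (suc i) (s≤s lt) → l′ i lt })

Rev-Dkˡ : ∀ {N f g} k → Rev N f g → Rev (k + N) (Dk k ⊛ f) g
Rev-Dkˡ {f = f} zero R = Rev-cong (≈-sym (coeff-[1] f)) ≈-refl R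
Rev-Dkˡ {f = f} (suc k) R = Rev-cong
  (≈-trans (≈-sym (D⋆ (Dk k ⊛ f))) (≈-trans (≈-sym (⋆-assoc Dˢ (Dk k) f)) (⋆-cong {g = f} (≈-sym (Dk-suc k)) ≈-refl)))
  ≈-refl (Rev-D′ˡ (Rev-Dkˡ k R))

Rev-Dkʳ : ∀ {N f g} k → Rev N f g → Rev (k + N) f (Dk k ⊛ g)
Rev-Dkʳ {g = g} zero R = Rev-cong ≈-refl (≈-sym (coeff-[1] g)) R
Rev-Dkʳ {g = g} (suc k) R = Rev-cong ≈-refl
  (≈-trans (≈-sym (D⋆ (Dk k ⊛ g))) (≈-trans (≈-sym (⋆-assoc Dˢ (Dk k) g)) (⋆-cong {g = g} (≈-sym (Dk-suc k)) ≈-refl)))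
  (Rev-D′ʳ (Rev-Dkʳ k R))

Rev-one : Rev 0 oneS oneS
Rev-one = rev (λ { zero _ → refl }) (λ { (suc i) _ → refl }) (λ { (suc i) _ → refl })

⊛-oneʳ : ∀ f → f ⊛ oneS ≈ f
⊛-oneʳ f = ≈-trans (⋆-comm f oneS) (⋆-identityˡ f)

Rev-D^-1 : ∀ k → Rev k (Dk k) oneS
Rev-D^-1 k = subst (λ z → Rev z (Dk k) oneS) (ℕₚ.+-identityʳ k) (Rev-cong (⊛-oneʳ (Dk k)) ≈-refl (Rev-Dkˡ k Rev-one))

Rev-1-D^ : ∀ k → Rev k oneS (Dk k)
Rev-1-D^ k = subst (λ z → Rev z oneS (Dk k)) (ℕₚ.+-identityʳ k) (Rev-cong ≈-refl (⊛-oneʳ (Dk k)) (Rev-Dkʳ k Rev-one))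

Dk-diag : ∀ k → Dk k k ≡ + 1
Dk-diag zero    = refl
Dk-diag (suc k) = Dk-diag k

Dk-off : ∀ k i → i ≢ k → Dk k i ≡ + 0
Dk-off zero    zero    ne = ⊥-elim (ne refl)
Dk-off zero    (suc i) ne = refl
Dk-off (suc k) zero    ne = refl
Dk-off (suc k) (suc i) ne = Dk-off k i (ne ∘ cong suc)

-- Induction on N: on one side f = f(0) + D · `tl f`, on the other side the top coefficient of g,
-- which is f(0), is split off. What remains of g, here `g₁`, is the reversal of `tl f` in degree N.
Rev-⊛ : ∀ N {M f g h h′} → Rev N f g → Rev M h h′ → Rev (N + M) (f ⊛ h) (g ⊛ h′)
Rev-⊛ zero {M} {f} {g} {h} {h′} (rev m l l′) R = Rev-cong (scaled f l refl) (scaled g l′ (sym (m 0 z≤n))) (Rev-scale (f 0) R)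
  where
  scaled : ∀ k {h} → (∀ i → 0 < i → k i ≡ + 0) → k 0 ≡ f 0 → (λ n → f 0 *ᶻ h n) ≈ k ⊛ h
  scaled k {h} z e zero    = trans (cong (_*ᶻ h 0) (sym e)) (sym (⋆-zero k h))
  scaled k {h} z e (suc n) = trans (cong (_*ᶻ h (suc n)) (sym e)) (sym (trans (⋆-suc k h n)
    (trans (cong (k 0 *ᶻ h (suc n) +ᶻ_) (trans (⋆-cong {f = tl k} {g = h} (λ i → z (suc i) (s≤s z≤n)) ≈-refl n) (⋆-zeroˡ h n))) (ℤₚ.+-identityʳ _))))
Rev-⊛ (suc N) {M} {f} {g} {h} {h′} (rev m l l′) R = Rev-cong eqf eqg
  (Rev-⊕ (Rev-scale (f 0) (Rev-Dkʳ (suc N) R)) (Rev-D′ˡ (Rev-⊛ N R₁ R)))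
  where
  g₁ : Series
  g₁ = g ⊕ ⊝ (λ n → f 0 *ᶻ Dk (suc N) n)
  g₁-low : ∀ i → i ≢ suc N → g₁ i ≡ g i
  g₁-low i ne rewrite Dk-off (suc N) i ne | ℤₚ.*-zeroʳ (f 0) = ℤₚ.+-identityʳ (g i)
  R₁ : Rev N (tl f) g₁
  R₁ = rev (λ i le → trans (trans (cong f (sym (ℕₚ.+-∸-assoc 1 le))) (m i (ℕₚ.m≤n⇒m≤1+n le))) (sym (g₁-low i (ℕₚ.<⇒≢ (s≤s le)))))
    (λ i lt → l (suc i) (s≤s lt)) hi
    where
    hi : ∀ i → N < i → g₁ i ≡ + 0
    hi i lt with i ℕ.≟ suc N
    ... | no ne = trans (g₁-low i ne) (l′ i (ℕₚ.≤∧≢⇒< lt (ne ∘ sym)))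
    ... | yes refl rewrite Dk-diag N | sym (m (suc N) ℕₚ.≤-refl) | ℕₚ.n∸n≡0 N | ℤₚ.*-identityʳ (f 0) = ℤₚ.+-inverseʳ (f 0)
  eqf : (λ n → f 0 *ᶻ h n) ⊕ D′ (tl f ⊛ h) ≈ f ⊛ h
  eqf zero    = trans (ℤₚ.+-identityʳ _) (sym (⋆-zero f h))
  eqf (suc n) = sym (⋆-suc f h n)
  eqg : (λ n → f 0 *ᶻ (Dk (suc N) ⊛ h′) n) ⊕ g₁ ⊛ h′ ≈ g ⊛ h′
  eqg = ≈-trans (⊕-cong {v = g₁ ⊛ h′} (≈-sym (⋆-scaleˡ (f 0) (Dk (suc N)) h′)) ≈-refl)
    (≈-trans (⊕-cong {f₀ ⊛ h′} ≈-refl (⋆-distribʳ h′ g (⊝ f₀))) (r f₀ g h′))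
    where
    f₀ : Series
    f₀ n = f 0 *ᶻ Dk (suc N) n
    r : ∀ a g h → a ⊛ h ⊕ (g ⊛ h ⊕ (⊝ a) ⊛ h) ≈ g ⊛ h
    r = solve 3 (λ a g h → a :* h :+ (g :* h :+ (:- a) :* h) := g :* h) ≈-refl

coeff-long : ∀ p n → length p ≤ n → coeff p n ≡ + 0
coeff-long []      n       le       = refl
coeff-long (a ∷ p) (suc n) (s≤s le) = coeff-long p n le

revPoly-Rev : ∀ N k P g → Rev N (coeff P) g → revPoly (k + N) P ≈ Dk k ⊛ g
revPoly-Rev N k P g R i with Rev-Dkʳ k R
... | rev m _ l′ with i ℕ.≤ᵇ (k + N) in eq
... | true  = m i (ℕₚ.≤ᵇ⇒≤ i (k + N) (subst IsTrue (sym eq) _))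
... | false = sym (l′ i (ℕₚ.≰⇒> (λ le → subst IsTrue eq (ℕₚ.≤⇒≤ᵇ le))))

-- `ReflectEq` reverses at the length L of the lists rather than at the natural degree N. This
-- multiplies both reversed polynomials by the same power D^(L-N), which cancels from the
-- cross-multiplied identity.
reflect : ∀ N P₁ P₂ Q → coeff Q 0 ≡ + 1 → Rev N (coeff P₂) (coeff P₁) → Rev N (coeff Q) (coeff Q) →
          ReflectEq P₁ Q P₂ Q
reflect N P₁ P₂ Q q₀ RP RQ = subst (λ z → revPoly z P₂ ⊛ coeff Q ≈ revPoly z Q ⊛ coeff P₁) (ℕₚ.m∸n+n≡m le)
  (≈-trans (⋆-cong {g = coeff Q} (revPoly-Rev N k P₂ (coeff P₁) RP) ≈-refl)
   (≈-trans (r (Dk k) (coeff P₁) (coeff Q))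
    (⋆-cong {g = coeff P₁} (≈-sym (revPoly-Rev N k Q (coeff Q) RQ)) ≈-refl)))
  where
  L : ℕ
  L = length P₂ ⊔ length Q
  k : ℕ
  k = L ∸ N
  top : coeff Q N ≡ + 1
  top = trans (mirror RQ 0 z≤n) q₀
  -- Reversal carries the constant term 1 of `Q` to its coefficient N, so `Q` has more than N
  -- entries.
  le : N ≤ L
  le with length Q ℕ.≤? N
  ... | no ¬p = ℕₚ.≤-trans (ℕₚ.<⇒≤ (ℕₚ.≰⇒> ¬p)) (ℕₚ.m≤n⊔m (length P₂) (length Q))
  ... | yes p with () ← trans (sym top) (coeff-long Q N p)
  r : ∀ a b c → a ⊛ b ⊛ c ≈ a ⊛ c ⊛ b
  r = solve 3 (λ a b c → a :* b :* c := a :* c :* b) ≈-refl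

-- Gap vectors

open S-Solver using (solve; _:=_; _:+_; _:*_; :-_; con)

bumpHead : ∀ {r} → Vec ℕ (suc r) → Vec ℕ (suc r)
bumpHead (j ∷ g) = suc j ∷ g

-- A weight is stored as its predecessor, which makes positivity automatic.
dot : ∀ {r} → Vec ℕ r → Vec ℕ r → ℕ
dot []       []      = 0
dot (c ∷ cs) (j ∷ g) = suc c * j + dot cs g

dot-bump : ∀ {r} c (cs : Vec ℕ r) g → dot (c ∷ cs) (bumpHead g) ≡ suc (c + dot (c ∷ cs) g)
dot-bump c cs (j ∷ g) = lem c j (dot cs g)
  where
  lem : ∀ c j d → suc c * suc j + d ≡ suc (c + (suc c * j + d))
  lem = ℕRing.solve-∀

dot-zero∷ : ∀ {r} c (cs : Vec ℕ r) g → dot (c ∷ cs) (0 ∷ g) ≡ dot cs g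
dot-zero∷ c cs g = cong (_+ dot cs g) (ℕₚ.*-zeroʳ (suc c))

-- In owing, p units of the budget N are still to be paid for the last increment of the first gap, which keeps
-- the recursion structural.
mutual
  gaps : ∀ {r} → Vec ℕ r → ℕ → List (Vec ℕ r)
  gaps []       N = [] ∷ []
  gaps (c ∷ cs) N = owing c cs 0 N

  owing : ∀ {r} → ℕ → Vec ℕ r → ℕ → ℕ → List (Vec ℕ (suc r))
  owing c cs zero    zero    = map (0 ∷_) (gaps cs 0)
  owing c cs zero    (suc N) = map (0 ∷_) (gaps cs (suc N)) ++ map bumpHead (owing c cs c N)
  owing c cs (suc p) zero    = []
  owing c cs (suc p) (suc N) = owing c cs p N

bumpHead-injective : ∀ {r} {g g′ : Vec ℕ (suc r)} → bumpHead g ≡ bumpHead g′ → g ≡ g′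
bumpHead-injective {g = _ ∷ _} {_ ∷ _} refl = refl

mutual
  gaps-unique : ∀ {r} (cs : Vec ℕ r) N → Unique (gaps cs N)
  gaps-unique []       N = [] ∷ []
  gaps-unique (c ∷ cs) N = owing-unique c cs 0 N

  owing-unique : ∀ {r} c (cs : Vec ℕ r) p N → Unique (owing c cs p N)
  owing-unique c cs zero    zero    = Uniqueₚ.map⁺ Vecₚ.∷-injectiveʳ (gaps-unique cs 0)
  owing-unique c cs zero    (suc N) = Uniqueₚ.++⁺ (Uniqueₚ.map⁺ Vecₚ.∷-injectiveʳ (gaps-unique cs (suc N)))
    (Uniqueₚ.map⁺ bumpHead-injective (owing-unique c cs c N)) disjoint
    where
    disjoint : ∀ {v} → v ∈ map (0 ∷_) (gaps cs (suc N)) × v ∈ map bumpHead (owing c cs c N) → ⊥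
    disjoint (a , b) with ∈-map⁻ (0 ∷_) a | ∈-map⁻ bumpHead b
    ... | _ , _ , refl | (_ ∷ _) , _ , ()
  owing-unique c cs (suc p) zero    = []
  owing-unique c cs (suc p) (suc N) = owing-unique c cs p N

mutual
  gaps-complete : ∀ {r} (cs : Vec ℕ r) N g → dot cs g ≤ N → g ∈ gaps cs N
  gaps-complete []       N []      le = here refl
  gaps-complete (c ∷ cs) N (j ∷ g) le = owing-complete c cs j 0 N g le

  owing-complete : ∀ {r} c (cs : Vec ℕ r) j p N g → p + dot (c ∷ cs) (j ∷ g) ≤ N → (j ∷ g) ∈ owing c cs p N
  owing-complete c cs zero zero zero g le = ∈-map⁺ (0 ∷_) (gaps-complete cs 0 g (subst (_≤ 0) (dot-zero∷ c cs g) le))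
  owing-complete c cs zero zero (suc N) g le =
    ∈-++⁺ˡ (∈-map⁺ (0 ∷_) (gaps-complete cs (suc N) g (subst (_≤ suc N) (dot-zero∷ c cs g) le)))
  owing-complete c cs (suc j) zero N g le with N | subst (_≤ N) (dot-bump c cs (j ∷ g)) le
  ... | suc N | s≤s le′ = ∈-++⁺ʳ (map (0 ∷_) (gaps cs (suc N))) (∈-map⁺ bumpHead (owing-complete c cs j c N g le′))
  owing-complete c cs j (suc p) (suc N) g (s≤s le) = owing-complete c cs j p N g le

∑L : {A : Set} → (A → ℤ) → List A → ℤ
∑L f xs = sumℤ (map f xs)

∑L-++ : {A : Set} (f : A → ℤ) (xs ys : List A) → ∑L f (xs ++ ys) ≡ ∑L f xs +ᶻ ∑L f ys
∑L-++ f []       ys = sym (ℤₚ.+-identityˡ _)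
∑L-++ f (x ∷ xs) ys = trans (cong (f x +ᶻ_) (∑L-++ f xs ys)) (sym (ℤₚ.+-assoc (f x) _ _))

∑L-map : {A B : Set} (f : B → ℤ) (h : A → B) (xs : List A) → ∑L f (map h xs) ≡ ∑L (f ∘ h) xs
∑L-map f h xs = cong sumℤ (sym (Listₚ.map-∘ xs))

∑L-cong : {A : Set} {f f′ : A → ℤ} (xs : List A) → (∀ x → f x ≡ f′ x) → ∑L f xs ≡ ∑L f′ xs
∑L-cong xs e = cong sumℤ (Listₚ.map-cong e xs)

∑L-zero : {A : Set} {f : A → ℤ} (xs : List A) → (∀ x → f x ≡ + 0) → ∑L f xs ≡ + 0
∑L-zero []       e = refl
∑L-zero (x ∷ xs) e = cong₂ _+ᶻ_ (e x) (∑L-zero xs e)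

∑L-ℕ : {A : Set} (f : A → ℕ) (xs : List A) → + sumℕ (map f xs) ≡ ∑L (λ x → + f x) xs
∑L-ℕ f []       = refl
∑L-ℕ f (x ∷ xs) = cong (+ f x +ᶻ_) (∑L-ℕ f xs)

∑L-∑< : {A : Set} (n : ℕ) (f : A → ℕ → ℤ) (xs : List A) →
        ∑< n (λ k → ∑L (λ x → f x k) xs) ≡ ∑L (λ x → ∑< n (f x)) xs
∑L-∑< n f []       = ∑<-zero n (λ _ _ → refl)
∑L-∑< n f (x ∷ xs) = trans (∑<-+ n (f x) (λ k → ∑L (λ x → f x k) xs)) (cong (∑< n (f x) +ᶻ_) (∑L-∑< n f xs))

∑L-*ʳ : {A : Set} (f : A → ℤ) (c : ℤ) (xs : List A) → ∑L f xs *ᶻ c ≡ ∑L (λ x → f x *ᶻ c) xs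
∑L-*ʳ f c []       = ℤₚ.*-zeroˡ c
∑L-*ʳ f c (x ∷ xs) = trans (ℤₚ.*-distribʳ-+ c (f x) (∑L f xs)) (cong (f x *ᶻ c +ᶻ_) (∑L-*ʳ f c xs))

mutual
  -- Vectors beyond the budget contribute 0, so all budgets k ≤ N may be replaced by N. The list of
  -- vectors then no longer depends on k and the sums over k and over vectors can be exchanged.
  gaps-extend : ∀ {r} (cs : Vec ℕ r) (f : Vec ℕ r → ℤ) k N → k ≤ N →
                (∀ g → k < dot cs g → f g ≡ + 0) → ∑L f (gaps cs k) ≡ ∑L f (gaps cs N)
  gaps-extend []       f k N le z = refl
  gaps-extend (c ∷ cs) f k N le z = owing-extend c cs f 0 k N le z

  owing-extend : ∀ {r} c (cs : Vec ℕ r) (f : Vec ℕ (suc r) → ℤ) p k N → k ≤ N →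
                 (∀ g → k < p + dot (c ∷ cs) g → f g ≡ + 0) → ∑L f (owing c cs p k) ≡ ∑L f (owing c cs p N)
  owing-extend c cs f (suc p) zero    N       le       z = sym (∑L-zero (owing c cs (suc p) N) (λ g → z g (s≤s z≤n)))
  owing-extend c cs f (suc p) (suc k) (suc N) (s≤s le) z = owing-extend c cs f p k N le (λ g lt → z g (s≤s lt))
  owing-extend c cs f zero zero zero le z = refl
  owing-extend c cs f zero zero (suc N) le z
    rewrite ∑L-++ f (map (0 ∷_) (gaps cs (suc N))) (map bumpHead (owing c cs c N))
          | ∑L-map f bumpHead (owing c cs c N)
          | ∑L-zero {f = f ∘ bumpHead} (owing c cs c N) (λ g → z (bumpHead g) (subst (0 <_) (sym (dot-bump c cs g)) (s≤s z≤n)))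
          | ∑L-map f (0 ∷_) (gaps cs (suc N)) | ∑L-map f (0 ∷_) (gaps cs 0)
          | ℤₚ.+-identityʳ (∑L (f ∘ (0 ∷_)) (gaps cs (suc N))) =
    gaps-extend cs (f ∘ (0 ∷_)) 0 (suc N) z≤n (λ g lt → z (0 ∷ g) (subst (0 <_) (sym (dot-zero∷ c cs g)) lt))
  owing-extend c cs f zero (suc k) (suc N) (s≤s le) z
    rewrite ∑L-++ f (map (0 ∷_) (gaps cs (suc N))) (map bumpHead (owing c cs c N))
          | ∑L-++ f (map (0 ∷_) (gaps cs (suc k))) (map bumpHead (owing c cs c k))
          | ∑L-map f bumpHead (owing c cs c N) | ∑L-map f bumpHead (owing c cs c k)
          | ∑L-map f (0 ∷_) (gaps cs (suc N)) | ∑L-map f (0 ∷_) (gaps cs (suc k)) =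
    cong₂ _+ᶻ_
      (gaps-extend cs (f ∘ (0 ∷_)) (suc k) (suc N) (s≤s le) (λ g lt → z (0 ∷ g) (subst (suc k <_) (sym (dot-zero∷ c cs g)) lt)))
      (owing-extend c cs (f ∘ bumpHead) c k N le (λ g lt → z (bumpHead g) (subst (suc k <_) (sym (dot-bump c cs g)) (s≤s lt))))

gapProduct : ∀ {r} → Vec ℕ r → Series
gapProduct []       = oneS
gapProduct (c ∷ cs) = (oneS ⊕ ⊝ Dk (suc c)) ⊛ gapProduct cs

-- The infinite sum of D^(c·g) Y over all gap vectors g. In degree N a vector with c·g > N
-- contributes nothing, so the finite list with budget N is enough.
gapSum : ∀ {r} → Vec ℕ r → Series → Series
gapSum cs Y N = ∑L (λ g → (Dk (dot cs g) ⊛ Y) N) (gaps cs N)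

Dk-suc-⊛ : ∀ k Y → Dk (suc k) ⊛ Y ≈ D′ (Dk k ⊛ Y)
Dk-suc-⊛ k Y = ≈-trans (⋆-cong {g = Y} (Dk-suc k) ≈-refl) (≈-trans (⋆-assoc Dˢ (Dk k) Y) (D⋆ (Dk k ⊛ Y)))

-- Let x be the sum over all vectors and y the sum over those of the remaining gaps. Splitting
-- according to whether the first gap is 0 gives x = y + D^(c+1) x, so each gap accounts for one
-- factor 1 - D^(c+1). The auxiliary `O p` carries p unpaid units and equals D^p x.
gapSum-product : ∀ {r} (cs : Vec ℕ r) Y → gapProduct cs ⊛ gapSum cs Y ≈ Y
gapSum-product [] Y = ≈-trans (⋆-identityˡ (gapSum [] Y)) (λ n → trans (ℤₚ.+-identityʳ _) (coeff-[1] Y n))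
gapSum-product (c ∷ cs) Y = ≈-trans (r₁ (oneS ⊕ ⊝ Dk (suc c)) (gapProduct cs) (gapSum (c ∷ cs) Y))
  (≈-trans (⋆-cong {f = gapProduct cs} ≈-refl peel) (gapSum-product cs Y))
  where
  r₁ : ∀ a b x → a ⊛ b ⊛ x ≈ b ⊛ (a ⊛ x)
  r₁ = solve 3 (λ a b x → a :* b :* x := b :* (a :* x)) ≈-refl
  O : ℕ → Series
  O p N = ∑L (λ g → (Dk (p + dot (c ∷ cs) g) ⊛ Y) N) (owing c cs p N)
  O-suc : ∀ p → O (suc p) ≈ D′ (O p)
  O-suc p zero    = refl
  O-suc p (suc N) = ∑L-cong (owing c cs p N) (λ g → Dk-suc-⊛ (p + dot (c ∷ cs) g) Y (suc N))
  O-Dk : ∀ p → O p ≈ Dk p ⊛ O 0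
  O-Dk zero    = ≈-sym (coeff-[1] (O 0))
  O-Dk (suc p) = ≈-trans (O-suc p) (≈-trans (λ { zero → refl ; (suc n) → O-Dk p n }) (≈-sym (Dk-suc-⊛ p (O 0))))
  heads : ∀ N → ∑L (λ g → (Dk (dot (c ∷ cs) g) ⊛ Y) N) (map (0 ∷_) (gaps cs N)) ≡ gapSum cs Y N
  heads N = trans (∑L-map _ (0 ∷_) (gaps cs N)) (∑L-cong (gaps cs N) (λ g → cong (λ z → (Dk z ⊛ Y) N) (dot-zero∷ c cs g)))
  O-zero : O 0 ≈ gapSum cs Y ⊕ D′ (O c)
  O-zero zero    = trans (heads 0) (sym (ℤₚ.+-identityʳ _))
  O-zero (suc N) = trans (∑L-++ (λ g → (Dk (dot (c ∷ cs) g) ⊛ Y) (suc N)) (map (0 ∷_) (gaps cs (suc N))) _) (cong₂ _+ᶻ_ (heads (suc N))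
    (trans (∑L-map _ bumpHead (owing c cs c N)) (∑L-cong (owing c cs c N) (λ g →
      trans (cong (λ z → (Dk z ⊛ Y) (suc N)) (dot-bump c cs g)) (Dk-suc-⊛ (c + dot (c ∷ cs) g) Y (suc N))))))
  r₂ : ∀ d x y → x ≈ y ⊕ d ⊛ x → (oneS ⊕ ⊝ d) ⊛ x ≈ y
  r₂ d x y e = ≈-trans (s₁ d x) (≈-trans (⊕-cong {v = ⊝ (d ⊛ x)} e ≈-refl) (s₂ d x y))
    where
    s₁ : ∀ d x → (oneS ⊕ ⊝ d) ⊛ x ≈ x ⊕ ⊝ (d ⊛ x)
    s₁ = solve 2 (λ d x → (con (+ 1) :+ (:- d)) :* x := x :+ (:- (d :* x))) ≈-refl
    s₂ : ∀ d x y → y ⊕ d ⊛ x ⊕ ⊝ (d ⊛ x) ≈ y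
    s₂ = solve 3 (λ d x y → y :+ d :* x :+ (:- (d :* x)) := y) ≈-refl
  peel : (oneS ⊕ ⊝ Dk (suc c)) ⊛ gapSum (c ∷ cs) Y ≈ gapSum cs Y
  peel = r₂ (Dk (suc c)) (O 0) (gapSum cs Y) (≈-trans O-zero (⊕-cong {gapSum cs Y} ≈-refl
    (≈-trans (λ { zero → refl ; (suc n) → O-Dk c n }) (≈-sym (Dk-suc-⊛ c (O 0))))))

subD-gapSum : ∀ {r} (cs : Vec ℕ r) (A : Vec ℕ r → ℕ → ℕ) Y →
  (∀ g k → k < dot cs g → A g k ≡ 0) → (∀ g → subD (A g) ≈ Dk (dot cs g) ⊛ Y) →
  subD (λ k → sumℕ (map (λ g → A g k) (gaps cs k))) ≈ gapSum cs Y
subD-gapSum cs A Y vanish eq N = begin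
  subD C N
    ≡⟨ subD-∑ C N ⟩
  ∑< (suc N) (λ k → + C k *ᶻ pow tD k N)
    ≡⟨ ∑<-cong (suc N) (λ k k<N → trans (cong (_*ᶻ pow tD k N)
         (trans (∑L-ℕ (λ g → A g k) (gaps cs k))
           (gaps-extend cs (λ g → + A g k) k N (ℕₚ.≤-pred k<N) (λ g lt → cong +_ (vanish g k lt)))))
         (∑L-*ʳ (λ g → + A g k) (pow tD k N) (gaps cs N))) ⟩
  ∑< (suc N) (λ k → ∑L (λ g → + A g k *ᶻ pow tD k N) (gaps cs N))
    ≡⟨ ∑L-∑< (suc N) (λ g k → + A g k *ᶻ pow tD k N) (gaps cs N) ⟩
  ∑L (λ g → ∑< (suc N) (λ k → + A g k *ᶻ pow tD k N)) (gaps cs N)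
    ≡⟨ ∑L-cong (gaps cs N) (λ g → trans (sym (subD-∑ (A g) N)) (eq g N)) ⟩
  gapSum cs Y N ∎
  where
  open ≡-Reasoning
  C : ℕ → ℕ
  C k = sumℕ (map (λ g → A g k) (gaps cs k))

-- The rational function and its reflection

oneMinusP : ℕ → List ℤ
oneMinusP k = addP (+ 1 ∷ []) (scaleP (ℤ.- (+ 1)) (mono k))

coeff-oneMinusP : ∀ k → coeff (oneMinusP k) ≈ oneS ⊕ ⊝ Dk k
coeff-oneMinusP k n = trans (coeff-addP (+ 1 ∷ []) (scaleP (ℤ.- (+ 1)) (mono k)) n)
  (cong₂ _+ᶻ_ (coeff-[1]≈ n) (trans (coeff-scaleP (ℤ.- (+ 1)) (mono k) n) (ℤₚ.-1*i≡-i (Dk k n))))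

gapProductP : ∀ {r} → Vec ℕ r → List ℤ
gapProductP []       = + 1 ∷ []
gapProductP (c ∷ cs) = mulP (oneMinusP (suc c)) (gapProductP cs)

coeff-gapProductP : ∀ {r} (cs : Vec ℕ r) → coeff (gapProductP cs) ≈ gapProduct cs
coeff-gapProductP []       = coeff-[1]≈
coeff-gapProductP (c ∷ cs) = ≈-trans (coeff-mulP (oneMinusP (suc c)) (gapProductP cs))
  (⋆-cong (coeff-oneMinusP (suc c)) (coeff-gapProductP cs))

sign : ℕ → Series → Series
sign zero    f = f
sign (suc k) f = ⊝ sign k f

totalWeight : ∀ {r} → Vec ℕ r → ℕ
totalWeight []       = 0
totalWeight (c ∷ cs) = suc c + totalWeight cs

sign-⊛ : ∀ k f h → sign k (h ⊛ f) ≈ h ⊛ sign k f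
sign-⊛ zero    f h = ≈-refl
sign-⊛ (suc k) f h = ≈-trans (⊝-cong (sign-⊛ k f h)) (r h (sign k f))
  where
  r : ∀ a b → ⊝ (a ⊛ b) ≈ a ⊛ ⊝ b
  r = solve 2 (λ a b → :- (a :* b) := a :* (:- b)) ≈-refl

⊝-⊛ : ∀ a b → ⊝ a ⊛ b ≈ ⊝ (a ⊛ b)
⊝-⊛ = solve 2 (λ a b → (:- a) :* b := :- (a :* b)) ≈-refl

Rev-oneMinus : ∀ k → Rev k (oneS ⊕ ⊝ Dk k) (⊝ (oneS ⊕ ⊝ Dk k))
Rev-oneMinus k = Rev-cong ≈-refl (r (Dk k)) (Rev-⊕ (Rev-1-D^ k) (Rev-⊝ (Rev-D^-1 k)))
  where
  r : ∀ a → a ⊕ ⊝ oneS ≈ ⊝ (oneS ⊕ ⊝ a)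
  r = solve 1 (λ a → a :+ (:- con (+ 1)) := :- (con (+ 1) :+ (:- a))) ≈-refl

Rev-gapProduct : ∀ {r} (cs : Vec ℕ r) → Rev (totalWeight cs) (gapProduct cs) (sign r (gapProduct cs))
Rev-gapProduct []       = Rev-one
Rev-gapProduct {suc r} (c ∷ cs) = Rev-cong ≈-refl
  (≈-trans (⊝-⊛ f (sign r (gapProduct cs))) (⊝-cong (≈-sym (sign-⊛ r (gapProduct cs) f))))
  (Rev-⊛ (suc c) (Rev-oneMinus (suc c)) (Rev-gapProduct cs))
  where
  f : Series
  f = oneS ⊕ ⊝ Dk (suc c)

Rev-pow-oneMinus² : ∀ E → Rev (E * 2) (pow (oneS ⊕ ⊝ Dk 2) E) (sign E (pow (oneS ⊕ ⊝ Dk 2) E))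
Rev-pow-oneMinus² zero    = Rev-one
Rev-pow-oneMinus² (suc E) = Rev-cong ≈-refl
  (≈-trans (⊝-⊛ (oneS ⊕ ⊝ Dk 2) (sign E (pow (oneS ⊕ ⊝ Dk 2) E))) (⊝-cong (≈-sym (sign-⊛ E (pow (oneS ⊕ ⊝ Dk 2) E) (oneS ⊕ ⊝ Dk 2)))))
  (Rev-⊛ 2 (Rev-oneMinus 2) (Rev-pow-oneMinus² E))

Rev-q : Rev 2 quad quad
Rev-q = rev (λ { 0 _ → refl ; 1 _ → refl ; 2 _ → refl ; (suc (suc (suc i))) (s≤s (s≤s ())) })
  (λ { 1 (s≤s ()) ; 2 (s≤s (s≤s ())) ; (suc (suc (suc i))) _ → refl })
  (λ { 1 (s≤s ()) ; 2 (s≤s (s≤s ())) ; (suc (suc (suc i))) _ → refl })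

Rev-pow-q : ∀ k → Rev (k * 2) (pow quad k) (pow quad k)
Rev-pow-q zero    = Rev-one
Rev-pow-q (suc k) = Rev-⊛ 2 Rev-q (Rev-pow-q k)

sign-even : ∀ k f → sign (k + k) f ≈ f
sign-even zero    f = ≈-refl
sign-even (suc k) f rewrite ℕₚ.+-suc k k = λ n → trans (ℤₚ.neg-involutive _) (sign-even k f n)

sign-sign : ∀ j k f → sign j (sign k f) ≡ sign (j + k) f
sign-sign zero    k f = refl
sign-sign (suc j) k f = cong ⊝_ (sign-sign j k f)

-- The exponent `a` is one more than the number of leaves of the scheme, and `E` is its number of
-- edges. From t^a comes (1+4D+D²)^a below, from the E paths (1+4D+D²)^E above. The fraction is left
-- unreduced, so that one denominator serves both orders.
module Assembly {r : ℕ} (a E : ℕ) (cs : Vec ℕ r) where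

  numerator : ℕ → List ℤ
  numerator base = mulP (mono (a + base)) (powP (+ 1 ∷ + 4 ∷ + 1 ∷ []) E)

  denominator : List ℤ
  denominator = mulP (powP (+ 1 ∷ + 4 ∷ + 1 ∷ []) a) (mulP (powP (oneMinusP 2) E) (gapProductP cs))

  coeff-numerator : ∀ base → coeff (numerator base) ≈ Dk (a + base) ⊛ pow quad E
  coeff-numerator base = ≈-trans (coeff-mulP (mono (a + base)) (powP (+ 1 ∷ + 4 ∷ + 1 ∷ []) E))
    (⋆-cong {f = Dk (a + base)} ≈-refl (coeff-powP (+ 1 ∷ + 4 ∷ + 1 ∷ []) E))

  coeff-denominator : coeff denominator ≈ pow quad a ⊛ (pow (oneS ⊕ ⊝ Dk 2) E ⊛ gapProduct cs)
  coeff-denominator = ≈-trans (coeff-mulP (powP (+ 1 ∷ + 4 ∷ + 1 ∷ []) a) _)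
    (⋆-cong (coeff-powP (+ 1 ∷ + 4 ∷ + 1 ∷ []) a)
      (≈-trans (coeff-mulP (powP (oneMinusP 2) E) (gapProductP cs))
        (⋆-cong (≈-trans (coeff-powP (oneMinusP 2) E) (pow-cong E (coeff-oneMinusP 2))) (coeff-gapProductP cs))))

  denominator-0 : coeff denominator 0 ≡ + 1
  denominator-0 = trans (coeff-denominator 0) (trans (⋆-zero (pow quad a) (pow (oneS ⊕ ⊝ Dk 2) E ⊛ gapProduct cs)) (cong₂ _*ᶻ_ (pow-0 quad refl a)
    (trans (⋆-zero (pow (oneS ⊕ ⊝ Dk 2) E) (gapProduct cs)) (cong₂ _*ᶻ_ (pow-0 (oneS ⊕ ⊝ Dk 2) refl E) (prod-0 cs)))))
    where
    pow-0 : ∀ f → f 0 ≡ + 1 → ∀ k → pow f k 0 ≡ + 1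
    pow-0 f e zero    = refl
    pow-0 f e (suc k) = trans (⋆-zero f (pow f k)) (cong₂ _*ᶻ_ e (pow-0 f e k))
    prod-0 : ∀ {r} (cs : Vec ℕ r) → gapProduct cs 0 ≡ + 1
    prod-0 []       = refl
    prod-0 (c ∷ cs) = trans (⋆-zero (oneS ⊕ ⊝ Dk (suc c)) (gapProduct cs)) (cong (+ 1 *ᶻ_) (prod-0 cs))

  ratRep : ∀ base F → F ≈ gapSum cs (pow tD a ⊛ (Dk base ⊛ pow bridge E)) → RatRep (numerator base) denominator F
  ratRep base F e = (0 , λ z → case01 (trans (sym denominator-0) z)) ,
    ≈-trans (⋆-cong coeff-denominator e)
    (≈-trans (r₁ (pow quad a) (pow b E) (gapProduct cs) (gapSum cs Y))
    (≈-trans (⋆-cong {f = pow quad a ⊛ pow b E} ≈-refl (gapSum-product cs Y))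
    (≈-trans (r₂ (pow quad a) (pow b E) (pow tD a) (Dk base) (pow bridge E))
    (≈-trans (⋆-cong {g = pow b E ⊛ pow bridge E} (⋆-cong {g = Dk base} (≈-trans (≈-sym (pow-⊛ tD quad a)) (≈-trans (pow-cong a tD-q) (pow-Dˢ a))) ≈-refl)
      (≈-trans (≈-sym (pow-⊛ b bridge E)) (pow-cong E b-bridge)))
    (≈-trans (⋆-cong {g = pow quad E} (≈-sym (Dk-+ a base)) ≈-refl) (≈-sym (coeff-numerator base)))))))
    where
    b : Series
    b = oneS ⊕ ⊝ Dk 2
    Y : Series
    Y = pow tD a ⊛ (Dk base ⊛ pow bridge E)
    case01 : + 1 ≡ + 0 → ⊥
    case01 ()
    r₁ : ∀ x y z w → x ⊛ (y ⊛ z) ⊛ w ≈ x ⊛ y ⊛ (z ⊛ w)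
    r₁ = solve 4 (λ x y z w → x :* (y :* z) :* w := x :* y :* (z :* w)) ≈-refl
    r₂ : ∀ x y t d w → x ⊛ y ⊛ (t ⊛ (d ⊛ w)) ≈ t ⊛ x ⊛ d ⊛ (y ⊛ w)
    r₂ = solve 5 (λ x y t d w → x :* y :* (t :* (d :* w)) := t :* x :* d :* (y :* w)) ≈-refl
    pow-Dˢ : ∀ k → pow Dˢ k ≈ Dk k
    pow-Dˢ zero    = ≈-sym Dk-zero
    pow-Dˢ (suc k) = ≈-trans (⋆-cong {f = Dˢ} ≈-refl (pow-Dˢ k)) (≈-sym (Dk-suc k))
    b-bridge : b ⊛ bridge ≈ quad
    b-bridge = ≈-trans (⋆-cong {g = bridge} (⊕-cong {oneS} ≈-refl (⊝-cong (Dk-suc 1))) ≈-refl) bridge-D²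

  -- In degree N = 2a + 2E + Σ cᵢ the denominator is its own reversal up to (-1)^(E+r), one sign for
  -- each factor 1 - D^k. The numerator with exponent a + `base′` reverses to the one with a +
  -- `base` precisely because `base` + `base′` = Σ cᵢ.
  reflectEq : ∀ base base′ → base + base′ ≡ totalWeight cs → (k : ℕ) → E + r ≡ k + k →
              ReflectEq (numerator base) denominator (numerator base′) denominator
  reflectEq base base′ tot k even = reflect N (numerator base) (numerator base′) denominator denominator-0
    (Rev-cong (≈-sym (coeff-numerator base′)) (≈-sym (coeff-numerator base))
      (subst (λ z → Rev z (Dk (a + base′) ⊛ pow quad E) (Dk (a + base) ⊛ pow quad E)) degree
        (Rev-Dkˡ (a + base′) (Rev-Dkʳ (a + base) (Rev-pow-q E)))))
    (Rev-cong (≈-sym coeff-denominator) (≈-trans (⋆-cong {f = pow quad a} ≈-refl signs) (≈-sym coeff-denominator))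
      (Rev-⊛ (a * 2) (Rev-pow-q a) (Rev-⊛ (E * 2) (Rev-pow-oneMinus² E) (Rev-gapProduct cs))))
    where
    b : Series
    b = pow (oneS ⊕ ⊝ Dk 2) E
    N : ℕ
    N = a * 2 + (E * 2 + totalWeight cs)
    degree : a + base′ + (a + base + E * 2) ≡ N
    degree rewrite sym tot = lem a base base′ (E * 2)
      where
      lem : ∀ a b b′ e → a + b′ + (a + b + e) ≡ a * 2 + (e + (b + b′))
      lem = ℕRing.solve-∀
    signs : sign E b ⊛ sign r (gapProduct cs) ≈ b ⊛ gapProduct cs
    signs = ≈-trans (≈-sym (sign-⊛ r (gapProduct cs) (sign E b)))
      (≈-trans (signs-cong r {sign E b ⊛ gapProduct cs} {sign E (b ⊛ gapProduct cs)}
        (≈-trans (⋆-comm (sign E b) (gapProduct cs)) (≈-trans (≈-sym (sign-⊛ E b (gapProduct cs)))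
          (signs-cong E {gapProduct cs ⊛ b} {b ⊛ gapProduct cs} (⋆-comm (gapProduct cs) b)))))
      (λ n → trans (cong (λ f → f n) (trans (sign-sign r E (b ⊛ gapProduct cs))
        (cong (λ z → sign z (b ⊛ gapProduct cs)) (trans (ℕₚ.+-comm r E) even)))) (sign-even k (b ⊛ gapProduct cs) n)))
      where
      signs-cong : ∀ k {f g} → f ≈ g → sign k f ≈ sign k g
      signs-cong zero    e = e
      signs-cong (suc k) e = ⊝-cong (signs-cong k e)

-- Words of arrangements

-- A vertex of interior degree 2 on a path, read counterclockwise from the half-edge through which the
-- path enters: the two stems come before, on both sides of, or after the half-edge through which it leaves.
data Gap : Set where
  before across after : Gap

-- The flag says whether the leaf is met before the bud.
Arr : Set
Arr = Gap × Bool

exit : Arr → Fin 4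
exit (before , _) = suc (suc (suc zero))
exit (across , _) = suc (suc zero)
exit (after  , _) = suc zero

stem₁ stem₂ : Bool → Kind
stem₁ true  = leaf
stem₁ false = bud
stem₂ true  = bud
stem₂ false = leaf

pattern′ : Arr → Fin 4 → Kind
pattern′ A               zero                   = edge
pattern′ (before , o)    (suc zero)             = stem₁ o
pattern′ (before , o)    (suc (suc zero))       = stem₂ o
pattern′ (before , o)    (suc (suc (suc zero))) = edge
pattern′ (across , o)    (suc zero)             = stem₁ o
pattern′ (across , o)    (suc (suc zero))       = edge
pattern′ (across , o)    (suc (suc (suc zero))) = stem₂ o
pattern′ (after  , o)    (suc zero)             = edge
pattern′ (after  , o)    (suc (suc zero))       = stem₁ o
pattern′ (after  , o)    (suc (suc (suc zero))) = stem₂ o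

dispA : Arr → ℤ
dispA (before , _)     = + 0
dispA (across , true)  = -[1+ 0 ]
dispA (across , false) = + 1
dispA (after  , _)     = + 0

disp : List Arr → ℤ
disp []      = + 0
disp (A ∷ w) = dispA A +ᶻ disp w

rest : ℤ → Arr → ℤ
rest Δ (before , _)     = Δ
rest Δ (across , true)  = ℤ.suc Δ
rest Δ (across , false) = ℤ.pred Δ
rest Δ (after  , _)     = Δ

rest-disp : ∀ A Δ → dispA A +ᶻ rest Δ A ≡ Δ
rest-disp (before , _)     Δ = ℤₚ.+-identityˡ Δ
rest-disp (across , true)  Δ = ℤₚ.pred-suc Δ
rest-disp (across , false) Δ = ℤₚ.suc-pred Δ
rest-disp (after  , _)     Δ = ℤₚ.+-identityˡ Δ

-- nothing forces the empty word, just Δ prescribes the displacement.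
Spec : ℕ → Set
Spec = Vec (Maybe ℤ)

Fit : ∀ {n} → Spec n → Vec (List Arr) n → Set
Fit []           []       = ⊤
Fit (nothing ∷ s) (w ∷ ws) = w ≡ [] × Fit s ws
Fit (just Δ ∷ s)  (w ∷ ws) = disp w ≡ Δ × Fit s ws

totalLength : ∀ {n} → Vec (List Arr) n → ℕ
totalLength []       = 0
totalLength (w ∷ ws) = length w + totalLength ws

prepend : ∀ {n} → Arr → Vec (List Arr) (suc n) → Vec (List Arr) (suc n)
prepend A (w ∷ ws) = (A ∷ w) ∷ ws

guard : {A : Set} → ℤ → List A → List A
guard (+ zero)  xs = xs
guard (+ suc _) xs = []
guard -[1+ _ ]  xs = []

mutual
  words : ∀ {n} → Spec n → ℕ → List (Vec (List Arr) n)
  words []            zero    = [] ∷ []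
  words []            (suc K) = []
  words (nothing ∷ s) K       = map ([] ∷_) (words s K)
  words (just Δ ∷ s)  K       = walks Δ s K

  walks : ∀ {n} → ℤ → Spec n → ℕ → List (Vec (List Arr) (suc n))
  walks Δ s zero    = guard Δ (map ([] ∷_) (words s zero))
  walks Δ s (suc K) = guard Δ (map ([] ∷_) (words s (suc K))) ++
    (map (prepend (before , true)) (walks Δ s K) ++
    (map (prepend (before , false)) (walks Δ s K) ++
    (map (prepend (across , true)) (walks (ℤ.suc Δ) s K) ++
    (map (prepend (across , false)) (walks (ℤ.pred Δ) s K) ++
    (map (prepend (after , true)) (walks Δ s K) ++
     map (prepend (after , false)) (walks Δ s K))))))

∈-guard⁻ : {A : Set} {x : A} → ∀ Δ {xs} → x ∈ guard Δ xs → Δ ≡ + 0 × x ∈ xs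
∈-guard⁻ (+ zero) p = refl , p

∈-extensions⁻ : {B : Set} {x : B} {p : Arr → B → B} {y : Arr → List B} →
  x ∈ (map (p (before , true)) (y (before , true)) ++ (map (p (before , false)) (y (before , false)) ++
      (map (p (across , true)) (y (across , true)) ++ (map (p (across , false)) (y (across , false)) ++
      (map (p (after , true)) (y (after , true)) ++ map (p (after , false)) (y (after , false))))))) →
  Σ[ A ∈ Arr ] Σ[ z ∈ B ] (z ∈ y A × x ≡ p A z)
∈-extensions⁻ {p = p} {y} m with ∈-++⁻ (map (p (before , true)) (y (before , true))) m
... | inj₁ i = (before , true) , ∈-map⁻ _ i
... | inj₂ m with ∈-++⁻ (map (p (before , false)) (y (before , false))) m
... | inj₁ i = (before , false) , ∈-map⁻ _ i
... | inj₂ m with ∈-++⁻ (map (p (across , true)) (y (across , true))) m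
... | inj₁ i = (across , true) , ∈-map⁻ _ i
... | inj₂ m with ∈-++⁻ (map (p (across , false)) (y (across , false))) m
... | inj₁ i = (across , false) , ∈-map⁻ _ i
... | inj₂ m with ∈-++⁻ (map (p (after , true)) (y (after , true))) m
... | inj₁ i = (after , true) , ∈-map⁻ _ i
... | inj₂ i = (after , false) , ∈-map⁻ _ i

∈-extensions⁺ : {B : Set} {z : B} (p : Arr → B → B) (y : Arr → List B) → ∀ A → z ∈ y A → p A z ∈
      (map (p (before , true)) (y (before , true)) ++ (map (p (before , false)) (y (before , false)) ++
      (map (p (across , true)) (y (across , true)) ++ (map (p (across , false)) (y (across , false)) ++
      (map (p (after , true)) (y (after , true)) ++ map (p (after , false)) (y (after , false)))))))
∈-extensions⁺ p y (before , true)  i = ∈-++⁺ˡ (∈-map⁺ _ i)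
∈-extensions⁺ p y (before , false) i = ∈-++⁺ʳ (map (p (before , true)) (y (before , true))) (∈-++⁺ˡ (∈-map⁺ _ i))
∈-extensions⁺ p y (across , true)  i = ∈-++⁺ʳ (map (p (before , true)) (y (before , true)))
  (∈-++⁺ʳ (map (p (before , false)) (y (before , false))) (∈-++⁺ˡ (∈-map⁺ _ i)))
∈-extensions⁺ p y (across , false) i = ∈-++⁺ʳ (map (p (before , true)) (y (before , true)))
  (∈-++⁺ʳ (map (p (before , false)) (y (before , false))) (∈-++⁺ʳ (map (p (across , true)) (y (across , true))) (∈-++⁺ˡ (∈-map⁺ _ i))))
∈-extensions⁺ p y (after , true)   i = ∈-++⁺ʳ (map (p (before , true)) (y (before , true)))
  (∈-++⁺ʳ (map (p (before , false)) (y (before , false))) (∈-++⁺ʳ (map (p (across , true)) (y (across , true)))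
  (∈-++⁺ʳ (map (p (across , false)) (y (across , false))) (∈-++⁺ˡ (∈-map⁺ _ i)))))
∈-extensions⁺ p y (after , false)  i = ∈-++⁺ʳ (map (p (before , true)) (y (before , true)))
  (∈-++⁺ʳ (map (p (before , false)) (y (before , false))) (∈-++⁺ʳ (map (p (across , true)) (y (across , true)))
  (∈-++⁺ʳ (map (p (across , false)) (y (across , false))) (∈-++⁺ʳ (map (p (after , true)) (y (after , true))) (∈-map⁺ _ i)))))

branch : ∀ {n} → ℤ → Spec n → ℕ → Arr → List (Vec (List Arr) (suc n))
branch Δ s K A = walks (rest Δ A) s K

mutual
  words-sound : ∀ {n} (s : Spec n) K {ws} → ws ∈ words s K → Fit s ws × totalLength ws ≡ K
  words-sound []            zero    (here refl) = tt , refl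
  words-sound (nothing ∷ s) K       m with ∈-map⁻ ([] ∷_) m
  ... | ws , i , refl = let f , e = words-sound s K i in (refl , f) , e
  words-sound (just Δ ∷ s)  K       m = walks-sound Δ s K m

  walks-sound : ∀ {n} Δ (s : Spec n) K {ws} → ws ∈ walks Δ s K → Fit (just Δ ∷ s) ws × totalLength ws ≡ K
  walks-sound Δ s zero m with ∈-guard⁻ Δ m
  ... | refl , i with ∈-map⁻ ([] ∷_) i
  ... | ws , j , refl = let f , e = words-sound s zero j in (refl , f) , e
  walks-sound Δ s (suc K) m with ∈-++⁻ (guard Δ (map ([] ∷_) (words s (suc K)))) m
  walks-sound Δ s (suc K) m | inj₁ i with ∈-guard⁻ Δ i
  ... | refl , i with ∈-map⁻ ([] ∷_) i
  ... | ws , j , refl = let f , e = words-sound s (suc K) j in (refl , f) , e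
  walks-sound Δ s (suc K) m | inj₂ i with ∈-extensions⁻ {p = prepend} {y = branch Δ s K} i
  ... | A , (w ∷ ws) , j , refl with walks-sound (rest Δ A) s K j
  ... | (d , f) , e = (trans (cong (dispA A +ᶻ_) d) (rest-disp A Δ) , f) , cong suc e

mutual
  words-complete : ∀ {n} (s : Spec n) K ws → Fit s ws → totalLength ws ≡ K → ws ∈ words s K
  words-complete []            zero [] tt refl = here refl
  words-complete (nothing ∷ s) K ([] ∷ ws) (refl , f) e = ∈-map⁺ ([] ∷_) (words-complete s K ws f e)
  words-complete (just Δ ∷ s)  K (w ∷ ws) (d , f) e = walks-complete Δ s K w ws d f e

  walks-complete : ∀ {n} Δ (s : Spec n) K w ws → disp w ≡ Δ → Fit s ws → length w + totalLength ws ≡ K → (w ∷ ws) ∈ walks Δ s K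
  walks-complete Δ s zero    [] ws refl f e = ∈-map⁺ ([] ∷_) (words-complete s zero ws f e)
  walks-complete Δ s (suc K) [] ws refl f e = ∈-++⁺ˡ (∈-map⁺ ([] ∷_) (words-complete s (suc K) ws f e))
  walks-complete Δ s (suc K) (A ∷ w) ws d f e =
    ∈-++⁺ʳ (guard Δ (map ([] ∷_) (words s (suc K)))) (∈-extensions⁺ prepend (branch Δ s K) A
      (walks-complete (rest Δ A) s K w ws
        (ℤ+.∙-cancelˡ (dispA A) (disp w) (rest Δ A) (trans d (sym (rest-disp A Δ)))) f (ℕₚ.suc-injective e)))

prepend-injective : ∀ {n} A {v w : Vec (List Arr) (suc n)} → prepend A v ≡ prepend A w → v ≡ w
prepend-injective A {_ ∷ _} {_ ∷ _} refl = refl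

-- The arrangement put in front can be recovered from the result, so the six lists are pairwise
-- disjoint. `Ext` records which arrangements may still occur in the tail of the concatenation.
unique-extensions : {B : Set} (p : Arr → B → B) (y : Arr → List B) → (∀ A {v w} → p A v ≡ p A w → v ≡ w) →
  (∀ A A′ {v w} → p A v ≡ p A′ w → A ≡ A′) → (∀ A → Unique (y A)) →
  Unique (map (p (before , true)) (y (before , true)) ++ (map (p (before , false)) (y (before , false)) ++
      (map (p (across , true)) (y (across , true)) ++ (map (p (across , false)) (y (across , false)) ++
      (map (p (after , true)) (y (after , true)) ++ map (p (after , false)) (y (after , false)))))))
unique-extensions {B} p y inj sep u =
  Uniqueₚ.++⁺ (un b₁) (Uniqueₚ.++⁺ (un b₀) (Uniqueₚ.++⁺ (un c₁) (Uniqueₚ.++⁺ (un c₀) (Uniqueₚ.++⁺ (un a₁) (un a₀)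
    (λ (m , m′) → clash a₁ (a₀ ∷ []) (m , from₁ a₀ m′) (λ { (here ()) ; (there ()) })))
    (λ (m , m′) → clash c₀ (a₁ ∷ a₀ ∷ []) (m , from₊ a₁ (from₁ a₀) m′) (λ { (here ()) ; (there (here ())) })))
    (λ (m , m′) → clash c₁ (c₀ ∷ a₁ ∷ a₀ ∷ []) (m , from₊ c₀ (from₊ a₁ (from₁ a₀)) m′) (λ { (here ()) ; (there (here ())) ; (there (there (here ()))) })))
    (λ (m , m′) → clash b₀ (c₁ ∷ c₀ ∷ a₁ ∷ a₀ ∷ []) (m , from₊ c₁ (from₊ c₀ (from₊ a₁ (from₁ a₀))) m′)
      (λ { (here ()) ; (there (here ())) ; (there (there (here ()))) ; (there (there (there (here ())))) })))
    (λ (m , m′) → clash b₁ (b₀ ∷ c₁ ∷ c₀ ∷ a₁ ∷ a₀ ∷ []) (m , from₊ b₀ (from₊ c₁ (from₊ c₀ (from₊ a₁ (from₁ a₀)))) m′)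
      (λ { (here ()) ; (there (here ())) ; (there (there (here ()))) ; (there (there (there (here ())))) ; (there (there (there (there (here ()))))) }))
  where
  b₁ b₀ c₁ c₀ a₁ a₀ : Arr
  b₁ = before , true
  b₀ = before , false
  c₁ = across , true
  c₀ = across , false
  a₁ = after , true
  a₀ = after , false
  L : Arr → List B
  L A = map (p A) (y A)
  un : ∀ A → Unique (L A)
  un A = Uniqueₚ.map⁺ (inj A) (u A)
  Ext : List Arr → B → Set
  Ext As x = Σ[ A ∈ Arr ] (A ∈ As × x ∈ L A)
  from₁ : ∀ A {x} → x ∈ L A → Ext (A ∷ []) x
  from₁ A m = A , here refl , m
  from₊ : ∀ A {As xs x} → (x ∈ xs → Ext As x) → x ∈ (L A ++ xs) → Ext (A ∷ As) x
  from₊ A f m with ∈-++⁻ (L A) m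
  ... | inj₁ i = A , here refl , i
  ... | inj₂ i = let A′ , j , k = f i in A′ , there j , k
  clash : ∀ A As {x} → x ∈ L A × Ext As x → (A ∈ As → ⊥) → ⊥
  clash A As (m , A′ , j , m′) ∉As with ∈-map⁻ (p A) m | ∈-map⁻ (p A′) m′
  ... | v , _ , refl | w , _ , e with sep A A′ e
  ... | refl = ∉As j

mutual
  words-unique : ∀ {n} (s : Spec n) K → Unique (words s K)
  words-unique []            zero    = [] ∷ []
  words-unique []            (suc K) = []
  words-unique (nothing ∷ s) K       = Uniqueₚ.map⁺ Vecₚ.∷-injectiveʳ (words-unique s K)
  words-unique (just Δ ∷ s)  K       = walks-unique Δ s K

  walks-unique : ∀ {n} Δ (s : Spec n) K → Unique (walks Δ s K)
  walks-unique Δ s zero    = guard-unique Δ (Uniqueₚ.map⁺ Vecₚ.∷-injectiveʳ (words-unique s zero))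
  walks-unique Δ s (suc K) = Uniqueₚ.++⁺ (guard-unique Δ (Uniqueₚ.map⁺ Vecₚ.∷-injectiveʳ (words-unique s (suc K))))
    (unique-extensions prepend (branch Δ s K) prepend-injective sep (λ A → walks-unique (rest Δ A) s K))
    disjoint
    where
    sep : ∀ A A′ {v w} → prepend A v ≡ prepend A′ w → A ≡ A′
    sep A A′ {_ ∷ _} {_ ∷ _} refl = refl
    disjoint : ∀ {x} → x ∈ guard Δ (map ([] ∷_) (words s (suc K))) × x ∈ _ → ⊥
    disjoint (m , m′) with ∈-guard⁻ Δ m | ∈-extensions⁻ {p = prepend} {y = branch Δ s K} m′
    ... | _ , i | A , (w ∷ ws) , _ , refl with ∈-map⁻ ([] ∷_) i
    ... | _ , _ , ()

  guard-unique : {A : Set} → ∀ Δ {xs : List A} → Unique xs → Unique (guard Δ xs)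
  guard-unique (+ zero)  u = u
  guard-unique (+ suc _) u = []
  guard-unique -[1+ _ ]  u = []

specEdges : ∀ {n} → Spec n → ℕ
specEdges []            = 0
specEdges (nothing ∷ s) = specEdges s
specEdges (just _ ∷ s)  = suc (specEdges s)

specSpan : ∀ {n} → Spec n → ℕ
specSpan []            = 0
specSpan (nothing ∷ s) = specSpan s
specSpan (just Δ ∷ s)  = ℤ.∣ Δ ∣ + specSpan s

∣disp∣≤length : ∀ w → ℤ.∣ disp w ∣ ≤ length w
∣disp∣≤length []      = z≤n
∣disp∣≤length (A ∷ w) = ℕₚ.≤-trans (ℤₚ.∣i+j∣≤∣i∣+∣j∣ (dispA A) (disp w)) (ℕₚ.+-mono-≤ (small A) (∣disp∣≤length w))
  where
  small : ∀ A → ℤ.∣ dispA A ∣ ≤ 1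
  small (before , _)     = z≤n
  small (across , true)  = s≤s z≤n
  small (across , false) = s≤s z≤n
  small (after  , _)     = z≤n

span≤length : ∀ {n} (s : Spec n) ws → Fit s ws → specSpan s ≤ totalLength ws
span≤length []            []       f       = z≤n
span≤length (nothing ∷ s) (w ∷ ws) (e , f) = ℕₚ.≤-trans (span≤length s ws f) (ℕₚ.m≤n+m (totalLength ws) (length w))
span≤length (just Δ ∷ s)  (w ∷ ws) (e , f) = ℕₚ.+-mono-≤ (subst (λ z → ℤ.∣ z ∣ ≤ length w) e (∣disp∣≤length w)) (span≤length s ws f)

countWords : ∀ {n} → Spec n → ℕ → ℕ
countWords s K = length (words s K)

-- An arrangement changes the label by at most one, so words cannot be shorter than their
-- displacement. Large gaps therefore contribute only in high degree, which keeps the sum over gap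
-- vectors finite in each degree.
countWords-short : ∀ {n} (s : Spec n) K → K < specSpan s → countWords s K ≡ 0
countWords-short s K lt with words s K in eq
... | []     = refl
... | w ∷ ws = let f , e = words-sound s K (subst (w ∈_) (sym eq) (here refl)) in
  ⊥-elim (ℕₚ.<⇒≱ lt (subst (specSpan s ≤_) e (span≤length s w f)))


-- Induction on the specification. A prescribed displacement Δ is a walk followed by the words of
-- the remaining paths, so the series of the latter plays the part of `Y` in `walk-series`, and each
-- path yields a factor D^|Δ| · `bridge`.
subD-words : ∀ {n} (s : Spec n) → subD (countWords s) ≈ Dk (specSpan s) ⊛ pow bridge (specEdges s)
subD-words [] = ≈-trans (subD-step (countWords []))
  (≈-trans (λ n → trans (cong₂ _+ᶻ_ (ℤₚ.*-identityˡ (oneS n))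
      (trans (⋆-cong {f = tD} {g = subD (countWords [] ∘ suc)} ≈-refl subD-0 n) (trans (⋆-comm tD 0ˢ n) (⋆-zeroˡ tD n))))
    (ℤₚ.+-identityʳ (oneS n))) (≈-sym (coeff-[1] oneS)))
subD-words (nothing ∷ s) = ≈-trans (subD-cong (λ K → Listₚ.length-map ([] ∷_) (words s K))) (subD-words s)
subD-words {suc n} (just Δ ∷ s) = ≈-trans (walk-series X (subD (countWords s)) step′ Δ)
  (≈-trans (⋆-cong {f = Dk ℤ.∣ Δ ∣} ≈-refl (⋆-cong {f = bridge} ≈-refl (subD-words s)))
  (≈-trans (r (Dk ℤ.∣ Δ ∣) bridge (Dk (specSpan s)) (pow bridge (specEdges s)))
   (⋆-cong {g = pow bridge (suc (specEdges s))} (≈-sym (Dk-+ ℤ.∣ Δ ∣ (specSpan s))) ≈-refl)))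
  where
  open S-Solver using (solve; _:=_; _:+_; _:*_; :-_; con)
  r : ∀ a b c d → a ⊛ (b ⊛ (c ⊛ d)) ≈ a ⊛ c ⊛ (b ⊛ d)
  r = solve 4 (λ a b c d → a :* (b :* (c :* d)) := a :* c :* (b :* d)) ≈-refl
  X : ℤ → Series
  X Δ = subD (λ K → length (walks Δ s K))
  base : ℤ → ℕ → ℕ
  base Δ K = length (guard Δ (map ([] ∷_) (words s K)))
  atBase : ∀ Δ → subD (base Δ) ≈ atZero (subD (countWords s)) Δ
  atBase (+ zero)  = subD-cong (λ K → Listₚ.length-map ([] ∷_) (words s K))
  atBase (+ suc _) = subD-0
  atBase -[1+ _ ]  = subD-0
  W : ℤ → ℕ → ℕ
  W Δ K = length (walks Δ s K)
  T : ℤ → ℕ → ℕ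
  T Δ K = W Δ K + W Δ K + W Δ K + W Δ K + (W (ℤ.suc Δ) K + W (ℤ.pred Δ) K)
  T-series : ∀ Δ → subD (T Δ) ≈ walkT X Δ
  T-series Δ = ≈-trans (subD-+ (λ K → W Δ K + W Δ K + W Δ K + W Δ K) (λ K → W (ℤ.suc Δ) K + W (ℤ.pred Δ) K))
    (⊕-cong (≈-trans (subD-+ (λ K → W Δ K + W Δ K + W Δ K) (W Δ)) (⊕-cong {v = X Δ}
       (≈-trans (subD-+ (λ K → W Δ K + W Δ K) (W Δ)) (⊕-cong {v = X Δ} (subD-+ (W Δ) (W Δ)) ≈-refl)) ≈-refl))
      (subD-+ (W (ℤ.suc Δ)) (W (ℤ.pred Δ))))
  -- One arrangement is one vertex carrying one leaf, hence the delay by 1, a single factor t.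
  recur : ∀ Δ K → W Δ K ≡ base Δ K + delay 1 (T Δ) K
  recur Δ zero    = sym (ℕₚ.+-identityʳ _)
  recur Δ (suc K) = trans (Listₚ.length-++ (guard Δ (map ([] ∷_) (words s (suc K))))) (cong (λ z → length (guard Δ (map ([] ∷_) (words s (suc K)))) + z)
    (trans (len₂ (walks Δ s K) _) (trans (cong (λ z → W Δ K + z) (trans (len₂ (walks Δ s K) _) (cong (λ z → W Δ K + z)
      (trans (len₂ (walks (ℤ.suc Δ) s K) _) (cong (λ z → W (ℤ.suc Δ) K + z) (trans (len₂ (walks (ℤ.pred Δ) s K) _)
      (cong (λ z → W (ℤ.pred Δ) K + z) (trans (len₂ (walks Δ s K) _) (cong (λ z → W Δ K + z) (Listₚ.length-map (prepend (after , false)) (walks Δ s K)))))))))))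
      (lem (W Δ K) (W (ℤ.suc Δ) K) (W (ℤ.pred Δ) K)))))
    where
    len₂ : ∀ {A} (xs ys : List (Vec (List Arr) (suc n))) → length (map (prepend A) xs ++ ys) ≡ length xs + length ys
    len₂ {A} xs ys = trans (Listₚ.length-++ (map (prepend A) xs)) (cong (_+ length ys) (Listₚ.length-map (prepend A) xs))
    lem : ∀ a b c → a + (a + (b + (c + (a + a)))) ≡ a + a + a + a + (b + c)
    lem = ℕRing.solve-∀
  step′ : ∀ Δ → X Δ ≈ atZero (subD (countWords s)) Δ ⊕ tD ⊛ walkT X Δ
  step′ Δ = ≈-trans (subD-cong (recur Δ)) (≈-trans (subD-+ (base Δ) (delay 1 (T Δ)))
    (⊕-cong (atBase Δ) (≈-trans (subD-delay 1 (T Δ)) (⋆-cong (⊛-oneʳ tD) (T-series Δ)))))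

-- Inserting half-edges into a contour

nxt : ∀ {m} → Fin (suc m) → Fin (suc m)
nxt {m} h = suc (toℕ h) mod suc m

toℕ-nxt : ∀ {m} (h : Fin (suc m)) → toℕ h < m → toℕ (nxt h) ≡ suc (toℕ h)
toℕ-nxt {m} h lt = trans (Finₚ.toℕ-fromℕ< (m%n<n (suc (toℕ h)) (suc m))) (m<n⇒m%n≡m (s≤s lt))

nxt-last : ∀ {m} (h : Fin (suc m)) → toℕ h ≡ m → nxt h ≡ zero
nxt-last {m} h e = Finₚ.toℕ-injective (trans (Finₚ.toℕ-fromℕ< (m%n<n (suc (toℕ h)) (suc m)))
  (trans (cong (λ z → suc z % suc m) e) (n%n≡0 (suc m))))

last? : ∀ {m} (h : Fin (suc m)) → toℕ h < m ⊎ toℕ h ≡ m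
last? h with toℕ h ℕ.≟ _
... | yes e = inj₂ e
... | no ne = inj₁ (ℕₚ.≤∧≢⇒< (Finₚ.toℕ≤pred[n] h) ne)

nxt-injective : ∀ {m} {x y : Fin (suc m)} → nxt x ≡ nxt y → x ≡ y
nxt-injective {m} {x} {y} e with last? x | last? y
... | inj₁ p | inj₁ r = Finₚ.toℕ-injective (ℕₚ.suc-injective (trans (sym (toℕ-nxt x p)) (trans (cong toℕ e) (toℕ-nxt y r))))
... | inj₂ p | inj₂ r = Finₚ.toℕ-injective (trans p (sym r))
... | inj₁ p | inj₂ r with () ← trans (sym (toℕ-nxt x p)) (cong toℕ (trans e (nxt-last y r)))
... | inj₂ p | inj₁ r with () ← trans (sym (toℕ-nxt y r)) (cong toℕ (trans (sym e) (nxt-last x p)))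

punchIn-low : ∀ {n} (i : Fin (suc n)) (x : Fin n) → toℕ x < toℕ i → toℕ (punchIn i x) ≡ toℕ x
punchIn-low (suc i) zero    lt       = refl
punchIn-low (suc i) (suc x) (s≤s lt) = cong suc (punchIn-low i x lt)

punchIn-high : ∀ {n} (i : Fin (suc n)) (x : Fin n) → toℕ i ≤ toℕ x → toℕ (punchIn i x) ≡ suc (toℕ x)
punchIn-high zero    x       le       = refl
punchIn-high (suc i) (suc x) (s≤s le) = cong suc (punchIn-high i x le)

punchIn-mono-< : ∀ {n} (i : Fin (suc n)) {x y : Fin n} → x Fin.< y → punchIn i x Fin.< punchIn i y
punchIn-mono-< i {x} {y} lt = ℕₚ.≤∧≢⇒< (Finₚ.punchIn-mono-≤ i x y (ℕₚ.<⇒≤ lt))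
  (λ e → ℕₚ.<⇒≢ lt (cong toℕ (Finₚ.punchIn-injective i x y (Finₚ.toℕ-injective e))))

-- The new half-edge follows `p` immediately in the contour. Its number is `suc p` and never 0, so
-- the root remains the root.
module AfterPoint {m : ℕ} (p : Fin (suc m)) where

  ι : Fin (suc m) → Fin (suc (suc m))
  ι = punchIn (suc p)

  nxt-ι : ∀ x → x ≢ p → nxt (ι x) ≡ ι (nxt x)
  nxt-ι x x≢p with ℕₚ.<-cmp (toℕ x) (toℕ p)
  ... | tri≈ _ e _ = ⊥-elim (x≢p (Finₚ.toℕ-injective e))

  ... | tri< x<p _ _ = Finₚ.toℕ-injective (trans
      (toℕ-nxt (ι x) (subst (_< suc m) (sym ιx) (ℕₚ.m≤n⇒m≤1+n x<m)))
      (trans (cong suc ιx) (trans (sym nx) (sym (punchIn-low (suc p) (nxt x) (subst (_< suc (toℕ p)) (sym nx) (s≤s x<p)))))))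
    where
    x<m : toℕ x < m
    x<m = ℕₚ.<-≤-trans x<p (Finₚ.toℕ≤pred[n] p)
    ιx : toℕ (ι x) ≡ toℕ x
    ιx = punchIn-low (suc p) x (ℕₚ.m≤n⇒m≤1+n x<p)
    nx : toℕ (nxt x) ≡ suc (toℕ x)
    nx = toℕ-nxt x x<m
  ... | tri> _ _ p<x with last? x
  ... | inj₂ e = trans (nxt-last (ι x) (trans (punchIn-high (suc p) x p<x) (cong suc e))) (cong ι (sym (nxt-last x e)))
  ... | inj₁ x<m = Finₚ.toℕ-injective (trans
      (toℕ-nxt (ι x) (subst (_< suc m) (sym ιx) (s≤s x<m)))
      (trans (cong suc ιx) (trans (cong suc (sym nx)) (sym (punchIn-high (suc p) (nxt x) (subst (suc (toℕ p) ≤_) (sym nx) (ℕₚ.m≤n⇒m≤1+n p<x)))))))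
    where
    ιx : toℕ (ι x) ≡ suc (toℕ x)
    ιx = punchIn-high (suc p) x p<x
    nx : toℕ (nxt x) ≡ suc (toℕ x)
    nx = toℕ-nxt x x<m

  nxt-point : nxt (ι p) ≡ suc p
  nxt-point = Finₚ.toℕ-injective (trans (toℕ-nxt (ι p) (subst (_< suc m) (sym ιp) (Finₚ.toℕ<n p))) (cong suc ιp))
    where
    ιp : toℕ (ι p) ≡ toℕ p
    ιp = punchIn-low (suc p) p ℕₚ.≤-refl

  nxt-new : nxt (suc p) ≡ ι (nxt p)
  nxt-new with last? p
  ... | inj₂ e = trans (nxt-last (suc p) (cong suc e)) (cong ι (sym (nxt-last p e)))
  ... | inj₁ lt = Finₚ.toℕ-injective (trans (toℕ-nxt (suc p) (s≤s lt))
      (trans (cong suc (sym np)) (sym (punchIn-high (suc p) (nxt p) (subst (suc (toℕ p) ≤_) (sym np) ℕₚ.≤-refl)))))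
    where
    np : toℕ (nxt p) ≡ suc (toℕ p)
    np = toℕ-nxt p lt

  ι-mono : ∀ {x y} → x Fin.< y → ι x Fin.< ι y
  ι-mono = punchIn-mono-< (suc p)

  ι-injective : ∀ {x y} → ι x ≡ ι y → x ≡ y
  ι-injective {x} {y} = Finₚ.punchIn-injective (suc p) x y

  ι≢new : ∀ x → ι x ≢ suc p
  ι≢new = Finₚ.punchInᵢ≢i (suc p)

  ι<new : ∀ {x} → toℕ x ≤ toℕ p → ι x Fin.< suc p
  ι<new {x} le = subst (_< suc (toℕ p)) (sym (punchIn-low (suc p) x (s≤s le))) (s≤s le)

  new<ι : ∀ {x} → p Fin.< x → suc p Fin.< ι x
  new<ι {x} lt = subst (suc (toℕ p) <_) (sym (punchIn-high (suc p) x lt)) (s≤s lt)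

  cover : ∀ y → (Σ[ x ∈ Fin (suc m) ] y ≡ ι x) ⊎ (y ≡ suc p)
  cover y with suc p Fin.≟ y
  ... | yes e  = inj₂ (sym e)
  ... | no ne = inj₁ (punchOut ne , sym (Finₚ.punchIn-punchOut ne))

leafTotal : ∀ {n} → (Fin n → Kind) → ℕ
leafTotal k = sum (leafInd ∘ k)

sum-insertAt : ∀ {n} (t : Fin n → ℕ) i v → sum (insertAt t i v) ≡ v + sum t
sum-insertAt t i v = trans (sum-remove {i = i} (insertAt t i v))
  (cong₂ _+_ (insertAt-lookup t i v) (sum-cong-≗ (removeAt-insertAt t i v)))

insertAt-∘ : ∀ {A B : Set} {n} (f : A → B) (t : Fin n → A) i v → f ∘ insertAt t i v ≗ insertAt (f ∘ t) i (f v)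
insertAt-∘ f t i v y with i Fin.≟ y
... | yes refl = trans (cong f (insertAt-lookup t i v)) (sym (insertAt-lookup (f ∘ t) i (f v)))
... | no ne with punchOut ne | Finₚ.punchIn-punchOut ne
... | x | refl = trans (cong f (insertAt-punchIn t i v x)) (sym (insertAt-punchIn (f ∘ t) i (f v) x))

leafTotal-insertAt : ∀ {n} (k : Fin n → Kind) i v → leafTotal (insertAt k i v) ≡ leafInd v + leafTotal k
leafTotal-insertAt k i v = trans (sum-cong-≗ (insertAt-∘ leafInd k i v)) (sum-insertAt (leafInd ∘ k) i (leafInd v))

-- The edge {h, z} becomes the two edges {h, b} and {f, z}. After traversing `h` the contour must go
-- on along `f`, and after `z` along `b`, which fixes the places of insertion; the rotation then
-- exchanges `b` and `f`, the two half-edges of the new vertex.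
module SplitEdge {m : ℕ} (a : Fin (suc m) → Fin (suc m)) (k : Fin (suc m) → Kind) (inv : ∀ x → a (a x) ≡ x)
                 (h : Fin (suc m)) (ah≢h : a h ≢ h) where

  private
    z : Fin (suc m)
    z = a h
    module P₁ = AfterPoint h
    module P₂ = AfterPoint (P₁.ι z)

  ι : Fin (suc m) → Fin (suc (suc (suc m)))
  ι = P₂.ι ∘ P₁.ι

  b f : Fin (suc (suc (suc m)))
  b = suc (P₁.ι z)
  f = P₂.ι (suc h)

  private
    a₀ : Fin (suc m) → Fin (suc (suc (suc m)))
    a₀ x = if does (x Fin.≟ h) then b else if does (x Fin.≟ z) then f else ι (a x)

  a′ : Fin (suc (suc (suc m))) → Fin (suc (suc (suc m)))
  a′ = insertAt (insertAt a₀ (suc h) (ι z)) b (ι h)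

  k′ : Fin (suc (suc (suc m))) → Kind
  k′ = insertAt (insertAt k (suc h) edge) b edge

  s s′ : _
  s  = λ x → nxt (a x)
  s′ = λ x → nxt (a′ x)

  b≢f : b ≢ f
  b≢f e = P₂.ι≢new (suc h) (sym e)

  ι≢b : ∀ x → ι x ≢ b
  ι≢b x = P₂.ι≢new (P₁.ι x)

  ι≢f : ∀ x → ι x ≢ f
  ι≢f x e = P₁.ι≢new x (P₂.ι-injective e)

  ι-mono : ∀ {x y} → x Fin.< y → ι x Fin.< ι y
  ι-mono lt = P₂.ι-mono (P₁.ι-mono lt)

  private
    a′ι : ∀ x → a′ (ι x) ≡ a₀ x
    a′ι x = trans (insertAt-punchIn (insertAt a₀ (suc h) (ι z)) b (ι h) (P₁.ι x)) (insertAt-punchIn a₀ (suc h) (ι z) x)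

  a′b : a′ b ≡ ι h
  a′b = insertAt-lookup (insertAt a₀ (suc h) (ι z)) b (ι h)

  a′f : a′ f ≡ ι z
  a′f = trans (insertAt-punchIn (insertAt a₀ (suc h) (ι z)) b (ι h) (suc h)) (insertAt-lookup a₀ (suc h) (ι z))

  a′h : a′ (ι h) ≡ b
  a′h = trans (a′ι h) (cong (if_then b else (if does (h Fin.≟ z) then f else ι (a h))) (dec-true (h Fin.≟ h) refl))

  a′z : a′ (ι z) ≡ f
  a′z = trans (a′ι z) (trans (cong (if_then b else (if does (z Fin.≟ z) then f else ι (a z))) (dec-false (z Fin.≟ h) ah≢h))
    (cong (if_then f else ι (a z)) (dec-true (z Fin.≟ z) refl)))

  a′-old : ∀ x → x ≢ h → x ≢ z → a′ (ι x) ≡ ι (a x)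
  a′-old x ne ne′ = trans (a′ι x) (trans (cong (if_then b else (if does (x Fin.≟ z) then f else ι (a x))) (dec-false (x Fin.≟ h) ne))
    (cong (if_then f else ι (a x)) (dec-false (x Fin.≟ z) ne′)))

  k′ι : ∀ x → k′ (ι x) ≡ k x
  k′ι x = trans (insertAt-punchIn (insertAt k (suc h) edge) b edge (P₁.ι x)) (insertAt-punchIn k (suc h) edge x)

  k′b : k′ b ≡ edge
  k′b = insertAt-lookup (insertAt k (suc h) edge) b edge

  k′f : k′ f ≡ edge
  k′f = trans (insertAt-punchIn (insertAt k (suc h) edge) b edge (suc h)) (insertAt-lookup k (suc h) edge)

  private
    ι₁-nxt : ∀ x → x ≢ h → x ≢ z → nxt (ι x) ≡ ι (nxt x)
    ι₁-nxt x ne ne′ = trans (P₂.nxt-ι (P₁.ι x) (ne′ ∘ P₁.ι-injective)) (cong P₂.ι (P₁.nxt-ι x ne))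

  s′b : s′ b ≡ f
  s′b = trans (cong nxt a′b) (trans (P₂.nxt-ι (P₁.ι h) (λ e → ah≢h (sym (P₁.ι-injective e)))) (cong P₂.ι P₁.nxt-point))

  s′f : s′ f ≡ b
  s′f = trans (cong nxt a′f) P₂.nxt-point

  s′ι : ∀ x → s′ (ι x) ≡ ι (s x)
  s′ι x with x Fin.≟ h
  ... | yes refl = trans (cong nxt a′h) (trans P₂.nxt-new (cong P₂.ι (P₁.nxt-ι z ah≢h)))
  ... | no ne with x Fin.≟ z
  ... | yes refl = trans (cong nxt a′z) (trans (P₂.nxt-ι (suc h) (λ e → P₁.ι≢new z (sym e)))
      (cong P₂.ι (trans P₁.nxt-new (cong (P₁.ι ∘ nxt) (sym (inv h))))))
  ... | no ne′ = trans (cong nxt (a′-old x ne ne′))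
      (ι₁-nxt (a x) (λ e → ne′ (trans (sym (inv x)) (cong a e))) (λ e → ne (trans (sym (inv x)) (trans (cong a e) (inv h)))))

  cover : ∀ y → (Σ[ x ∈ Fin (suc m) ] y ≡ ι x) ⊎ (y ≡ b ⊎ y ≡ f)
  cover y with P₂.cover y
  ... | inj₂ e = inj₂ (inj₁ e)
  ... | inj₁ (y′ , refl) with P₁.cover y′
  ... | inj₂ refl = inj₂ (inj₂ refl)
  ... | inj₁ (x , refl) = inj₁ (x , refl)

  inv′ : ∀ y → a′ (a′ y) ≡ y
  inv′ y with cover y
  ... | inj₂ (inj₁ refl) = trans (cong a′ a′b) a′h
  ... | inj₂ (inj₂ refl) = trans (cong a′ a′f) a′z
  ... | inj₁ (x , refl) with x Fin.≟ h
  ... | yes refl = trans (cong a′ a′h) a′b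
  ... | no ne with x Fin.≟ z
  ... | yes refl = trans (cong a′ a′z) a′f
  ... | no ne′ = trans (cong a′ (a′-old x ne ne′)) (trans
      (a′-old (a x) (λ e → ne′ (trans (sym (inv x)) (cong a e))) (λ e → ne (trans (sym (inv x)) (trans (cong a e) (inv h)))))
      (cong ι (inv x)))

  leaves′ : leafTotal k′ ≡ leafTotal k
  leaves′ = trans (leafTotal-insertAt (insertAt k (suc h) edge) b edge) (leafTotal-insertAt k (suc h) edge)

  h<b : h Fin.< a h → ι h Fin.< b
  h<b lt = P₂.ι<new (ℕₚ.<⇒≤ (P₁.ι-mono lt))

  f<z : h Fin.< a h → f Fin.< ι z
  f<z lt = P₂.ι-mono (P₁.new<ι lt)

-- The stem is to follow `c` counterclockwise. As the rotation is `nxt` after `a`, its place in the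
-- contour is right after `a c`.
module InsertStem {m : ℕ} (a : Fin (suc m) → Fin (suc m)) (k : Fin (suc m) → Kind) (inv : ∀ x → a (a x) ≡ x)
                  (c : Fin (suc m)) (kd : Kind) where

  private
    module P = AfterPoint (a c)

  open P public using (ι; ι-mono; ι-injective; cover)

  new : Fin (suc (suc m))
  new = suc (a c)

  ι≢new : ∀ x → ι x ≢ new
  ι≢new = P.ι≢new

  a′ : Fin (suc (suc m)) → Fin (suc (suc m))
  a′ = insertAt (ι ∘ a) new new

  k′ : Fin (suc (suc m)) → Kind
  k′ = insertAt k new kd

  s s′ : _
  s  = λ x → nxt (a x)
  s′ = λ x → nxt (a′ x)

  a′ι : ∀ x → a′ (ι x) ≡ ι (a x)
  a′ι = insertAt-punchIn (ι ∘ a) new new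

  a′new : a′ new ≡ new
  a′new = insertAt-lookup (ι ∘ a) new new

  k′ι : ∀ x → k′ (ι x) ≡ k x
  k′ι = insertAt-punchIn k new kd

  k′new : k′ new ≡ kd
  k′new = insertAt-lookup k new kd

  s′ι : ∀ x → x ≢ c → s′ (ι x) ≡ ι (s x)
  s′ι x ne = trans (cong nxt (a′ι x)) (P.nxt-ι (a x) (λ e → ne (trans (sym (inv x)) (trans (cong a e) (inv c)))))

  s′c : s′ (ι c) ≡ new
  s′c = trans (cong nxt (a′ι c)) P.nxt-point

  s′new : s′ new ≡ ι (s c)
  s′new = trans (cong nxt a′new) P.nxt-new

  inv′ : ∀ y → a′ (a′ y) ≡ y
  inv′ y with cover y
  ... | inj₂ refl = trans (cong a′ a′new) a′new
  ... | inj₁ (x , refl) = trans (cong a′ (a′ι x)) (trans (a′ι (a x)) (cong ι (inv x)))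

  leaves′ : leafTotal k′ ≡ leafInd kd + leafTotal k
  leaves′ = leafTotal-insertAt k new kd

-- Inserting a vertex of interior degree 2

pattern 0F = zero
pattern 1F = suc zero
pattern 2F = suc (suc zero)
pattern 3F = suc (suc (suc zero))

rot : Fin 4 → Fin 4
rot 0F = 1F
rot 1F = 2F
rot 2F = 3F
rot 3F = 0F

-- An interface that hides the numbers of the four new half-edges, which differ between
-- arrangements. They are listed by `v` counterclockwise, beginning with the one joined to `h`; the
-- original end of the edge is joined to `v (exit A)`.
record VertexInsertion {m : ℕ} (a : Fin (suc m) → Fin (suc m)) (k : Fin (suc m) → Kind)
                       (h : Fin (suc m)) (A : Arr) : Set where
  field
    m′ : ℕ
    a′ : Fin (suc m′) → Fin (suc m′)
    k′ : Fin (suc m′) → Kind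
    ι  : Fin (suc m) → Fin (suc m′)
    v  : Fin 4 → Fin (suc m′)
    inv′    : ∀ y → a′ (a′ y) ≡ y
    ι-mono  : ∀ {x y} → x Fin.< y → ι x Fin.< ι y
    ι-zero  : ι zero ≡ zero
    ι≢v     : ∀ x j → ι x ≢ v j
    v-inj   : ∀ i j → v i ≡ v j → i ≡ j
    cover   : ∀ y → (Σ[ x ∈ Fin (suc m) ] y ≡ ι x) ⊎ (Σ[ j ∈ Fin 4 ] y ≡ v j)
    kι      : ∀ x → k′ (ι x) ≡ k x
    kv      : ∀ j → k′ (v j) ≡ pattern′ A j
    sι      : ∀ x → nxt (a′ (ι x)) ≡ ι (nxt (a x))
    sv      : ∀ j → nxt (a′ (v j)) ≡ v (rot j)
    a-old   : ∀ x → x ≢ h → x ≢ a h → a′ (ι x) ≡ ι (a x)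
    a-entry : a′ (ι h) ≡ v zero
    a-exit  : a′ (v (exit A)) ≡ ι (a h)
    a-stem  : ∀ j → pattern′ A j ≢ edge → a′ (v j) ≡ v j
    order   : h Fin.< a h → ι h Fin.< v zero × v (exit A) Fin.< ι (a h)
    leaves′ : leafTotal k′ ≡ suc (leafTotal k)

module _ {m : ℕ} (a : Fin (suc m) → Fin (suc m)) (k : Fin (suc m) → Kind) (inv : ∀ x → a (a x) ≡ x)
         (h : Fin (suc m)) (ah≢h : a h ≢ h) where

  private
    module Sp = SplitEdge a k inv h ah≢h

    -- The second stem is inserted first. When both have the same predecessor, the stem inserted
    -- last lands directly behind it, so `n₁` precedes `n₂` as required.
    module TwoStems (c₂ c₁ : Fin (suc (suc (suc m)))) (o : Bool) where
      module T₂ = InsertStem Sp.a′ Sp.k′ Sp.inv′ c₂ (stem₂ o)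
      module T₁ = InsertStem T₂.a′ T₂.k′ T₂.inv′ (T₂.ι c₁) (stem₁ o)

      J : Fin (suc (suc (suc m))) → Fin (suc (suc (suc (suc (suc m)))))
      J = T₁.ι ∘ T₂.ι

      n₁ n₂ : Fin (suc (suc (suc (suc (suc m)))))
      n₁ = T₁.new
      n₂ = T₁.ι T₂.new

      J-inj : ∀ {x y} → J x ≡ J y → x ≡ y
      J-inj = T₂.ι-injective ∘ T₁.ι-injective

      J-mono : ∀ {x y} → x Fin.< y → J x Fin.< J y
      J-mono lt = T₁.ι-mono (T₂.ι-mono lt)

      J≢n₁ : ∀ x → J x ≢ n₁
      J≢n₁ x = T₁.ι≢new (T₂.ι x)

      J≢n₂ : ∀ x → J x ≢ n₂
      J≢n₂ x e = T₂.ι≢new x (T₁.ι-injective e)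

      n₂≢n₁ : n₂ ≢ n₁
      n₂≢n₁ = T₁.ι≢new T₂.new

      sJ : ∀ x → x ≢ c₁ → x ≢ c₂ → T₁.s′ (J x) ≡ J (Sp.s′ x)
      sJ x ne₁ ne₂ = trans (T₁.s′ι (T₂.ι x) (ne₁ ∘ T₂.ι-injective)) (cong T₁.ι (T₂.s′ι x ne₂))

      s-n₂ : T₁.s′ n₂ ≡ J (Sp.s′ c₂)
      s-n₂ = trans (T₁.s′ι T₂.new (λ e → T₂.ι≢new c₁ (sym e))) (cong T₁.ι T₂.s′new)

      s-c₁ : T₁.s′ (J c₁) ≡ n₁
      s-c₁ = T₁.s′c

      s-c₂ : c₂ ≢ c₁ → T₁.s′ (J c₂) ≡ n₂
      s-c₂ ne = trans (T₁.s′ι (T₂.ι c₂) (ne ∘ T₂.ι-injective)) (cong T₁.ι T₂.s′c)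

      s-n₁≢ : c₁ ≢ c₂ → T₁.s′ n₁ ≡ J (Sp.s′ c₁)
      s-n₁≢ ne = trans T₁.s′new (cong T₁.ι (T₂.s′ι c₁ ne))

      s-n₁≡ : c₁ ≡ c₂ → T₁.s′ n₁ ≡ n₂
      s-n₁≡ refl = trans T₁.s′new (cong T₁.ι T₂.s′c)

      aJ : ∀ x → T₁.a′ (J x) ≡ J (Sp.a′ x)
      aJ x = trans (T₁.a′ι (T₂.ι x)) (cong T₁.ι (T₂.a′ι x))

      a-n₁ : T₁.a′ n₁ ≡ n₁
      a-n₁ = T₁.a′new

      a-n₂ : T₁.a′ n₂ ≡ n₂
      a-n₂ = trans (T₁.a′ι T₂.new) (cong T₁.ι T₂.a′new)

      kJ : ∀ x → T₁.k′ (J x) ≡ Sp.k′ x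
      kJ x = trans (T₁.k′ι (T₂.ι x)) (T₂.k′ι x)

      k-n₁ : T₁.k′ n₁ ≡ stem₁ o
      k-n₁ = T₁.k′new

      k-n₂ : T₁.k′ n₂ ≡ stem₂ o
      k-n₂ = trans (T₁.k′ι T₂.new) T₂.k′new

      coverJ : ∀ y → (Σ[ x ∈ Fin (suc m) ] y ≡ J (Sp.ι x)) ⊎ (y ≡ J Sp.b ⊎ (y ≡ J Sp.f ⊎ (y ≡ n₁ ⊎ y ≡ n₂)))
      coverJ y with T₁.cover y
      ... | inj₂ e = inj₂ (inj₂ (inj₂ (inj₁ e)))
      ... | inj₁ (y₁ , refl) with T₂.cover y₁
      ... | inj₂ refl = inj₂ (inj₂ (inj₂ (inj₂ refl)))
      ... | inj₁ (y₂ , refl) with Sp.cover y₂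
      ... | inj₁ (x , refl) = inj₁ (x , refl)
      ... | inj₂ (inj₁ refl) = inj₂ (inj₁ refl)
      ... | inj₂ (inj₂ refl) = inj₂ (inj₂ (inj₁ refl))

      total : leafTotal T₁.k′ ≡ suc (leafTotal k)
      total = trans T₁.leaves′ (trans (cong (λ z → leafInd (stem₁ o) + z) (trans T₂.leaves′ (cong (λ z → leafInd (stem₂ o) + z) Sp.leaves′))) (one o))
        where
        one : ∀ o → leafInd (stem₁ o) + (leafInd (stem₂ o) + leafTotal k) ≡ suc (leafTotal k)
        one true  = refl
        one false = refl

      module Common (A : Arr) (v : Fin 4 → Fin (suc (suc (suc (suc (suc m))))))
        (v₀ : v zero ≡ J Sp.b) (vₑ : v (exit A) ≡ J Sp.f)
        (v-inj : ∀ i j → v i ≡ v j → i ≡ j)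
        (v-class : ∀ j → v j ≡ J Sp.b ⊎ (v j ≡ J Sp.f ⊎ (v j ≡ n₁ ⊎ v j ≡ n₂)))
        (v-onto : ∀ y → y ≡ J Sp.b ⊎ (y ≡ J Sp.f ⊎ (y ≡ n₁ ⊎ y ≡ n₂)) → Σ[ j ∈ Fin 4 ] y ≡ v j)
        (kv : ∀ j → T₁.k′ (v j) ≡ pattern′ A j)
        (sv : ∀ j → T₁.s′ (v j) ≡ v (rot j))
        (c₁-new : c₁ ≡ Sp.b ⊎ c₁ ≡ Sp.f) (c₂-new : c₂ ≡ Sp.b ⊎ c₂ ≡ Sp.f)
        where

        old≢ : ∀ x c → c ≡ Sp.b ⊎ c ≡ Sp.f → Sp.ι x ≢ c
        old≢ x c (inj₁ refl) = Sp.ι≢b x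
        old≢ x c (inj₂ refl) = Sp.ι≢f x

        result : VertexInsertion a k h A
        result = record
          { m′ = _ ; a′ = T₁.a′ ; k′ = T₁.k′ ; ι = J ∘ Sp.ι ; v = v
          ; inv′ = T₁.inv′
          ; ι-mono = λ lt → J-mono (Sp.ι-mono lt)
          ; ι-zero = refl
          ; ι≢v = λ x j e → ι≢ x (v j) (v-class j) e
          ; v-inj = v-inj
          ; cover = λ y → cov y (coverJ y)
          ; kι = λ x → trans (kJ (Sp.ι x)) (Sp.k′ι x)
          ; kv = kv
          ; sι = λ x → trans (sJ (Sp.ι x) (old≢ x c₁ c₁-new) (old≢ x c₂ c₂-new)) (cong J (Sp.s′ι x))
          ; sv = sv
          ; a-old = λ x ne ne′ → trans (aJ (Sp.ι x)) (cong J (Sp.a′-old x ne ne′))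
          ; a-entry = trans (aJ (Sp.ι h)) (trans (cong J Sp.a′h) (sym v₀))
          ; a-exit = trans (cong T₁.a′ vₑ) (trans (aJ Sp.f) (cong J Sp.a′f))
          ; a-stem = λ j ne → stem (v j) (v-class j) (λ e → ne (trans (sym (kv j)) e))
          ; order = λ lt → subst (J (Sp.ι h) Fin.<_) (sym v₀) (J-mono (Sp.h<b lt))
                         , subst (Fin._< J (Sp.ι (a h))) (sym vₑ) (J-mono (Sp.f<z lt))
          ; leaves′ = total }
          where
          ι≢ : ∀ x y → y ≡ J Sp.b ⊎ (y ≡ J Sp.f ⊎ (y ≡ n₁ ⊎ y ≡ n₂)) → J (Sp.ι x) ≢ y
          ι≢ x y (inj₁ refl)               e = Sp.ι≢b x (J-inj e)
          ι≢ x y (inj₂ (inj₁ refl))        e = Sp.ι≢f x (J-inj e)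
          ι≢ x y (inj₂ (inj₂ (inj₁ refl))) e = J≢n₁ (Sp.ι x) e
          ι≢ x y (inj₂ (inj₂ (inj₂ refl))) e = J≢n₂ (Sp.ι x) e
          cov : ∀ y → (Σ[ x ∈ Fin (suc m) ] y ≡ J (Sp.ι x)) ⊎ (y ≡ J Sp.b ⊎ (y ≡ J Sp.f ⊎ (y ≡ n₁ ⊎ y ≡ n₂))) →
                (Σ[ x ∈ Fin (suc m) ] y ≡ J (Sp.ι x)) ⊎ (Σ[ j ∈ Fin 4 ] y ≡ v j)
          cov y (inj₁ p) = inj₁ p
          cov y (inj₂ p) = inj₂ (v-onto y p)
          stem : ∀ y → y ≡ J Sp.b ⊎ (y ≡ J Sp.f ⊎ (y ≡ n₁ ⊎ y ≡ n₂)) → T₁.k′ y ≢ edge → T₁.a′ y ≡ y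
          stem y (inj₁ refl)               ne = ⊥-elim (ne (trans (kJ Sp.b) Sp.k′b))
          stem y (inj₂ (inj₁ refl))        ne = ⊥-elim (ne (trans (kJ Sp.f) Sp.k′f))
          stem y (inj₂ (inj₂ (inj₁ refl))) ne = a-n₁
          stem y (inj₂ (inj₂ (inj₂ refl))) ne = a-n₂

      k-b : T₁.k′ (J Sp.b) ≡ edge
      k-b = trans (kJ Sp.b) Sp.k′b

      k-f : T₁.k′ (J Sp.f) ≡ edge
      k-f = trans (kJ Sp.f) Sp.k′f

      b≢f : J Sp.b ≢ J Sp.f
      b≢f e = Sp.b≢f (J-inj e)

      four-inj : ∀ (v : Fin 4 → Fin (suc (suc (suc (suc (suc m)))))) → v 0F ≢ v 1F → v 0F ≢ v 2F → v 0F ≢ v 3F →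
        v 1F ≢ v 2F → v 1F ≢ v 3F → v 2F ≢ v 3F → ∀ i j → v i ≡ v j → i ≡ j
      four-inj v p q r s t u 0F 0F e = refl
      four-inj v p q r s t u 0F 1F e = ⊥-elim (p e)
      four-inj v p q r s t u 0F 2F e = ⊥-elim (q e)
      four-inj v p q r s t u 0F 3F e = ⊥-elim (r e)
      four-inj v p q r s t u 1F 0F e = ⊥-elim (p (sym e))
      four-inj v p q r s t u 1F 1F e = refl
      four-inj v p q r s t u 1F 2F e = ⊥-elim (s e)
      four-inj v p q r s t u 1F 3F e = ⊥-elim (t e)
      four-inj v p q r s t u 2F 0F e = ⊥-elim (q (sym e))
      four-inj v p q r s t u 2F 1F e = ⊥-elim (s (sym e))
      four-inj v p q r s t u 2F 2F e = refl
      four-inj v p q r s t u 2F 3F e = ⊥-elim (u e)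
      four-inj v p q r s t u 3F 0F e = ⊥-elim (r (sym e))
      four-inj v p q r s t u 3F 1F e = ⊥-elim (t (sym e))
      four-inj v p q r s t u 3F 2F e = ⊥-elim (u (sym e))
      four-inj v p q r s t u 3F 3F e = refl

  insertVertex : ∀ A → VertexInsertion a k h A
  insertVertex (before , o) = Common.result (before , o) v refl refl
    (four-inj v (J≢n₁ Sp.b) (J≢n₂ Sp.b) b≢f (n₂≢n₁ ∘ sym) (J≢n₁ Sp.f ∘ sym) (J≢n₂ Sp.f ∘ sym))
    (λ { 0F → inj₁ refl ; 1F → inj₂ (inj₂ (inj₁ refl)) ; 2F → inj₂ (inj₂ (inj₂ refl)) ; 3F → inj₂ (inj₁ refl) })
    (λ { y (inj₁ e) → 0F , e ; y (inj₂ (inj₁ e)) → 3F , e ; y (inj₂ (inj₂ (inj₁ e))) → 1F , e ; y (inj₂ (inj₂ (inj₂ e))) → 2F , e })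
    (λ { 0F → k-b ; 1F → k-n₁ ; 2F → k-n₂ ; 3F → k-f })
    (λ { 0F → s-c₁ ; 1F → s-n₁≡ refl ; 2F → trans s-n₂ (cong J Sp.s′b) ; 3F → trans (sJ Sp.f (Sp.b≢f ∘ sym) (Sp.b≢f ∘ sym)) (cong J Sp.s′f) })
    (inj₁ refl) (inj₁ refl)
    where
    open TwoStems Sp.b Sp.b o
    v : Fin 4 → Fin (suc (suc (suc (suc (suc m)))))
    v 0F = J Sp.b
    v 1F = n₁
    v 2F = n₂
    v 3F = J Sp.f
  insertVertex (across , o) = Common.result (across , o) v refl refl
    (four-inj v (J≢n₁ Sp.b) b≢f (J≢n₂ Sp.b) (J≢n₁ Sp.f ∘ sym) (n₂≢n₁ ∘ sym) (J≢n₂ Sp.f))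
    (λ { 0F → inj₁ refl ; 1F → inj₂ (inj₂ (inj₁ refl)) ; 3F → inj₂ (inj₂ (inj₂ refl)) ; 2F → inj₂ (inj₁ refl) })
    (λ { y (inj₁ e) → 0F , e ; y (inj₂ (inj₁ e)) → 2F , e ; y (inj₂ (inj₂ (inj₁ e))) → 1F , e ; y (inj₂ (inj₂ (inj₂ e))) → 3F , e })
    (λ { 0F → k-b ; 1F → k-n₁ ; 3F → k-n₂ ; 2F → k-f })
    (λ { 0F → s-c₁ ; 1F → trans (s-n₁≢ Sp.b≢f) (cong J Sp.s′b) ; 2F → s-c₂ (Sp.b≢f ∘ sym) ; 3F → trans s-n₂ (cong J Sp.s′f) })
    (inj₁ refl) (inj₂ refl)
    where
    open TwoStems Sp.f Sp.b o
    v : Fin 4 → Fin (suc (suc (suc (suc (suc m)))))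
    v 0F = J Sp.b
    v 1F = n₁
    v 2F = J Sp.f
    v 3F = n₂
  insertVertex (after , o) = Common.result (after , o) v refl refl
    (four-inj v b≢f (J≢n₁ Sp.b) (J≢n₂ Sp.b) (J≢n₁ Sp.f) (J≢n₂ Sp.f) (n₂≢n₁ ∘ sym))
    (λ { 0F → inj₁ refl ; 2F → inj₂ (inj₂ (inj₁ refl)) ; 3F → inj₂ (inj₂ (inj₂ refl)) ; 1F → inj₂ (inj₁ refl) })
    (λ { y (inj₁ e) → 0F , e ; y (inj₂ (inj₁ e)) → 1F , e ; y (inj₂ (inj₂ (inj₁ e))) → 2F , e ; y (inj₂ (inj₂ (inj₂ e))) → 3F , e })
    (λ { 0F → k-b ; 2F → k-n₁ ; 3F → k-n₂ ; 1F → k-f })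
    (λ { 0F → trans (sJ Sp.b Sp.b≢f Sp.b≢f) (cong J Sp.s′b) ; 1F → s-c₁ ; 2F → s-n₁≡ refl ; 3F → trans s-n₂ (cong J Sp.s′f) })
    (inj₂ refl) (inj₂ refl)
    where
    open TwoStems Sp.f Sp.f o
    v : Fin 4 → Fin (suc (suc (suc (suc (suc m)))))
    v 0F = J Sp.b
    v 1F = J Sp.f
    v 2F = n₁
    v 3F = n₂

-- Expanding a scheme along words

iter-map : {A B : Set} (g : A → B) (f : A → A) (f′ : B → B) → (∀ x → f′ (g x) ≡ g (f x)) →
           ∀ j x → iter f′ j (g x) ≡ g (iter f j x)
iter-map g f f′ c zero    x = refl
iter-map g f f′ c (suc j) x = trans (cong f′ (iter-map g f f′ c j x)) (c (iter f j x))

edge? : (κ : Kind) → Dec (κ ≡ edge)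
edge? edge = yes refl
edge? leaf = no (λ ())
edge? bud  = no (λ ())

-- The labels l, l′ of the corners before and after the half-edge y at its vertex, where y′ is the opposite half-edge.
Rule : ∀ {n} → Kind → Fin n → Fin n → ℤ → ℤ → Set
Rule edge y′ y l l′ = (y′ Fin.< y → l′ ≡ l +ᶻ + 1) × (y Fin.< y′ → l ≡ l′ +ᶻ + 1)
Rule leaf y′ y l l′ = l ≡ l′ +ᶻ + 1
Rule bud  y′ y l l′ = l′ ≡ l +ᶻ + 1

module Walking {m : ℕ} (a : Fin (suc m) → Fin (suc m)) (k : Fin (suc m) → Kind) where

  turn : Fin 4 → Fin (suc m) → Fin (suc m)
  turn j = iter (nxt ∘ a) (toℕ j)

  Pattern : Arr → Fin (suc m) → Set
  Pattern A b = ∀ j → k (turn j b) ≡ pattern′ A j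

  -- The edges of a path are numbered backwards, from its last edge 0; piece records path and number.
  Walk : {X : Set} → (Fin (suc m) → X × ℕ) → X → Fin (suc m) → List Arr → Fin (suc m) → Set
  Walk piece x h []      t = piece h ≡ (x , 0) × a h ≡ t
  Walk piece x h (A ∷ w) t = piece h ≡ (x , suc (length w)) × Pattern A (a h) × Walk piece x (turn (exit A) (a h)) w t

  -- Besides the kinds, this records that the rotation at the vertex is a cycle of length exactly
  -- four; 4-valence and interior degree 2 of path vertices are read off from it.
  OnPath : Fin (suc m) → Set
  OnPath y = Σ[ b ∈ Fin (suc m) ] Σ[ A ∈ Arr ] Σ[ j ∈ Fin 4 ] (y ≡ turn j b × Pattern A b
           × nxt (a (turn 3F b)) ≡ b × (∀ i i′ → turn i b ≡ turn i′ b → i ≡ i′))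

-- Labels of the four corners of a path vertex relative to the corner before the entering half-edge:
-- going counterclockwise, the entering half-edge and a bud add 1, the leaving half-edge and a leaf
-- subtract 1.
offset : Arr → Fin 4 → ℤ
offset (before , true)  0F = + 0
offset (before , true)  1F = + 1
offset (before , true)  2F = + 0
offset (before , true)  3F = + 1
offset (before , false) 0F = + 0
offset (before , false) 1F = + 1
offset (before , false) 2F = + 2
offset (before , false) 3F = + 1
offset (across , true)  0F = + 0
offset (across , true)  1F = + 1
offset (across , true)  2F = + 0
offset (across , true)  3F = -[1+ 0 ]
offset (across , false) 0F = + 0
offset (across , false) 1F = + 1
offset (across , false) 2F = + 2
offset (across , false) 3F = + 1
offset (after , true)   0F = + 0
offset (after , true)   1F = + 1
offset (after , true)   2F = + 0
offset (after , true)   3F = -[1+ 0 ]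
offset (after , false)  0F = + 0
offset (after , false)  1F = + 1
offset (after , false)  2F = + 0
offset (after , false)  3F = + 1

offset-1 : ∀ A → offset A 1F ≡ + 1
offset-1 (before , true)  = refl
offset-1 (before , false) = refl
offset-1 (across , true)  = refl
offset-1 (across , false) = refl
offset-1 (after , true)   = refl
offset-1 (after , false)  = refl

offset-exit : ∀ A → offset A (exit A) ≡ + 1 +ᶻ dispA A
offset-exit (before , true)  = refl
offset-exit (before , false) = refl
offset-exit (across , true)  = refl
offset-exit (across , false) = refl
offset-exit (after , true)   = refl
offset-exit (after , false)  = refl

up : ∀ b x → b +ᶻ (x +ᶻ + 1) ≡ b +ᶻ x +ᶻ + 1
up b x = sym (ℤₚ.+-assoc b x (+ 1))

-- The entering half-edge points away from the vertex, the leaving one towards it.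
offset-rule : ∀ {n} (B : ℤ) A (w′ w : Fin 4 → Fin n) → w′ 0F Fin.< w 0F → w (exit A) Fin.< w′ (exit A) →
              ∀ j → Rule (pattern′ A j) (w′ j) (w j) (B +ᶻ offset A j) (B +ᶻ offset A (rot j))
offset-rule B (before , true)  w′ w lo hi 0F = (λ _ → up B _) , (λ lt → ⊥-elim (ℕₚ.<-asym lo lt))
offset-rule B (before , true)  w′ w lo hi 1F = up B _
offset-rule B (before , true)  w′ w lo hi 2F = up B _
offset-rule B (before , true)  w′ w lo hi 3F = (λ lt → ⊥-elim (ℕₚ.<-asym hi lt)) , (λ _ → up B _)
offset-rule B (before , false) w′ w lo hi 0F = (λ _ → up B _) , (λ lt → ⊥-elim (ℕₚ.<-asym lo lt))
offset-rule B (before , false) w′ w lo hi 1F = up B _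
offset-rule B (before , false) w′ w lo hi 2F = up B _
offset-rule B (before , false) w′ w lo hi 3F = (λ lt → ⊥-elim (ℕₚ.<-asym hi lt)) , (λ _ → up B _)
offset-rule B (across , true)  w′ w lo hi 0F = (λ _ → up B _) , (λ lt → ⊥-elim (ℕₚ.<-asym lo lt))
offset-rule B (across , true)  w′ w lo hi 1F = up B _
offset-rule B (across , true)  w′ w lo hi 2F = (λ lt → ⊥-elim (ℕₚ.<-asym hi lt)) , (λ _ → up B _)
offset-rule B (across , true)  w′ w lo hi 3F = up B _
offset-rule B (across , false) w′ w lo hi 0F = (λ _ → up B _) , (λ lt → ⊥-elim (ℕₚ.<-asym lo lt))
offset-rule B (across , false) w′ w lo hi 1F = up B _
offset-rule B (across , false) w′ w lo hi 2F = (λ lt → ⊥-elim (ℕₚ.<-asym hi lt)) , (λ _ → up B _)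
offset-rule B (across , false) w′ w lo hi 3F = up B _
offset-rule B (after , true)   w′ w lo hi 0F = (λ _ → up B _) , (λ lt → ⊥-elim (ℕₚ.<-asym lo lt))
offset-rule B (after , true)   w′ w lo hi 1F = (λ lt → ⊥-elim (ℕₚ.<-asym hi lt)) , (λ _ → up B _)
offset-rule B (after , true)   w′ w lo hi 2F = up B _
offset-rule B (after , true)   w′ w lo hi 3F = up B _
offset-rule B (after , false)  w′ w lo hi 0F = (λ _ → up B _) , (λ lt → ⊥-elim (ℕₚ.<-asym lo lt))
offset-rule B (after , false)  w′ w lo hi 1F = (λ lt → ⊥-elim (ℕₚ.<-asym hi lt)) , (λ _ → up B _)
offset-rule B (after , false)  w′ w lo hi 2F = up B _
offset-rule B (after , false)  w′ w lo hi 3F = up B _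

edge-positions : ∀ A j → pattern′ A j ≡ edge → j ≡ 0F ⊎ j ≡ exit A
edge-positions A               0F e = inj₁ refl
edge-positions (before , true) 1F ()
edge-positions (before , false) 1F ()
edge-positions (before , true) 2F ()
edge-positions (before , false) 2F ()
edge-positions (before , o)    3F e = inj₂ refl
edge-positions (across , true) 1F ()
edge-positions (across , false) 1F ()
edge-positions (across , o)    2F e = inj₂ refl
edge-positions (across , true) 3F ()
edge-positions (across , false) 3F ()
edge-positions (after , o)     1F e = inj₂ refl
edge-positions (after , true)  2F ()
edge-positions (after , false) 2F ()
edge-positions (after , true)  3F ()
edge-positions (after , false) 3F ()

exit≢0 : ∀ A → exit A ≢ 0F
exit≢0 (before , o) ()
exit≢0 (across , o) ()
exit≢0 (after , o) ()

sum-update : ∀ {n} (t t′ : Fin n → ℕ) i → t′ i ≡ suc (t i) → (∀ j → j ≢ i → t′ j ≡ t j) → sum t′ ≡ suc (sum t)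
sum-update t t′ zero e e′ = cong₂ _+_ e (sum-cong-≗ (λ j → e′ (suc j) (λ ())))
sum-update t t′ (suc i) e e′ = trans (cong₂ _+_ (e′ zero (λ ())) (sum-update (t ∘ suc) (t′ ∘ suc) i e (λ j ne → e′ (suc j) (ne ∘ Finₚ.suc-injective))))
  (ℕₚ.+-suc (t zero) _)

sum-zero : ∀ n → sum {n} (λ _ → 0) ≡ 0
sum-zero zero    = refl
sum-zero (suc n) = sum-zero n

First : (S : BMap) → HE S → Set
First S x = κ S x ≡ edge × x Fin.< α S x

first? : ∀ S x → Dec (First S x)
first? S x = edge? (κ S x) ×-dec (x Fin.<? α S x)

module Expansion (S : BMap) (valid : Valid S) (L₀ : HE S → ℤ)
                 (rule₀ : ∀ x → Rule (κ S x) (α S x) x (L₀ x) (L₀ (σ S x))) where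

  -- The invariant of a partly expanded scheme. The labels already obey the rule around every
  -- vertex; what may still fail is the agreement of labels along the first edge of a path, which is
  -- restored only when the complete word is in place.
  record Expanded (d : HE S → List Arr) : Set where
    field
      m : ℕ
      a : Fin (suc m) → Fin (suc m)
      k : Fin (suc m) → Kind
      e : HE S → Fin (suc m)
      L : Fin (suc m) → ℤ
      piece : Fin (suc m) → HE S × ℕ
    open Walking a k public
    field
      inv     : ∀ y → a (a y) ≡ y
      a-edge  : ∀ y → k y ≡ edge → a y ≢ y
      a-stem  : ∀ y → k y ≢ edge → a y ≡ y
      e-mono  : ∀ {x y} → x Fin.< y → e x Fin.< e y
      e-zero  : e zero ≡ zero
      e-κ     : ∀ x → k (e x) ≡ κ S x
      e-σ     : ∀ x → nxt (a (e x)) ≡ e (σ S x)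
      e-first : ∀ x → First S x → e x Fin.< a (e x)
      cover   : ∀ y → (Σ[ x ∈ HE S ] y ≡ e x) ⊎ OnPath y
      piece-a : ∀ y → piece (a y) ≡ piece y
      walk    : ∀ x → First S x → Walk piece x (e x) (d x) (e (α S x))
      L-e     : ∀ x → L (e x) ≡ L₀ x
      L-rule  : ∀ y → Rule (k y) (a y) y (L y) (L (nxt (a y)))
      L-edge  : ∀ y → k y ≡ edge → y Fin.< a y → (Σ[ x ∈ HE S ] (First S x × y ≡ e x)) ⊎ L y ≡ L (nxt y)
      -- The discrepancy between the two ends of the path is concentrated on its first edge.
      L-gap   : ∀ x → First S x → L₀ (next S x) ≡ L (nxt (e x)) +ᶻ disp (d x)
      leaves′ : leafTotal k ≡ leafTotal (κ S) + sum (length ∘ d)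

  unexpanded : Expanded (λ _ → [])
  unexpanded = record
    { m = BMap.m S ; a = α S ; k = κ S ; e = λ x → x ; L = L₀ ; piece = λ x → first x , 0
    ; inv = proj₁ valid ; a-edge = proj₁ (proj₂ valid) ; a-stem = proj₁ (proj₂ (proj₂ valid))
    ; e-mono = λ lt → lt ; e-zero = refl ; e-κ = λ x → refl ; e-σ = λ x → refl ; e-first = λ x → proj₂
    ; cover = λ y → inj₁ (y , refl)
    ; piece-a = λ y → cong (_, 0) (first-α y)
    ; walk = λ x (_ , lt) → cong (_, 0) (first-first x lt) , refl
    ; L-e = λ x → refl ; L-rule = rule₀
    ; L-edge = λ y κe lt → inj₁ (y , (κe , lt) , refl)
    ; L-gap = λ x f → sym (ℤₚ.+-identityʳ _)
    ; leaves′ = sym (trans (cong (λ z → leafTotal (κ S) + z) (sum-zero (suc (BMap.m S)))) (ℕₚ.+-identityʳ _)) }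
    where
    first : HE S → HE S
    first x = if does (α S x Fin.<? x) then α S x else x
    first-first : ∀ x → x Fin.< α S x → first x ≡ x
    first-first x lt = cong (if_then α S x else x) (dec-false (α S x Fin.<? x) (ℕₚ.<-asym lt))
    first-second : ∀ x → α S x Fin.< x → first x ≡ α S x
    first-second x lt = cong (if_then α S x else x) (dec-true (α S x Fin.<? x) lt)
    first-α : ∀ x → first (α S x) ≡ first x
    first-α x with ℕₚ.<-cmp (toℕ x) (toℕ (α S x))
    ... | tri< lt _ _ = trans (first-second (α S x) (subst (Fin._< α S x) (sym (proj₁ valid x)) lt)) (trans (proj₁ valid x) (sym (first-first x lt)))
    ... | tri≈ _ e _ = cong first (sym (Finₚ.toℕ-injective e))
    ... | tri> _ _ gt = trans (first-first (α S x) (subst (α S x Fin.<_) (sym (proj₁ valid x)) gt)) (sym (first-second x gt))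

  module _ {d : HE S → List Arr} (E : Expanded d) (x : HE S) (x-first : First S x) (A : Arr)
           {d′ : HE S → List Arr} (d′-x : d′ x ≡ A ∷ d x) (d′-y : ∀ y → y ≢ x → d′ y ≡ d y) where

    private
      open module E = Expanded E using (m; a; k; e; L; piece; Walk; turn; Pattern; OnPath)
      h : Fin (suc m)
      h = e x
      h<ah : h Fin.< a h
      h<ah = E.e-first x x-first
      ah≢h : a h ≢ h
      ah≢h = E.a-edge h (trans (E.e-κ x) (proj₁ x-first))
      V : VertexInsertion a k h A
      V = insertVertex a k E.inv h ah≢h A
      open module V = VertexInsertion V using (m′; a′; k′; ι; v)
      module W′ = Walking a′ k′

      n : ℕ
      n = length (d x)

      piece-h : piece h ≡ (x , n)
      piece-h with d x | E.walk x x-first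
      ... | []    | p , _ = p
      ... | _ ∷ _ | p , _ = p

      onNew : {X : Set} → (Fin (suc m) → X) → (Fin 4 → X) → Fin (suc m′) → X
      onNew f g y with V.cover y
      ... | inj₁ (z , _) = f z
      ... | inj₂ (j , _) = g j

      ι-inj : ∀ {y z} → ι y ≡ ι z → y ≡ z
      ι-inj {y} {z} eq with ℕₚ.<-cmp (toℕ y) (toℕ z)
      ... | tri< lt _ _ = ⊥-elim (ℕₚ.<⇒≢ (V.ι-mono lt) (cong toℕ eq))
      ... | tri≈ _ eq′ _ = Finₚ.toℕ-injective eq′
      ... | tri> _ _ gt = ⊥-elim (ℕₚ.<⇒≢ (V.ι-mono gt) (cong toℕ (sym eq)))

      onNew-ι : {X : Set} (f : Fin (suc m) → X) (g : Fin 4 → X) → ∀ z → onNew f g (ι z) ≡ f z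
      onNew-ι f g z with V.cover (ι z)
      ... | inj₁ (z′ , eq) = cong f (sym (ι-inj eq))
      ... | inj₂ (j , eq)  = ⊥-elim (V.ι≢v z j eq)

      onNew-v : {X : Set} (f : Fin (suc m) → X) (g : Fin 4 → X) → ∀ j → onNew f g (v j) ≡ g j
      onNew-v f g j with V.cover (v j)
      ... | inj₁ (z , eq) = ⊥-elim (V.ι≢v z j (sym eq))
      ... | inj₂ (j′ , eq) = cong g (sym (V.v-inj j j′ eq))

      -- This choice gives the corner before the leaving half-edge the label `L (nxt h)` found
      -- across the edge. The new second edge is thus balanced, and the discrepancy, changed by
      -- `dispA A`, moves to the new first edge.
      B : ℤ
      B = L (nxt h) +ᶻ ℤ.- (+ 1 +ᶻ dispA A)

      L′ : Fin (suc m′) → ℤ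
      L′ = onNew L (λ j → B +ᶻ offset A j)

      L′ι : ∀ z → L′ (ι z) ≡ L z
      L′ι = onNew-ι L (λ j → B +ᶻ offset A j)

      L′v : ∀ j → L′ (v j) ≡ B +ᶻ offset A j
      L′v = onNew-v L (λ j → B +ᶻ offset A j)

      pieceOld : Fin (suc m) → HE S × ℕ
      pieceOld z = if does (z Fin.≟ h) then (x , suc n) else piece z

      pieceNew : Fin 4 → HE S × ℕ
      pieceNew j = if does (j Fin.≟ exit A) then (x , n) else (x , suc n)

      piece′ : Fin (suc m′) → HE S × ℕ
      piece′ = onNew pieceOld pieceNew

      piece′h : piece′ (ι h) ≡ (x , suc n)
      piece′h = trans (onNew-ι pieceOld pieceNew h) (cong (if_then (x , suc n) else piece h) (dec-true (h Fin.≟ h) refl))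

      piece′-old : ∀ z → z ≢ h → piece′ (ι z) ≡ piece z
      piece′-old z ne = trans (onNew-ι pieceOld pieceNew z) (cong (if_then (x , suc n) else piece z) (dec-false (z Fin.≟ h) ne))

      piece′exit : piece′ (v (exit A)) ≡ (x , n)
      piece′exit = trans (onNew-v pieceOld pieceNew (exit A)) (cong (if_then (x , n) else (x , suc n)) (dec-true (exit A Fin.≟ exit A) refl))

      piece′v : ∀ j → j ≢ exit A → piece′ (v j) ≡ (x , suc n)
      piece′v j ne = trans (onNew-v pieceOld pieceNew j) (cong (if_then (x , n) else (x , suc n)) (dec-false (j Fin.≟ exit A) ne))

      a′v₀ : a′ (v 0F) ≡ ι h
      a′v₀ = trans (cong a′ (sym V.a-entry)) (V.inv′ (ι h))

      a′ah : a′ (ι (a h)) ≡ v (exit A)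
      a′ah = trans (cong a′ (sym V.a-exit)) (V.inv′ (v (exit A)))

      turn-v : ∀ j → W′.turn j (v 0F) ≡ v j
      turn-v 0F = refl
      turn-v 1F = V.sv 0F
      turn-v 2F = trans (cong (nxt ∘ a′) (V.sv 0F)) (V.sv 1F)
      turn-v 3F = trans (cong (nxt ∘ a′) (trans (cong (nxt ∘ a′) (V.sv 0F)) (V.sv 1F))) (V.sv 2F)

      turn-ι : ∀ j z → W′.turn j (ι z) ≡ ι (turn j z)
      turn-ι j z = iter-map ι (nxt ∘ a) (nxt ∘ a′) V.sι (toℕ j) z

      data Old (y : Fin (suc m)) : Set where
        entry : y ≡ h → Old y
        back  : y ≡ a h → Old y
        other : y ≢ h → y ≢ a h → Old y

      old : ∀ y → Old y
      old y with y Fin.≟ h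
      ... | yes p = entry p
      ... | no ne with y Fin.≟ a h
      ... | yes p = back p
      ... | no ne′ = other ne ne′

      nxt-ι : ∀ y → y ≢ h → y ≢ a h → nxt (ι y) ≡ ι (nxt y)
      nxt-ι y ne ne′ = begin
        nxt (ι y)              ≡⟨ cong (nxt ∘ ι) (E.inv y) ⟨
        nxt (ι (a (a y)))      ≡⟨ cong nxt (V.a-old (a y) (λ p → ne′ (trans (sym (E.inv y)) (cong a p)))
                                   (λ p → ne (trans (sym (E.inv y)) (trans (cong a p) (E.inv h))))) ⟨
        nxt (a′ (ι (a y)))     ≡⟨ V.sι (a y) ⟩
        ι (nxt (a (a y)))      ≡⟨ cong (ι ∘ nxt) (E.inv y) ⟩
        ι (nxt y) ∎
        where open ≡-Reasoning

      -- `piece` tells every edge of this walk from the subdivided edge, which belongs to path `x`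
      -- and has number `n`. Hence the walk avoids `h` and `a h`, where alone the involution is
      -- altered.
      walk-ι : ∀ {y} w {f t} → y ≢ x ⊎ length w < n → Walk piece y f w t → W′.Walk piece′ y (ι f) w (ι t)
      walk-ι {y} w {f} c wk = go w c wk
        where
        apart : ∀ {f l} → y ≢ x ⊎ l < n → piece f ≡ (y , l) → f ≢ h × f ≢ a h
        apart {f} {l} c p = (λ { refl → clash c (trans (sym piece-h) p) }) , (λ { refl → clash c (trans (sym piece-h) (trans (sym (E.piece-a h)) p)) })
          where
          clash : y ≢ x ⊎ l < n → (x , n) ≡ (y , l) → ⊥
          clash (inj₁ ne) refl = ne refl
          clash (inj₂ lt) refl = ℕₚ.<-irrefl refl lt
        go : ∀ w {f t} → y ≢ x ⊎ length w < n → Walk piece y f w t → W′.Walk piece′ y (ι f) w (ι t)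
        go [] {f} c (p , q) = let ne , ne′ = apart c p in trans (piece′-old f ne) p , trans (V.a-old f ne ne′) (cong ι q)
        go (A′ ∷ w) {f} c (p , pat , wk) = trans (piece′-old f ne) p
          , (λ j → trans (cong k′ (trans (cong (W′.turn j) af) (turn-ι j (a f)))) (trans (V.kι _) (pat j)))
          , subst (λ z → W′.Walk piece′ y z w _) (sym (trans (cong (W′.turn (exit A′)) af) (turn-ι (exit A′) (a f))))
              (go w (shorter c) wk)
          where
          shorter : y ≢ x ⊎ suc (length w) < n → y ≢ x ⊎ length w < n
          shorter (inj₁ q) = inj₁ q
          shorter (inj₂ q) = inj₂ (ℕₚ.<-trans (ℕₚ.n<1+n _) q)
          ne = proj₁ (apart c p)
          ne′ = proj₂ (apart c p)
          af : a′ (ι f) ≡ ι (a f)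
          af = V.a-old f ne ne′

      walk-x : ∀ w {t} → length w ≡ n → Walk piece x h w t → W′.Walk piece′ x (ι h) (A ∷ w) (ι t)
      walk-x w {t} len wk = trans piece′h (cong (λ z → x , suc z) (sym len))
        , (λ j → trans (cong k′ (trans (cong (W′.turn j) V.a-entry) (turn-v j))) (V.kv j))
        , subst (λ z → W′.Walk piece′ x z w (ι t)) (sym (trans (cong (W′.turn (exit A)) V.a-entry) (turn-v (exit A)))) (rest′ w len wk)
        where
        rest′ : ∀ w {t} → length w ≡ n → Walk piece x h w t → W′.Walk piece′ x (v (exit A)) w (ι t)
        rest′ [] len (p , q) = trans piece′exit (cong (x ,_) (sym len)) , trans V.a-exit (cong ι q)
        rest′ (A′ ∷ w) len (p , pat , wk) = trans piece′exit (cong (x ,_) (sym len))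
          , (λ j → trans (cong k′ (trans (cong (W′.turn j) V.a-exit) (turn-ι j (a h)))) (trans (V.kι _) (pat j)))
          , subst (λ z → W′.Walk piece′ x z w _) (sym (trans (cong (W′.turn (exit A′)) V.a-exit) (turn-ι (exit A′) (a h))))
              (walk-ι w (inj₂ (subst (length w <_) len ℕₚ.≤-refl)) wk)

      lower : ∀ y → a y Fin.< y → a′ (ι y) Fin.< ι y
      lower y lt with old y
      ... | entry refl = ⊥-elim (ℕₚ.<-asym lt h<ah)
      ... | back refl = subst (Fin._< ι (a h)) (sym a′ah) (proj₂ (V.order h<ah))
      ... | other ne ne′ = subst (Fin._< ι y) (sym (V.a-old y ne ne′)) (V.ι-mono lt)

      raise : ∀ y → y Fin.< a y → ι y Fin.< a′ (ι y)
      raise y lt with old y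
      ... | entry refl = subst (ι h Fin.<_) (sym V.a-entry) (proj₁ (V.order h<ah))
      ... | back refl = ⊥-elim (ℕₚ.<-asym (subst (a h Fin.<_) (E.inv h) lt) h<ah)
      ... | other ne ne′ = subst (ι y Fin.<_) (sym (V.a-old y ne ne′)) (V.ι-mono lt)

      lower⁻ : ∀ y → a′ (ι y) Fin.< ι y → a y Fin.< y
      lower⁻ y lt with ℕₚ.<-cmp (toℕ (a y)) (toℕ y)
      ... | tri< p _ _ = p
      ... | tri> _ _ p = ⊥-elim (ℕₚ.<-asym lt (raise y p))
      ... | tri≈ _ p _ with old y
      ... | entry refl = ⊥-elim (ah≢h (Finₚ.toℕ-injective p))
      ... | back refl = ⊥-elim (ah≢h (sym (trans (sym (E.inv h)) (Finₚ.toℕ-injective p))))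
      ... | other ne ne′ = ⊥-elim (ℕₚ.<-irrefl (cong toℕ (trans (V.a-old y ne ne′) (cong ι (Finₚ.toℕ-injective p)))) lt)

      raise⁻ : ∀ y → ι y Fin.< a′ (ι y) → y Fin.< a y
      raise⁻ y lt with ℕₚ.<-cmp (toℕ (a y)) (toℕ y)
      ... | tri< p _ _ = ⊥-elim (ℕₚ.<-asym lt (lower y p))
      ... | tri> _ _ p = p
      ... | tri≈ _ p _ with old y
      ... | entry refl = ⊥-elim (ah≢h (Finₚ.toℕ-injective p))
      ... | back refl = ⊥-elim (ah≢h (sym (trans (sym (E.inv h)) (Finₚ.toℕ-injective p))))
      ... | other ne ne′ = ⊥-elim (ℕₚ.<-irrefl (cong toℕ (sym (trans (V.a-old y ne ne′) (cong ι (Finₚ.toℕ-injective p))))) lt)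

      rule-ι : ∀ y κ′ {l l′ m m′} → l ≡ m → l′ ≡ m′ → Rule κ′ (a y) y l l′ → Rule κ′ (a′ (ι y)) (ι y) m m′
      rule-ι y edge refl refl (r , r′) = (λ lt → r (lower⁻ y lt)) , (λ lt → r′ (raise⁻ y lt))
      rule-ι y leaf refl refl r = r
      rule-ι y bud  refl refl r = r

      rule′ : ∀ y → Rule (k′ y) (a′ y) y (L′ y) (L′ (nxt (a′ y)))
      rule′ y with V.cover y
      ... | inj₁ (z , refl) rewrite V.kι z = rule-ι z (k z) refl (sym (trans (cong L′ (V.sι z)) (L′ι _))) (E.L-rule z)
      ... | inj₂ (j , refl) rewrite V.kv j =
        subst (Rule (pattern′ A j) (a′ (v j)) (v j) (B +ᶻ offset A j)) (sym (trans (cong L′ (V.sv j)) (L′v (rot j))))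
          (offset-rule B A (a′ ∘ v) v (subst (Fin._< v 0F) (sym a′v₀) (proj₁ (V.order h<ah)))
            (subst (v (exit A) Fin.<_) (sym V.a-exit) (proj₂ (V.order h<ah))) j)

      B-exit : B +ᶻ offset A (exit A) ≡ L (nxt h)
      B-exit rewrite offset-exit A = lem (L (nxt h)) (+ 1 +ᶻ dispA A)
        where
        lem : ∀ l c → l +ᶻ ℤ.- c +ᶻ c ≡ l
        lem = ℤRing.solve-∀

      edge′ : ∀ y → k′ y ≡ edge → y Fin.< a′ y → (Σ[ z ∈ HE S ] (First S z × y ≡ ι (e z))) ⊎ L′ y ≡ L′ (nxt y)
      edge′ y ke lt with V.cover y
      edge′ _ ke lt | inj₁ (z , refl) with old z
      ... | entry refl = inj₁ (x , x-first , refl)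
      ... | back refl = ⊥-elim (ℕₚ.<-asym lt (subst (Fin._< ι (a h)) (sym a′ah) (proj₂ (V.order h<ah))))
      ... | other ne ne′ with E.L-edge z (trans (sym (V.kι z)) ke) (raise⁻ z lt)
      ... | inj₁ (x₂ , f , q) = inj₁ (x₂ , f , cong ι q)
      ... | inj₂ q = inj₂ (trans q (sym (trans (cong L′ (nxt-ι z ne ne′)) (L′ι (nxt z)))))
      edge′ _ ke lt | inj₂ (j , refl) with edge-positions A j (trans (sym (V.kv j)) ke)
      ... | inj₁ refl = ⊥-elim (ℕₚ.<-asym lt (subst (Fin._< v 0F) (sym a′v₀) (proj₁ (V.order h<ah))))
      ... | inj₂ refl = inj₂ (trans B-exit (sym (trans (cong L′ nx) (L′ι (nxt h)))))
        where
        nx : nxt (v (exit A)) ≡ ι (nxt h)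
        nx = trans (cong nxt (sym a′ah)) (trans (V.sι (a h)) (cong (ι ∘ nxt) (E.inv h)))

      gap′ : ∀ y → First S y → L₀ (next S y) ≡ L′ (nxt (ι (e y))) +ᶻ disp (d′ y)
      gap′ y f with y Fin.≟ x
      ... | yes refl = begin
        L₀ (next S y)                                   ≡⟨ E.L-gap y f ⟩
        L (nxt h) +ᶻ disp (d y)                         ≡⟨ lem (L (nxt h)) (dispA A) (disp (d y)) ⟩
        (B +ᶻ + 1) +ᶻ disp (A ∷ d y)                     ≡⟨ cong₂ _+ᶻ_ (trans (cong (B +ᶻ_) (sym (offset-1 A))) (sym (L′v 1F))) (cong disp (sym d′-x)) ⟩
        L′ (v 1F) +ᶻ disp (d′ y)                         ≡⟨ cong (λ z → L′ z +ᶻ disp (d′ y)) (sym (trans (cong nxt (sym a′v₀)) (V.sv 0F))) ⟩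
        L′ (nxt (ι h)) +ᶻ disp (d′ y) ∎
        where
        open ≡-Reasoning
        lem : ∀ l c w → l +ᶻ w ≡ l +ᶻ ℤ.- (+ 1 +ᶻ c) +ᶻ + 1 +ᶻ (c +ᶻ w)
        lem = ℤRing.solve-∀
      ... | no ne = trans (E.L-gap y f) (cong₂ _+ᶻ_
          (sym (trans (cong L′ (nxt-ι (e y) ne₁ ne₂)) (L′ι (nxt (e y))))) (cong disp (sym (d′-y y ne))))
        where
        ne₁ : e y ≢ h
        ne₁ q with ℕₚ.<-cmp (toℕ y) (toℕ x)
        ... | tri< p _ _ = ℕₚ.<-irrefl (cong toℕ q) (E.e-mono p)
        ... | tri≈ _ p _ = ne (Finₚ.toℕ-injective p)
        ... | tri> _ _ p = ℕₚ.<-irrefl (cong toℕ (sym q)) (E.e-mono p)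
        ne₂ : e y ≢ a h
        ne₂ q = ℕₚ.<-asym h<ah (subst₂ Fin._<_ q (trans (cong a q) (E.inv h)) (E.e-first y f))

      cover′ : ∀ y → (Σ[ z ∈ HE S ] y ≡ ι (e z)) ⊎ W′.OnPath y
      cover′ y with V.cover y
      ... | inj₂ (j , refl) = inj₂ (v 0F , A , j , sym (turn-v j) , (λ i → trans (cong k′ (turn-v i)) (V.kv i))
            , trans (cong (nxt ∘ a′) (turn-v 3F)) (V.sv 3F)
            , (λ i i′ q → V.v-inj i i′ (trans (sym (turn-v i)) (trans q (turn-v i′)))))
      ... | inj₁ (z , refl) with E.cover z
      ... | inj₁ (z₂ , q) = inj₁ (z₂ , cong ι q)
      ... | inj₂ (b , A₂ , j , q , pat , loop , dist) = inj₂ (ι b , A₂ , j , trans (cong ι q) (sym (turn-ι j b))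
            , (λ i → trans (cong k′ (turn-ι i b)) (trans (V.kι _) (pat i)))
            , trans (cong (nxt ∘ a′) (turn-ι 3F b)) (trans (V.sι (turn 3F b)) (cong ι loop))
            , (λ i i′ q → dist i i′ (ι-inj (trans (sym (turn-ι i b)) (trans q (turn-ι i′ b))))))

      piece-a′ : ∀ y → piece′ (a′ y) ≡ piece′ y
      piece-a′ y = go y (V.cover y)
        where
        go : ∀ y → (Σ[ x ∈ Fin (suc m) ] y ≡ ι x) ⊎ (Σ[ j ∈ Fin 4 ] y ≡ v j) → piece′ (a′ y) ≡ piece′ y
        go y (inj₁ (z , refl)) with old z
        ... | entry refl = trans (cong piece′ V.a-entry) (trans (piece′v 0F (exit≢0 A ∘ sym)) (sym piece′h))
        ... | back refl = trans (cong piece′ a′ah) (trans piece′exit (sym (trans (piece′-old (a h) ah≢h) (trans (E.piece-a h) piece-h))))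
        ... | other ne ne′ = trans (cong piece′ (V.a-old z ne ne′)) (trans (piece′-old (a z) (λ p → ne′ (trans (sym (E.inv z)) (cong a p))))
              (trans (E.piece-a z) (sym (piece′-old z ne))))
        go y (inj₂ (j , refl)) with edge? (pattern′ A j)
        ... | no ne = cong piece′ (V.a-stem j ne)
        ... | yes p with edge-positions A j p
        ... | inj₁ refl = trans (cong piece′ a′v₀) (trans piece′h (sym (piece′v 0F (exit≢0 A ∘ sym))))
        ... | inj₂ refl = trans (cong piece′ V.a-exit) (trans (piece′-old (a h) ah≢h) (trans (trans (E.piece-a h) piece-h) (sym piece′exit)))

      a-edge′ : ∀ y → k′ y ≡ edge → a′ y ≢ y
      a-edge′ y ke q with V.cover y
      a-edge′ _ ke q | inj₁ (z , refl) with old z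
      ... | entry refl = V.ι≢v h 0F (trans (sym q) V.a-entry)
      ... | back refl = V.ι≢v (a h) (exit A) (trans (sym q) a′ah)
      ... | other ne ne′ = E.a-edge z (trans (sym (V.kι z)) ke) (ι-inj (trans (sym (V.a-old z ne ne′)) q))
      a-edge′ _ ke q | inj₂ (j , refl) with edge-positions A j (trans (sym (V.kv j)) ke)
      ... | inj₁ refl = V.ι≢v h 0F (trans (sym a′v₀) q)
      ... | inj₂ refl = V.ι≢v (a h) (exit A) (trans (sym V.a-exit) q)

      a-stem′ : ∀ y → k′ y ≢ edge → a′ y ≡ y
      a-stem′ y ke with V.cover y
      ... | inj₂ (j , refl) = V.a-stem j (ke ∘ trans (V.kv j))
      ... | inj₁ (z , refl) with old z
      ... | entry refl = ⊥-elim (ke (trans (V.kι h) (trans (E.e-κ x) (proj₁ x-first))))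
      ... | back refl = ⊥-elim (ke (trans (V.kι (a h)) kah))
        where
        kah : k (a h) ≡ edge
        kah with edge? (k (a h))
        ... | yes p = p
        ... | no ne = ⊥-elim (ah≢h (sym (trans (sym (E.inv h)) (E.a-stem (a h) ne))))
      ... | other ne ne′ = trans (V.a-old z ne ne′) (cong ι (E.a-stem z (λ p → ke (trans (V.kι z) p))))

    lengthen : Expanded d′
    lengthen = record
      { m = m′ ; a = a′ ; k = k′ ; e = ι ∘ e ; L = L′ ; piece = piece′
      ; inv = V.inv′ ; a-edge = a-edge′ ; a-stem = a-stem′
      ; e-mono = λ lt → V.ι-mono (E.e-mono lt)
      ; e-zero = trans (cong ι E.e-zero) V.ι-zero
      ; e-κ = λ y → trans (V.kι (e y)) (E.e-κ y)
      ; e-σ = λ y → trans (V.sι (e y)) (cong ι (E.e-σ y))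
      ; e-first = λ y f → raise (e y) (E.e-first y f)
      ; cover = cover′
      ; piece-a = piece-a′
      ; walk = walk′
      ; L-e = λ y → trans (L′ι (e y)) (E.L-e y)
      ; L-rule = rule′
      ; L-edge = edge′
      ; L-gap = gap′
      ; leaves′ = trans V.leaves′ (trans (cong suc E.leaves′) (trans (sym (ℕₚ.+-suc _ _)) (cong (λ z → leafTotal (κ S) + z)
          (sym (sum-update (length ∘ d) (length ∘ d′) x (cong length d′-x) (λ y ne → cong length (d′-y y ne))))))) }
      where
      walk′ : ∀ y → First S y → W′.Walk piece′ y (ι (e y)) (d′ y) (ι (e (α S y)))
      walk′ y f with y Fin.≟ x
      ... | yes refl = subst (λ w → W′.Walk piece′ y (ι (e y)) w (ι (e (α S y)))) (sym d′-x) (walk-x (d y) refl (E.walk y f))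
      ... | no ne = subst (λ w → W′.Walk piece′ y (ι (e y)) w (ι (e (α S y)))) (sym (d′-y y ne)) (walk-ι (d y) (inj₁ ne) (E.walk y f))

  Expanded-cong : ∀ {d d′} → (∀ y → d′ y ≡ d y) → Expanded d → Expanded d′
  Expanded-cong {d} {d′} q E = record
    { m = m ; a = a ; k = k ; e = e ; L = L ; piece = piece ; inv = inv ; a-edge = a-edge ; a-stem = a-stem
    ; e-mono = e-mono ; e-zero = e-zero ; e-κ = e-κ ; e-σ = e-σ ; e-first = e-first ; cover = cover
    ; piece-a = piece-a
    ; walk = λ x f → subst (λ w → Walk piece x (e x) w (e (α S x))) (sym (q x)) (walk x f)
    ; L-e = L-e ; L-rule = L-rule ; L-edge = L-edge
    ; L-gap = λ x f → trans (L-gap x f) (cong (λ w → L (nxt (e x)) +ᶻ disp w) (sym (q x)))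
    ; leaves′ = trans leaves′ (cong (λ z → leafTotal (κ S) + z) (sum-cong-≗ (λ y → cong length (sym (q y))))) }
    where open Expanded E

  masked : (HE S → List Arr) → HE S → List Arr
  masked d x = if does (first? S x) then d x else []

  masked-first : ∀ d x → First S x → masked d x ≡ d x
  masked-first d x f = cong (if_then d x else []) (dec-true (first? S x) f)

  masked-other : ∀ d x → ¬ First S x → masked d x ≡ []
  masked-other d x nf = cong (if_then d x else []) (dec-false (first? S x) nf)

  private
    upTo′ : (HE S → List Arr) → ℕ → HE S → List Arr
    upTo′ d i x = if does (toℕ x ℕ.<? i) then d x else []

    upTo-in : ∀ d i x → toℕ x < i → upTo′ d i x ≡ d x
    upTo-in d i x lt = cong (if_then d x else []) (dec-true (toℕ x ℕ.<? i) lt)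

    upTo-out : ∀ d i x → ¬ (toℕ x < i) → upTo′ d i x ≡ []
    upTo-out d i x nlt = cong (if_then d x else []) (dec-false (toℕ x ℕ.<? i) nlt)

    override : HE S → List Arr → (HE S → List Arr) → HE S → List Arr
    override x w d y = if does (y Fin.≟ x) then w else d y

    override-at : ∀ x w d → override x w d x ≡ w
    override-at x w d = cong (if_then w else d x) (dec-true (x Fin.≟ x) refl)

    override-off : ∀ x w d y → y ≢ x → override x w d y ≡ d y
    override-off x w d y ne = cong (if_then w else d y) (dec-false (y Fin.≟ x) ne)

    -- A new vertex always goes on the first edge of the path, so a word is inserted from its last
    -- arrangement to its first.
    addWord : ∀ {d} x → First S x → d x ≡ [] → Expanded d → ∀ w → Expanded (override x w d)
    addWord {d} x f q E [] = Expanded-cong eq E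
      where
      eq : ∀ y → override x [] d y ≡ d y
      eq y with y Fin.≟ x
      ... | yes refl = sym q
      ... | no _ = refl
    addWord {d} x f q E (A ∷ w) = lengthen (addWord x f q E w) x f A
      (trans (override-at x (A ∷ w) d) (cong (A ∷_) (sym (override-at x w d))))
      (λ y ne → trans (override-off x (A ∷ w) d y ne) (sym (override-off x w d y ne)))

    partial : ∀ d i → i ≤ suc (BMap.m S) → Expanded (upTo′ (masked d) i)
    partial d zero    le = Expanded-cong (λ y → upTo-out (masked d) 0 y (λ ())) unexpanded
    partial d (suc i) le = fill (first? S x)
      where
      x : HE S
      x = fromℕ< le
      toℕ-x : toℕ x ≡ i
      toℕ-x = Finₚ.toℕ-fromℕ< le
      E : Expanded (upTo′ (masked d) i)
      E = partial d i (ℕₚ.<⇒≤ le)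
      x-out : upTo′ (masked d) i x ≡ []
      x-out = upTo-out (masked d) i x (ℕₚ.<-irrefl (toℕ-x))
      same : ∀ y → y ≢ x → upTo′ (masked d) (suc i) y ≡ upTo′ (masked d) i y
      same y ne with toℕ y ℕ.<? i
      ... | yes lt = trans (upTo-in (masked d) (suc i) y (ℕₚ.m≤n⇒m≤1+n lt)) (sym (upTo-in (masked d) i y lt))
      ... | no nlt = trans (upTo-out (masked d) (suc i) y (λ lt → nlt (ℕₚ.≤∧≢⇒< (ℕₚ.≤-pred lt) (λ e → ne (Finₚ.toℕ-injective (trans e (sym toℕ-x))))))) (sym (upTo-out (masked d) i y nlt))
      at-x : upTo′ (masked d) (suc i) x ≡ masked d x
      at-x = upTo-in (masked d) (suc i) x (s≤s (ℕₚ.≤-reflexive toℕ-x))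
      fill : Dec (First S x) → Expanded (upTo′ (masked d) (suc i))
      fill (yes f) = Expanded-cong eq (addWord x f x-out E (d x))
        where
        eq : ∀ y → upTo′ (masked d) (suc i) y ≡ override x (d x) (upTo′ (masked d) i) y
        eq y with y Fin.≟ x
        ... | yes refl = trans at-x (masked-first d x f)
        ... | no ne = same y ne
      fill (no nf) = Expanded-cong eq E
        where
        eq : ∀ y → upTo′ (masked d) (suc i) y ≡ upTo′ (masked d) i y
        eq y with y Fin.≟ x
        ... | yes refl = trans at-x (trans (masked-other d x nf) (sym x-out))
        ... | no ne = same y ne

  -- Only the invariant is used from here on, so the construction is kept from unfolding in later
  -- types.
  abstract
    expand : ∀ d → Expanded (masked d)
    expand d = Expanded-cong (λ y → sym (upTo-in (masked d) _ y (Finₚ.toℕ<n y))) (partial d (suc (BMap.m S)) ℕₚ.≤-refl)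

-- Uniqueness of the expansion

-- The interior degree unfolded into its four summands, for arbitrary rotation and kinds; for those
-- of a map it agrees with `intDeg` by computation.
degree : ∀ {m} → (Fin (suc m) → Fin (suc m)) → (Fin (suc m) → Kind) → Fin (suc m) → ℕ
degree s k y = edgeInd (k y) + (edgeInd (k (s y)) + (edgeInd (k (s (s y))) + (edgeInd (k (s (s (s y)))) + 0)))

degree-s : ∀ {m} (s : Fin (suc m) → Fin (suc m)) k y → s (s (s (s y))) ≡ y → degree s k (s y) ≡ degree s k y
degree-s s k y e = trans (cong (λ z → edgeInd (k (s y)) + (edgeInd (k (s (s y))) + (edgeInd (k (s (s (s y)))) + (edgeInd (k z) + 0)))) e)
  (lem (edgeInd (k y)) (edgeInd (k (s y))) (edgeInd (k (s (s y)))) (edgeInd (k (s (s (s y))))))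
  where
  lem : ∀ a b c d → b + (c + (d + (a + 0))) ≡ a + (b + (c + (d + 0)))
  lem = ℕRing.solve-∀

pattern-degree : ∀ A → edgeInd (pattern′ A 0F) + (edgeInd (pattern′ A 1F) + (edgeInd (pattern′ A 2F) + (edgeInd (pattern′ A 3F) + 0))) ≡ 2
pattern-degree (before , true)  = refl
pattern-degree (before , false) = refl
pattern-degree (across , true)  = refl
pattern-degree (across , false) = refl
pattern-degree (after , true)   = refl
pattern-degree (after , false)  = refl

pattern-injective : ∀ A A′ → (∀ j → pattern′ A j ≡ pattern′ A′ j) → A ≡ A′
pattern-injective A A′ e = trans (sym (decode-pattern A)) (trans (decode-cong (e 1F) (e 2F)) (decode-pattern A′))
  where
  -- The kinds at positions 1 and 2 already determine the arrangement. The pairs of equal kinds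
  -- occur in no pattern and receive an arbitrary value.
  decode : Kind → Kind → Arr
  decode leaf bud  = before , true
  decode bud  leaf = before , false
  decode leaf edge = across , true
  decode bud  edge = across , false
  decode edge leaf = after , true
  decode edge bud  = after , false
  decode edge edge = after , false
  decode leaf leaf = after , false
  decode bud bud   = after , false
  decode-pattern : ∀ A → decode (pattern′ A 1F) (pattern′ A 2F) ≡ A
  decode-pattern (before , true)  = refl
  decode-pattern (before , false) = refl
  decode-pattern (across , true)  = refl
  decode-pattern (across , false) = refl
  decode-pattern (after , true)   = refl
  decode-pattern (after , false)  = refl
  decode-cong : ∀ {a a′ b b′} → a ≡ a′ → b ≡ b′ → decode a b ≡ decode a′ b′
  decode-cong = cong₂ decode

module Paths {m : ℕ} (a : Fin (suc m) → Fin (suc m)) (k : Fin (suc m) → Kind) where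
  open Walking a k using (turn; Pattern) public

  s : Fin (suc m) → Fin (suc m)
  s y = nxt (a y)

  Vertex : Arr → Fin (suc m) → Set
  Vertex A b = Pattern A b × s (turn 3F b) ≡ b

  Path : Fin (suc m) → List Arr → Fin (suc m) → Set
  Path h []      t = a h ≡ t
  Path h (A ∷ w) t = Vertex A (a h) × Path (turn (exit A) (a h)) w t

  degree-turn : ∀ b → s (turn 3F b) ≡ b → ∀ j → degree s k (turn j b) ≡ degree s k b
  degree-turn b e 0F = refl
  degree-turn b e 1F = degree-s s k b e
  degree-turn b e 2F = trans (degree-s s k (s b) (cong s e)) (degree-s s k b e)
  degree-turn b e 3F = trans (degree-s s k (s (s b)) (cong (s ∘ s) e)) (trans (degree-s s k (s b) (cong s e)) (degree-s s k b e))

  degree-vertex : ∀ {A b} → Vertex A b → ∀ j → degree s k (turn j b) ≡ 2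
  degree-vertex {A} {b} (pat , e) j = trans (degree-turn b e j)
    (trans (cong₂ _+_ (cong edgeInd (pat 0F)) (cong₂ _+_ (cong edgeInd (pat 1F)) (cong₂ _+_ (cong edgeInd (pat 2F))
      (cong₂ _+_ (cong edgeInd (pat 3F)) refl)))) (pattern-degree A))

  -- The start of a path determines its first vertex, whose kinds determine the arrangement and the
  -- exit. The two words also stop together, since an end has interior degree at least 3 and a path
  -- vertex exactly 2.
  path-unique : ∀ w w′ {h t t′} → 3 ≤ degree s k t → 3 ≤ degree s k t′ → Path h w t → Path h w′ t′ → w ≡ w′
  path-unique []      []        d d′ p p′ = refl
  path-unique []      (A ∷ w′)  d d′ refl (v , p′) = ⊥-elim (ℕₚ.<-irrefl (sym (degree-vertex v 0F)) d)
  path-unique (A ∷ w) []        d d′ (v , p) refl = ⊥-elim (ℕₚ.<-irrefl (sym (degree-vertex v 0F)) d′)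
  path-unique (A ∷ w) (A′ ∷ w′) d d′ (v , p) (v′ , p′)
    with pattern-injective A A′ (λ j → trans (sym (proj₁ v j)) (proj₁ v′ j))
  ... | refl = cong (A ∷_) (path-unique w w′ d d′ p p′)

record Model (S : BMap) (d : HE S → List Arr) {m : ℕ} (a : Fin (suc m) → Fin (suc m)) (k : Fin (suc m) → Kind)
             (e : HE S → Fin (suc m)) : Set where
  open Paths a k
  field
    inv    : ∀ y → a (a y) ≡ y
    a-stem : ∀ y → k y ≢ edge → a y ≡ y
    e-zero : e zero ≡ zero
    e-inj  : ∀ {x y} → e x ≡ e y → x ≡ y
    e-κ    : ∀ x → k (e x) ≡ κ S x
    e-σ    : ∀ x → s (e x) ≡ e (σ S x)
    path   : ∀ x → First S x → Path (e x) (d x) (e (α S x))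

  degree-e : ∀ x → degree s k (e x) ≡ intDeg S x
  degree-e x = cong₂ _+_ (c x) (cong₂ _+_ (trans (cong (edgeInd ∘ k) (e-σ x)) (c (σ S x)))
    (cong₂ _+_ (trans (cong (edgeInd ∘ k) (trans (cong s (e-σ x)) (e-σ _))) (c (σ S (σ S x))))
    (cong (_+ 0) (trans (cong (edgeInd ∘ k) (trans (cong s (trans (cong s (e-σ x)) (e-σ _))) (e-σ _))) (c (σ S (σ S (σ S x))))))))
    where
    c : ∀ x → edgeInd (k (e x)) ≡ edgeInd (κ S x)
    c x = cong edgeInd (e-κ x)

iter-nxt : ∀ {m} i → i ≤ m → toℕ (iter (nxt {m}) i zero) ≡ i
iter-nxt zero    le = refl
iter-nxt {m} (suc i) le = trans (toℕ-nxt _ (subst (_< m) (sym IH) le)) (cong suc IH)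
  where
  IH : toℕ (iter (nxt {m}) i zero) ≡ i
  IH = iter-nxt i (ℕₚ.<⇒≤ le)

iter-nxt-full : ∀ {m} → iter (nxt {m}) (suc m) zero ≡ zero
iter-nxt-full {m} = nxt-last _ (iter-nxt m ℕₚ.≤-refl)

iter-+ : {A : Set} (f : A → A) → ∀ i j x → iter f i (iter f j x) ≡ iter f (i + j) x
iter-+ f zero    j x = refl
iter-+ f (suc i) j x = cong f (iter-+ f i j x)

iter-nxt-toℕ : ∀ {m} (y : Fin (suc m)) → iter nxt (toℕ y) zero ≡ y
iter-nxt-toℕ y = Finₚ.toℕ-injective (iter-nxt (toℕ y) (Finₚ.toℕ≤pred[n] y))

iter-nxt-return : ∀ {m} (y : Fin (suc m)) → iter nxt (suc m ∸ toℕ y) y ≡ zero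
iter-nxt-return {m} y = begin
  iter nxt (suc m ∸ toℕ y) y                          ≡⟨ cong (iter nxt (suc m ∸ toℕ y)) (iter-nxt-toℕ y) ⟨
  iter nxt (suc m ∸ toℕ y) (iter nxt (toℕ y) zero)    ≡⟨ iter-+ nxt (suc m ∸ toℕ y) (toℕ y) zero ⟩
  iter nxt (suc m ∸ toℕ y + toℕ y) zero               ≡⟨ cong (λ i → iter nxt i zero) (ℕₚ.m∸n+n≡m (ℕₚ.<⇒≤ (Finₚ.toℕ<n y))) ⟩
  iter nxt (suc m) zero                               ≡⟨ iter-nxt-full ⟩
  zero ∎
  where open ≡-Reasoning

iter-nxt-injective : ∀ {m} i {x y : Fin (suc m)} → iter nxt i x ≡ iter nxt i y → x ≡ y
iter-nxt-injective zero    e = e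
iter-nxt-injective (suc i) e = iter-nxt-injective i (nxt-injective e)

-- A map is determined by the words along the edges of its scheme: Sim matches half-edges of two maps with the
-- same words, and following the contours from the roots shows that it is the identity.
module Rigidity (S : BMap) (valid : Valid S) (deg : ∀ x → 3 ≤ intDeg S x) (d : HE S → List Arr)
  {m : ℕ} {a : Fin (suc m) → Fin (suc m)} {k : Fin (suc m) → Kind} {e : HE S → Fin (suc m)}
  {m′ : ℕ} {a′ : Fin (suc m′) → Fin (suc m′)} {k′ : Fin (suc m′) → Kind} {e′ : HE S → Fin (suc m′)}
  (M : Model S d a k e) (M′ : Model S d a′ k′ e′) where

  private
    module M = Model M
    module M′ = Model M′
    open Paths a k
    module P′ = Paths a′ k′

    -- Corresponding half-edges `f`, `f′` reached on the path of `x` in the two maps, with the word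
    -- still ahead of them.
    data Fwd (x : HE S) : Fin (suc m) → Fin (suc m′) → List Arr → Set where
      begins : First S x → Fwd x (e x) (e′ x) (d x)
      goes   : ∀ {f f′ A w} → Fwd x f f′ (A ∷ w) → Fwd x (turn (exit A) (a f)) (P′.turn (exit A) (a′ f′)) w

    data Sim : Fin (suc m) → Fin (suc m′) → Set where
      onScheme : ∀ x → Sim (e x) (e′ x)
      onPath   : ∀ {x f f′ A w} → Fwd x f f′ (A ∷ w) → ∀ j → Sim (turn j (a f)) (P′.turn j (a′ f′))

    fwdPath : ∀ {x f f′ w} → Fwd x f f′ w → Path f w (e (α S x)) × P′.Path f′ w (e′ (α S x))
    fwdPath {x} (begins i) = M.path x i , M′.path x i
    fwdPath (goes F) = let (_ , p) , (_ , p′) = fwdPath F in p , p′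

    fwdVertex : ∀ {x f f′ A w} → Fwd x f f′ (A ∷ w) → Vertex A (a f) × P′.Vertex A (a′ f′)
    fwdVertex F = let (v , _) , (v′ , _) = fwdPath F in v , v′

    fwdEnd : ∀ w {x f f′} → Fwd x f f′ w → Σ[ g ∈ _ ] Σ[ g′ ∈ _ ] Fwd x g g′ []
    fwdEnd []      F = _ , _ , F
    fwdEnd (A ∷ w) F = fwdEnd w (goes F)

    fwdSim : ∀ {x f f′ w} → Fwd x f f′ w → Sim f f′
    fwdSim (begins _) = onScheme _
    fwdSim (goes {A = A} F) = onPath F (exit A)

    arrive : ∀ w {x f f′} → Fwd x f f′ w → Sim (a f) (a′ f′)
    arrive []      {x} F = let p , p′ = fwdPath F in subst₂ Sim (sym p) (sym p′) (onScheme (α S x))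
    arrive (A ∷ w) F = onPath F 0F

    sim-κ : ∀ {y y′} → Sim y y′ → k y ≡ k′ y′
    sim-κ (onScheme x) = trans (M.e-κ x) (sym (M′.e-κ x))
    sim-κ (onPath F j) = let v , v′ = fwdVertex F in trans (proj₁ v j) (sym (proj₁ v′ j))

    α-edge : ∀ x → κ S x ≡ edge → κ S (α S x) ≡ edge
    α-edge x κe with edge? (κ S (α S x))
    ... | yes p = p
    ... | no ne = ⊥-elim (proj₁ (proj₂ valid) x κe (trans (sym (proj₁ (proj₂ (proj₂ valid)) (α S x) ne)) (proj₁ valid x)))

    sim-a : ∀ {y y′} → Sim y y′ → Sim (a y) (a′ y′)
    sim-a (onScheme x) with edge? (κ S x)
    ... | no ne = subst₂ Sim (sym (M.a-stem (e x) (ne ∘ trans (sym (M.e-κ x))))) (sym (M′.a-stem (e′ x) (ne ∘ trans (sym (M′.e-κ x))))) (onScheme x)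
    ... | yes κe with ℕₚ.<-cmp (toℕ x) (toℕ (α S x))
    ... | tri< lt _ _ = arrive (d x) (begins (κe , lt))
    ... | tri≈ _ q _ = ⊥-elim (proj₁ (proj₂ valid) x κe (sym (Finₚ.toℕ-injective q)))
    -- Here `x` is the second half of its edge, so its path is followed from `α S x` to the end: the
    -- last forward half-edges in the two maps are the partners of `e x` and `e′ x`.
    ... | tri> _ _ gt with fwdEnd (d (α S x)) (begins (α-edge x κe , subst (α S x Fin.<_) (sym (proj₁ valid x)) gt))
    ... | g , g′ , F = subst₂ Sim
        (trans (sym (M.inv g)) (cong a (trans (proj₁ (fwdPath F)) (cong e (proj₁ valid x)))))
        (trans (sym (M′.inv g′)) (cong a′ (trans (proj₂ (fwdPath F)) (cong e′ (proj₁ valid x))))) (fwdSim F)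
    sim-a (onPath {A = A} F j) with edge? (pattern′ A j)
    ... | no ne = let v , v′ = fwdVertex F in
        subst₂ Sim (sym (M.a-stem _ (ne ∘ trans (sym (proj₁ v j))))) (sym (M′.a-stem _ (ne ∘ trans (sym (proj₁ v′ j))))) (onPath F j)
    ... | yes p with edge-positions A j p
    ... | inj₁ refl = subst₂ Sim (sym (M.inv _)) (sym (M′.inv _)) (fwdSim F)
    ... | inj₂ refl = arrive _ (goes F)

    sim-s : ∀ {y y′} → Sim y y′ → Sim (nxt (a y)) (nxt (a′ y′))
    sim-s (onScheme x) = subst₂ Sim (sym (M.e-σ x)) (sym (M′.e-σ x)) (onScheme (σ S x))
    sim-s (onPath F 0F) = onPath F 1F
    sim-s (onPath F 1F) = onPath F 2F
    sim-s (onPath F 2F) = onPath F 3F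
    sim-s (onPath F 3F) = let v , v′ = fwdVertex F in subst₂ Sim (sym (proj₂ v)) (sym (proj₂ v′)) (onPath F 0F)

    sim-nxt : ∀ {y y′} → Sim y y′ → Sim (nxt y) (nxt y′)
    sim-nxt {y} {y′} R = subst₂ Sim (cong nxt (M.inv y)) (cong nxt (M′.inv y′)) (sim-s (sim-a R))

    sim-iter : ∀ i {y y′} → Sim y y′ → Sim (iter nxt i y) (iter nxt i y′)
    sim-iter zero    R = R
    sim-iter (suc i) R = sim-nxt (sim-iter i R)

    -- The root lies at a scheme vertex, and half-edges of path vertices have interior degree 2, so
    -- the root is matched with nothing but the root.
    sim-zero : ∀ {y y′} → Sim y y′ → (y ≡ zero → y′ ≡ zero) × (y′ ≡ zero → y ≡ zero)
    sim-zero (onScheme x) = (λ q → trans (cong e′ (M.e-inj (trans q (sym M.e-zero)))) M′.e-zero)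
                          , (λ q → trans (cong e (M′.e-inj (trans q (sym M′.e-zero)))) M.e-zero)
    sim-zero (onPath F j) = let v , v′ = fwdVertex F in
        (λ q → ⊥-elim (ℕₚ.<⇒≢ (deg zero) (trans (sym (degree-vertex v j)) (trans (cong (degree s k) (trans q (sym M.e-zero))) (M.degree-e zero)))))
      , (λ q → ⊥-elim (ℕₚ.<⇒≢ (deg zero) (trans (sym (P′.degree-vertex v′ j)) (trans (cong (degree P′.s k′) (trans q (sym M′.e-zero))) (M′.degree-e zero)))))

    sim-start : ∀ i → Sim (iter nxt i zero) (iter nxt i zero)
    sim-start i = sim-iter i (subst₂ Sim M.e-zero M′.e-zero (onScheme zero))

  -- When the shorter contour returns to its root, the matched half-edge of the longer one would be
  -- a root too, although that contour has not yet closed.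
  size : m ≡ m′
  size with ℕₚ.<-cmp m m′
  ... | tri≈ _ q _ = q
  ... | tri< lt _ _ with () ← trans (sym (cong toℕ (proj₁ (sim-zero (sim-start (suc m))) iter-nxt-full))) (iter-nxt (suc m) lt)
  ... | tri> _ _ gt with () ← trans (sym (cong toℕ (proj₂ (sim-zero (sim-start (suc m′))) iter-nxt-full))) (iter-nxt (suc m′) gt)

  matches : (q : m ≡ m′) → (∀ y → a′ (subst (Fin ∘ suc) q y) ≡ subst (Fin ∘ suc) q (a y)) × (∀ y → k′ (subst (Fin ∘ suc) q y) ≡ k y)
  matches refl = (λ y → sym (same (sim-a (diag y)))) , (λ y → sym (sim-κ (diag y)))
    where
    -- The contour leads from `y` to the root in `suc m ∸ toℕ y` steps. The partner arrives there
    -- after equally many, and steps of the contour are injective.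
    same : ∀ {y y′} → Sim y y′ → y ≡ y′
    same {y} {y′} R = iter-nxt-injective (suc m ∸ toℕ y)
      (trans (iter-nxt-return y) (sym (proj₁ (sim-zero (sim-iter (suc m ∸ toℕ y) R)) (iter-nxt-return y))))
    diag : ∀ y → Sim y y
    diag y = subst₂ Sim (iter-nxt-toℕ y) (iter-nxt-toℕ y) (sim-start (toℕ y))

  same-map : bmap m (tabulate a) (tabulate k) ≡ bmap m′ (tabulate a′) (tabulate k′)
  same-map = go size
    where
    go : m ≡ m′ → bmap m (tabulate a) (tabulate k) ≡ bmap m′ (tabulate a′) (tabulate k′)
    go q with matches q
    go refl | qa , qk = cong₂ (bmap m) (Vecₚ.tabulate-cong (sym ∘ qa)) (Vecₚ.tabulate-cong (sym ∘ qk))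

-- Both embeddings have the same image, and by induction they agree below `x`; hence neither value
-- at `x` can be the other's value at an earlier argument, and monotonicity gives both inequalities.
-- A map thus contains its scheme in only one way.
strictly-monotone-unique : ∀ {n m} (e e′ : Fin n → Fin m) → (∀ {x y} → x Fin.< y → e x Fin.< e y) →
  (∀ {x y} → x Fin.< y → e′ x Fin.< e′ y) → (∀ x → Σ[ y ∈ Fin n ] e′ y ≡ e x) → (∀ x → Σ[ y ∈ Fin n ] e y ≡ e′ x) → ∀ x → e x ≡ e′ x
strictly-monotone-unique {n} e e′ mono mono′ im im′ x = go (suc (toℕ x)) x ℕₚ.≤-refl
  where
  go : ∀ i x → toℕ x < i → e x ≡ e′ x
  go (suc i) x (s≤s le) = Finₚ.toℕ-injective (ℕₚ.≤-antisym (below (im′ x)) (above (im x)))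
    where
    inj< : ∀ {f : Fin n → Fin _} → (∀ {x y} → x Fin.< y → f x Fin.< f y) → ∀ {x y} → ¬ (y Fin.< x) → f x Fin.≤ f y
    inj< {f} mn {x} {y} nlt with toℕ x ℕ.≟ toℕ y
    ... | yes q = ℕₚ.≤-reflexive (cong (toℕ ∘ f) (Finₚ.toℕ-injective q))
    ... | no ne = ℕₚ.<⇒≤ (mn (ℕₚ.≤∧≢⇒< (ℕₚ.≮⇒≥ nlt) ne))
    below : Σ[ y ∈ Fin n ] e y ≡ e′ x → e x Fin.≤ e′ x
    below (y , q) with y Fin.<? x
    ... | no nlt = subst (e x Fin.≤_) q (inj< {e} mono nlt)
    ... | yes lt = ⊥-elim (ℕₚ.<-irrefl (cong toℕ (trans (sym (go i y (ℕₚ.<-≤-trans lt le))) q)) (mono′ lt))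
    above : Σ[ y ∈ Fin n ] e′ y ≡ e x → e′ x Fin.≤ e x
    above (y , q) with y Fin.<? x
    ... | no nlt = subst (e′ x Fin.≤_) q (inj< {e′} mono′ nlt)
    ... | yes lt = ⊥-elim (ℕₚ.<-irrefl (cong toℕ (trans (go i y (ℕₚ.<-≤-trans lt le)) q)) (mono lt))

-- Reading the words off a map

shift≢ : ∀ i n → i ≢ i +ᶻ + suc n
shift≢ i n e with ℤ+.∙-cancelˡ i (+ 0) (+ suc n) (trans (ℤₚ.+-identityʳ i) e)
... | ()

module Reaching (M : BMap) (valid : Valid M) (four : FourValent M) where

  open Paths (α M) (κ M) public

  a : HE M → HE M
  a = α M

  k : HE M → Kind
  k = κ M

  deg : HE M → ℕ
  deg = degree s k

  inv : ∀ h → a (a h) ≡ h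
  inv = proj₁ valid

  a-edge : ∀ h → k h ≡ edge → k (a h) ≡ edge
  a-edge h κe with edge? (k (a h))
  ... | yes p = p
  ... | no ne = ⊥-elim (proj₁ (proj₂ valid) h κe (trans (sym (proj₁ (proj₂ (proj₂ valid)) (a h) ne)) (inv h)))

  loop : ∀ y → s (s (s (s y))) ≡ y
  loop y = proj₁ (four y)

  turn-distinct : ∀ y i → i ≢ 0F → turn i y ≢ y
  turn-distinct y 0F ne = ⊥-elim (ne refl)
  turn-distinct y 1F ne = proj₂ (four y) 1 (s≤s z≤n) (s≤s (s≤s z≤n))
  turn-distinct y 2F ne = proj₂ (four y) 2 (s≤s z≤n) (s≤s (s≤s (s≤s z≤n)))
  turn-distinct y 3F ne = proj₂ (four y) 3 (s≤s z≤n) (s≤s (s≤s (s≤s (s≤s z≤n))))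

  deg-iter : ∀ i y → deg (iter s i y) ≡ deg y
  deg-iter zero    y = refl
  deg-iter (suc i) y = trans (degree-s s k (iter s i y) (loop (iter s i y))) (deg-iter i y)

  sameVertex-turn : ∀ {x y} → SameVertex M x y → Σ[ j ∈ Fin 4 ] turn j x ≡ y
  sameVertex-turn (j , e) = go j e
    where
    go : ∀ j {x y} → iter s j x ≡ y → Σ[ i ∈ Fin 4 ] turn i x ≡ y
    go 0 e = 0F , e
    go 1 e = 1F , e
    go 2 e = 2F , e
    go 3 e = 3F , e
    go (suc (suc (suc (suc j)))) {x} e = go j (trans (sym (loop (iter s j x))) e)

  private
    too-many : ∀ x → suc (x + 2) ≢ 2
    too-many zero    ()
    too-many (suc x) e with () ← trans (ℕₚ.+-comm 2 x) (ℕₚ.suc-injective (ℕₚ.suc-injective e))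

  third-edge : ∀ b j i → j ≢ 0F → i ≢ 0F → i ≢ j → k b ≡ edge → k (turn j b) ≡ edge → deg b ≡ 2 → k (turn i b) ≢ edge
  third-edge b 0F i  j0 i0 ij p q d r = j0 refl
  third-edge b 1F 0F j0 i0 ij p q d r = i0 refl
  third-edge b 2F 0F j0 i0 ij p q d r = i0 refl
  third-edge b 3F 0F j0 i0 ij p q d r = i0 refl
  third-edge b 1F 1F j0 i0 ij p q d r = ij refl
  third-edge b 2F 2F j0 i0 ij p q d r = ij refl
  third-edge b 3F 3F j0 i0 ij p q d r = ij refl
  third-edge b 1F 2F j0 i0 ij p q d r with k b | k (s b) | k (s (s b))
  third-edge b 1F 2F j0 i0 ij refl refl () refl | _ | _ | _
  third-edge b 2F 1F j0 i0 ij p q d r with k b | k (s b) | k (s (s b))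
  third-edge b 2F 1F j0 i0 ij refl refl () refl | _ | _ | _
  third-edge b 1F 3F j0 i0 ij p q d r with k b | k (s b) | k (s (s (s b)))
  ... | edge | edge | edge with edgeInd (k (s (s b)))
  third-edge b 1F 3F j0 i0 ij refl refl () refl | edge | edge | edge | zero
  third-edge b 1F 3F j0 i0 ij refl refl () refl | edge | edge | edge | suc _
  third-edge b 3F 1F j0 i0 ij p q d r with k b | k (s b) | k (s (s (s b)))
  ... | edge | edge | edge with edgeInd (k (s (s b)))
  third-edge b 3F 1F j0 i0 ij refl refl () refl | edge | edge | edge | zero
  third-edge b 3F 1F j0 i0 ij refl refl () refl | edge | edge | edge | suc _
  third-edge b 2F 3F j0 i0 ij p q d r with k b | k (s (s b)) | k (s (s (s b)))
  ... | edge | edge | edge = too-many (edgeInd (k (s b))) d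
  third-edge b 3F 2F j0 i0 ij p q d r with k b | k (s (s b)) | k (s (s (s b)))
  ... | edge | edge | edge = too-many (edgeInd (k (s b))) d

  private
    2≱3 : ∀ {n} → n ≡ 2 → ¬ 3 ≤ n
    2≱3 refl (s≤s (s≤s ()))

  reach-unique : ∀ {h h₁ h₂} → k h ≡ edge → Reach M h h₁ → Reach M h h₂ → h₁ ≡ h₂
  reach-unique ke (stop _) (stop _) = refl
  reach-unique ke (stop d) (step d′ _ _ _ _) = ⊥-elim (2≱3 d′ d)
  reach-unique ke (step d′ _ _ _ _) (stop d) = ⊥-elim (2≱3 d′ d)
  reach-unique {h} ke (step d sv ne ze r) (step d′ sv′ ne′ ze′ r′) with sameVertex-turn sv | sameVertex-turn sv′
  ... | j , refl | j′ , refl with j Fin.≟ j′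
  ... | yes refl = reach-unique ze r r′
  ... | no jj′ = ⊥-elim (third-edge (a h) j j′ (λ { refl → ne refl }) (λ { refl → ne′ refl }) (jj′ ∘ sym) (a-edge h ke) ze d ze′)

  sameVertex-sym : ∀ {x y} → SameVertex M x y → SameVertex M y x
  sameVertex-sym {x} sv with sameVertex-turn sv
  ... | 0F , refl = 0 , refl
  ... | 1F , refl = 3 , loop x
  ... | 2F , refl = 2 , loop x
  ... | 3F , refl = 1 , loop x

  -- With t the half-edge from which z was reached, this reverses a path.
  reach-reverse : ∀ {z h′ t} → k z ≡ edge → Reach M z h′ → Reach M (a z) t → Reach M h′ t
  reach-reverse ke (stop _) r = r
  reach-reverse {z} ke (step {z = z₂} d sv ne ze r′) r = reach-reverse ze r′
    (step (trans (cong deg (inv z₂)) (trans (deg-same sv) d)) (subst (λ y → SameVertex M y (a z)) (sym (inv z₂)) (sameVertex-sym sv))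
      (λ e → ne (sym (trans e (inv z₂)))) (a-edge z ke) r)
    where
    deg-same : ∀ {x y} → SameVertex M x y → deg y ≡ deg x
    deg-same {x} (j , refl) = deg-iter j x

  path-reach : ∀ w {h t} → 3 ≤ deg t → Path h w t → Reach M h t
  path-reach []      d refl = stop d
  path-reach (A ∷ w) {h} d (v , p) = step (degree-vertex v 0F) (toℕ (exit A) , refl) (turn-distinct (a h) (exit A) (exit≢0 A))
    (trans (proj₁ v (exit A)) (pattern-exit A)) (path-reach w d p)
    where
    pattern-exit : ∀ A → pattern′ A (exit A) ≡ edge
    pattern-exit (before , o) = refl
    pattern-exit (across , o) = refl
    pattern-exit (after , o)  = refl

outRule : (M : BMap) (L : HE M → ℤ) → (∀ h → Out M h → L (σ M h) ≡ L h +ᶻ + 1) →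
          (∀ h → ¬ Out M h → L h ≡ L (σ M h) +ᶻ + 1) → ∀ h → Rule (κ M h) (α M h) h (L h) (L (σ M h))
outRule M L out inn h = go (κ M h) refl
  where
  go : ∀ K → κ M h ≡ K → Rule K (α M h) h (L h) (L (σ M h))
  go edge q = (λ lt → out h (subst (outK M h) (sym q) lt)) , (λ lt → inn h (λ o → ℕₚ.<-asym lt (subst (outK M h) q o)))
  go leaf q = inn h (λ o → subst (outK M h) q o)
  go bud  q = out h (subst (outK M h) (sym q) _)

module Decoding (M : BMap) (inR : InR M) where

  private
    valid : Valid M
    valid = proj₁ inR
    root≥3 : 3 ≤ intDeg M zero
    root≥3 = proj₁ (proj₂ (proj₂ (proj₂ inR)))
    wl : WellLabeled M
    wl = proj₂ (proj₂ (proj₂ (proj₂ inR)))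
    L : HE M → ℤ
    L = label M
    rule : ∀ h → Rule (κ M h) (α M h) h (L h) (L (σ M h))
    rule = outRule M L (proj₁ (proj₂ wl)) (proj₂ (proj₂ wl))

  open Reaching M valid (proj₁ (proj₂ inR)) public

  private
    a-stem : ∀ h → k h ≢ edge → a h ≡ h
    a-stem = proj₁ (proj₂ (proj₂ valid))

    a≢ : ∀ h → k h ≡ edge → a h ≢ h
    a≢ = proj₁ (proj₂ valid)

    nonroot : ∀ {y} → deg y ≡ 2 → y ≢ zero
    nonroot d refl = ℕₚ.<-irrefl (sym d) root≥3

    toℕ-nxt′ : ∀ (y : HE M) → nxt y ≢ zero → toℕ (nxt y) ≡ suc (toℕ y)
    toℕ-nxt′ y ne with last? y
    ... | inj₁ lt = toℕ-nxt y lt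
    ... | inj₂ e = ⊥-elim (ne (nxt-last y e))

    -- After arriving at a path vertex the contour runs over the stems up to the next edge, so the
    -- half-edges on that side have consecutive numbers. The numbering cannot wrap around, because
    -- the root is not at a vertex of interior degree 2.
    chain : ∀ y b l → a y ≡ b → deg b ≡ 2 → (∀ i → i < l → k (iter s (suc i) b) ≢ edge) →
            ∀ i → i ≤ l → toℕ (iter s (suc i) b) ≡ toℕ y + suc i
    chain y b l refl d st zero le = trans (cong toℕ q) (trans (toℕ-nxt′ y (λ z → nonroot (trans (deg-iter 1 (a y)) d) (trans q z)))
      (ℕₚ.+-comm 1 (toℕ y)))
      where
      q : s (a y) ≡ nxt y
      q = cong nxt (inv y)
    chain y b l refl d st (suc i) le = trans (cong toℕ q) (trans (toℕ-nxt′ _ (λ z → nonroot (trans (deg-iter (suc (suc i)) (a y)) d) (trans q z)))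
      (trans (cong suc (chain y b l refl d st i (ℕₚ.<⇒≤ le))) (sym (ℕₚ.+-suc (toℕ y) (suc i)))))
      where
      q : iter s (suc (suc i)) (a y) ≡ nxt (iter s (suc i) (a y))
      q = cong nxt (a-stem _ (st i le))

    between : ∀ y b l → a y ≡ b → deg b ≡ 2 → (∀ i → i < l → k (iter s (suc i) b) ≢ edge) →
              ∀ w → y Fin.< w → w Fin.≤ iter s (suc l) b → Σ[ i ∈ ℕ ] (i ≤ l × w ≡ iter s (suc i) b)
    between y b l q d st w lt le = i , i≤l , Finₚ.toℕ-injective (trans (sym w≡) (sym (chain y b l q d st i i≤l)))
      where
      i : ℕ
      i = toℕ w ∸ suc (toℕ y)
      w≡ : toℕ y + suc i ≡ toℕ w
      w≡ = trans (ℕₚ.+-suc (toℕ y) i) (ℕₚ.m+[n∸m]≡n lt)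
      i≤l : i ≤ l
      i≤l = ℕₚ.≤-pred (ℕₚ.+-cancelˡ-≤ (toℕ y) (suc i) (suc l) (subst₂ _≤_ (sym w≡) (chain y b l q d st l ℕₚ.≤-refl) le))

    last-edge : ∀ {w z} (v : ℕ → HE M) l → (∀ i → i < l → k (v i) ≢ edge) → z ≡ v l → k w ≡ edge →
                Σ[ i ∈ ℕ ] (i ≤ l × w ≡ v i) → w ≡ z
    last-edge v l st zl we (i , i≤ , q) with i ℕ.≟ l
    ... | yes refl = trans q (sym zl)
    ... | no ne = ⊥-elim (st i (ℕₚ.≤∧≢⇒< i≤ ne) (trans (cong k (sym q)) we))

    -- The two sides of a path vertex entered along `h` and left along `z`, with `l₁` stems on the
    -- way out and `l₂` on the way back.
    record Passage (h z : HE M) : Set where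
      field
        l₁ l₂  : ℕ
        ahead  : z ≡ iter s (suc l₁) (a h)
        back   : a h ≡ iter s (suc l₂) z
        stems₁ : ∀ i → i < l₁ → k (iter s (suc i) (a h)) ≢ edge
        stems₂ : ∀ i → i < l₂ → k (iter s (suc i) z) ≢ edge

    passage : ∀ h j → j ≢ 0F → k h ≡ edge → k (turn j (a h)) ≡ edge → deg (a h) ≡ 2 → Passage h (turn j (a h))
    passage h 0F ne ke ze d = ⊥-elim (ne refl)
    passage h 1F ne ke ze d = record { l₁ = 0 ; l₂ = 2 ; ahead = refl ; back = sym (loop (a h))
      ; stems₁ = λ _ () ; stems₂ = λ { 0 _ → te 2F (λ ()) (λ ()) ; 1 _ → te 3F (λ ()) (λ ()) ; (suc (suc _)) (s≤s (s≤s ())) } }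
      where te = λ i i0 ij → third-edge (a h) 1F i ne i0 ij (a-edge h ke) ze d
    passage h 2F ne ke ze d = record { l₁ = 1 ; l₂ = 1 ; ahead = refl ; back = sym (loop (a h))
      ; stems₁ = λ { 0 _ → te 1F (λ ()) (λ ()) ; (suc _) (s≤s ()) } ; stems₂ = λ { 0 _ → te 3F (λ ()) (λ ()) ; (suc _) (s≤s ()) } }
      where te = λ i i0 ij → third-edge (a h) 2F i ne i0 ij (a-edge h ke) ze d
    passage h 3F ne ke ze d = record { l₁ = 2 ; l₂ = 0 ; ahead = refl ; back = sym (loop (a h))
      ; stems₁ = λ { 0 _ → te 1F (λ ()) (λ ()) ; 1 _ → te 2F (λ ()) (λ ()) ; (suc (suc _)) (s≤s (s≤s ())) } ; stems₂ = λ _ () }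
      where te = λ i i0 ij → third-edge (a h) 3F i ne i0 ij (a-edge h ke) ze d

    record Crossing (h z : HE M) : Set where
      field
        h<z     : h Fin.< z
        az<ah   : a z Fin.< a h
        path-2  : ∀ w → a z Fin.< w → w Fin.≤ a h → deg w ≡ 2
        forward : h Fin.< a h → z Fin.< a z
        backward : a h Fin.< h → a z Fin.< z

    -- Between `h` and `z` the contour meets only stems, and likewise between `a z` and `a h`. If
    -- consecutive edges of a path were oriented differently, one of these intervals would contain
    -- an edge half-edge; so the orientation is inherited along the path.
    crossing : ∀ h z → k h ≡ edge → k z ≡ edge → z ≢ a h → deg (a h) ≡ 2 → Passage h z → Crossing h z
    crossing h z ke ze z≢ d P = record
      { h<z = h<z ; az<ah = az<ah
      ; path-2 = λ w lt le → let i , _ , q = btw₂ w lt le in trans (cong deg q) (trans (deg-iter (suc i) z) dz)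
      ; forward = forward
      ; backward = back′ }
      where
      open Passage P
      dz : deg z ≡ 2
      dz = trans (cong deg ahead) (trans (deg-iter (suc l₁) (a h)) d)
      h<z : h Fin.< z
      h<z = subst (toℕ h <_) (sym (trans (cong toℕ ahead) (chain h (a h) l₁ refl d stems₁ l₁ ℕₚ.≤-refl))) (ℕₚ.m<m+n (toℕ h) (s≤s z≤n))
      az<ah : a z Fin.< a h
      az<ah = subst (toℕ (a z) <_) (sym (trans (cong toℕ back) (chain (a z) z l₂ (inv z) dz stems₂ l₂ ℕₚ.≤-refl))) (ℕₚ.m<m+n (toℕ (a z)) (s≤s z≤n))
      btw₁ : ∀ w → h Fin.< w → w Fin.≤ z → Σ[ i ∈ ℕ ] (i ≤ l₁ × w ≡ iter s (suc i) (a h))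
      btw₁ w lt le = between h (a h) l₁ refl d stems₁ w lt (subst (w Fin.≤_) ahead le)
      btw₂ : ∀ w → a z Fin.< w → w Fin.≤ a h → Σ[ i ∈ ℕ ] (i ≤ l₂ × w ≡ iter s (suc i) z)
      btw₂ w lt le = between (a z) z l₂ (inv z) dz stems₂ w lt (subst (w Fin.≤_) back le)
      only₁ : ∀ w → k w ≡ edge → h Fin.< w → w Fin.≤ z → w ≡ z
      only₁ w we lt le = last-edge (λ i → iter s (suc i) (a h)) l₁ stems₁ ahead we (btw₁ w lt le)
      only₂ : ∀ w → k w ≡ edge → a z Fin.< w → w Fin.≤ a h → w ≡ a h
      only₂ w we lt le = last-edge (λ i → iter s (suc i) z) l₂ stems₂ back we (btw₂ w lt le)
      forward : h Fin.< a h → z Fin.< a z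
      forward h<ah with ℕₚ.<-cmp (toℕ z) (toℕ (a z))
      ... | tri< lt _ _ = lt
      ... | tri≈ _ q _ = ⊥-elim (a≢ z ze (sym (Finₚ.toℕ-injective q)))
      ... | tri> _ _ az<z with ℕₚ.<-cmp (toℕ h) (toℕ (a z))
      ... | tri< lt _ _ = ⊥-elim (a≢ z ze (only₁ (a z) (a-edge z ze) lt (ℕₚ.<⇒≤ az<z)))
      ... | tri≈ _ q _ = ⊥-elim (z≢ (trans (sym (inv z)) (cong a (sym (Finₚ.toℕ-injective q)))))
      ... | tri> _ _ az<h = ⊥-elim (a≢ h ke (sym (only₂ h ke az<h (ℕₚ.<⇒≤ h<ah))))
      back′ : a h Fin.< h → a z Fin.< z
      back′ ah<h with ℕₚ.<-cmp (toℕ z) (toℕ (a z))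
      ... | tri< lt _ _ = ⊥-elim (ℕₚ.<-asym ah<h (ℕₚ.<-trans h<z (ℕₚ.<-trans lt az<ah)))
      ... | tri≈ _ q _ = ⊥-elim (a≢ z ze (sym (Finₚ.toℕ-injective q)))
      ... | tri> _ _ az<z = az<z

    -- Around a vertex the labels return to their start, so of the two stems one is a leaf and one a bud.
    pattern-at : ∀ b j → j ≢ 0F → k b ≡ edge → k (turn j b) ≡ edge → deg b ≡ 2 → a b Fin.< b → turn j b Fin.< a (turn j b) →
                 Σ[ A ∈ Arr ] (exit A ≡ j × Pattern A b)
    pattern-at b 0F ne be ze d lo hi = ⊥-elim (ne refl)
    pattern-at b 1F ne be ze d lo hi = go (k (s (s b))) (k (s (s (s b)))) refl refl
      where
      te = λ i i0 ij → third-edge b 1F i ne i0 ij be ze d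
      r₀ : L (s b) ≡ L b +ᶻ + 1
      r₀ = proj₁ (subst (λ K → Rule K (a b) b (L b) (L (s b))) be (rule b)) lo
      r₁ : L (s b) ≡ L (s (s b)) +ᶻ + 1
      r₁ = proj₂ (subst (λ K → Rule K (a (s b)) (s b) (L (s b)) (L (s (s b)))) ze (rule (s b))) hi
      same : L (s (s b)) ≡ L b
      same = ℤ+.∙-cancelʳ (+ 1) _ _ (trans (sym r₁) r₀)
      go : ∀ K K′ → k (s (s b)) ≡ K → k (s (s (s b))) ≡ K′ → Σ[ A ∈ Arr ] (exit A ≡ 1F × Pattern A b)
      go edge _ p q = ⊥-elim (te 2F (λ ()) (λ ()) p)
      go leaf edge p q = ⊥-elim (te 3F (λ ()) (λ ()) q)
      go bud edge p q = ⊥-elim (te 3F (λ ()) (λ ()) q)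
      go leaf bud p q = (after , true) , refl , λ { 0F → be ; 1F → ze ; 2F → p ; 3F → q }
      go bud leaf p q = (after , false) , refl , λ { 0F → be ; 1F → ze ; 2F → p ; 3F → q }
      go leaf leaf p q = ⊥-elim (shift≢ (L b) 1 (begin
        L b                                   ≡⟨ same ⟨
        L (s (s b))                           ≡⟨ subst (λ K → Rule K (a (s (s b))) (s (s b)) (L (s (s b))) (L (s (s (s b))))) p (rule (s (s b))) ⟩
        L (s (s (s b))) +ᶻ + 1                ≡⟨ cong (_+ᶻ + 1) (subst (λ K → Rule K (a (s (s (s b)))) (s (s (s b))) (L (s (s (s b)))) (L (s (s (s (s b)))))) q (rule (s (s (s b))))) ⟩
        L (s (s (s (s b)))) +ᶻ + 1 +ᶻ + 1     ≡⟨ cong (λ y → L y +ᶻ + 1 +ᶻ + 1) (loop b) ⟩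
        L b +ᶻ + 1 +ᶻ + 1                     ≡⟨ ℤₚ.+-assoc (L b) (+ 1) (+ 1) ⟩
        L b +ᶻ + 2 ∎))
        where open ≡-Reasoning
      go bud bud p q = ⊥-elim (shift≢ (L b) 1 (begin
        L b                                   ≡⟨ cong L (loop b) ⟨
        L (s (s (s (s b))))                   ≡⟨ subst (λ K → Rule K (a (s (s (s b)))) (s (s (s b))) (L (s (s (s b)))) (L (s (s (s (s b)))))) q (rule (s (s (s b)))) ⟩
        L (s (s (s b))) +ᶻ + 1                ≡⟨ cong (_+ᶻ + 1) (subst (λ K → Rule K (a (s (s b))) (s (s b)) (L (s (s b))) (L (s (s (s b))))) p (rule (s (s b)))) ⟩
        L (s (s b)) +ᶻ + 1 +ᶻ + 1             ≡⟨ cong (λ y → y +ᶻ + 1 +ᶻ + 1) same ⟩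
        L b +ᶻ + 1 +ᶻ + 1                     ≡⟨ ℤₚ.+-assoc (L b) (+ 1) (+ 1) ⟩
        L b +ᶻ + 2 ∎))
        where open ≡-Reasoning
    pattern-at b 2F ne be ze d lo hi = go (k (s b)) (k (s (s (s b)))) refl refl
      where
      te = λ i i0 ij → third-edge b 2F i ne i0 ij be ze d
      r₀ : L (s b) ≡ L b +ᶻ + 1
      r₀ = proj₁ (subst (λ K → Rule K (a b) b (L b) (L (s b))) be (rule b)) lo
      r₂ : L (s (s b)) ≡ L (s (s (s b))) +ᶻ + 1
      r₂ = proj₂ (subst (λ K → Rule K (a (s (s b))) (s (s b)) (L (s (s b))) (L (s (s (s b))))) ze (rule (s (s b)))) hi
      go : ∀ K K′ → k (s b) ≡ K → k (s (s (s b))) ≡ K′ → Σ[ A ∈ Arr ] (exit A ≡ 2F × Pattern A b)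
      go edge _ p q = ⊥-elim (te 1F (λ ()) (λ ()) p)
      go leaf edge p q = ⊥-elim (te 3F (λ ()) (λ ()) q)
      go bud edge p q = ⊥-elim (te 3F (λ ()) (λ ()) q)
      go leaf bud p q = (across , true) , refl , λ { 0F → be ; 1F → p ; 2F → ze ; 3F → q }
      go bud leaf p q = (across , false) , refl , λ { 0F → be ; 1F → p ; 2F → ze ; 3F → q }
      go leaf leaf p q = ⊥-elim (shift≢ (L (s b)) 1 (begin
        L (s b)                               ≡⟨ subst (λ K → Rule K (a (s b)) (s b) (L (s b)) (L (s (s b)))) p (rule (s b)) ⟩
        L (s (s b)) +ᶻ + 1                    ≡⟨ cong (_+ᶻ + 1) r₂ ⟩
        L (s (s (s b))) +ᶻ + 1 +ᶻ + 1         ≡⟨ cong (λ y → y +ᶻ + 1 +ᶻ + 1) (subst (λ K → Rule K (a (s (s (s b)))) (s (s (s b))) (L (s (s (s b)))) (L (s (s (s (s b)))))) q (rule (s (s (s b))))) ⟩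
        L (s (s (s (s b)))) +ᶻ + 1 +ᶻ + 1 +ᶻ + 1 ≡⟨ cong (λ y → L y +ᶻ + 1 +ᶻ + 1 +ᶻ + 1) (loop b) ⟩
        L b +ᶻ + 1 +ᶻ + 1 +ᶻ + 1              ≡⟨ cong (λ y → y +ᶻ + 1 +ᶻ + 1) r₀ ⟨
        L (s b) +ᶻ + 1 +ᶻ + 1                 ≡⟨ ℤₚ.+-assoc (L (s b)) (+ 1) (+ 1) ⟩
        L (s b) +ᶻ + 2 ∎))
        where open ≡-Reasoning
      go bud bud p q = ⊥-elim (shift≢ (L b) 1 (begin
        L b                                   ≡⟨ cong L (loop b) ⟨
        L (s (s (s (s b))))                   ≡⟨ subst (λ K → Rule K (a (s (s (s b)))) (s (s (s b))) (L (s (s (s b)))) (L (s (s (s (s b)))))) q (rule (s (s (s b)))) ⟩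
        L (s (s (s b))) +ᶻ + 1                ≡⟨ r₂ ⟨
        L (s (s b))                           ≡⟨ subst (λ K → Rule K (a (s b)) (s b) (L (s b)) (L (s (s b)))) p (rule (s b)) ⟩
        L (s b) +ᶻ + 1                        ≡⟨ cong (_+ᶻ + 1) r₀ ⟩
        L b +ᶻ + 1 +ᶻ + 1                     ≡⟨ ℤₚ.+-assoc (L b) (+ 1) (+ 1) ⟩
        L b +ᶻ + 2 ∎))
        where open ≡-Reasoning
    pattern-at b 3F ne be ze d lo hi = go (k (s b)) (k (s (s b))) refl refl
      where
      te = λ i i0 ij → third-edge b 3F i ne i0 ij be ze d
      r₀ : L (s b) ≡ L b +ᶻ + 1
      r₀ = proj₁ (subst (λ K → Rule K (a b) b (L b) (L (s b))) be (rule b)) lo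
      r₃ : L (s (s (s b))) ≡ L b +ᶻ + 1
      r₃ = trans (proj₂ (subst (λ K → Rule K (a (s (s (s b)))) (s (s (s b))) (L (s (s (s b)))) (L (s (s (s (s b)))))) ze (rule (s (s (s b))))) hi)
             (cong (λ y → L y +ᶻ + 1) (loop b))
      same : L (s (s (s b))) ≡ L (s b)
      same = trans r₃ (sym r₀)
      go : ∀ K K′ → k (s b) ≡ K → k (s (s b)) ≡ K′ → Σ[ A ∈ Arr ] (exit A ≡ 3F × Pattern A b)
      go edge _ p q = ⊥-elim (te 1F (λ ()) (λ ()) p)
      go leaf edge p q = ⊥-elim (te 2F (λ ()) (λ ()) q)
      go bud edge p q = ⊥-elim (te 2F (λ ()) (λ ()) q)
      go leaf bud p q = (before , true) , refl , λ { 0F → be ; 1F → p ; 2F → q ; 3F → ze }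
      go bud leaf p q = (before , false) , refl , λ { 0F → be ; 1F → p ; 2F → q ; 3F → ze }
      go leaf leaf p q = ⊥-elim (shift≢ (L (s b)) 1 (begin
        L (s b)                               ≡⟨ subst (λ K → Rule K (a (s b)) (s b) (L (s b)) (L (s (s b)))) p (rule (s b)) ⟩
        L (s (s b)) +ᶻ + 1                    ≡⟨ cong (_+ᶻ + 1) (subst (λ K → Rule K (a (s (s b))) (s (s b)) (L (s (s b))) (L (s (s (s b))))) q (rule (s (s b)))) ⟩
        L (s (s (s b))) +ᶻ + 1 +ᶻ + 1         ≡⟨ cong (λ y → y +ᶻ + 1 +ᶻ + 1) same ⟩
        L (s b) +ᶻ + 1 +ᶻ + 1                 ≡⟨ ℤₚ.+-assoc (L (s b)) (+ 1) (+ 1) ⟩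
        L (s b) +ᶻ + 2 ∎))
        where open ≡-Reasoning
      go bud bud p q = ⊥-elim (shift≢ (L (s b)) 1 (begin
        L (s b)                               ≡⟨ same ⟨
        L (s (s (s b)))                       ≡⟨ subst (λ K → Rule K (a (s (s b))) (s (s b)) (L (s (s b))) (L (s (s (s b))))) q (rule (s (s b))) ⟩
        L (s (s b)) +ᶻ + 1                    ≡⟨ cong (_+ᶻ + 1) (subst (λ K → Rule K (a (s b)) (s b) (L (s b)) (L (s (s b)))) p (rule (s b))) ⟩
        L (s b) +ᶻ + 1 +ᶻ + 1                 ≡⟨ ℤₚ.+-assoc (L (s b)) (+ 1) (+ 1) ⟩
        L (s b) +ᶻ + 2 ∎))
        where open ≡-Reasoning

  -- What a whole path from `h` to `h′` means for the contour. By `clear` the way back, from `h′` to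
  -- `a h`, meets only vertices of interior degree 2 after `h′`, so it contains no further half-edge
  -- of the scheme.
  record Reached (h h′ : HE M) : Set where
    field
      end≤    : h′ Fin.≤ a h
      clear   : ∀ w → h′ Fin.< w → w Fin.≤ a h → deg w ≡ 2
      up′     : h Fin.< a h → a h′ Fin.< h′
      down    : a h Fin.< h → h′ Fin.< a h′
      start≤  : h Fin.≤ a h′
      end-edge : k h′ ≡ edge
      word    : h Fin.< a h → Σ[ w ∈ List Arr ] Path h w h′

  reached : ∀ {h h′} → k h ≡ edge → Reach M h h′ → Reached h h′
  reached {h} ke (stop d) = record
    { end≤ = ℕₚ.≤-refl ; clear = λ w lt le → ⊥-elim (ℕₚ.<⇒≱ lt le)
    ; up′ = subst (Fin._< a h) (sym (inv h)) ; down = subst (a h Fin.<_) (sym (inv h))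
    ; start≤ = ℕₚ.≤-reflexive (cong toℕ (sym (inv h))) ; end-edge = a-edge h ke ; word = λ _ → [] , refl }
  reached {h} {h′} ke (step d sv ne ze r) with sameVertex-turn sv
  ... | j , refl = record
    { end≤ = ℕₚ.≤-trans R.end≤ (ℕₚ.<⇒≤ C.az<ah)
    ; clear = clear′
    ; up′ = R.up′ ∘ C.forward ; down = R.down ∘ C.backward
    ; start≤ = ℕₚ.≤-trans (ℕₚ.<⇒≤ C.h<z) R.start≤
    ; end-edge = R.end-edge
    ; word = word′ }
    where
    z : HE M
    z = turn j (a h)
    j≢0 : j ≢ 0F
    j≢0 refl = ne refl
    module R = Reached (reached {z} {h′} ze r)
    module C = Crossing (crossing h z ke ze ne d (passage h j j≢0 ke ze d))
    clear′ : ∀ w → h′ Fin.< w → w Fin.≤ a h → deg w ≡ 2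
    clear′ w lt le with toℕ w ℕ.≤? toℕ (a z)
    ... | yes p = R.clear w lt p
    ... | no np = C.path-2 w (ℕₚ.≰⇒> np) le
    word′ : h Fin.< a h → Σ[ w ∈ List Arr ] Path h w h′
    word′ lt with pattern-at (a h) j j≢0 (a-edge h ke) ze d (subst (Fin._< a h) (sym (inv h)) lt) (C.forward lt)
    ... | A , refl , pat = let w , p = R.word (C.forward lt) in A ∷ w , (pat , loop (a h)) , p

  -- Going forward, the contour sees only the stems between the entering and the leaving half-edge:
  -- a leaf and a bud that cancel, a single stem, or none. These three cases are the values of
  -- `dispA`.
  path-label : ∀ w {h t} → k h ≡ edge → Path h w t → L (s t) ≡ L h +ᶻ disp w
  path-label []      {h} ke refl = trans (sym (proj₁ wl h ke)) (sym (ℤₚ.+-identityʳ (L h)))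
  path-label (A ∷ w) {h} ke ((pat , lp) , p) = trans (path-label w (trans (pat (exit A)) (pattern-exit A)) p)
    (trans (cong (_+ᶻ disp w) (trans (stems A pat) (cong (_+ᶻ dispA A) (sym (proj₁ wl h ke))))) (ℤₚ.+-assoc (L h) (dispA A) (disp w)))
    where
    pattern-exit : ∀ A → pattern′ A (exit A) ≡ edge
    pattern-exit (before , o) = refl
    pattern-exit (across , o) = refl
    pattern-exit (after , o)  = refl
    at : ∀ {K} y → k y ≡ K → Rule K (a y) y (L y) (L (s y))
    at y q = subst (λ K → Rule K (a y) y (L y) (L (s y))) q (rule y)
    minus : ∀ {x y} → x ≡ y +ᶻ + 1 → y ≡ x +ᶻ -[1+ 0 ]
    minus {x} {y} refl = sym (trans (ℤₚ.+-assoc y (+ 1) -[1+ 0 ]) (ℤₚ.+-identityʳ y))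
    stems : ∀ A → Pattern A (a h) → L (turn (exit A) (a h)) ≡ L (s (a h)) +ᶻ dispA A
    stems (before , true)  pat = trans (at _ (pat 2F)) (trans (sym (at _ (pat 1F))) (sym (ℤₚ.+-identityʳ _)))
    stems (before , false) pat = let b = a h in trans (minus {L (s (s b))} {L (s (s (s b)))} (at _ (pat 2F)))
      (trans (sym (minus {L (s (s b))} {L (s b)} (at _ (pat 1F)))) (sym (ℤₚ.+-identityʳ (L (s b)))))
    stems (across , true)  pat = minus (at _ (pat 1F))
    stems (across , false) pat = at _ (pat 1F)
    stems (after , o)      pat = sym (ℤₚ.+-identityʳ _)

  module Scheme (S : BMap) (e : HE S → HE M) (emb : SchemeEmb M S e) where

    private
      e-mono : ∀ {x y} → x Fin.< y → e x Fin.< e y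
      e-mono {x} {y} = proj₁ emb x y
      onto : ∀ h → 3 ≤ deg h → ∃[ x ] e x ≡ h
      onto = proj₁ (proj₂ emb)
      e-deg : ∀ x → 3 ≤ deg (e x)
      e-deg = proj₁ (proj₂ (proj₂ emb))
      e-κ : ∀ x → κ S x ≡ k (e x)
      e-κ = proj₁ (proj₂ (proj₂ (proj₂ emb)))
      e-reach : ∀ x → κ S x ≡ edge → Reach M (e x) (e (α S x))
      e-reach = proj₁ (proj₂ (proj₂ (proj₂ (proj₂ emb))))
      S-stem : ∀ x → κ S x ≢ edge → α S x ≡ x
      S-stem = proj₂ (proj₂ (proj₂ (proj₂ (proj₂ emb))))

      e-mono≤ : ∀ {x y} → x Fin.≤ y → e x Fin.≤ e y
      e-mono≤ {x} {y} le with toℕ x ℕ.≟ toℕ y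
      ... | yes q = ℕₚ.≤-reflexive (cong (toℕ ∘ e) (Finₚ.toℕ-injective q))
      ... | no ne = ℕₚ.<⇒≤ (e-mono (ℕₚ.≤∧≢⇒< le ne))

      e-refl< : ∀ {x y} → e x Fin.< e y → x Fin.< y
      e-refl< {x} {y} lt with toℕ x ℕ.<? toℕ y
      ... | yes p = p
      ... | no np = ⊥-elim (ℕₚ.<⇒≱ lt (e-mono≤ (ℕₚ.≮⇒≥ np)))

    e-injective : ∀ {x y} → e x ≡ e y → x ≡ y
    e-injective {x} {y} q with ℕₚ.<-cmp (toℕ x) (toℕ y)
    ... | tri< lt _ _ = ⊥-elim (ℕₚ.<-irrefl (cong toℕ q) (e-mono lt))
    ... | tri≈ _ p _ = Finₚ.toℕ-injective p
    ... | tri> _ _ gt = ⊥-elim (ℕₚ.<-irrefl (cong toℕ (sym q)) (e-mono gt))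

    e-zero : e zero ≡ zero
    e-zero with onto zero root≥3
    ... | zero , q = q
    ... | suc x , q with () ← subst (e zero Fin.<_) q (e-mono {zero} {suc x} (s≤s z≤n))

    private
      -- If no scheme half-edge lies after `e c` up to `p`, then the first one beyond `p` is the
      -- image of the contour successor of `c`, since `e` preserves order and covers all scheme
      -- half-edges. The four cases tell whether either contour closes at its root.
      follow : ∀ c p → e c Fin.≤ p → (∀ w → e c Fin.< w → w Fin.≤ p → deg w ≡ 2) → 3 ≤ deg (nxt p) → nxt p ≡ e (nxt c)
      follow c p le clear d with onto (nxt p) d
      ... | y , q = trans (sym q) (cong e (here′ (last? p) (last? c)))
        where
        beyond : ∀ c′ → e c Fin.< e c′ → p Fin.< e c′
        beyond c′ lt with toℕ (e c′) ℕ.≤? toℕ p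
        ... | yes le′ = ⊥-elim (ℕₚ.<-irrefl (sym (clear (e c′) lt le′)) (e-deg c′))
        ... | no nle = ℕₚ.≰⇒> nle
        here′ : toℕ p < BMap.m M ⊎ toℕ p ≡ BMap.m M → toℕ c < BMap.m S ⊎ toℕ c ≡ BMap.m S → y ≡ nxt c
        here′ (inj₁ p<) (inj₁ c<) = Finₚ.toℕ-injective (ℕₚ.≤-antisym
            (ℕₚ.≮⇒≥ (λ lt → ℕₚ.<⇒≱ (e-mono lt) (subst (_≤ toℕ (e (nxt c))) (sym ey) (beyond (nxt c) c<nc))))
            (subst (_≤ toℕ y) (sym (toℕ-nxt c c<)) (e-refl< (ℕₚ.≤-<-trans le (subst (toℕ p <_) (sym ey) ℕₚ.≤-refl)))))
          where
          ey : toℕ (e y) ≡ suc (toℕ p)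
          ey = trans (cong toℕ q) (toℕ-nxt p p<)
          c<nc : e c Fin.< e (nxt c)
          c<nc = e-mono (subst (toℕ c <_) (sym (toℕ-nxt c c<)) ℕₚ.≤-refl)
        here′ (inj₁ p<) (inj₂ cl) = ⊥-elim (ℕₚ.<⇒≱ (e-refl< (ℕₚ.≤-<-trans le (subst (toℕ p <_) (sym (trans (cong toℕ q) (toℕ-nxt p p<))) ℕₚ.≤-refl)))
            (subst (toℕ y ≤_) (sym cl) (Finₚ.toℕ≤pred[n] y)))
        here′ (inj₂ pl) (inj₂ cl) = trans (e-injective (trans q (trans (nxt-last p pl) (sym e-zero)))) (sym (nxt-last c cl))
        here′ (inj₂ pl) (inj₁ c<) = ⊥-elim (ℕₚ.<⇒≱ (beyond (nxt c) (e-mono (subst (toℕ c <_) (sym (toℕ-nxt c c<)) ℕₚ.≤-refl)))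
            (subst (toℕ (e (nxt c)) ≤_) (sym pl) (Finₚ.toℕ≤pred[n] _)))

      ke : ∀ x → κ S x ≡ edge → k (e x) ≡ edge
      ke x q = trans (sym (e-κ x)) q

      R : ∀ x → κ S x ≡ edge → Reached (e x) (e (α S x))
      R x q = reached (ke x q) (e-reach x q)

    e-σ : ∀ x → s (e x) ≡ e (σ S x)
    e-σ x with edge? (κ S x)
    ... | yes q = follow (α S x) (a (e x)) (Reached.end≤ (R x q)) (Reached.clear (R x q))
                    (subst (3 ≤_) (sym (degree-s s k (e x) (loop (e x)))) (e-deg x))
    ... | no ne = trans (cong nxt ae) (trans (follow x (e x) ℕₚ.≤-refl (λ w lt le → ⊥-elim (ℕₚ.<⇒≱ lt le))
                    (subst (3 ≤_) (trans (sym (degree-s s k (e x) (loop (e x)))) (cong (deg ∘ nxt) ae)) (e-deg x)))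
                    (cong (e ∘ nxt) (sym (S-stem x ne))))
      where
      ae : a (e x) ≡ e x
      ae = a-stem (e x) (ne ∘ trans (e-κ x))

    α-edge-S : ∀ x → κ S x ≡ edge → κ S (α S x) ≡ edge
    α-edge-S x q = trans (e-κ (α S x)) (Reached.end-edge (R x q))

    first-out : ∀ x → κ S x ≡ edge → x Fin.< α S x → e x Fin.< a (e x)
    first-out x q lt = ℕₚ.<-≤-trans (e-mono lt) (Reached.end≤ (R x q))

    second-in : ∀ x → κ S x ≡ edge → α S x Fin.< x → a (e x) Fin.< e x
    second-in x q lt with ℕₚ.<-cmp (toℕ (a (e x))) (toℕ (e x))
    ... | tri< p _ _ = p
    ... | tri≈ _ p _ = ⊥-elim (a≢ (e x) (ke x q) (Finₚ.toℕ-injective p))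
    ... | tri> _ _ p = ⊥-elim (ℕₚ.<-asym (e-mono lt) (ℕₚ.≤-<-trans (Reached.start≤ (R x q)) (Reached.up′ (R x q) p)))

    -- Validity is inherited from M through the embedding. The edge map of S is an involution
    -- because paths can be reversed and have a unique end; it has no fixed edge because the two
    -- ends of a path have opposite orientations.
    valid-S : Valid S
    valid-S = invS , neq , S-stem , trans (e-κ zero) (trans (cong k e-zero) (proj₂ (proj₂ (proj₂ valid))))
      where
      invS : ∀ x → α S (α S x) ≡ x
      invS x with edge? (κ S x)
      ... | no ne = trans (cong (α S) (S-stem x ne)) (S-stem x ne)
      ... | yes q = e-injective (reach-unique (ke (α S x) (α-edge-S x q)) (e-reach (α S x) (α-edge-S x q))
                      (reach-reverse (ke x q) (e-reach x q)
                        (subst (Reach M (a (e x))) (inv (e x)) (stop (subst (λ y → 3 ≤ deg y) (sym (inv (e x))) (e-deg x))))))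
      neq : ∀ x → κ S x ≡ edge → α S x ≢ x
      neq x q p with ℕₚ.<-cmp (toℕ (a (e x))) (toℕ (e x))
      ... | tri< lt _ _ = ℕₚ.<⇒≱ lt (subst (λ y → toℕ (e y) ≤ toℕ (a (e x))) p (Reached.end≤ (R x q)))
      ... | tri≈ _ r _ = a≢ (e x) (ke x q) (Finₚ.toℕ-injective r)
      ... | tri> _ _ gt = ℕₚ.<-asym gt (subst (λ y → a (e y) Fin.< e y) p (Reached.up′ (R x q) gt))

    words-S : HE S → List Arr
    words-S x with first? S x
    ... | yes (q , lt) = proj₁ (Reached.word (R x q) (first-out x q lt))
    ... | no _ = []

    model : Model S words-S a k e
    model = record { inv = inv ; a-stem = a-stem ; e-zero = e-zero ; e-inj = e-injective ; e-κ = λ x → sym (e-κ x)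
                   ; e-σ = e-σ ; path = path′ }
      where
      path′ : ∀ x → First S x → Path (e x) (words-S x) (e (α S x))
      path′ x f with first? S x
      ... | yes (q , lt) = proj₂ (Reached.word (R x q) (first-out x q lt))
      ... | no nf = ⊥-elim (nf f)

    words-S-other : ∀ x → ¬ First S x → words-S x ≡ []
    words-S-other x nf with first? S x
    ... | yes f = ⊥-elim (nf f)
    ... | no _ = refl

    deg-S : ∀ x → 3 ≤ intDeg S x
    deg-S x = subst (3 ≤_) (Model.degree-e model x) (e-deg x)

    e-iter : ∀ j x → e (iter (σ S) j x) ≡ iter s j (e x)
    e-iter j x = sym (iter-map e (σ S) s e-σ j x)

    four-S : FourValent S
    four-S x = e-injective (trans (e-iter 4 x) (loop (e x)))
             , (λ j lt lt′ q → proj₂ (proj₁ (proj₂ inR) (e x)) j lt lt′ (trans (sym (e-iter j x)) (cong e q)))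

    label-S : HE S → ℤ
    label-S x = L (e x)

    rule-S : ∀ x → Rule (κ S x) (α S x) x (label-S x) (label-S (σ S x))
    rule-S x = go (κ S x) refl (subst (λ y → Rule (k (e x)) (a (e x)) (e x) (L (e x)) (L y)) (e-σ x) (rule (e x)))
      where
      go : ∀ K → κ S x ≡ K → Rule (k (e x)) (a (e x)) (e x) (label-S x) (label-S (σ S x)) → Rule K (α S x) x (label-S x) (label-S (σ S x))
      go K q r with k (e x) | trans (sym (e-κ x)) q
      go edge q (r , r′) | _ | refl = (λ lt → r (second-in x q lt)) , (λ lt → r′ (first-out x q lt))
      go leaf q r | _ | refl = r
      go bud  q r | _ | refl = r

    label-S-zero : label-S zero ≡ + 0
    label-S-zero = cong L e-zero

    disp-S : ∀ x → First S x → label-S (next S x) ≡ label-S x +ᶻ disp (words-S x)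
    disp-S x f = trans (cong L (trans (cong (e ∘ next S) (sym (proj₁ valid-S x))) (sym (e-σ (α S x)))))
      (path-label (words-S x) (ke x (proj₁ f)) (Model.path model x f))

-- Parity of the numbers of edges and vertices

odd : ℕ → Bool
odd zero    = false
odd (suc n) = not (odd n)

odd-+ : ∀ m n → odd (m + n) ≡ odd m xor odd n
odd-+ zero    n = refl
odd-+ (suc m) n = trans (cong not (odd-+ m n)) (Boolₚ.not-distribˡ-xor (odd m) (odd n))

even-half : ∀ n → odd n ≡ false → Σ[ k ∈ ℕ ] n ≡ k + k
even-half zero          e = 0 , refl
even-half (suc (suc n)) e = let k , q = even-half n (trans (sym (Boolₚ.not-involutive (odd n))) e) in
  suc k , cong suc (trans (cong suc q) (sym (ℕₚ.+-suc k k)))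

xor-swap : ∀ x y z → x xor (y xor z) ≡ y xor (x xor z)
xor-swap true  true  z = refl
xor-swap true  false z = refl
xor-swap false y     z = refl

not-xor : ∀ x y → x xor not y ≡ not (x xor y)
not-xor true  y = refl
not-xor false y = refl

-- Only parities are kept: this is the number of smaller entries modulo 2, and `inversions` the sign
-- of the list.
below : ℕ → List ℕ → Bool
below x []       = false
below x (y ∷ ys) = does (y ℕ.<? x) xor below x ys

inversions : List ℕ → Bool
inversions []       = false
inversions (x ∷ xs) = below x xs xor inversions xs

<?-flip : ∀ x y → x ≢ y → does (y ℕ.<? x) ≡ not (does (x ℕ.<? y))
<?-flip x y ne with ℕₚ.<-cmp x y
... | tri< p _ np = trans (dec-false (y ℕ.<? x) np) (cong not (sym (dec-true (x ℕ.<? y) p)))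
... | tri≈ _ p _ = ⊥-elim (ne p)
... | tri> np _ p = trans (dec-true (y ℕ.<? x) p) (cong not (sym (dec-false (x ℕ.<? y) np)))

below-move : ∀ z x v w → below z (x ∷ v ++ w) ≡ below z (v ++ x ∷ w)
below-move z x []      w = refl
below-move z x (y ∷ v) w = trans (xor-swap (does (x ℕ.<? z)) (does (y ℕ.<? z)) (below z (v ++ w)))
  (cong (does (y ℕ.<? z) xor_) (below-move z x v w))

inversions-adjacent : ∀ x y w → x ≢ y → inversions (x ∷ y ∷ w) ≡ not (inversions (y ∷ x ∷ w))
inversions-adjacent x y w ne rewrite <?-flip x y ne =
  lem (does (x ℕ.<? y)) (below x w) (below y w) (inversions w)
  where
  lem : ∀ p a b c → (not p xor a) xor (b xor c) ≡ not ((p xor b) xor (a xor c))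
  lem true true b c with b | c
  ... | true | true = refl
  ... | true | false = refl
  ... | false | true = refl
  ... | false | false = refl
  lem true  false b c with b | c
  ... | true | true = refl
  ... | true | false = refl
  ... | false | true = refl
  ... | false | false = refl
  lem false true b c with b | c
  ... | true | true = refl
  ... | true | false = refl
  ... | false | true = refl
  ... | false | false = refl
  lem false false b c with b | c
  ... | true | true = refl
  ... | true | false = refl
  ... | false | true = refl
  ... | false | false = refl

inversions-move : ∀ x v w → All (x ≢_) v → inversions (x ∷ v ++ w) ≡ odd (length v) xor inversions (v ++ x ∷ w)
inversions-move x []      w []       = refl
inversions-move x (y ∷ v) w (ne ∷ a) = begin
  inversions (x ∷ y ∷ v ++ w)                                          ≡⟨ inversions-adjacent x y (v ++ w) ne ⟩
  not (below y (x ∷ v ++ w) xor inversions (x ∷ v ++ w))               ≡⟨ cong not (cong₂ _xor_ (below-move y x v w) (inversions-move x v w a)) ⟩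
  not (below y (v ++ x ∷ w) xor (odd (length v) xor inversions (v ++ x ∷ w)))
    ≡⟨ cong not (xor-swap (below y (v ++ x ∷ w)) (odd (length v)) (inversions (v ++ x ∷ w))) ⟩
  not (odd (length v) xor inversions (y ∷ v ++ x ∷ w))                 ≡⟨ Boolₚ.not-distribˡ-xor (odd (length v)) _ ⟩
  odd (suc (length v)) xor inversions (y ∷ v ++ x ∷ w) ∎
  where open ≡-Reasoning

data Swapped : List ℕ → List ℕ → Set where
  heads : ∀ x y v w → x ≢ y → All (x ≢_) v → All (y ≢_) v → Swapped (x ∷ v ++ y ∷ w) (y ∷ v ++ x ∷ w)
  later : ∀ z {l l′} → Swapped l l′ → Swapped (z ∷ l) (z ∷ l′)

below-swapped : ∀ z {l l′} → Swapped l l′ → below z l ≡ below z l′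
below-swapped z (heads x y v w _ _ _) = trans (cong (does (x ℕ.<? z) xor_) (sym (below-move z y v w)))
  (trans (xor-swap (does (x ℕ.<? z)) (does (y ℕ.<? z)) (below z (v ++ w))) (cong (does (y ℕ.<? z) xor_) (below-move z x v w)))
below-swapped z (later x s) = cong (does (x ℕ.<? z) xor_) (below-swapped z s)

-- Bring the front entry of either list across `v`: this costs the parity of the length of `v` in
-- both cases and cancels. What remains is an exchange of neighbours, which changes exactly one
-- inversion.
inversions-swapped : ∀ {l l′} → Swapped l l′ → inversions l′ ≡ not (inversions l)
inversions-swapped (later z {l} {l′} s) = trans (cong₂ _xor_ (sym (below-swapped z s)) (inversions-swapped s)) (not-xor (below z l) (inversions l))
inversions-swapped (heads x y v w ne a b) = begin
  inversions (y ∷ v ++ x ∷ w)                       ≡⟨ inversions-move y v (x ∷ w) b ⟩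
  p xor inversions (v ++ y ∷ x ∷ w)                 ≡⟨ cong (p xor_) (under v) ⟩
  p xor not (inversions (v ++ x ∷ y ∷ w))           ≡⟨ not-xor p (inversions (v ++ x ∷ y ∷ w)) ⟩
  not (p xor inversions (v ++ x ∷ y ∷ w))           ≡⟨ cong not (inversions-move x v (y ∷ w) a) ⟨
  not (inversions (x ∷ v ++ y ∷ w)) ∎
  where
  open ≡-Reasoning
  p : Bool
  p = odd (length v)
  under : ∀ v → inversions (v ++ y ∷ x ∷ w) ≡ not (inversions (v ++ x ∷ y ∷ w))
  under []      = inversions-adjacent y x w (ne ∘ sym)
  under (z ∷ v) = trans (cong₂ _xor_ (trans (sym (below-move z y v (x ∷ w))) (trans (two z v) (below-move z x v (y ∷ w)))) (under v))
    (not-xor (below z (v ++ x ∷ y ∷ w)) (inversions (v ++ x ∷ y ∷ w)))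
    where
    two : ∀ z v → below z (y ∷ v ++ x ∷ w) ≡ below z (x ∷ v ++ y ∷ w)
    two z v = trans (cong (does (y ℕ.<? z) xor_) (sym (below-move z x v w)))
      (trans (xor-swap (does (y ℕ.<? z)) (does (x ℕ.<? z)) (below z (v ++ w))) (cong (does (x ℕ.<? z) xor_) (below-move z y v w)))

values : ∀ {n} → (Fin n → ℕ) → List ℕ
values = List.tabulate

replace : ∀ {n} (g g′ : Fin n → ℕ) j → (∀ i → i ≢ j → g′ i ≡ g i) → {P : ℕ → Set} → (∀ i → i ≢ j → P (g i)) →
          Σ[ v ∈ List ℕ ] Σ[ w ∈ List ℕ ] (values g ≡ v ++ g j ∷ w × values g′ ≡ v ++ g′ j ∷ w × All P v)
replace g g′ zero e p = [] , values (g ∘ suc) , refl , cong (g′ zero ∷_) (Listₚ.tabulate-cong (λ i → e (suc i) (λ ()))) , []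
replace g g′ (suc j) e p with replace (g ∘ suc) (g′ ∘ suc) j (λ i ne → e (suc i) (ne ∘ Finₚ.suc-injective)) (λ i ne → p (suc i) (ne ∘ Finₚ.suc-injective))
... | v , w , q , q′ , a = g zero ∷ v , w , cong (g zero ∷_) q , cong₂ _∷_ (e zero (λ ())) q′ , p zero (λ ()) ∷ a

swapped-values : ∀ {n} (g g′ : Fin n → ℕ) i j → i Fin.< j → (∀ {x y} → g x ≡ g y → x ≡ y) →
  g′ i ≡ g j → g′ j ≡ g i → (∀ k → k ≢ i → k ≢ j → g′ k ≡ g k) → Swapped (values g) (values g′)
swapped-values g g′ zero (suc j) lt inj p q r
  with replace (g ∘ suc) (g′ ∘ suc) j (λ k ne → r (suc k) (λ ()) (ne ∘ Finₚ.suc-injective))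
         {λ z → g zero ≢ z × g (suc j) ≢ z} (λ k ne → (λ e → case0 (inj e)) , (λ e → ne (sym (Finₚ.suc-injective (inj e)))))
  where
  case0 : ∀ {n} {k : Fin n} → Fin.zero ≡ Fin.suc k → ⊥
  case0 ()
... | v , w , e , e′ , a rewrite e | e′ | p | q =
  heads (g zero) (g (suc j)) v w (λ z → case0 (inj z)) (All.map proj₁ a) (All.map proj₂ a)
  where
  case0 : ∀ {n} {k : Fin n} → Fin.zero ≡ Fin.suc k → ⊥
  case0 ()
swapped-values g g′ (suc i) (suc j) (s≤s lt) inj p q r = subst (λ z → Swapped (values g) (z ∷ values (g′ ∘ suc))) (sym (r zero (λ ()) (λ ())))
  (later (g zero) (swapped-values (g ∘ suc) (g′ ∘ suc) i j lt (Finₚ.suc-injective ∘ inj) p q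
    (λ k ne ne′ → r (suc k) (ne ∘ Finₚ.suc-injective) (ne′ ∘ Finₚ.suc-injective))))

sgn : ∀ {n} → (Fin n → Fin n) → Bool
sgn f = inversions (values (toℕ ∘ f))

sgn-cong : ∀ {n} {f g : Fin n → Fin n} → (∀ x → f x ≡ g x) → sgn f ≡ sgn g
sgn-cong e = cong inversions (Listₚ.tabulate-cong (cong toℕ ∘ e))

Inj : ∀ {n} → (Fin n → Fin n) → Set
Inj f = ∀ {x y} → f x ≡ f y → x ≡ y

-- Composition on the right with a transposition: `f′` is f after exchanging i and j.
record Transposed {n} (f f′ : Fin n → Fin n) : Set where
  field
    i j    : Fin n
    i≢j    : i ≢ j
    at-i   : f′ i ≡ f j
    at-j   : f′ j ≡ f i
    else   : ∀ k → k ≢ i → k ≢ j → f′ k ≡ f k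

sgn-transposed : ∀ {n} {f f′ : Fin n → Fin n} → Inj f → Transposed f f′ → sgn f′ ≡ not (sgn f) × Inj f′
sgn-transposed {n} {f} {f′} inj t = flip′ , inj′
  where
  open Transposed t
  flip′ : sgn f′ ≡ not (sgn f)
  flip′ with ℕₚ.<-cmp (toℕ i) (toℕ j)
  ... | tri≈ _ e _ = ⊥-elim (i≢j (Finₚ.toℕ-injective e))
  ... | tri< lt _ _ = inversions-swapped (swapped-values (toℕ ∘ f) (toℕ ∘ f′) i j lt (inj ∘ Finₚ.toℕ-injective)
                        (cong toℕ at-i) (cong toℕ at-j) (λ k p q → cong toℕ (else k p q)))
  ... | tri> _ _ gt = inversions-swapped (swapped-values (toℕ ∘ f) (toℕ ∘ f′) j i gt (inj ∘ Finₚ.toℕ-injective)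
                        (cong toℕ at-j) (cong toℕ at-i) (λ k p q → cong toℕ (else k q p)))
  τ : Fin n → Fin n
  τ k = if does (k Fin.≟ i) then j else if does (k Fin.≟ j) then i else k
  τ-i : τ i ≡ j
  τ-i = cong (if_then j else (if does (i Fin.≟ j) then i else i)) (dec-true (i Fin.≟ i) refl)
  τ-j : τ j ≡ i
  τ-j = trans (cong (if_then j else (if does (j Fin.≟ j) then i else j)) (dec-false (j Fin.≟ i) (i≢j ∘ sym)))
    (cong (if_then i else j) (dec-true (j Fin.≟ j) refl))
  τ-else : ∀ k → k ≢ i → k ≢ j → τ k ≡ k
  τ-else k p q = trans (cong (if_then j else (if does (k Fin.≟ j) then i else k)) (dec-false (k Fin.≟ i) p))
    (cong (if_then i else k) (dec-false (k Fin.≟ j) q))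
  f′τ : ∀ k → f′ k ≡ f (τ k)
  f′τ k with k Fin.≟ i
  ... | yes refl = at-i
  ... | no p with k Fin.≟ j
  ... | yes refl = at-j
  ... | no q = else k p q
  ττ : ∀ k → τ (τ k) ≡ k
  ττ k = go (k Fin.≟ i) (k Fin.≟ j)
    where
    go : Dec (k ≡ i) → Dec (k ≡ j) → τ (τ k) ≡ k
    go (yes refl) _ = trans (cong τ τ-i) τ-j
    go (no p) (yes refl) = trans (cong τ τ-j) τ-i
    go (no p) (no q) = trans (cong τ (τ-else k p q)) (τ-else k p q)
  inj′ : Inj f′
  inj′ {x} {y} e = trans (sym (ττ x)) (trans (cong τ (inj (trans (sym (f′τ x)) (trans e (f′τ y))))) (ττ y))

data Product {n} : ℕ → (Fin n → Fin n) → (Fin n → Fin n) → Set where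
  unchanged : ∀ {f g} → (∀ x → g x ≡ f x) → Product 0 f g
  next′ : ∀ {c f g h} → Product c f g → Transposed g h → Product (suc c) f h

sgn-product : ∀ {n c} {f g : Fin n → Fin n} → Inj f → Product c f g → sgn g ≡ odd c xor sgn f × Inj g
sgn-product inj (unchanged e) = sgn-cong e , (λ {x} {y} q → inj (trans (sym (e x)) (trans q (e y))))
sgn-product {f = f} inj (next′ {c} P t) = let q , i = sgn-product inj P; q′ , i′ = sgn-transposed i t in
  trans q′ (trans (cong not q) (Boolₚ.not-distribˡ-xor (odd c) (sgn f))) , i′

sgn-chain : ∀ {n} N (F : ℕ → Fin n → Fin n) (t : Fin N → ℕ) → Inj (F 0) →
            (∀ x → Product (t x) (F (toℕ x)) (F (suc (toℕ x)))) → sgn (F N) ≡ odd (sum t) xor sgn (F 0)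
sgn-chain zero    F t inj P = refl
sgn-chain (suc N) F t inj P = let q , i = sgn-product inj (P zero) in
  trans (sgn-chain N (F ∘ suc) (t ∘ suc) i (P ∘ suc)) (trans (cong (odd (sum (t ∘ suc)) xor_) q)
    (trans (xor-swap (odd (sum (t ∘ suc))) (odd (t zero)) (sgn (F 0))) (trans (sym (Boolₚ.xor-assoc (odd (t zero)) (odd (sum (t ∘ suc))) (sgn (F 0))))
      (cong (_xor sgn (F 0)) (sym (odd-+ (t zero) (sum (t ∘ suc))))))))

sum-const : ∀ n c → sum {n} (λ _ → c) ≡ n * c
sum-const zero    c = refl
sum-const (suc n) c = cong (λ z → c + z) (sum-const n c)

-- `F c` is the cycle on 0, ..., c with everything above fixed. It leads from the identity at c = 0
-- to `nxt` at c = m by one transposition per step.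
sgn-nxt : ∀ m → sgn (nxt {m}) ≡ odd m xor sgn {suc m} (λ x → x)
sgn-nxt m = trans (sgn-cong final) (trans (sgn-chain m F (λ _ → 1) (λ {x} {y} e → trans (sym (start x)) (trans e (start y))) link)
  (cong₂ _xor_ (cong odd (trans (sum-const m 1) (ℕₚ.*-identityʳ m))) (sgn-cong start)))
  where
  F : ℕ → Fin (suc m) → Fin (suc m)
  F c x = if does (toℕ x ℕ.<? c) then nxt x else if does (toℕ x ℕ.≟ c) then zero else x
  F-lt : ∀ c x → toℕ x < c → F c x ≡ nxt x
  F-lt c x lt = cong (if_then nxt x else (if does (toℕ x ℕ.≟ c) then zero else x)) (dec-true (toℕ x ℕ.<? c) lt)
  F-eq : ∀ c x → toℕ x ≡ c → F c x ≡ zero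
  F-eq c x e = trans (cong (if_then nxt x else (if does (toℕ x ℕ.≟ c) then zero else x)) (dec-false (toℕ x ℕ.<? c) (ℕₚ.<-irrefl e)))
    (cong (if_then zero else x) (dec-true (toℕ x ℕ.≟ c) e))
  F-gt : ∀ c x → c < toℕ x → F c x ≡ x
  F-gt c x gt = trans (cong (if_then nxt x else (if does (toℕ x ℕ.≟ c) then zero else x)) (dec-false (toℕ x ℕ.<? c) (ℕₚ.<-asym gt)))
    (cong (if_then zero else x) (dec-false (toℕ x ℕ.≟ c) (λ e → ℕₚ.<-irrefl (sym e) gt)))
  start : ∀ x → F 0 x ≡ x
  start zero    = F-eq 0 zero refl
  start (suc x) = F-gt 0 (suc x) (s≤s z≤n)
  final : ∀ x → nxt x ≡ F m x
  final x with last? x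
  ... | inj₁ lt = sym (F-lt m x lt)
  ... | inj₂ e  = trans (nxt-last x e) (sym (F-eq m x e))
  link : ∀ (x : Fin m) → Product 1 (F (toℕ x)) (F (suc (toℕ x)))
  link x = next′ (unchanged (λ _ → refl)) (record
    { i = i ; j = suc x ; i≢j = λ e → ℕₚ.<⇒≢ (ℕₚ.n<1+n (toℕ x)) (trans (sym ti) (cong toℕ e))
    ; at-i = trans (F-lt (suc c) i (s≤s (ℕₚ.≤-reflexive ti))) (trans (Finₚ.toℕ-injective (trans (toℕ-nxt i (subst (_< m) (sym ti) (Finₚ.toℕ<n x))) (cong suc ti)))
              (sym (F-gt c (suc x) ℕₚ.≤-refl)))
    ; at-j = trans (F-eq (suc c) (suc x) refl) (sym (F-eq c i ti))
    ; else = rest′ })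
    where
    c : ℕ
    c = toℕ x
    i : Fin (suc m)
    i = Fin.inject₁ x
    ti : toℕ i ≡ c
    ti = Finₚ.toℕ-inject₁ x
    rest′ : ∀ k → k ≢ i → k ≢ suc x → F (suc c) k ≡ F c k
    rest′ k p q with ℕₚ.<-cmp (toℕ k) c
    ... | tri< lt _ _ = trans (F-lt (suc c) k (ℕₚ.m≤n⇒m≤1+n lt)) (sym (F-lt c k lt))
    ... | tri≈ _ e _ = ⊥-elim (p (Finₚ.toℕ-injective (trans e (sym ti))))
    ... | tri> _ _ gt = trans (F-gt (suc c) k (ℕₚ.≤∧≢⇒< gt (λ e → q (Finₚ.toℕ-injective (sym e))))) (sym (F-gt c k gt))

-- Signs of the rotation and of the edge involution

module Vertices (S : BMap) (valid : Valid S) (four : FourValent S) (n : ℕ) (π : Fin n → HE S) (enum : VertexEnum S n π) where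

  open Reaching S valid four using (sameVertex-turn; sameVertex-sym; turn; turn-distinct; s; loop)

  pos : HE S → Fin n
  pos x = proj₁ (proj₂ enum x)

  pos-vertex : ∀ x → SameVertex S (π (pos x)) x
  pos-vertex x = proj₂ (proj₂ enum x)

  sameVertex-trans : ∀ {x y z} → SameVertex S x y → SameVertex S y z → SameVertex S x z
  sameVertex-trans {x} (i , refl) (j , refl) = j + i , sym (iter-+ s j i x)

  pos-unique : ∀ {x i} → SameVertex S (π i) x → pos x ≡ i
  pos-unique {x} {i} v = proj₁ enum (pos x) i (sameVertex-trans (pos-vertex x) (sameVertex-sym v))

  pos-same : ∀ {x y} → SameVertex S x y → pos x ≡ pos y
  pos-same {x} {y} v = sym (pos-unique (sameVertex-trans (pos-vertex x) v))

  pos-π : ∀ i → pos (π i) ≡ i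
  pos-π i = pos-unique (0 , refl)

  idx : HE S → Fin 4
  idx x = proj₁ (sameVertex-turn (pos-vertex x))

  turn-idx : ∀ x → turn (idx x) (π (pos x)) ≡ x
  turn-idx x = proj₂ (sameVertex-turn (pos-vertex x))

  private
    s-inj : ∀ {x y} → s x ≡ s y → x ≡ y
    s-inj {x} {y} e = trans (sym (loop x)) (trans (cong (s ∘ s ∘ s) e) (loop y))

  turn-injective : ∀ y i j → turn i y ≡ turn j y → i ≡ j
  turn-injective y 0F 0F e = refl
  turn-injective y 0F 1F e = ⊥-elim (turn-distinct y 1F (λ ()) (sym e))
  turn-injective y 0F 2F e = ⊥-elim (turn-distinct y 2F (λ ()) (sym e))
  turn-injective y 0F 3F e = ⊥-elim (turn-distinct y 3F (λ ()) (sym e))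
  turn-injective y 1F 0F e = ⊥-elim (turn-distinct y 1F (λ ()) e)
  turn-injective y 1F 1F e = refl
  turn-injective y 1F 2F e = ⊥-elim (turn-distinct y 1F (λ ()) (sym (s-inj e)))
  turn-injective y 1F 3F e = ⊥-elim (turn-distinct y 2F (λ ()) (sym (s-inj e)))
  turn-injective y 2F 0F e = ⊥-elim (turn-distinct y 2F (λ ()) e)
  turn-injective y 2F 1F e = ⊥-elim (turn-distinct y 1F (λ ()) (s-inj e))
  turn-injective y 2F 2F e = refl
  turn-injective y 2F 3F e = ⊥-elim (turn-distinct y 1F (λ ()) (sym (s-inj (s-inj e))))
  turn-injective y 3F 0F e = ⊥-elim (turn-distinct y 3F (λ ()) e)
  turn-injective y 3F 1F e = ⊥-elim (turn-distinct y 2F (λ ()) (s-inj e))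
  turn-injective y 3F 2F e = ⊥-elim (turn-distinct y 1F (λ ()) (s-inj (s-inj e)))
  turn-injective y 3F 3F e = refl

  pos-turn : ∀ i j → pos (turn j (π i)) ≡ i
  pos-turn i j = pos-unique (toℕ j , refl)

  idx-turn : ∀ i j → idx (turn j (π i)) ≡ j
  idx-turn i j = turn-injective (π i) _ j (trans (cong (λ p → turn (idx (turn j (π i))) (π p)) (sym (pos-turn i j))) (turn-idx (turn j (π i))))

  count : suc (BMap.m S) ≡ n * 4
  count = ↔⇒≡ (↔-trans (mk↔ₛ′ (λ x → pos x , idx x) (λ (i , j) → turn j (π i)) (λ (i , j) → cong₂ _,_ (pos-turn i j) (idx-turn i j)) turn-idx)
    (↔-sym (Finₚ.*↔× {n} {4})))

  private
    -- The first `c` vertices of the enumeration are rotated, the others fixed. This joins the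
    -- identity to the rotation of the map, each step adding a 4-cycle.
    rotations : ℕ → HE S → HE S
    rotations c x = if does (toℕ (pos x) ℕ.<? c) then s x else x

    rot-in : ∀ c x → toℕ (pos x) < c → rotations c x ≡ s x
    rot-in c x lt = cong (if_then s x else x) (dec-true (toℕ (pos x) ℕ.<? c) lt)

    rot-out : ∀ c x → ¬ toℕ (pos x) < c → rotations c x ≡ x
    rot-out c x nlt = cong (if_then s x else x) (dec-false (toℕ (pos x) ℕ.<? c) nlt)

    -- The 4-cycle at a vertex is the product of the transpositions (0 1), (1 2), (2 3).
    module AtVertex (i : Fin n) where
      v : Fin 4 → HE S
      v j = turn j (π i)
      c : ℕ
      c = toℕ i

      v-inj : ∀ {j j′} → v j ≡ v j′ → j ≡ j′
      v-inj {j} {j′} = turn-injective (π i) j j′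

      H : (Fin 4 → Fin 4) → HE S → HE S
      H t x = if does (pos x Fin.≟ i) then v (t (idx x)) else rotations c x

      H-v : ∀ t j → H t (v j) ≡ v (t j)
      H-v t j = trans (cong (if_then v (t (idx (v j))) else rotations c (v j)) (dec-true (pos (v j) Fin.≟ i) (pos-turn i j)))
        (cong (v ∘ t) (idx-turn i j))

      H-else : ∀ t x → pos x ≢ i → H t x ≡ rotations c x
      H-else t x ne = cong (if_then v (t (idx x)) else rotations c x) (dec-false (pos x Fin.≟ i) ne)

      at-v : ∀ x → pos x ≡ i → x ≡ v (idx x)
      at-v x e = trans (sym (turn-idx x)) (cong (λ p → turn (idx x) (π p)) e)

      transposition : ∀ t t′ p q → p ≢ q → t′ p ≡ t q → t′ q ≡ t p → (∀ r → r ≢ p → r ≢ q → t′ r ≡ t r) → Transposed (H t) (H t′)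
      transposition t t′ p q ne a b r = record
        { i = v p ; j = v q ; i≢j = ne ∘ v-inj
        ; at-i = trans (H-v t′ p) (trans (cong v a) (sym (H-v t q)))
        ; at-j = trans (H-v t′ q) (trans (cong v b) (sym (H-v t p)))
        ; else = λ x n₁ n₂ → off x n₁ n₂ (pos x Fin.≟ i) }
        where
        off : ∀ x → x ≢ v p → x ≢ v q → Dec (pos x ≡ i) → H t′ x ≡ H t x
        off x n₁ n₂ (no ne) = trans (H-else t′ x ne) (sym (H-else t x ne))
        off x n₁ n₂ (yes e) = trans (cong (H t′) (at-v x e)) (trans (H-v t′ (idx x)) (trans
          (cong v (r (idx x) (λ { refl → n₁ (at-v x e) }) (λ { refl → n₂ (at-v x e) })))
          (trans (sym (H-v t (idx x))) (cong (H t) (sym (at-v x e))))))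

      t₀ t₁ t₂ : Fin 4 → Fin 4
      t₀ j = j
      t₁ 0F = 1F
      t₁ 1F = 0F
      t₁ 2F = 2F
      t₁ 3F = 3F
      t₂ 0F = 1F
      t₂ 1F = 2F
      t₂ 2F = 0F
      t₂ 3F = 3F

      off₁ : ∀ r → r ≢ 0F → r ≢ 1F → t₁ r ≡ t₀ r
      off₁ 0F a b = ⊥-elim (a refl)
      off₁ 1F a b = ⊥-elim (b refl)
      off₁ 2F a b = refl
      off₁ 3F a b = refl

      off₂ : ∀ r → r ≢ 1F → r ≢ 2F → t₂ r ≡ t₁ r
      off₂ 0F a b = refl
      off₂ 1F a b = ⊥-elim (a refl)
      off₂ 2F a b = ⊥-elim (b refl)
      off₂ 3F a b = refl

      off₃ : ∀ r → r ≢ 2F → r ≢ 3F → rot r ≡ t₂ r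
      off₃ 0F a b = refl
      off₃ 1F a b = refl
      off₃ 2F a b = ⊥-elim (a refl)
      off₃ 3F a b = ⊥-elim (b refl)

      v-rot : ∀ j → v (rot j) ≡ s (v j)
      v-rot 0F = refl
      v-rot 1F = refl
      v-rot 2F = refl
      v-rot 3F = sym (loop (π i))

      starts : ∀ x → H t₀ x ≡ rotations c x
      starts x = go (pos x Fin.≟ i)
        where
        go : Dec (pos x ≡ i) → H t₀ x ≡ rotations c x
        go (no ne) = H-else t₀ x ne
        go (yes e) = trans (cong (H t₀) (at-v x e)) (trans (H-v t₀ (idx x)) (trans (sym (at-v x e)) (sym (rot-out c x (ℕₚ.<-irrefl (cong toℕ e))))))

      ends : ∀ x → rotations (suc c) x ≡ H rot x
      ends x = go (pos x Fin.≟ i)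
        where
        go : Dec (pos x ≡ i) → rotations (suc c) x ≡ H rot x
        go (yes e) = trans (rot-in (suc c) x (s≤s (ℕₚ.≤-reflexive (cong toℕ e)))) (trans (cong s (at-v x e))
          (trans (sym (v-rot (idx x))) (trans (sym (H-v rot (idx x))) (cong (H rot) (sym (at-v x e))))))
        go (no ne) = trans (lem (toℕ (pos x) ℕ.<? c)) (sym (H-else rot x ne))
          where
          lem : Dec (toℕ (pos x) < c) → rotations (suc c) x ≡ rotations c x
          lem (yes lt) = trans (rot-in (suc c) x (ℕₚ.m≤n⇒m≤1+n lt)) (sym (rot-in c x lt))
          lem (no nlt) = trans (rot-out (suc c) x (λ lt → nlt (ℕₚ.≤∧≢⇒< (ℕₚ.≤-pred lt) (ne ∘ Finₚ.toℕ-injective)))) (sym (rot-out c x nlt))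

      link : Product 3 (rotations c) (rotations (suc c))
      link = subst′ (next′ (next′ (next′ (unchanged starts)
        (transposition t₀ t₁ 0F 1F (λ ()) refl refl off₁))
        (transposition t₁ t₂ 1F 2F (λ ()) refl refl off₂))
        (transposition t₂ rot 2F 3F (λ ()) refl refl off₃))
        where
        subst′ : ∀ {k f} → Product (suc k) f (H rot) → Product (suc k) f (rotations (suc c))
        subst′ (next′ P t) = next′ P (record { i = T.i ; j = T.j ; i≢j = T.i≢j ; at-i = trans (ends T.i) T.at-i
          ; at-j = trans (ends T.j) T.at-j ; else = λ x p q → trans (ends x) (T.else x p q) })
          where module T = Transposed t

  edgeFlag : HE S → ℕ
  edgeFlag x = if does (first? S x) then 1 else 0

  private
    sgn-σ : sgn s ≡ odd (n * 3) xor sgn {suc (BMap.m S)} (λ x → x)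
    sgn-σ = trans (sgn-cong (λ x → sym (rot-in n x (Finₚ.toℕ<n (pos x)))))
      (trans (sgn-chain n rotations (λ _ → 3) (λ {x} {y} e → trans (sym (rot-out 0 x (λ ()))) (trans e (rot-out 0 y (λ ())))) AtVertex.link)
        (cong₂ _xor_ (cong odd (sum-const n 3)) (sgn-cong (λ x → rot-out 0 x (λ ())))))

    N : ℕ
    N = suc (BMap.m S)

    seen? : ∀ c (x : HE S) → Dec (toℕ x < c ⊎ toℕ (α S x) < c)
    seen? c x = (toℕ x ℕ.<? c) ⊎-dec (toℕ (α S x) ℕ.<? c)

    -- The contour composed with the involution on those edges having a half numbered below `c`.
    -- From c = 0 to the end this joins `nxt` to the rotation, with one transposition at the first
    -- half of each edge.
    glue : ℕ → HE S → HE S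
    glue c x = nxt (if does (seen? c x) then α S x else x)

    glue-in : ∀ c x → toℕ x < c ⊎ toℕ (α S x) < c → glue c x ≡ nxt (α S x)
    glue-in c x p = cong nxt (cong (if_then α S x else x) (dec-true (seen? c x) p))

    glue-out : ∀ c x → ¬ (toℕ x < c ⊎ toℕ (α S x) < c) → glue c x ≡ nxt x
    glue-out c x p = cong nxt (cong (if_then α S x else x) (dec-false (seen? c x) p))

    glue-link : ∀ x → Product (edgeFlag x) (glue (toℕ x)) (glue (suc (toℕ x)))
    glue-link x = go (first? S x)
      where
      c : ℕ
      c = toℕ x
      inv : ∀ x → α S (α S x) ≡ x
      inv = proj₁ valid
      agree : ∀ y → y ≢ x → y ≢ α S x → glue (suc c) y ≡ glue c y
      agree y n₁ n₂ = lem (seen? c y)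
        where
        lem : Dec (toℕ y < c ⊎ toℕ (α S y) < c) → glue (suc c) y ≡ glue c y
        lem (yes (inj₁ p)) = trans (glue-in (suc c) y (inj₁ (ℕₚ.m≤n⇒m≤1+n p))) (sym (glue-in c y (inj₁ p)))
        lem (yes (inj₂ p)) = trans (glue-in (suc c) y (inj₂ (ℕₚ.m≤n⇒m≤1+n p))) (sym (glue-in c y (inj₂ p)))
        lem (no np) = trans (glue-out (suc c) y (λ
          { (inj₁ p) → np (inj₁ (ℕₚ.≤∧≢⇒< (ℕₚ.≤-pred p) (n₁ ∘ Finₚ.toℕ-injective)))
          ; (inj₂ p) → np (inj₂ (ℕₚ.≤∧≢⇒< (ℕₚ.≤-pred p) (λ e → n₂ (trans (sym (inv y)) (cong (α S) (Finₚ.toℕ-injective e)))))) }))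
          (sym (glue-out c y np))
      go : (d : Dec (First S x)) → Product (if does d then 1 else 0) (glue c) (glue (suc c))
      go (yes (κe , lt)) = next′ (unchanged (λ _ → refl)) (record
        { i = x ; j = α S x ; i≢j = λ e → ℕₚ.<-irrefl (cong toℕ e) lt
        ; at-i = trans (glue-in (suc c) x (inj₁ ℕₚ.≤-refl)) (sym (glue-out c (α S x) (λ
            { (inj₁ p) → ℕₚ.<-asym p lt ; (inj₂ p) → ℕₚ.<-irrefl (cong toℕ (inv x)) p })))
        ; at-j = trans (glue-in (suc c) (α S x) (inj₂ (s≤s (ℕₚ.≤-reflexive (cong toℕ (inv x)))))) (trans (cong nxt (inv x))
            (sym (glue-out c x (λ { (inj₁ p) → ℕₚ.<-irrefl refl p ; (inj₂ p) → ℕₚ.<-asym p lt }))))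
        ; else = agree })
      go (no nf) = unchanged all′
        where
        κ-edge : x ≢ α S x → κ S x ≡ edge
        κ-edge ne with edge? (κ S x)
        ... | yes p = p
        ... | no np = ⊥-elim (ne (sym (proj₁ (proj₂ (proj₂ valid)) x np)))
        all′ : ∀ y → glue (suc c) y ≡ glue c y
        all′ y with y Fin.≟ x
        all′ y | no n₁ with y Fin.≟ α S x
        ... | no n₂ = agree y n₁ n₂
        ... | yes refl with ℕₚ.<-cmp (toℕ x) (toℕ (α S x))
        ... | tri< lt ne _ = ⊥-elim (nf (κ-edge (ne ∘ cong toℕ) , lt))
        ... | tri≈ _ e _ = ⊥-elim (n₁ (sym (Finₚ.toℕ-injective e)))
        ... | tri> _ _ gt = trans (glue-in (suc c) (α S x) (inj₁ (ℕₚ.m≤n⇒m≤1+n gt))) (sym (glue-in c (α S x) (inj₁ gt)))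
        all′ y | yes refl with ℕₚ.<-cmp (toℕ x) (toℕ (α S x))
        ... | tri< lt ne _ = ⊥-elim (nf (κ-edge (ne ∘ cong toℕ) , lt))
        ... | tri> _ _ gt = trans (glue-in (suc c) x (inj₁ ℕₚ.≤-refl)) (sym (glue-in c x (inj₂ gt)))
        ... | tri≈ _ e _ = trans (glue-in (suc c) x (inj₁ ℕₚ.≤-refl)) (trans (cong nxt (sym (Finₚ.toℕ-injective e)))
            (sym (glue-out c x (λ { (inj₁ p) → ℕₚ.<-irrefl refl p ; (inj₂ p) → ℕₚ.<-irrefl (sym e) p }))))

    sgn-σ′ : sgn s ≡ odd (sum edgeFlag) xor sgn (nxt {BMap.m S})
    sgn-σ′ = trans (sgn-cong (λ x → sym (glue-in N x (inj₁ (Finₚ.toℕ<n x)))))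
      (trans (sgn-chain N glue edgeFlag (λ {x} {y} e → nxt-injective (trans (sym (out0 x)) (trans e (out0 y)))) glue-link)
        (cong (odd (sum edgeFlag) xor_) (sgn-cong out0)))
      where
      out0 : ∀ x → glue 0 x ≡ nxt x
      out0 x = glue-out 0 x (λ { (inj₁ ()) ; (inj₂ ()) })

  -- The sign of the rotation is computed twice: as n cycles of length 4, giving 3n, and as E
  -- transpositions times a cycle of length 4n, giving E + 4n - 1. Hence n ≡ E + 1 modulo 2, and n =
  -- r + 1.
  euler-parity : ∀ r → n ≡ suc r → Σ[ k ∈ ℕ ] sum edgeFlag + r ≡ k + k
  euler-parity r refl = even-half (sum edgeFlag + r) (trans (odd-+ (sum edgeFlag) r) eq)
    where
    E : Bool
    E = odd (sum edgeFlag)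
    I : Bool
    I = sgn {N} (λ x → x)
    odd-m : odd (BMap.m S) ≡ true
    odd-m = trans (sym (Boolₚ.not-involutive _)) (cong not (trans (cong odd count) (quad4 (suc r))))
      where
      quad4 : ∀ n → odd (n * 4) ≡ false
      quad4 zero    = refl
      quad4 (suc n) = trans (odd-+ 4 (n * 4)) (quad4 n)
    triple : ∀ n → odd (n * 3) ≡ odd n
    triple zero    = refl
    triple (suc n) = trans (odd-+ 3 (n * 3)) (cong not (triple n))
    total : E xor (true xor I) ≡ not (odd r) xor I
    total = trans (cong (λ b → E xor (b xor I)) (sym odd-m)) (trans (cong (E xor_) (sym (sgn-nxt (BMap.m S))))
      (trans (sym sgn-σ′) (trans sgn-σ (cong (_xor I) (triple (suc r))))))
    solve′ : ∀ a b c → a xor (true xor c) ≡ not b xor c → a xor b ≡ false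
    solve′ true  true  c     e = refl
    solve′ false false c     e = refl
    solve′ true  false true  ()
    solve′ true  false false ()
    solve′ false true  true  ()
    solve′ false true  false ()
    eq : E xor odd r ≡ false
    eq = solve′ E (odd r) I total

-- The expanded map belongs to the class

label-prefix-suc : ∀ {n} (v : Vec Kind n) (y : Fin n) →
  sumℤ (map δ (take (suc (toℕ y)) (toList v))) ≡ sumℤ (map δ (take (toℕ y) (toList v))) +ᶻ δ (lookup v y)
label-prefix-suc (κ ∷ v) zero    = ℤₚ.+-comm (δ κ) (+ 0)
label-prefix-suc (κ ∷ v) (suc y) = trans (cong (δ κ +ᶻ_) (label-prefix-suc v y)) (sym (ℤₚ.+-assoc (δ κ) _ _))

leaves-sum : ∀ {n} (v : Vec Kind n) → sumℕ (map leafInd (toList v)) ≡ sum (leafInd ∘ lookup v)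
leaves-sum []      = refl
leaves-sum (κ ∷ v) = cong (λ z → leafInd κ + z) (leaves-sum v)

iter-cong : {A : Set} {f g : A → A} → (∀ x → f x ≡ g x) → ∀ j x → iter f j x ≡ iter g j x
iter-cong e zero    x = refl
iter-cong {f = f} e (suc j) x = trans (cong f (iter-cong e j x)) (e _)

degree-cong : ∀ {m} {s s′ : Fin (suc m) → Fin (suc m)} {k k′ : Fin (suc m) → Kind} →
              (∀ x → s x ≡ s′ x) → (∀ x → k x ≡ k′ x) → ∀ y → degree s k y ≡ degree s′ k′ y
degree-cong {s = s} {s′} {k} {k′} es ek y = cong₂ _+_ (c 0) (cong₂ _+_ (c 1) (cong₂ _+_ (c 2) (cong (_+ 0) (c 3))))
  where
  c : ∀ j → edgeInd (k (iter s j y)) ≡ edgeInd (k′ (iter s′ j y))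
  c j = cong edgeInd (trans (ek (iter s j y)) (cong k′ (iter-cong es j y)))

module Assembling (S : BMap) (valid : Valid S) (four : FourValent S) (deg : ∀ x → 3 ≤ intDeg S x)
  (L₀ : HE S → ℤ) (rule₀ : ∀ x → Rule (κ S x) (α S x) x (L₀ x) (L₀ (σ S x))) (L₀-zero : L₀ zero ≡ + 0)
  (d : HE S → List Arr) (E : Expansion.Expanded S valid L₀ rule₀ d)
  (closed : ∀ x → First S x → L₀ (next S x) ≡ L₀ x +ᶻ disp (d x)) where

  private
    open module E = Expansion.Expanded E using (m; a; k; e; L; turn; OnPath)

  map′ : BMap
  map′ = bmap m (tabulate a) (tabulate k)

  private
    M : BMap
    M = map′

    s : Fin (suc m) → Fin (suc m)
    s y = nxt (a y)

    αM : ∀ y → α M y ≡ a y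
    αM y = Vecₚ.lookup∘tabulate a y

    κM : ∀ y → κ M y ≡ k y
    κM y = Vecₚ.lookup∘tabulate k y

    σM : ∀ y → σ M y ≡ s y
    σM y = cong nxt (αM y)

    a-inv : ∀ y → a (a y) ≡ y
    a-inv = E.inv

    s-inj : ∀ {x y} → s x ≡ s y → x ≡ y
    s-inj {x} {y} q = trans (sym (a-inv x)) (trans (cong a (nxt-injective q)) (a-inv y))

    e-inj : ∀ {x y} → e x ≡ e y → x ≡ y
    e-inj {x} {y} q with ℕₚ.<-cmp (toℕ x) (toℕ y)
    ... | tri< lt _ _ = ⊥-elim (ℕₚ.<-irrefl (cong toℕ q) (E.e-mono lt))
    ... | tri≈ _ p _ = Finₚ.toℕ-injective p
    ... | tri> _ _ gt = ⊥-elim (ℕₚ.<-irrefl (cong toℕ (sym q)) (E.e-mono gt))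

    e-iter : ∀ j x → iter s j (e x) ≡ e (iter (σ S) j x)
    e-iter = iter-map e (σ S) s E.e-σ

    s-iter-inj : ∀ j {x y} → iter s j x ≡ iter s j y → x ≡ y
    s-iter-inj zero    q = q
    s-iter-inj (suc j) q = s-iter-inj j (s-inj q)

    iter-swap : ∀ i j y → iter s i (iter s j y) ≡ iter s j (iter s i y)
    iter-swap i j y = trans (iter-+ s i j y) (trans (cong (λ z → iter s z y) (ℕₚ.+-comm i j)) (sym (iter-+ s j i y)))

  valid-map : Valid map′
  valid-map = (λ h → trans (αM _) (trans (cong a (αM h)) (a-inv h)))
            , (λ h q p → E.a-edge h (trans (sym (κM h)) q) (trans (sym (αM h)) p))
            , (λ h q → trans (αM h) (E.a-stem h (q ∘ trans (κM h))))
            , trans (κM zero) (trans (cong k (sym E.e-zero)) (trans (E.e-κ zero) (proj₂ (proj₂ (proj₂ valid)))))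

  private
    loop : ∀ y → iter s 4 y ≡ y
    loop y with E.cover y
    ... | inj₁ (x , refl) = trans (e-iter 4 x) (cong e (proj₁ (four x)))
    ... | inj₂ (b , A , j , refl , _ , lp , _) = trans (iter-swap 4 (toℕ j) b) (cong (iter s (toℕ j)) lp)

    apart : ∀ y j → 0 < j → j < 4 → iter s j y ≢ y
    apart y j lo hi q with E.cover y
    ... | inj₁ (x , refl) = proj₂ (four x) j lo hi (e-inj (trans (sym (e-iter j x)) q))
    ... | inj₂ (b , A , i , refl , _ , lp , dist) = zero≢ (dist (fromℕ< hi) 0F
          (trans (cong (λ z → iter s z b) (Finₚ.toℕ-fromℕ< hi)) (s-iter-inj (toℕ i) (trans (sym (iter-swap j (toℕ i) b)) q))))
      where
      zero≢ : fromℕ< hi ≢ 0F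
      zero≢ p = ℕₚ.<-irrefl (trans (sym (cong toℕ p)) (Finₚ.toℕ-fromℕ< hi)) lo

  four-map : FourValent map′
  four-map h = trans (iter-cong σM 4 h) (loop h) , (λ j lo hi q → apart h j lo hi (trans (sym (iter-cong σM j h)) q))

  open Reaching map′ valid-map four-map using (Path; Vertex; path-reach; reach-reverse; a-edge; inv) renaming (loop to loop-map)

  private
    walk-path : ∀ w {h t x} → Walking.Walk a k E.piece x h w t → Path h w t
    walk-path []      {h} (_ , q) = trans (αM h) q
    walk-path (A ∷ w) {h} (_ , pat , wk) = ((λ j → trans (κM _) (trans (cong k (trans (iter-cong σM (toℕ j) (α M h)) (cong (turn j) (αM h)))) (pat j)))
        , loop-map (α M h))
      , subst (λ z → Path z w _) (sym (trans (iter-cong σM (toℕ (exit A)) (α M h)) (cong (turn (exit A)) (αM h)))) (walk-path w wk)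

  model-map : Model S d (α map′) (κ map′) e
  model-map = record
    { inv = proj₁ valid-map ; a-stem = proj₁ (proj₂ (proj₂ valid-map)) ; e-zero = E.e-zero ; e-inj = e-inj
    ; e-κ = λ x → trans (κM (e x)) (E.e-κ x) ; e-σ = λ x → trans (σM (e x)) (E.e-σ x)
    ; path = λ x f → walk-path (d x) (E.walk x f) }

  private
    degM : ∀ y → intDeg M y ≡ degree s k y
    degM = degree-cong σM κM

    deg-e : ∀ x → 3 ≤ intDeg M (e x)
    deg-e x = subst (3 ≤_) (sym (Model.degree-e model-map x)) (deg x)

    deg-path : ∀ {y} → OnPath y → intDeg M y ≡ 2
    deg-path (b , A , j , refl , pat , lp , _) = trans (degM _) (Paths.degree-vertex a k {A} (pat , lp) j)

    -- By `closed` the word of each path has the displacement its ends require, so the discrepancy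
    -- left on the first edge is zero.
    second-e : ∀ y → k y ≡ edge → y Fin.< a y → L y ≡ L (nxt y)
    second-e y q lt with E.L-edge y q lt
    ... | inj₂ p = p
    ... | inj₁ (x , f , refl) = ℤ+.∙-cancelʳ (disp (d x)) (L (e x)) (L (nxt (e x)))
            (trans (cong (_+ᶻ disp (d x)) (E.L-e x)) (trans (sym (closed x f)) (E.L-gap x f)))

    rule-at : ∀ {K} y → k y ≡ K → Rule K (a y) y (L y) (L (s y))
    rule-at y q = subst (λ K → Rule K (a y) y (L y) (L (s y))) q (E.L-rule y)

    edge-a : ∀ y → k y ≡ edge → k (a y) ≡ edge
    edge-a y q = trans (sym (κM (a y))) (trans (cong (κ M) (sym (αM y))) (a-edge y (trans (κM y) q)))

    edge-label : ∀ y → k y ≡ edge → L y ≡ L (nxt y)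
    edge-label y q with ℕₚ.<-cmp (toℕ y) (toℕ (a y))
    ... | tri< lt _ _ = second-e y q lt
    ... | tri≈ _ p _ = ⊥-elim (E.a-edge y q (sym (Finₚ.toℕ-injective p)))
    ... | tri> _ _ gt = ℤ+.∙-cancelʳ (+ 1) (L y) (L (nxt y)) (begin
          L y +ᶻ + 1          ≡⟨ proj₁ (rule-at y q) gt ⟨
          L (nxt (a y))       ≡⟨ second-e (a y) (edge-a y q) lt′ ⟨
          L (a y)             ≡⟨ proj₂ (rule-at (a y) (edge-a y q)) lt′ ⟩
          L (s (a y)) +ᶻ + 1  ≡⟨ cong (λ z → L (nxt z) +ᶻ + 1) (a-inv y) ⟩
          L (nxt y) +ᶻ + 1 ∎)
      where
      open ≡-Reasoning
      lt′ : a y Fin.< a (a y)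
      lt′ = subst (a y Fin.<_) (sym (a-inv y)) gt

    contour-label : ∀ y → L (nxt y) ≡ L y +ᶻ δ (k y)
    contour-label y = go (k y) refl
      where
      stem : k y ≢ edge → s y ≡ nxt y
      stem ne = cong nxt (E.a-stem y ne)
      go : ∀ K → k y ≡ K → L (nxt y) ≡ L y +ᶻ δ K
      go edge q = trans (sym (edge-label y q)) (sym (ℤₚ.+-identityʳ (L y)))
      go bud  q = trans (cong L (sym (stem (λ p → case′ (trans (sym q) p))))) (rule-at y q)
        where
        case′ : bud ≢ edge
        case′ ()
      go leaf q = trans (cong L (sym (stem (λ p → case′ (trans (sym q) p))))) (sym (trans (cong (_+ᶻ -[1+ 0 ]) (rule-at y q)) (lem (L (s y)))))
        where
        case′ : leaf ≢ edge
        case′ ()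
        lem : ∀ z → z +ᶻ + 1 +ᶻ -[1+ 0 ] ≡ z
        lem z = trans (ℤₚ.+-assoc z (+ 1) -[1+ 0 ]) (ℤₚ.+-identityʳ z)

    -- The canonical labeling is determined by its value 0 at the root and its increments along the
    -- contour, and `L` has the same ones.
    label-at : ∀ i (y : Fin (suc m)) → toℕ y ≡ i → label M y ≡ L y
    label-at zero    zero    q = sym (trans (cong L (sym E.e-zero)) (trans (E.L-e zero) L₀-zero))
    label-at (suc i) (suc y) q = begin
      label M (suc y)
        ≡⟨ cong (λ z → sumℤ (map δ (take (suc z) (toList (tabulate k))))) (Finₚ.toℕ-inject₁ y) ⟨
      sumℤ (map δ (take (suc (toℕ p)) (toList (tabulate k))))       ≡⟨ label-prefix-suc (tabulate k) p ⟩
      label M p +ᶻ δ (κ M p)                                        ≡⟨ cong₂ _+ᶻ_ (label-at i p (trans (Finₚ.toℕ-inject₁ y) (ℕₚ.suc-injective q))) (cong δ (κM p)) ⟩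
      L p +ᶻ δ (k p)                                                ≡⟨ contour-label p ⟨
      L (nxt p)                                                     ≡⟨ cong L (Finₚ.toℕ-injective (trans (toℕ-nxt p (subst (_< m) (sym (Finₚ.toℕ-inject₁ y)) (Finₚ.toℕ<n y))) (cong suc (Finₚ.toℕ-inject₁ y)))) ⟩
      L (suc y) ∎
      where
      open ≡-Reasoning
      p : Fin (suc m)
      p = Fin.inject₁ y

  label-map : ∀ y → label map′ y ≡ L y
  label-map y = label-at (toℕ y) y refl

  label-e : ∀ x → label map′ (e x) ≡ L₀ x
  label-e x = trans (label-map (e x)) (E.L-e x)

  private
    well-labeled : WellLabeled M
    well-labeled = (λ h q → trans (label-map h) (trans (edge-label h (trans (sym (κM h)) q))
                     (sym (trans (label-map _) (cong L (trans (cong (next M) (trans (αM _) (cong a (αM h)))) (cong nxt (a-inv h))))))))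
                 , (λ h o → trans (label-map _) (trans (cong L (σM h)) (trans (out h (κ M h) refl o) (cong (_+ᶻ + 1) (sym (label-map h))))))
                 , (λ h o → trans (label-map h) (trans (inn h (κ M h) refl o) (cong (_+ᶻ + 1) (trans (cong L (sym (σM h))) (sym (label-map _))))))
      where
      out : ∀ h K → κ M h ≡ K → outK M h K → L (s h) ≡ L h +ᶻ + 1
      out h edge q o = proj₁ (rule-at h (trans (sym (κM h)) q)) (subst (Fin._< h) (αM h) o)
      out h bud  q o = rule-at h (trans (sym (κM h)) q)
      inn : ∀ h K → κ M h ≡ K → ¬ outK M h K → L h ≡ L (s h) +ᶻ + 1
      inn h leaf q o = rule-at h (trans (sym (κM h)) q)
      inn h bud  q o = ⊥-elim (o _)
      inn h edge q o with ℕₚ.<-cmp (toℕ h) (toℕ (a h))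
      ... | tri< lt _ _ = proj₂ (rule-at h (trans (sym (κM h)) q)) lt
      ... | tri≈ _ p _ = ⊥-elim (E.a-edge h (trans (sym (κM h)) q) (sym (Finₚ.toℕ-injective p)))
      ... | tri> _ _ gt = ⊥-elim (o (subst (Fin._< h) (sym (αM h)) gt))

  inR-map : InR map′
  inR-map = valid-map , four-map , two , subst (λ z → 3 ≤ intDeg M z) E.e-zero (deg-e zero) , well-labeled
    where
    two : ∀ h → 2 ≤ intDeg M h
    two h with E.cover h
    ... | inj₁ (x , refl) = ℕₚ.<⇒≤ (deg-e x)
    ... | inj₂ p = ℕₚ.≤-reflexive (sym (deg-path p))

  emb-map : SchemeEmb map′ S e
  emb-map = (λ x y → E.e-mono) , onto , deg-e , (λ x → sym (Model.e-κ model-map x)) , reach , proj₁ (proj₂ (proj₂ valid))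
    where
    onto : ∀ h → 3 ≤ intDeg M h → ∃[ x ] e x ≡ h
    onto h d₃ with E.cover h
    ... | inj₁ (x , q) = x , sym q
    ... | inj₂ p = ⊥-elim (ℕₚ.<-irrefl (sym (deg-path p)) d₃)
    forth : ∀ x → First S x → Reach M (e x) (e (α S x))
    forth x f = path-reach (d x) (deg-e (α S x)) (Model.path model-map x f)
    κe : ∀ x → κ S x ≡ edge → κ M (e x) ≡ edge
    κe x q = trans (Model.e-κ model-map x) q
    α-edge : ∀ x → κ S x ≡ edge → κ S (α S x) ≡ edge
    α-edge x q with edge? (κ S (α S x))
    ... | yes p = p
    ... | no ne = ⊥-elim (proj₁ (proj₂ valid) x q (trans (sym (proj₁ (proj₂ (proj₂ valid)) (α S x) ne)) (proj₁ valid x)))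
    reach : ∀ x → κ S x ≡ edge → Reach M (e x) (e (α S x))
    reach x q with ℕₚ.<-cmp (toℕ x) (toℕ (α S x))
    ... | tri< lt _ _ = forth x (q , lt)
    ... | tri≈ _ p _ = ⊥-elim (proj₁ (proj₂ valid) x q (sym (Finₚ.toℕ-injective p)))
    ... | tri> _ _ gt = reach-reverse (κe (α S x) (α-edge x q))
            (subst (λ z → Reach M (e (α S x)) (e z)) (proj₁ valid x)
              (forth (α S x) (α-edge x q , subst (α S x Fin.<_) (sym (proj₁ valid x)) gt)))
            (subst (Reach M (α M (e (α S x)))) (inv (e (α S x)))
              (stop (subst (λ z → 3 ≤ intDeg M z) (sym (inv (e (α S x)))) (deg-e (α S x)))))

  leaves-map : leaves map′ ≡ leaves S + sum (length ∘ d)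
  leaves-map = trans (leaves-sum (tabulate k)) (trans (sum-cong (λ y → cong leafInd (κM y))) (trans E.leaves′
    (cong (_+ sum (length ∘ d)) (sym (leaves-sum (BMap.kinds S))))))
    where
    open import Algebra.Properties.CommutativeMonoid.Sum ℕₚ.+-0-commutativeMonoid using () renaming (sum-cong-≗ to sum-cong)

  scheme-half-edges : HE S → HE map′
  scheme-half-edges = e

-- Heights, gaps and cuts

indicator : Bool → ℕ
indicator b = if b then 1 else 0

prefix : ∀ {r} → (Fin r → ℕ) → ℕ → ℕ
prefix {zero}  f j       = 0
prefix {suc r} f zero    = 0
prefix {suc r} f (suc j) = f zero + prefix (f ∘ suc) j

prefix-zero : ∀ {r} (f : Fin r → ℕ) → prefix f 0 ≡ 0
prefix-zero {zero}  f = refl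
prefix-zero {suc r} f = refl

prefix-suc : ∀ {r} (f : Fin r → ℕ) k → prefix f (suc (toℕ k)) ≡ prefix f (toℕ k) + f k
prefix-suc f zero    = trans (cong (λ z → f zero + z) (prefix-zero (f ∘ suc))) (ℕₚ.+-identityʳ (f zero))
prefix-suc f (suc k) = trans (cong (λ z → f zero + z) (prefix-suc (f ∘ suc) k)) (sym (ℕₚ.+-assoc (f zero) _ _))

span : ℕ → ℕ → ℕ → ℕ
span p q i = indicator (not (i <ᵇ p) ∧ (i <ᵇ q))

sum-zero-terms : ∀ {r} (f : Fin r → ℕ) → (∀ i → f i ≡ 0) → sum f ≡ 0
sum-zero-terms {zero}  f e = refl
sum-zero-terms {suc r} f e = cong₂ _+_ (e zero) (sum-zero-terms (f ∘ suc) (e ∘ suc))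

prefix-span : ∀ {r} (f : Fin r → ℕ) p q → p ≤ q → prefix f q ≡ prefix f p + sum (λ i → span p q (toℕ i) * f i)
prefix-span {zero}  f p       q       le = refl
prefix-span {suc r} f zero    zero    le = sym (sum-zero-terms {suc r} (λ i → span 0 0 (toℕ i) * f i) (λ i → refl))
prefix-span {suc r} f zero    (suc q) le = cong₂ _+_ (sym (ℕₚ.+-identityʳ (f zero)))
  (trans (prefix-span (f ∘ suc) 0 q z≤n) (cong (_+ sum (λ i → span 0 q (toℕ i) * f (suc i))) (prefix-zero (f ∘ suc))))
prefix-span {suc r} f (suc p) (suc q) (s≤s le) = trans (cong (λ z → f zero + z) (prefix-span (f ∘ suc) p q le)) (sym (ℕₚ.+-assoc (f zero) _ _))

span-empty : ∀ p q i → q ≤ p → span p q i ≡ 0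
span-empty p q i le with i <ᵇ p in eq | i <ᵇ q in eq′
... | true  | _     = refl
... | false | false = refl
... | false | true  = ⊥-elim (subst IsTrue eq (ℕₚ.<⇒<ᵇ (ℕₚ.<-≤-trans (ℕₚ.<ᵇ⇒< i q (subst IsTrue (sym eq′) _)) le)))

-- Cut i lies between positions i and i + 1 of the enumeration. The value is 1 if it separates p
-- from q, in either order, and 0 otherwise.
cut : ℕ → ℕ → ℕ → ℕ
cut p q i = span p q i + span q p i

cut-comm : ∀ p q i → cut p q i ≡ cut q p i
cut-comm p q i = ℕₚ.+-comm (span p q i) (span q p i)

cut-< : ∀ {p q} i → p ≤ q → cut p q i ≡ span p q i
cut-< {p} {q} i le = trans (cong (λ z → span p q i + z) (span-empty q p i le)) (ℕₚ.+-identityʳ (span p q i))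

along : ∀ {r} → (Fin r → ℕ) → ℕ → ℕ → ℕ
along f p q = sum (λ i → cut p q (toℕ i) * f i)

prefix-along : ∀ {r} (f : Fin r → ℕ) p q → p ≤ q → prefix f q ≡ prefix f p + along f p q
prefix-along f p q le = trans (prefix-span f p q le) (cong (λ z → prefix f p + z) (sum-cong-≗ (λ i → cong (_* f i) (sym (cut-< (toℕ i) le)))))

along-comm : ∀ {r} (f : Fin r → ℕ) p q → along f p q ≡ along f q p
along-comm f p q = sum-cong-≗ (λ i → cong (_* f i) (cut-comm p q (toℕ i)))

along-+ : ∀ {r} (f g : Fin r → ℕ) p q → along (λ i → f i + g i) p q ≡ along f p q + along g p q
along-+ f g p q = trans (sum-cong-≗ (λ i → ℕₚ.*-distribˡ-+ (cut p q (toℕ i)) (f i) (g i))) (∑-distrib-+ (λ i → cut p q (toℕ i) * f i) (λ i → cut p q (toℕ i) * g i))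

ltᵈ : ∀ {n} → Bool → Fin n → Fin n → Set
ltᵈ true  a b = a Fin.< b
ltᵈ false a b = b Fin.< a

ltᵈ? : ∀ {n} dir (a b : Fin n) → Dec (ltᵈ dir a b)
ltᵈ? true  a b = a Fin.<? b
ltᵈ? false a b = b Fin.<? a

ltᵈ-trans : ∀ {n} dir {a b c : Fin n} → ltᵈ dir a b → ltᵈ dir b c → ltᵈ dir a c
ltᵈ-trans true  p q = ℕₚ.<-trans p q
ltᵈ-trans false p q = ℕₚ.<-trans q p

ltᵈ-asym : ∀ {n} dir {a b : Fin n} → ltᵈ dir a b → ¬ ltᵈ dir b a
ltᵈ-asym true  = ℕₚ.<-asym
ltᵈ-asym false = ℕₚ.<-asym

ltᵈ-connex : ∀ {n} dir {a b : Fin n} → a ≢ b → ¬ ltᵈ dir b a → ltᵈ dir a b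
ltᵈ-connex true  ne nlt = ℕₚ.≤∧≢⇒< (ℕₚ.≮⇒≥ nlt) (ne ∘ Finₚ.toℕ-injective)
ltᵈ-connex false ne nlt = ℕₚ.≤∧≢⇒< (ℕₚ.≮⇒≥ nlt) (ne ∘ sym ∘ Finₚ.toℕ-injective)

ltᵈ-not : ∀ {n} dir {a b : Fin n} → ltᵈ dir a b → ltᵈ (not dir) b a
ltᵈ-not true  p = p
ltᵈ-not false p = p

-- Heights decreasing along the enumeration are reduced to increasing ones by negation.
signed : Bool → ℤ → ℤ
signed true  z = z
signed false z = ℤ.- z

signed-+ : ∀ dir y z → signed dir (y +ᶻ z) ≡ signed dir y +ᶻ signed dir z
signed-+ true  y z = refl
signed-+ false y z = ℤₚ.neg-distrib-+ y z

signed-involutive : ∀ dir z → signed dir (signed dir z) ≡ z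
signed-involutive true  z = refl
signed-involutive false z = ℤₚ.neg-involutive z

∣signed∣ : ∀ dir z → ℤ.∣ signed dir z ∣ ≡ ℤ.∣ z ∣
∣signed∣ true  z = refl
∣signed∣ false z = ℤₚ.∣-i∣≡∣i∣ z

module Named (r : ℕ) (name : Fin (suc r) → Fin (suc r)) (name-injective : ∀ {i j} → name i ≡ name j → i ≡ j) where

  private
    steps : ∀ k → name (inject₁ k) ≢ name (suc k)
    steps k e = ℕₚ.<⇒≢ (ℕₚ.n<1+n (toℕ k)) (trans (sym (Finₚ.toℕ-inject₁ k)) (cong toℕ (name-injective e)))

  -- Neighbours in the height order may be level only if their names ascend, so this is the least
  -- admissible rise at cut k; the gap counts what exceeds it.
  desc : Bool → Fin r → ℕ
  desc dir k = indicator (does (ltᵈ? dir (name (suc k)) (name (inject₁ k))))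

  desc-yes : ∀ dir k → ltᵈ dir (name (suc k)) (name (inject₁ k)) → desc dir k ≡ 1
  desc-yes dir k lt = cong indicator (dec-true (ltᵈ? dir (name (suc k)) (name (inject₁ k))) lt)

  desc-no : ∀ dir k → ltᵈ dir (name (inject₁ k)) (name (suc k)) → desc dir k ≡ 0
  desc-no dir k lt = cong indicator (dec-false (ltᵈ? dir (name (suc k)) (name (inject₁ k))) (ltᵈ-asym dir lt))

  ascending : ∀ dir k → desc dir k ≡ 0 → ltᵈ dir (name (inject₁ k)) (name (suc k))
  ascending dir k e = ltᵈ-connex dir (steps k) (λ lt → case01 (trans (sym (desc-yes dir k lt)) e))
    where
    case01 : 1 ≡ 0 → ⊥
    case01 ()

  -- Distinct names ascend in exactly one direction. The complementarity of the two orders rests on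
  -- this.
  desc-both : ∀ k → desc true k + desc false k ≡ 1
  desc-both k with ltᵈ? true (name (suc k)) (name (inject₁ k))
  ... | yes lt = cong₂ _+_ (desc-yes true k lt) (desc-no false k lt)
  ... | no nlt = let lt = ltᵈ-connex true (steps k) nlt in cong₂ _+_ (desc-no true k lt) (desc-yes false k lt)

  Lex : Bool → (Fin (suc r) → ℤ) → Fin (suc r) → Fin (suc r) → Set
  Lex dir U i j = (U i ℤ.< U j) ⊎ (U i ≡ U j × ltᵈ dir (name i) (name j))

  lex-trans : ∀ dir U {i j k} → Lex dir U i j → Lex dir U j k → Lex dir U i k
  lex-trans dir U (inj₁ p)       (inj₁ q)         = inj₁ (ℤₚ.<-trans p q)
  lex-trans dir U {i} (inj₁ p)   (inj₂ (q , _))   = inj₁ (subst (λ z → U i ℤ.< z) q p)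
  lex-trans dir U {k = k} (inj₂ (p , _)) (inj₁ q) = inj₁ (subst (λ z → z ℤ.< U k) (sym p) q)
  lex-trans dir U (inj₂ (p , l)) (inj₂ (q , l′))  = inj₂ (trans p q , ltᵈ-trans dir l l′)

  lex-all : ∀ dir U → (∀ k → Lex dir U (inject₁ k) (suc k)) → ∀ i j → i Fin.< j → Lex dir U i j
  lex-all dir U adj i j lt = go (toℕ j) j refl lt
    where
    go : ∀ N j → toℕ j ≡ N → i Fin.< j → Lex dir U i j
    go (suc N) (suc k) e lt with toℕ i ℕ.≟ toℕ k
    ... | yes q = subst (λ z → Lex dir U z (suc k)) (Finₚ.toℕ-injective (trans (Finₚ.toℕ-inject₁ k) (sym q))) (adj k)
    ... | no ne = lex-trans dir U (go N (inject₁ k) (trans (Finₚ.toℕ-inject₁ k) (ℕₚ.suc-injective e))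
                    (subst (toℕ i <_) (sym (Finₚ.toℕ-inject₁ k)) (ℕₚ.≤∧≢⇒< (ℕₚ.≤-pred lt) ne))) (adj k)

  rise : Bool → Vec ℕ r → Fin r → ℕ
  rise dir g k = desc dir k + lookup g k

  elevation : Bool → Vec ℕ r → Fin (suc r) → ℕ
  elevation dir g j = prefix (rise dir g) (toℕ j)

  elevation-suc : ∀ dir g k → elevation dir g (suc k) ≡ elevation dir g (inject₁ k) + rise dir g k
  elevation-suc dir g k = trans (prefix-suc (rise dir g) k) (cong (λ z → prefix (rise dir g) z + rise dir g k) (sym (Finₚ.toℕ-inject₁ k)))

  elevation-lex : ∀ dir g i j → i Fin.< j → Lex dir (λ j → + elevation dir g j) i j
  elevation-lex dir g = lex-all dir _ adj
    where
    adj : ∀ k → Lex dir (λ j → + elevation dir g j) (inject₁ k) (suc k)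
    adj k with rise dir g k in eq
    ... | zero  = inj₂ (cong +_ (sym (trans (elevation-suc dir g k) (trans (cong (λ z → elevation dir g (inject₁ k) + z) eq) (ℕₚ.+-identityʳ _))))
                      , ascending dir k (ℕₚ.m+n≡0⇒m≡0 (desc dir k) eq))
    ... | suc n = inj₁ (ℤ.+<+ (subst (elevation dir g (inject₁ k) <_) (sym (trans (elevation-suc dir g k) (cong (λ z → elevation dir g (inject₁ k) + z) eq)))
                      (ℕₚ.m<m+n _ (s≤s z≤n))))

  lex-elevation : ∀ dir U → (∀ i j → i Fin.< j → Lex dir U i j) → Σ[ g ∈ Vec ℕ r ] (∀ j → U j ≡ U zero +ᶻ + elevation dir g j)
  lex-elevation dir U lex = g , λ j → go (toℕ j) j refl
    where
    excess : ∀ k → Σ[ x ∈ ℕ ] U (suc k) ≡ U (inject₁ k) +ᶻ + (desc dir k + x)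
    excess k with lex (inject₁ k) (suc k) (subst (_< suc (toℕ k)) (sym (Finₚ.toℕ-inject₁ k)) ℕₚ.≤-refl)
    ... | inj₂ (e , lt) = 0 , trans (sym e) (sym (trans (cong (λ z → U (inject₁ k) +ᶻ + (z + 0)) (desc-no dir k lt)) (ℤₚ.+-identityʳ _)))
    -- A strict rise is at least 1, hence at least `desc`, and the truncated subtraction is exact.
    ... | inj₁ lt = ∣Δ∣ ∸ desc dir k , trans (sym (lem (U (suc k)) (U (inject₁ k)))) (cong (U (inject₁ k) +ᶻ_)
            (trans (sym (ℤₚ.0≤i⇒+∣i∣≡i (ℤₚ.<⇒≤ pos))) (cong +_ (sym (ℕₚ.m+[n∸m]≡n (ℕₚ.≤-trans (desc≤1 k) one≤))))))
      where
      Δ : ℤ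
      Δ = U (suc k) ℤ.- U (inject₁ k)
      ∣Δ∣ : ℕ
      ∣Δ∣ = ℤ.∣ Δ ∣
      pos : + 0 ℤ.< Δ
      pos = subst (ℤ._< Δ) (ℤₚ.+-inverseʳ (U (inject₁ k))) (ℤₚ.+-monoˡ-< (ℤ.- U (inject₁ k)) lt)
      one≤ : 1 ≤ ∣Δ∣
      one≤ with Δ | pos
      ... | + suc n | _ = s≤s z≤n
      ... | + zero  | ℤ.+<+ ()
      desc≤1 : ∀ k → desc dir k ≤ 1
      desc≤1 k with does (ltᵈ? dir (name (suc k)) (name (inject₁ k)))
      ... | true  = s≤s z≤n
      ... | false = z≤n
      lem : ∀ a b → b +ᶻ (a ℤ.- b) ≡ a
      lem = ℤRing.solve-∀
    g : Vec ℕ r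
    g = tabulate (proj₁ ∘ excess)
    go : ∀ N j → toℕ j ≡ N → U j ≡ U zero +ᶻ + elevation dir g j
    go zero zero e = sym (trans (cong (λ z → U zero +ᶻ + z) (prefix-zero (rise dir g))) (ℤₚ.+-identityʳ (U zero)))
    go (suc N) (suc k) e = begin
      U (suc k)                                                     ≡⟨ proj₂ (excess k) ⟩
      U (inject₁ k) +ᶻ + (desc dir k + proj₁ (excess k))            ≡⟨ cong₂ (λ y z → y +ᶻ + (desc dir k + z))
                                                                        (go N (inject₁ k) (trans (Finₚ.toℕ-inject₁ k) (ℕₚ.suc-injective e)))
                                                                        (sym (Vecₚ.lookup∘tabulate (proj₁ ∘ excess) k)) ⟩
      U zero +ᶻ + elevation dir g (inject₁ k) +ᶻ + rise dir g k     ≡⟨ ℤₚ.+-assoc (U zero) _ _ ⟩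
      U zero +ᶻ + (elevation dir g (inject₁ k) + rise dir g k)      ≡⟨ cong (λ z → U zero +ᶻ + z) (elevation-suc dir g k) ⟨
      U zero +ᶻ + elevation dir g (suc k) ∎
      where open ≡-Reasoning

  elevation-injective : ∀ dir g g′ c c′ → (∀ j → c +ᶻ + elevation dir g j ≡ c′ +ᶻ + elevation dir g′ j) → g ≡ g′
  elevation-injective dir g g′ c c′ e = trans (sym (Vecₚ.tabulate∘lookup g)) (trans (Vecₚ.tabulate-cong same) (Vecₚ.tabulate∘lookup g′))
    where
    same : ∀ k → lookup g k ≡ lookup g′ k
    same k = ℕₚ.+-cancelˡ-≡ (desc dir k) _ _ (ℤₚ.+-injective (ℤ+.∙-cancelˡ (c +ᶻ + elevation dir g (inject₁ k)) _ _ (begin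
      c +ᶻ + elevation dir g (inject₁ k) +ᶻ + rise dir g k        ≡⟨ split c g k ⟨
      c +ᶻ + elevation dir g (suc k)                              ≡⟨ e (suc k) ⟩
      c′ +ᶻ + elevation dir g′ (suc k)                            ≡⟨ split c′ g′ k ⟩
      c′ +ᶻ + elevation dir g′ (inject₁ k) +ᶻ + rise dir g′ k     ≡⟨ cong (_+ᶻ + rise dir g′ k) (e (inject₁ k)) ⟨
      c +ᶻ + elevation dir g (inject₁ k) +ᶻ + rise dir g′ k ∎)))
      where
      open ≡-Reasoning
      split : ∀ c g k → c +ᶻ + elevation dir g (suc k) ≡ c +ᶻ + elevation dir g (inject₁ k) +ᶻ + rise dir g k
      split c g k = trans (cong (λ z → c +ᶻ + z) (elevation-suc dir g k)) (sym (ℤₚ.+-assoc c _ _))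

  -- The contribution of the types of its two half-edges to the displacement along an edge from p to q.
  data Tilt (dir : Bool) (p q : Fin (suc r)) : ℤ → Set where
    flat   : Tilt dir p q (+ 0)
    toward : ltᵈ dir (name p) (name q) → Tilt dir p q (+ 1)
    away   : ltᵈ dir (name q) (name p) → Tilt dir p q -[1+ 0 ]

  tilt-swap : ∀ {dir p q θ} → Tilt dir p q θ → Tilt dir q p (ℤ.- θ)
  tilt-swap flat       = flat
  tilt-swap (toward l) = away l
  tilt-swap (away l)   = toward l

  tilt-not : ∀ {dir p q θ} → Tilt dir p q θ → Tilt (not dir) p q (ℤ.- θ)
  tilt-not flat             = flat
  tilt-not {dir} (toward l) = away (ltᵈ-not dir l)
  tilt-not {dir} (away l)   = toward (ltᵈ-not dir l)

  climb : Bool → Vec ℕ r → Fin (suc r) → Fin (suc r) → ℤ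
  climb dir g p q = + elevation dir g q ℤ.- + elevation dir g p

  climb-along : ∀ dir g {p q} → p Fin.≤ q → climb dir g p q ≡ + along (rise dir g) (toℕ p) (toℕ q)
  climb-along dir g {p} {q} le = trans (cong (λ z → + z ℤ.- + elevation dir g p) (prefix-along (rise dir g) (toℕ p) (toℕ q) le))
    (lem (+ elevation dir g p) (+ along (rise dir g) (toℕ p) (toℕ q)))
    where
    lem : ∀ a b → a +ᶻ b ℤ.- a ≡ b
    lem = ℤRing.solve-∀

  along-desc-positive : ∀ dir {p q} → p Fin.< q → along (desc dir) (toℕ p) (toℕ q) ≡ 0 → ltᵈ dir (name p) (name q)
  -- Take all gaps minimal: without descents in between, p and q are then level, and their
  -- lexicographic order is that of their names.
  along-desc-positive dir {p} {q} lt e with elevation-lex dir (Vec.replicate r 0) p q lt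
  ... | inj₂ (_ , l) = l
  ... | inj₁ l = ⊥-elim (ℤₚ.<-irrefl (sym level) l)
    where
    level : + elevation dir (Vec.replicate r 0) q ≡ + elevation dir (Vec.replicate r 0) p
    level = cong +_ (trans (prefix-along (rise dir (Vec.replicate r 0)) (toℕ p) (toℕ q) (ℕₚ.<⇒≤ lt))
      (trans (cong (λ z → elevation dir (Vec.replicate r 0) p + z) (trans (sum-cong-≗ (λ i → cong (λ z → cut (toℕ p) (toℕ q) (toℕ i) * z)
          (trans (cong (λ z → desc dir i + z) (Vecₚ.lookup-replicate i 0)) (ℕₚ.+-identityʳ (desc dir i))))) e)) (ℕₚ.+-identityʳ _)))

  -- Consistency of the naming makes the displacement of every edge nonnegative in the direction of increasing height.
  tilted : ∀ {dir p q θ} → p Fin.< q → Tilt dir p q θ → Σ[ B ∈ ℕ ] + along (desc dir) (toℕ p) (toℕ q) +ᶻ θ ≡ + B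
  tilted {dir} {p} {q} lt flat       = along (desc dir) (toℕ p) (toℕ q) , ℤₚ.+-identityʳ _
  tilted {dir} {p} {q} lt (toward _) = along (desc dir) (toℕ p) (toℕ q) + 1 , refl
  tilted {dir} {p} {q} lt (away l) with along (desc dir) (toℕ p) (toℕ q) in eq
  ... | zero  = ⊥-elim (ltᵈ-asym dir l (along-desc-positive dir lt eq))
  ... | suc B = B , refl

  base : Bool → Fin (suc r) → Fin (suc r) → ℤ → ℕ
  base dir p q θ = ℤ.∣ climb dir (Vec.replicate r 0) p q +ᶻ θ ∣

  private
    rise-0 : ∀ dir k → rise dir (Vec.replicate r 0) k ≡ desc dir k
    rise-0 dir k = trans (cong (λ z → desc dir k + z) (Vecₚ.lookup-replicate k 0)) (ℕₚ.+-identityʳ (desc dir k))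

    climb-0 : ∀ dir {p q} → p Fin.≤ q → climb dir (Vec.replicate r 0) p q ≡ + along (desc dir) (toℕ p) (toℕ q)
    climb-0 dir {p} {q} le = trans (climb-along dir (Vec.replicate r 0) le)
      (cong +_ (sum-cong-≗ (λ i → cong (λ z → cut (toℕ p) (toℕ q) (toℕ i) * z) (rise-0 dir i))))

    ∣flip∣ : ∀ a b θ → ℤ.∣ a ℤ.- b +ᶻ θ ∣ ≡ ℤ.∣ b ℤ.- a +ᶻ ℤ.- θ ∣
    ∣flip∣ a b θ = trans (sym (ℤₚ.∣-i∣≡∣i∣ (a ℤ.- b +ᶻ θ))) (cong ℤ.∣_∣ (lem a b θ))
      where
      lem : ∀ a b θ → ℤ.- (a ℤ.- b +ᶻ θ) ≡ b ℤ.- a +ᶻ ℤ.- θ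
      lem = ℤRing.solve-∀

    level-tilt : ∀ {dir p θ} → Tilt dir p p θ → θ ≡ + 0
    level-tilt flat                = refl
    level-tilt {dir} (toward l)    = ⊥-elim (ltᵈ-asym dir l l)
    level-tilt {dir} (away l)      = ⊥-elim (ltᵈ-asym dir l l)

    along-level : ∀ (f : Fin r → ℕ) p → along f p p ≡ 0
    along-level f p = sum-zero-terms _ (λ i → cong (_* f i) (cong₂ _+_ (span-empty p p (toℕ i) ℕₚ.≤-refl) (span-empty p p (toℕ i) ℕₚ.≤-refl)))

  private
    level : ∀ dir g {p θ} → θ ≡ + 0 → ℤ.∣ climb dir g p p +ᶻ θ ∣ ≡ 0
    level dir g {p} refl = cong (λ z → ℤ.∣ z +ᶻ + 0 ∣) (ℤₚ.+-inverseʳ (+ elevation dir g p))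

  -- With minimal gaps the displacement is already nonnegative by `tilted`, and larger gaps only add
  -- to it, so the absolute value is additive.
  displacement-< : ∀ {dir p q θ} → p Fin.< q → Tilt dir p q θ → ∀ g → ℤ.∣ climb dir g p q +ᶻ θ ∣ ≡ base dir p q θ + along (lookup g) (toℕ p) (toℕ q)
  displacement-< {dir} {p} {q} {θ} lt T g with tilted lt T
  ... | B , e = begin
    ℤ.∣ climb dir g p q +ᶻ θ ∣     ≡⟨ cong (λ z → ℤ.∣ z +ᶻ θ ∣) (trans (climb-along dir g (ℕₚ.<⇒≤ lt)) (cong +_ (along-+ (desc dir) (lookup g) (toℕ p) (toℕ q)))) ⟩
    ℤ.∣ + A +ᶻ + G +ᶻ θ ∣          ≡⟨ cong ℤ.∣_∣ (trans (lem (+ A) (+ G) θ) (cong (_+ᶻ + G) e)) ⟩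
    B + G                          ≡⟨ cong (_+ G) (cong ℤ.∣_∣ e) ⟨
    ℤ.∣ + A +ᶻ θ ∣ + G             ≡⟨ cong (λ z → ℤ.∣ z +ᶻ θ ∣ + G) (climb-0 dir (ℕₚ.<⇒≤ lt)) ⟨
    base dir p q θ + G ∎
    where
    open ≡-Reasoning
    A G : ℕ
    A = along (desc dir) (toℕ p) (toℕ q)
    G = along (lookup g) (toℕ p) (toℕ q)
    lem : ∀ a g θ → a +ᶻ g +ᶻ θ ≡ a +ᶻ θ +ᶻ g
    lem = ℤRing.solve-∀

  displacement : ∀ {dir p q θ} → Tilt dir p q θ → ∀ g → ℤ.∣ climb dir g p q +ᶻ θ ∣ ≡ base dir p q θ + along (lookup g) (toℕ p) (toℕ q)
  displacement {dir} {p} {q} {θ} T g with ℕₚ.<-cmp (toℕ p) (toℕ q)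
  ... | tri< lt _ _ = displacement-< lt T g
  ... | tri≈ _ e _ with Finₚ.toℕ-injective e
  ... | refl = trans (level dir g (level-tilt T)) (sym (cong₂ _+_ (level dir (Vec.replicate r 0) (level-tilt T)) (along-level (lookup g) (toℕ p))))
  displacement {dir} {p} {q} {θ} T g | tri> _ _ gt = trans (∣flip∣ (+ elevation dir g q) (+ elevation dir g p) θ)
    (trans (displacement-< gt (tilt-swap T) g) (cong₂ _+_ (sym (∣flip∣ (+ elevation dir (Vec.replicate r 0) q) (+ elevation dir (Vec.replicate r 0) p) θ)) (along-comm (lookup g) (toℕ q) (toℕ p))))

  -- Both displacements are nonnegative, θ cancels against -θ, and every cut between p and q is a
  -- descent in exactly one direction.
  base-both-< : ∀ {p q θ} → p Fin.< q → Tilt true p q θ → base true p q θ + base false p q (ℤ.- θ) ≡ along {r} (λ _ → 1) (toℕ p) (toℕ q)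
  base-both-< {p} {q} {θ} lt T with tilted lt T | tilted lt (tilt-not T)
  ... | B , e | B′ , e′ = begin
    base true p q θ + base false p q (ℤ.- θ)  ≡⟨ cong₂ (λ y z → ℤ.∣ y +ᶻ θ ∣ + ℤ.∣ z +ᶻ ℤ.- θ ∣) (climb-0 true (ℕₚ.<⇒≤ lt)) (climb-0 false (ℕₚ.<⇒≤ lt)) ⟩
    ℤ.∣ + A +ᶻ θ ∣ + ℤ.∣ + A′ +ᶻ ℤ.- θ ∣       ≡⟨ cong₂ (λ y z → ℤ.∣ y ∣ + ℤ.∣ z ∣) e e′ ⟩
    B + B′                                    ≡⟨ ℤₚ.+-injective (trans (cong₂ _+ᶻ_ (sym e) (sym e′)) (lem (+ A) (+ A′) θ)) ⟩
    A + A′                                    ≡⟨ along-+ (desc true) (desc false) (toℕ p) (toℕ q) ⟨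
    along (λ k → desc true k + desc false k) (toℕ p) (toℕ q) ≡⟨ sum-cong-≗ (λ i → cong (λ z → cut (toℕ p) (toℕ q) (toℕ i) * z) (desc-both i)) ⟩
    along {r} (λ _ → 1) (toℕ p) (toℕ q) ∎
    where
    open ≡-Reasoning
    A A′ : ℕ
    A = along (desc true) (toℕ p) (toℕ q)
    A′ = along (desc false) (toℕ p) (toℕ q)
    lem : ∀ a b θ → a +ᶻ θ +ᶻ (b +ᶻ ℤ.- θ) ≡ a +ᶻ b
    lem = ℤRing.solve-∀

  base-both : ∀ {p q θ} → Tilt true p q θ → base true p q θ + base false p q (ℤ.- θ) ≡ along {r} (λ _ → 1) (toℕ p) (toℕ q)
  base-both {p} {q} {θ} T with ℕₚ.<-cmp (toℕ p) (toℕ q)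
  ... | tri< lt _ _ = base-both-< lt T
  ... | tri≈ _ e _ with Finₚ.toℕ-injective e
  ... | refl = trans (cong₂ _+_ (level true (Vec.replicate r 0) (level-tilt T)) (level false (Vec.replicate r 0) (cong ℤ.-_ (level-tilt T)))) (sym (along-level (λ _ → 1) (toℕ p)))
  base-both {p} {q} {θ} T | tri> _ _ gt = trans (cong₂ _+_ (∣flip∣ (+ elevation true (Vec.replicate r 0) q) (+ elevation true (Vec.replicate r 0) p) θ)
      (∣flip∣ (+ elevation false (Vec.replicate r 0) q) (+ elevation false (Vec.replicate r 0) p) (ℤ.- θ)))
    (trans (base-both-< gt (tilt-swap T)) (along-comm {r} (λ _ → 1) (toℕ q) (toℕ p)))

-- Maps with a given scheme and height order

FitAt : Maybe ℤ → List Arr → Set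
FitAt nothing  w = w ≡ []
FitAt (just Δ) w = disp w ≡ Δ

fit-lookup : ∀ {n} (f : Fin n → Maybe ℤ) ws → Fit (tabulate f) ws → ∀ x → FitAt (f x) (lookup ws x)
fit-lookup f (w ∷ ws) F zero with f zero
... | nothing = proj₁ F
... | just Δ  = proj₁ F
fit-lookup f (w ∷ ws) F (suc x) with f zero
... | nothing = fit-lookup (f ∘ suc) ws (proj₂ F) x
... | just Δ  = fit-lookup (f ∘ suc) ws (proj₂ F) x

fit-tabulate : ∀ {n} (f : Fin n → Maybe ℤ) ws → (∀ x → FitAt (f x) (lookup ws x)) → Fit (tabulate f) ws
fit-tabulate {zero}  f []       F = tt
fit-tabulate {suc n} f (w ∷ ws) F with f zero | F zero
... | nothing | p = p , fit-tabulate (f ∘ suc) ws (F ∘ suc)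
... | just Δ  | p = p , fit-tabulate (f ∘ suc) ws (F ∘ suc)

totalLength-sum : ∀ {n} (ws : Vec (List Arr) n) → totalLength ws ≡ sum (length ∘ lookup ws)
totalLength-sum []       = refl
totalLength-sum (w ∷ ws) = cong (λ z → length w + z) (totalLength-sum ws)

spanAt edgesAt : Maybe ℤ → ℕ
spanAt nothing   = 0
spanAt (just Δ)  = ℤ.∣ Δ ∣
edgesAt nothing  = 0
edgesAt (just Δ) = 1

specSpan-sum : ∀ {n} (f : Fin n → Maybe ℤ) → specSpan (tabulate f) ≡ sum (spanAt ∘ f)
specSpan-sum {zero}  f = refl
specSpan-sum {suc n} f with f zero
... | nothing = specSpan-sum (f ∘ suc)
... | just Δ  = cong (λ z → ℤ.∣ Δ ∣ + z) (specSpan-sum (f ∘ suc))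

specEdges-sum : ∀ {n} (f : Fin n → Maybe ℤ) → specEdges (tabulate f) ≡ sum (edgesAt ∘ f)
specEdges-sum {zero}  f = refl
specEdges-sum {suc n} f with f zero
... | nothing = specEdges-sum (f ∘ suc)
... | just Δ  = cong suc (specEdges-sum (f ∘ suc))

sum-*ˡ : ∀ {n} c (f : Fin n → ℕ) → c * sum f ≡ sum (λ i → c * f i)
sum-*ˡ {zero}  c f = ℕₚ.*-zeroʳ c
sum-*ˡ {suc n} c f = trans (ℕₚ.*-distribˡ-+ c (f zero) _) (cong (λ z → c * f zero + z) (sum-*ˡ c (f ∘ suc)))

sum-*ʳ : ∀ {n} c (f : Fin n → ℕ) → sum f * c ≡ sum (λ i → f i * c)
sum-*ʳ c f = trans (ℕₚ.*-comm (sum f) c) (trans (sum-*ˡ c f) (sum-cong-≗ (λ i → ℕₚ.*-comm c (f i))))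

dot-sum : ∀ {r} (c : Fin r → ℕ) (g : Vec ℕ r) → dot (tabulate c) g ≡ sum (λ i → suc (c i) * lookup g i)
dot-sum c []      = refl
dot-sum c (j ∷ g) = cong (λ z → suc (c zero) * j + z) (dot-sum (c ∘ suc) g)

totalWeight-sum : ∀ {r} (c : Fin r → ℕ) → totalWeight (tabulate c) ≡ sum (λ i → suc (c i))
totalWeight-sum {zero}  c = refl
totalWeight-sum {suc r} c = cong (λ z → suc (c zero) + z) (totalWeight-sum (c ∘ suc))

sum-zero⁻ : ∀ {n} (f : Fin n → ℕ) → sum f ≡ 0 → ∀ i → f i ≡ 0
sum-zero⁻ f e zero    = ℕₚ.m+n≡0⇒m≡0 (f zero) e
sum-zero⁻ f e (suc i) = sum-zero⁻ (f ∘ suc) (ℕₚ.m+n≡0⇒n≡0 (f zero) e) i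

rule-shift : ∀ {n} K {y′ y : Fin n} c {l l′} → Rule K y′ y l l′ → Rule K y′ y (c +ᶻ l) (c +ᶻ l′)
rule-shift edge c (p , q) = (λ lt → trans (cong (c +ᶻ_) (p lt)) (sym (ℤₚ.+-assoc c _ (+ 1))))
                          , (λ lt → trans (cong (c +ᶻ_) (q lt)) (sym (ℤₚ.+-assoc c _ (+ 1))))
rule-shift leaf c p = trans (cong (c +ᶻ_) p) (sym (ℤₚ.+-assoc c _ (+ 1)))
rule-shift bud  c p = trans (cong (c +ᶻ_) p) (sym (ℤₚ.+-assoc c _ (+ 1)))

-- Both labelings change by the same ±1 across a half-edge. Labels and relative labels therefore
-- differ by a constant around each vertex, which is its height.
rule-difference : ∀ {n} K {y′ y : Fin n} {l l′ m m′} → (K ≡ edge → y′ ≢ y) → Rule K y′ y l l′ → Rule K y′ y m m′ → l′ ℤ.- m′ ≡ l ℤ.- m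
rule-difference {n} K {y′} {y} {l} {l′} {m} {m′} ne R R′ = go K ne R R′
  where
  lem : ∀ l m → (l +ᶻ + 1) ℤ.- (m +ᶻ + 1) ≡ l ℤ.- m
  lem = ℤRing.solve-∀
  plus : l′ ≡ l +ᶻ + 1 → m′ ≡ m +ᶻ + 1 → l′ ℤ.- m′ ≡ l ℤ.- m
  plus p q = trans (cong₂ ℤ._-_ p q) (lem l m)
  minus : l ≡ l′ +ᶻ + 1 → m ≡ m′ +ᶻ + 1 → l′ ℤ.- m′ ≡ l ℤ.- m
  minus p q = sym (trans (cong₂ ℤ._-_ p q) (lem l′ m′))
  go : ∀ K → (K ≡ edge → y′ ≢ y) → Rule K y′ y l l′ → Rule K y′ y m m′ → l′ ℤ.- m′ ≡ l ℤ.- m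
  go leaf ne p q = minus p q
  go bud  ne p q = plus p q
  go edge ne (p , p′) (q , q′) with ℕₚ.<-cmp (toℕ y′) (toℕ y)
  ... | tri< lt _ _ = plus (p lt) (q lt)
  ... | tri≈ _ e _ = ⊥-elim (ne refl (Finₚ.toℕ-injective e))
  ... | tri> _ _ gt = minus (p′ gt) (q′ gt)

add-difference : ∀ a b → b +ᶻ (a ℤ.- b) ≡ a
add-difference = ℤRing.solve-∀

Ltᶻ : Bool → ℤ → ℤ → Set
Ltᶻ true  x y = x ℤ.< y
Ltᶻ false x y = y ℤ.< x

signed-< : ∀ dir {x y} → signed dir x ℤ.< signed dir y → Ltᶻ dir x y
signed-< true  p = p
signed-< false p = ℤₚ.neg-cancel-< p

signed-<⁻ : ∀ dir {x y} → Ltᶻ dir x y → signed dir x ℤ.< signed dir y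
signed-<⁻ true  p = p
signed-<⁻ false p = ℤₚ.neg-mono-< p

signed-injective : ∀ dir {x y} → signed dir x ≡ signed dir y → x ≡ y
signed-injective dir {x} {y} e = trans (sym (signed-involutive dir x)) (trans (cong (signed dir) e) (signed-involutive dir y))

Model-cong : ∀ {S d d′ m a k e} → (∀ x → d x ≡ d′ x) → Model S d {m} a k e → Model S d′ {m} a k e
Model-cong {S} {a = a} {k} {e} q M = record { inv = inv ; a-stem = a-stem ; e-zero = e-zero ; e-inj = e-inj ; e-κ = e-κ ; e-σ = e-σ
  ; path = λ x f → subst (λ w → Paths.Path a k (e x) w (e (α S x))) (q x) (path x f) }
  where open Model M

-- Maps encoded by gaps and words

module Class (S : BMap) (valid : Valid S) (four : FourValent S) (deg : ∀ x → 3 ≤ intDeg S x)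
  (r : ℕ) (ν : HE S → Fin (suc r)) (π : Fin (suc r) → HE S)
  (naming : Naming S (suc r) ν) (enum : VertexEnum S (suc r) π)
  (rl : HE S → ℤ) (relative : RelLabeling S rl)
  (consistent : ∀ x → κ S x ≡ edge → Type0 S rl x → Type1 S rl (α S x) → ν x Fin.< ν (α S x)) where

  open Vertices S valid four (suc r) π enum public
  open Reaching S valid four using (turn; sameVertex-turn)

  name : Fin (suc r) → Fin (suc r)
  name = ν ∘ π

  name-injective : ∀ {i j} → name i ≡ name j → i ≡ j
  name-injective {i} {j} e = proj₁ enum i j (proj₁ (proj₂ naming) (π i) (π j) e)

  name-pos : ∀ x → name (pos x) ≡ ν x
  name-pos x = proj₁ naming (π (pos x)) x (pos-vertex x)

  open Named r name name-injective public

  pos-σ : ∀ x → pos (σ S x) ≡ pos x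
  pos-σ x = sym (pos-same (1 , refl))

  rl-rule : ∀ x → Rule (κ S x) (α S x) x (rl x) (rl (σ S x))
  rl-rule = outRule S rl (proj₁ relative) (proj₁ (proj₂ relative))

  -- Gaps determine heights only up to a common shift; this one gives the root corner the label 0.
  height₀ : Bool → Vec ℕ r → ℤ
  height₀ dir g = ℤ.- (signed dir (+ elevation dir g (pos zero)) +ᶻ rl zero)

  heights : Bool → Vec ℕ r → Fin (suc r) → ℤ
  heights dir g i = height₀ dir g +ᶻ signed dir (+ elevation dir g i)

  lab : Bool → Vec ℕ r → HE S → ℤ
  lab dir g x = heights dir g (pos x) +ᶻ rl x

  lab-zero : ∀ dir g → lab dir g zero ≡ + 0
  lab-zero dir g = lem (signed dir (+ elevation dir g (pos zero))) (rl zero)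
    where
    lem : ∀ a b → ℤ.- (a +ᶻ b) +ᶻ a +ᶻ b ≡ + 0
    lem = ℤRing.solve-∀

  lab-rule : ∀ dir g x → Rule (κ S x) (α S x) x (lab dir g x) (lab dir g (σ S x))
  lab-rule dir g x = subst (λ i → Rule (κ S x) (α S x) x (lab dir g x) (heights dir g i +ᶻ rl (σ S x))) (sym (pos-σ x))
    (rule-shift (κ S x) (heights dir g (pos x)) (rl-rule x))

  -- Across the edge of `x` the contour of the scheme continues at corner `next S x`, so the
  -- difference is the change of label its path has to produce. Second halves of edges and stems
  -- carry no path.
  gapSpec : Bool → Vec ℕ r → HE S → Maybe ℤ
  gapSpec dir g x = if does (first? S x) then just (lab dir g (next S x) ℤ.- lab dir g x) else nothing

  gapSpec-first : ∀ dir g x → First S x → gapSpec dir g x ≡ just (lab dir g (next S x) ℤ.- lab dir g x)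
  gapSpec-first dir g x f = cong (if_then just (lab dir g (next S x) ℤ.- lab dir g x) else nothing) (dec-true (first? S x) f)

  gapSpec-other : ∀ dir g x → ¬ First S x → gapSpec dir g x ≡ nothing
  gapSpec-other dir g x nf = cong (if_then just (lab dir g (next S x) ℤ.- lab dir g x) else nothing) (dec-false (first? S x) nf)

  spec : Bool → Vec ℕ r → Spec (suc (BMap.m S))
  spec dir g = tabulate (gapSpec dir g)

  module _ (dir : Bool) (g : Vec ℕ r) where
    open Expansion S valid (lab dir g) (lab-rule dir g)

    expansion : (ws : Vec (List Arr) (suc (BMap.m S))) → Expanded (masked (lookup ws))
    expansion ws = expand (lookup ws)

    fit-first : ∀ ws → Fit (spec dir g) ws → ∀ x → First S x → disp (lookup ws x) ≡ lab dir g (next S x) ℤ.- lab dir g x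
    fit-first ws F x f = subst (λ o → FitAt o (lookup ws x)) (gapSpec-first dir g x f) (fit-lookup (gapSpec dir g) ws F x)

    fit-other : ∀ ws → Fit (spec dir g) ws → ∀ x → ¬ First S x → lookup ws x ≡ []
    fit-other ws F x nf = subst (λ o → FitAt o (lookup ws x)) (gapSpec-other dir g x nf) (fit-lookup (gapSpec dir g) ws F x)

    fit-masked : ∀ ws → Fit (spec dir g) ws → ∀ x → masked (lookup ws) x ≡ lookup ws x
    fit-masked ws F x = go (first? S x)
      where
      go : Dec (First S x) → masked (lookup ws) x ≡ lookup ws x
      go (yes f) = masked-first (lookup ws) x f
      go (no nf) = trans (masked-other (lookup ws) x nf) (sym (fit-other ws F x nf))

    module Built (ws : Vec (List Arr) (suc (BMap.m S))) (F : Fit (spec dir g) ws) =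
      Assembling S valid four deg (lab dir g) (lab-rule dir g) (lab-zero dir g) (masked (lookup ws)) (expansion ws)
        (λ x f → trans (sym (add-difference (lab dir g (next S x)) (lab dir g x)))
          (cong (lab dir g x +ᶻ_) (sym (trans (cong disp (masked-first (lookup ws) x f)) (fit-first ws F x f)))))

  -- All that ties a map to gaps and words. Built maps and decoded maps both carry it, so the two
  -- constructions are compared through it alone.
  record Certificate (dir : Bool) (M : BMap) (g : Vec ℕ r) (ws : Vec (List Arr) (suc (BMap.m S))) : Set where
    field
      e     : HE S → HE M
      inR   : InR M
      emb   : SchemeEmb M S e
      model : Model S (lookup ws) (α M) (κ M) e
      lab-e : ∀ x → label M (e x) ≡ lab dir g x

  abstract
    build : Bool → Vec ℕ r → Vec (List Arr) (suc (BMap.m S)) → BMap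
    build dir g ws = bmap (Expansion.Expanded.m (expansion dir g ws))
      (tabulate (Expansion.Expanded.a (expansion dir g ws))) (tabulate (Expansion.Expanded.k (expansion dir g ws)))

    build-certificate : ∀ dir g ws → Fit (spec dir g) ws → Certificate dir (build dir g ws) g ws
    build-certificate dir g ws F = record { e = B.scheme-half-edges ; inR = B.inR-map ; emb = B.emb-map
      ; model = Model-cong (fit-masked dir g ws F) B.model-map ; lab-e = B.label-e }
      where module B = Built dir g ws F

    build-leaves : ∀ dir g ws → Fit (spec dir g) ws → leaves (build dir g ws) ≡ leaves S + totalLength ws
    build-leaves dir g ws F = trans (Built.leaves-map dir g ws F) (cong (λ z → leaves S + z)
      (trans (sum-cong-≗ (λ x → cong length (fit-masked dir g ws F x))) (sym (totalLength-sum ws))))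

  certificate-rigid : ∀ {dir M M′ g g′ ws} → Certificate dir M g ws → Certificate dir M′ g′ ws → M ≡ M′
  certificate-rigid {M = M} {M′} {ws = ws} C C′ = trans (sym (η M)) (trans
    (Rigidity.same-map S valid deg (lookup ws) (Certificate.model C) (Certificate.model C′)) (η M′))
    where
    η : ∀ M → bmap (BMap.m M) (tabulate (α M)) (tabulate (κ M)) ≡ M
    η M = cong₂ (bmap (BMap.m M)) (Vecₚ.tabulate∘lookup (BMap.inv M)) (Vecₚ.tabulate∘lookup (BMap.kinds M))

  -- The map determines the embedding of its scheme, then the labels at scheme vertices, the heights
  -- and the gaps; the words are read off along the paths.
  certificate-unique : ∀ {dir M g g′ ws ws′} → Fit (spec dir g) ws → Fit (spec dir g′) ws′ →
    Certificate dir M g ws → Certificate dir M g′ ws′ → g ≡ g′ × ws ≡ ws′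
  certificate-unique {dir} {M} {g} {g′} {ws} {ws′} F F′ C C′ = same-g , same-ws
    where
    module C = Certificate C
    module C′ = Certificate C′
    onto : ∀ (C₁ C₂ : Σ[ e ∈ (HE S → HE M) ] SchemeEmb M S e) → ∀ x → Σ[ y ∈ HE S ] proj₁ C₂ y ≡ proj₁ C₁ x
    onto (e₁ , m₁) (e₂ , m₂) x = proj₁ (proj₂ m₂) (e₁ x) (proj₁ (proj₂ (proj₂ m₁)) x)
    same-e : ∀ x → C.e x ≡ C′.e x
    same-e = strictly-monotone-unique C.e C′.e (λ {x} {y} → proj₁ C.emb x y) (λ {x} {y} → proj₁ C′.emb x y)
      (onto (C.e , C.emb) (C′.e , C′.emb)) (onto (C′.e , C′.emb) (C.e , C.emb))
    same-lab : ∀ x → lab dir g x ≡ lab dir g′ x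
    same-lab x = trans (sym (C.lab-e x)) (trans (cong (label M) (same-e x)) (C′.lab-e x))
    same-height : ∀ i → heights dir g i ≡ heights dir g′ i
    same-height i = ℤ+.∙-cancelʳ (rl (π i)) _ _ (subst (λ j → heights dir g j +ᶻ rl (π i) ≡ heights dir g′ j +ᶻ rl (π i)) (pos-π i) (same-lab (π i)))
    same-g : g ≡ g′
    same-g = elevation-injective dir g g′ (signed dir (height₀ dir g)) (signed dir (height₀ dir g′)) (λ i →
      trans (sym (unsign g i)) (trans (cong (signed dir) (same-height i)) (unsign g′ i)))
      where
      unsign : ∀ g i → signed dir (heights dir g i) ≡ signed dir (height₀ dir g) +ᶻ + elevation dir g i
      unsign g i = trans (signed-+ dir (height₀ dir g) _) (cong (signed dir (height₀ dir g) +ᶻ_) (signed-involutive dir _))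
    same-at : ∀ x → lookup ws x ≡ lookup ws′ x
    same-at x with first? S x
    ... | no nf = trans (fit-other dir g ws F x nf) (sym (fit-other dir g′ ws′ F′ x nf))
    ... | yes f = Paths.path-unique (α M) (κ M) (lookup ws x) (lookup ws′ x) (proj₁ (proj₂ (proj₂ C.emb)) (α S x)) (proj₁ (proj₂ (proj₂ C′.emb)) (α S x))
        (Model.path C.model x f) (subst (λ y → Paths.Path (α M) (κ M) y (lookup ws′ x) (C′.e (α S x))) (sym (same-e x)) (Model.path C′.model x f))
    same-ws : ws ≡ ws′
    same-ws = trans (sym (Vecₚ.tabulate∘lookup ws)) (trans (Vecₚ.tabulate-cong same-at) (Vecₚ.tabulate∘lookup ws′))

  -- Relative labels are nonnegative and vanish at some corner of the vertex, which is one of the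
  -- four over which the minimum is taken.
  height-value : ∀ {M e} (h : Fin (suc r) → ℤ) → (∀ x → nxt (α M (e x)) ≡ e (σ S x)) →
                 (∀ x → label M (e x) ≡ h (pos x) +ᶻ rl x) → ∀ x → height M S e x ≡ h (pos x)
  height-value {M} {e} h e-σ lab-h x = ℤₚ.≤-antisym (lower (sameVertex-turn (proj₁ zeroAt , refl)))
    (ℤₚ.⊓-glb (ℤₚ.⊓-glb (ℤₚ.⊓-glb (ge 0) (ge 1)) (ge 2)) (ge 3))
    where
    zeroAt : ∃[ j ] rl (iter (σ S) j x) ≡ + 0
    zeroAt = proj₂ (proj₂ (proj₂ relative)) x
    L : ℕ → ℤ
    L j = label M (iter (σ M) j (e x))
    at : ∀ j → L j ≡ h (pos x) +ᶻ rl (iter (σ S) j x)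
    at j = trans (cong (label M) (iter-map e (σ S) (σ M) e-σ j x)) (trans (lab-h (iter (σ S) j x))
      (cong (λ i → h i +ᶻ rl (iter (σ S) j x)) (sym (pos-same (j , refl)))))
    ge : ∀ j → h (pos x) ℤ.≤ L j
    ge j = subst (h (pos x) ℤ.≤_) (sym (at j)) (subst (λ z → z ℤ.≤ h (pos x) +ᶻ rl (iter (σ S) j x)) (ℤₚ.+-identityʳ (h (pos x)))
      (ℤₚ.+-monoʳ-≤ (h (pos x)) (proj₁ (proj₂ (proj₂ relative)) (iter (σ S) j x))))
    attained : ∀ (j : Fin 4) → turn j x ≡ iter (σ S) (proj₁ zeroAt) x → L (toℕ j) ≡ h (pos x)
    attained j q = trans (at (toℕ j)) (trans (cong (h (pos x) +ᶻ_) (trans (cong rl q) (proj₂ zeroAt))) (ℤₚ.+-identityʳ (h (pos x))))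
    lower : Σ[ j ∈ Fin 4 ] turn j x ≡ iter (σ S) (proj₁ zeroAt) x → height M S e x ℤ.≤ h (pos x)
    lower (0F , q) = subst (height M S e x ℤ.≤_) (attained 0F q) (ℤₚ.≤-trans (ℤₚ.i⊓j≤i _ _) (ℤₚ.≤-trans (ℤₚ.i⊓j≤i _ _) (ℤₚ.i⊓j≤i (L 0) (L 1))))
    lower (1F , q) = subst (height M S e x ℤ.≤_) (attained 1F q) (ℤₚ.≤-trans (ℤₚ.i⊓j≤i _ _) (ℤₚ.≤-trans (ℤₚ.i⊓j≤i _ _) (ℤₚ.i⊓j≤j (L 0) (L 1))))
    lower (2F , q) = subst (height M S e x ℤ.≤_) (attained 2F q) (ℤₚ.≤-trans (ℤₚ.i⊓j≤i _ _) (ℤₚ.i⊓j≤j (L 0 ℤ.⊓ L 1) (L 2)))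
    lower (3F , q) = subst (height M S e x ℤ.≤_) (attained 3F q) (ℤₚ.i⊓j≤j (L 0 ℤ.⊓ L 1 ℤ.⊓ L 2) (L 3))

  Ordered : Bool → (M : BMap) → (HE S → HE M) → Set
  Ordered dir M e = ∀ i j → i Fin.< j → Ltᶻ dir (height M S e (π i)) (height M S e (π j))
    ⊎ (height M S e (π i) ≡ height M S e (π j) × ltᵈ dir (name i) (name j))

  Member : Bool → ℕ → BMap → Set
  Member dir k M = InR M × (leaves M + 1 ≡ k) × Σ[ e ∈ (HE S → HE M) ] (SchemeEmb M S e × Ordered dir M e)

  certificate-ordered : ∀ {dir M g ws} (C : Certificate dir M g ws) → Ordered dir M (Certificate.e C)
  certificate-ordered {dir} {M} {g} C i j lt = transfer (elevation-lex dir g i j lt)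
    where
    module C = Certificate C
    h : ∀ i → height M S C.e (π i) ≡ heights dir g i
    h i = trans (height-value {M} {C.e} (heights dir g) (Model.e-σ C.model) C.lab-e (π i)) (cong (heights dir g) (pos-π i))
    sh : ∀ i → signed dir (height M S C.e (π i)) ≡ signed dir (height₀ dir g) +ᶻ + elevation dir g i
    sh i = trans (cong (signed dir) (h i)) (trans (signed-+ dir (height₀ dir g) _) (cong (signed dir (height₀ dir g) +ᶻ_) (signed-involutive dir _)))
    transfer : Lex dir (λ j → + elevation dir g j) i j → _
    transfer (inj₁ p) = inj₁ (signed-< dir (subst₂ ℤ._<_ (sym (sh i)) (sym (sh j)) (ℤₚ.+-monoʳ-< (signed dir (height₀ dir g)) p)))
    transfer (inj₂ (p , l)) = inj₂ (signed-injective dir (trans (sh i) (trans (cong (signed dir (height₀ dir g) +ᶻ_) p) (sym (sh j)))) , l)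

  build-member : ∀ dir g ws k → Fit (spec dir g) ws → totalLength ws + (leaves S + 1) ≡ k → Member dir k (build dir g ws)
  build-member dir g ws k F len = C.inR , trans (cong (_+ 1) (build-leaves dir g ws F)) (trans (lem (leaves S) (totalLength ws)) len)
    , C.e , C.emb , certificate-ordered (build-certificate dir g ws F)
    where
    module C = Certificate (build-certificate dir g ws F)
    lem : ∀ a b → a + b + 1 ≡ b + (a + 1)
    lem = ℕRing.solve-∀

  member-built : ∀ dir k M → Member dir k M →
    Σ[ g ∈ Vec ℕ r ] Σ[ ws ∈ Vec (List Arr) (suc (BMap.m S)) ] (Fit (spec dir g) ws × totalLength ws + (leaves S + 1) ≡ k × M ≡ build dir g ws)
  member-built dir k M (inR , lv , e , emb , ord) = g , ws , F , len , M≡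
    where
    module Sch = Decoding.Scheme M inR S e emb
    h′ : HE S → ℤ
    h′ x = Sch.label-S x ℤ.- rl x
    h′-σ : ∀ x → h′ (σ S x) ≡ h′ x
    h′-σ x = rule-difference (κ S x) (proj₁ (proj₂ valid) x) (Sch.rule-S x) (rl-rule x)
    h′-iter : ∀ j x → h′ (iter (σ S) j x) ≡ h′ x
    h′-iter zero    x = refl
    h′-iter (suc j) x = trans (h′-σ (iter (σ S) j x)) (h′-iter j x)
    h : Fin (suc r) → ℤ
    h i = h′ (π i)
    label-h : ∀ x → label M (e x) ≡ h (pos x) +ᶻ rl x
    label-h x = sym (trans (cong (_+ᶻ rl x) (trans (sym (h′-iter (proj₁ (pos-vertex x)) (π (pos x)))) (cong h′ (proj₂ (pos-vertex x)))))
      (lem (Sch.label-S x) (rl x)))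
      where
      lem : ∀ a b → a ℤ.- b +ᶻ b ≡ a
      lem = ℤRing.solve-∀
    height-h : ∀ i → height M S e (π i) ≡ h i
    height-h i = trans (height-value {M} {e} h Sch.e-σ label-h (π i)) (cong h (pos-π i))
    U : Fin (suc r) → ℤ
    U i = signed dir (h i)
    lex : ∀ i j → i Fin.< j → Lex dir U i j
    lex i j lt with ord i j lt
    ... | inj₁ p = inj₁ (signed-<⁻ dir (subst₂ (Ltᶻ dir) (height-h i) (height-h j) p))
    ... | inj₂ (p , l) = inj₂ (cong (signed dir) (trans (sym (height-h i)) (trans p (height-h j))) , l)
    g : Vec ℕ r
    g = proj₁ (lex-elevation dir U lex)
    c : ℤ
    c = signed dir (U zero)
    h-g : ∀ i → h i ≡ c +ᶻ signed dir (+ elevation dir g i)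
    h-g i = trans (sym (signed-involutive dir (h i))) (trans (cong (signed dir) (proj₂ (lex-elevation dir U lex) i)) (signed-+ dir (U zero) _))
    -- Both constants give the root corner the label 0.
    c≡ : c ≡ height₀ dir g
    c≡ = ℤ+.∙-cancelʳ (signed dir (+ elevation dir g (pos zero)) +ᶻ rl zero) _ _ (trans (sym (ℤₚ.+-assoc c _ _))
      (trans (cong (_+ᶻ rl zero) (sym (h-g (pos zero)))) (trans (sym (label-h zero)) (trans Sch.label-S-zero (sym (ℤₚ.+-inverseˡ (signed dir (+ elevation dir g (pos zero)) +ᶻ rl zero)))))))
    lab-e : ∀ x → label M (e x) ≡ lab dir g x
    lab-e x = trans (label-h x) (cong (_+ᶻ rl x) (trans (h-g (pos x)) (cong (_+ᶻ signed dir (+ elevation dir g (pos x))) c≡)))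
    ws : Vec (List Arr) (suc (BMap.m S))
    ws = tabulate Sch.words-S
    F : Fit (spec dir g) ws
    F = fit-tabulate (gapSpec dir g) ws at
      where
      at : ∀ x → FitAt (gapSpec dir g x) (lookup ws x)
      at x with first? S x
      ... | no nf = subst (λ o → FitAt o (lookup ws x)) (sym (gapSpec-other dir g x nf))
          (trans (Vecₚ.lookup∘tabulate Sch.words-S x) (Sch.words-S-other x nf))
      ... | yes f = subst (λ o → FitAt o (lookup ws x)) (sym (gapSpec-first dir g x f))
          (trans (cong disp (Vecₚ.lookup∘tabulate Sch.words-S x)) (trans (sym (lem (Sch.label-S x) (disp (Sch.words-S x))))
          (cong₂ ℤ._-_ (trans (sym (Sch.disp-S x f)) (lab-e (next S x))) (lab-e x))))
        where
        lem : ∀ a b → a +ᶻ b ℤ.- a ≡ b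
        lem = ℤRing.solve-∀
    C : Certificate dir M g ws
    C = record { e = e ; inR = inR ; emb = emb ; model = Model-cong (λ x → sym (Vecₚ.lookup∘tabulate Sch.words-S x)) Sch.model ; lab-e = lab-e }
    M≡ : M ≡ build dir g ws
    M≡ = certificate-rigid C (build-certificate dir g ws F)
    len : totalLength ws + (leaves S + 1) ≡ k
    len = trans (lem (leaves S) (totalLength ws)) (trans (cong (_+ 1) (trans (sym (build-leaves dir g ws F)) (cong leaves (sym M≡)))) lv)
      where
      lem : ∀ a b → b + (a + 1) ≡ a + b + 1
      lem = ℕRing.solve-∀

-- The total displacement

cut-separates : ∀ p q i → p ≤ i → i < q → 1 ≤ cut p q i
cut-separates p q i le lt = subst (1 ≤_) (sym (cut-< i (ℕₚ.≤-trans le (ℕₚ.<⇒≤ lt)))) (ℕₚ.≤-reflexive (sym one))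
  where
  one : span p q i ≡ 1
  one = cong₂ (λ b c → indicator (not b ∧ c)) (dec-false (i ℕ.<? p) (ℕₚ.≤⇒≯ le)) (dec-true (i ℕ.<? q) lt)

module Weight (S : BMap) (valid : Valid S) (four : FourValent S) (deg : ∀ x → 3 ≤ intDeg S x)
  (r : ℕ) (ν : HE S → Fin (suc r)) (π : Fin (suc r) → HE S)
  (naming : Naming S (suc r) ν) (enum : VertexEnum S (suc r) π)
  (rl : HE S → ℤ) (relative : RelLabeling S rl)
  (consistent : ∀ x → κ S x ≡ edge → Type0 S rl x → Type1 S rl (α S x) → ν x Fin.< ν (α S x)) where

  open Class S valid four deg r ν π naming enum rl relative consistent
  open Reaching S valid four using (sameVertex-turn; turn; a-edge; loop)

  private
    ρ : HE S → ℕ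
    ρ x = ℤ.∣ rl x ∣

    rl-ρ : ∀ x → rl x ≡ + ρ x
    rl-ρ x = sym (ℤₚ.0≤i⇒+∣i∣≡i (proj₁ (proj₂ (proj₂ relative)) x))

    close : ∀ x → ρ x ≤ suc (ρ (σ S x)) × ρ (σ S x) ≤ suc (ρ x)
    close x = go (κ S x) (rl-rule x) refl
      where
      up′ : ∀ {x y} → rl x ≡ rl y +ᶻ + 1 → ρ x ≤ suc (ρ y) × ρ y ≤ suc (ρ x)
      up′ {x} {y} q = ℕₚ.≤-reflexive e , ℕₚ.≤-trans (ℕₚ.n≤1+n (ρ y)) (ℕₚ.≤-trans (ℕₚ.≤-reflexive (sym e)) (ℕₚ.n≤1+n (ρ x)))
        where
        e : ρ x ≡ suc (ρ y)
        e = trans (cong ℤ.∣_∣ (trans q (cong (_+ᶻ + 1) (rl-ρ y)))) (ℕₚ.+-comm (ρ y) 1)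
      down′ : ∀ {x y} → rl y ≡ rl x +ᶻ + 1 → ρ x ≤ suc (ρ y) × ρ y ≤ suc (ρ x)
      down′ q = let u , v = up′ q in v , u
      go : ∀ K → Rule K (α S x) x (rl x) (rl (σ S x)) → κ S x ≡ K → ρ x ≤ suc (ρ (σ S x)) × ρ (σ S x) ≤ suc (ρ x)
      go leaf R q = up′ R
      go bud  R q = down′ R
      go edge (R , R′) q with ℕₚ.<-cmp (toℕ (α S x)) (toℕ x)
      ... | tri< lt _ _ = down′ (R lt)
      ... | tri≈ _ e _ = ⊥-elim (proj₁ (proj₂ valid) x q (Finₚ.toℕ-injective e))
      ... | tri> _ _ gt = up′ (R′ gt)

    -- Relative labels change by one from corner to corner, and among four corners in a cycle each
    -- is at most two steps from one with value 0.
    ρ≤2 : ∀ x → ρ x ≤ 2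
    ρ≤2 x with sameVertex-turn {x} (proj₁ (proj₂ (proj₂ (proj₂ relative)) x) , refl) | proj₂ (proj₂ (proj₂ (proj₂ relative)) x)
    ... | j , q | z = go j (cong ℤ.∣_∣ (trans (cong rl q) z))
      where
      go : ∀ j → ρ (turn j x) ≡ 0 → ρ x ≤ 2
      go 0F e = ℕₚ.≤-trans (ℕₚ.≤-reflexive e) z≤n
      go 1F e = ℕₚ.≤-trans (proj₁ (close x)) (s≤s (ℕₚ.≤-trans (ℕₚ.≤-reflexive e) z≤n))
      go 2F e = ℕₚ.≤-trans (proj₁ (close x)) (s≤s (ℕₚ.≤-trans (proj₁ (close (σ S x))) (s≤s (ℕₚ.≤-reflexive e))))
      go 3F e = ℕₚ.≤-trans (subst (λ y → ρ y ≤ suc (ρ (turn 3F x))) (loop x) (proj₂ (close (turn 3F x))))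
                  (s≤s (ℕₚ.≤-trans (ℕₚ.≤-reflexive e) z≤n))

  -- For the first half `x` of an edge this is the type of `α S x` minus the type of `x`, because
  -- the smaller relative labels beside them are those of the corners `α S x` and `σ S x`. It is
  -- nonzero exactly for offset edges.
  tilt : HE S → ℤ
  tilt x = rl (α S x) ℤ.- rl (σ S x)

  module AtFirst (x : HE S) (f : First S x) where
    private
      y : HE S
      y = α S x
      inv : α S y ≡ x
      inv = proj₁ valid x
      κy : κ S y ≡ edge
      κy = a-edge x (proj₁ f)
      t b : ℕ
      t = ρ (σ S x)
      b = ρ y

      rl-x : rl x ≡ + t +ᶻ + 1
      rl-x = trans (proj₂ (subst (λ K → Rule K (α S x) x (rl x) (rl (σ S x))) (proj₁ f) (rl-rule x)) (proj₂ f)) (cong (_+ᶻ + 1) (rl-ρ (σ S x)))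

      rl-σy : rl (σ S y) ≡ + b +ᶻ + 1
      rl-σy = trans (proj₁ (subst (λ K → Rule K (α S y) y (rl y) (rl (σ S y))) κy (rl-rule y)) (subst (Fin._< y) (sym inv) (proj₂ f))) (cong (_+ᶻ + 1) (rl-ρ y))

      t≤1 : t ≤ 1
      t≤1 = ℕₚ.≤-pred (subst (_≤ 2) (trans (cong ℤ.∣_∣ rl-x) (ℕₚ.+-comm t 1)) (ρ≤2 x))

      b≤1 : b ≤ 1
      b≤1 = ℕₚ.≤-pred (subst (_≤ 2) (trans (cong ℤ.∣_∣ rl-σy) (ℕₚ.+-comm b 1)) (ρ≤2 (σ S y)))

      tilt-value : tilt x ≡ + b ℤ.- + t
      tilt-value = cong₂ ℤ._-_ (rl-ρ y) (rl-ρ (σ S x))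

      offset-x : t ≡ 0 → b ≡ 1 → ltᵈ true (name (pos x)) (name (pos y))
      offset-x t0 b1 = subst₂ Fin._<_ (sym (name-pos x)) (sym (name-pos y)) (consistent x (proj₁ f)
        (inj₂ (trans rl-x (cong (λ z → + z +ᶻ + 1) t0) , trans (rl-ρ (σ S x)) (cong +_ t0)))
        (inj₁ (trans (rl-ρ y) (cong +_ b1) , trans rl-σy (cong (λ z → + z +ᶻ + 1) b1))))

      offset-y : t ≡ 1 → b ≡ 0 → ltᵈ true (name (pos y)) (name (pos x))
      offset-y t1 b0 = subst₂ Fin._<_ (sym (name-pos y)) (trans (cong ν inv) (sym (name-pos x))) (consistent y κy
        (inj₁ (trans (rl-ρ y) (cong +_ b0) , trans rl-σy (cong (λ z → + z +ᶻ + 1) b0)))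
        (subst (Type1 S rl) (sym inv) (inj₂ (trans rl-x (cong (λ z → + z +ᶻ + 1) t1) , trans (rl-ρ (σ S x)) (cong +_ t1)))))

    tilted-true : Tilt true (pos x) (pos y) (tilt x)
    tilted-true = subst (Tilt true (pos x) (pos y)) (sym tilt-value) (go t b refl refl t≤1 b≤1)
      where
      go : ∀ t′ b′ → t ≡ t′ → b ≡ b′ → t′ ≤ 1 → b′ ≤ 1 → Tilt true (pos x) (pos y) (+ b′ ℤ.- + t′)
      go 0 0 p q _ _ = flat
      go 0 1 p q _ _ = toward (offset-x p q)
      go 1 0 p q _ _ = away (offset-y p q)
      go 1 1 p q _ _ = flat
      go (suc (suc _)) _ p q (s≤s ()) _
      go 0 (suc (suc _)) p q _ (s≤s ())
      go 1 (suc (suc _)) p q _ (s≤s ())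

    tilted-dir : ∀ dir → Tilt dir (pos x) (pos y) (signed dir (tilt x))
    tilted-dir true  = tilted-true
    tilted-dir false = tilt-not tilted-true

    displacement-lab : ∀ dir g → ℤ.∣ lab dir g (next S x) ℤ.- lab dir g x ∣ ≡ ℤ.∣ climb dir g (pos x) (pos y) +ᶻ signed dir (tilt x) ∣
    displacement-lab dir g = trans (sym (∣signed∣ dir _)) (cong ℤ.∣_∣ (begin
      signed dir (lab dir g (next S x) ℤ.- lab dir g x)
        ≡⟨ cong (λ z → signed dir (z ℤ.- lab dir g x)) (cong₂ (λ i z → heights dir g i +ᶻ z) pos-next rl-next) ⟩
      signed dir (heights dir g (pos y) +ᶻ (+ b +ᶻ + 1) ℤ.- (heights dir g (pos x) +ᶻ rl x))
        ≡⟨ cong (λ z → signed dir (heights dir g (pos y) +ᶻ (+ b +ᶻ + 1) ℤ.- (heights dir g (pos x) +ᶻ z))) rl-x ⟩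
      signed dir (heights dir g (pos y) +ᶻ (+ b +ᶻ + 1) ℤ.- (heights dir g (pos x) +ᶻ (+ t +ᶻ + 1)))
        ≡⟨ expand′ dir (height₀ dir g) (+ elevation dir g (pos y)) (+ elevation dir g (pos x)) (+ b) (+ t) ⟩
      climb dir g (pos x) (pos y) +ᶻ signed dir (+ b ℤ.- + t)
        ≡⟨ cong (λ z → climb dir g (pos x) (pos y) +ᶻ signed dir z) tilt-value ⟨
      climb dir g (pos x) (pos y) +ᶻ signed dir (tilt x) ∎))
      where
      open ≡-Reasoning
      next-σ : next S x ≡ σ S y
      next-σ = cong (next S) (sym inv)
      pos-next : pos (next S x) ≡ pos y
      pos-next = trans (cong pos next-σ) (pos-σ y)
      rl-next : rl (next S x) ≡ + b +ᶻ + 1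
      rl-next = trans (cong rl next-σ) rl-σy
      expand′ : ∀ dir c u w b t → signed dir ((c +ᶻ signed dir u) +ᶻ (b +ᶻ + 1) ℤ.- ((c +ᶻ signed dir w) +ᶻ (t +ᶻ + 1))) ≡ (u ℤ.- w) +ᶻ signed dir (b ℤ.- t)
      expand′ true = lem
        where
        lem : ∀ c u w b t → (c +ᶻ u) +ᶻ (b +ᶻ + 1) ℤ.- ((c +ᶻ w) +ᶻ (t +ᶻ + 1)) ≡ (u ℤ.- w) +ᶻ (b ℤ.- t)
        lem = ℤRing.solve-∀
      expand′ false = lem
        where
        lem : ∀ c u w b t → ℤ.- ((c +ᶻ ℤ.- u) +ᶻ (b +ᶻ + 1) ℤ.- ((c +ᶻ ℤ.- w) +ᶻ (t +ᶻ + 1))) ≡ (u ℤ.- w) +ᶻ ℤ.- (b ℤ.- t)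
        lem = ℤRing.solve-∀

  crossing : Fin r → ℕ
  crossing i = sum (λ x → edgeFlag x * cut (toℕ (pos x)) (toℕ (pos (α S x))) (toℕ i))

  -- The contour visits all vertices, so every cut of the enumeration is crossed by an edge.
  crossing-positive : ∀ i → 1 ≤ crossing i
  crossing-positive i with crossing i in eq
  ... | suc _ = s≤s z≤n
  ... | zero  = ⊥-elim (subst (λ b → b ≡ true → ⊥) (sym side-hi) (λ ()) (trans (everywhere (π (suc i))) (trans (sym (everywhere (π (inject₁ i)))) side-lo)))
    where
    side : HE S → Bool
    side x = toℕ (pos x) <ᵇ suc (toℕ i)
    in-side : ∀ x → toℕ (pos x) ≤ toℕ i → side x ≡ true
    in-side x le = dec-true (toℕ (pos x) ℕ.<? suc (toℕ i)) (s≤s le)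
    out-side : ∀ x → toℕ i < toℕ (pos x) → side x ≡ false
    out-side x lt = dec-false (toℕ (pos x) ℕ.<? suc (toℕ i)) (λ le → ℕₚ.<⇒≱ lt (ℕₚ.≤-pred le))
    side-lo : side (π (inject₁ i)) ≡ true
    side-lo = in-side (π (inject₁ i)) (ℕₚ.≤-reflexive (trans (cong toℕ (pos-π (inject₁ i))) (Finₚ.toℕ-inject₁ i)))
    side-hi : side (π (suc i)) ≡ false
    side-hi = out-side (π (suc i)) (ℕₚ.≤-reflexive (sym (cong toℕ (pos-π (suc i)))))
    flag : ∀ x → First S x → edgeFlag x ≡ 1
    flag x f = cong indicator (dec-true (first? S x) f)
    no-cut : ∀ x → First S x → cut (toℕ (pos x)) (toℕ (pos (α S x))) (toℕ i) ≡ 0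
    no-cut x f = trans (sym (ℕₚ.*-identityˡ _)) (trans (cong (_* cut (toℕ (pos x)) (toℕ (pos (α S x))) (toℕ i)) (sym (flag x f))) (sum-zero⁻ (λ x → edgeFlag x * cut (toℕ (pos x)) (toℕ (pos (α S x))) (toℕ i)) eq x))
    first-side : ∀ x → First S x → side (α S x) ≡ side x
    first-side x f with toℕ (pos x) ℕ.≤? toℕ i | toℕ (pos (α S x)) ℕ.≤? toℕ i
    ... | yes p | yes q = trans (in-side (α S x) q) (sym (in-side x p))
    ... | no p | no q = trans (out-side (α S x) (ℕₚ.≰⇒> q)) (sym (out-side x (ℕₚ.≰⇒> p)))
    ... | yes p | no q with () ← subst (1 ≤_) (no-cut x f) (cut-separates _ _ (toℕ i) p (ℕₚ.≰⇒> q))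
    ... | no p | yes q with () ← subst (1 ≤_) (trans (cut-comm (toℕ (pos (α S x))) (toℕ (pos x)) (toℕ i)) (no-cut x f)) (cut-separates _ _ (toℕ i) q (ℕₚ.≰⇒> p))
    α-side : ∀ x → side (α S x) ≡ side x
    α-side x with edge? (κ S x)
    ... | no ne = cong side (proj₁ (proj₂ (proj₂ valid)) x ne)
    ... | yes q with ℕₚ.<-cmp (toℕ x) (toℕ (α S x))
    ... | tri< lt _ _ = first-side x (q , lt)
    ... | tri≈ _ e _ = cong side (sym (Finₚ.toℕ-injective e))
    ... | tri> _ _ gt = sym (trans (cong side (sym (proj₁ valid x)))
        (first-side (α S x) (a-edge x q , subst (α S x Fin.<_) (sym (proj₁ valid x)) gt)))
    next-side : ∀ x → side (next S x) ≡ side x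
    next-side x = trans (cong (side ∘ next S) (sym (proj₁ valid x))) (trans (cong (λ i′ → toℕ i′ <ᵇ suc (toℕ i)) (pos-σ (α S x))) (α-side x))
    from-root : ∀ j → side (iter (next S) j zero) ≡ side zero
    from-root zero    = refl
    from-root (suc j) = trans (next-side _) (from-root j)
    everywhere : ∀ x → side x ≡ side zero
    everywhere x = trans (cong side (sym (iter-nxt-toℕ x))) (from-root (toℕ x))

  weights : Vec ℕ r
  weights = tabulate (λ i → crossing i ∸ 1)

  private
    crossing-suc : ∀ i → suc (crossing i ∸ 1) ≡ crossing i
    crossing-suc i = ℕₚ.m+[n∸m]≡n (crossing-positive i)

    -- Double counting of pairs of an edge and a cut it crosses: this turns sums over edges into
    -- sums over gaps.
    crossing-sum : ∀ (f : Fin r → ℕ) → sum (λ x → edgeFlag x * along f (toℕ (pos x)) (toℕ (pos (α S x)))) ≡ sum (λ i → crossing i * f i)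
    crossing-sum f = begin
      sum (λ x → edgeFlag x * along f (toℕ (pos x)) (toℕ (pos (α S x))))
        ≡⟨ sum-cong-≗ (λ x → trans (sum-*ˡ {r} (edgeFlag x) (λ i → cut (toℕ (pos x)) (toℕ (pos (α S x))) (toℕ i) * f i)) (sum-cong-≗ (λ i → sym (ℕₚ.*-assoc (edgeFlag x) (cut (toℕ (pos x)) (toℕ (pos (α S x))) (toℕ i)) (f i))))) ⟩
      sum (λ x → sum (λ i → edgeFlag x * cut (toℕ (pos x)) (toℕ (pos (α S x))) (toℕ i) * f i))
        ≡⟨ ∑-comm (λ x i → edgeFlag x * cut (toℕ (pos x)) (toℕ (pos (α S x))) (toℕ i) * f i) ⟩
      sum (λ i → sum (λ x → edgeFlag x * cut (toℕ (pos x)) (toℕ (pos (α S x))) (toℕ i) * f i))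
        ≡⟨ sum-cong-≗ (λ i → sym (sum-*ʳ (f i) (λ x → edgeFlag x * cut (toℕ (pos x)) (toℕ (pos (α S x))) (toℕ i)))) ⟩
      sum (λ i → crossing i * f i) ∎
      where open ≡-Reasoning

  baseAt : Bool → HE S → ℕ
  baseAt dir x = base dir (pos x) (pos (α S x)) (signed dir (tilt x))

  baseTotal : Bool → ℕ
  baseTotal dir = sum (λ x → edgeFlag x * baseAt dir x)

  spec-span : ∀ dir g → specSpan (spec dir g) ≡ baseTotal dir + dot weights g
  spec-span dir g = begin
    specSpan (spec dir g)                                         ≡⟨ specSpan-sum (gapSpec dir g) ⟩
    sum (spanAt ∘ gapSpec dir g)                                  ≡⟨ sum-cong-≗ (λ x → at x (first? S x)) ⟩
    sum (λ x → edgeFlag x * baseAt dir x + edgeFlag x * along (lookup g) (toℕ (pos x)) (toℕ (pos (α S x))))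
      ≡⟨ ∑-distrib-+ (λ x → edgeFlag x * baseAt dir x) (λ x → edgeFlag x * along (lookup g) (toℕ (pos x)) (toℕ (pos (α S x)))) ⟩
    baseTotal dir + sum (λ x → edgeFlag x * along (lookup g) (toℕ (pos x)) (toℕ (pos (α S x))))
      ≡⟨ cong (λ z → baseTotal dir + z) (trans (crossing-sum (lookup g)) (sym (trans (dot-sum (λ i → crossing i ∸ 1) g)
           (sum-cong-≗ (λ i → cong (_* lookup g i) (crossing-suc i)))))) ⟩
    baseTotal dir + dot weights g ∎
    where
    open ≡-Reasoning
    at : ∀ x → Dec (First S x) → spanAt (gapSpec dir g x) ≡ edgeFlag x * baseAt dir x + edgeFlag x * along (lookup g) (toℕ (pos x)) (toℕ (pos (α S x)))
    at x (yes f) = trans (cong spanAt (gapSpec-first dir g x f)) (trans (AtFirst.displacement-lab x f dir g)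
      (trans (displacement (AtFirst.tilted-dir x f dir) g) (cong₂ _+_ (one (baseAt dir x)) (one _))))
      where
      one : ∀ z → z ≡ edgeFlag x * z
      one z = sym (trans (cong (_* z) (cong indicator (dec-true (first? S x) f))) (ℕₚ.*-identityˡ z))
    at x (no nf) = trans (cong spanAt (gapSpec-other dir g x nf)) (sym (cong₂ _+_ (none (baseAt dir x)) (none _)))
      where
      none : ∀ z → edgeFlag x * z ≡ 0
      none z = cong (_* z) (cong indicator (dec-false (first? S x) nf))

  spec-edges : ∀ dir g → specEdges (spec dir g) ≡ sum edgeFlag
  spec-edges dir g = trans (specEdges-sum (gapSpec dir g)) (sum-cong-≗ (λ x → at x (first? S x)))
    where
    at : ∀ x → Dec (First S x) → edgesAt (gapSpec dir g x) ≡ edgeFlag x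
    at x (yes f) = trans (cong edgesAt (gapSpec-first dir g x f)) (sym (cong indicator (dec-true (first? S x) f)))
    at x (no nf) = trans (cong edgesAt (gapSpec-other dir g x nf)) (sym (cong indicator (dec-false (first? S x) nf)))

  base-sum : baseTotal true + baseTotal false ≡ totalWeight weights
  base-sum = begin
    baseTotal true + baseTotal false
      ≡⟨ ∑-distrib-+ (λ x → edgeFlag x * baseAt true x) (λ x → edgeFlag x * baseAt false x) ⟨
    sum (λ x → edgeFlag x * baseAt true x + edgeFlag x * baseAt false x)
      ≡⟨ sum-cong-≗ (λ x → trans (sym (ℕₚ.*-distribˡ-+ (edgeFlag x) (baseAt true x) (baseAt false x))) (at x (first? S x))) ⟩
    sum (λ x → edgeFlag x * along {r} (λ _ → 1) (toℕ (pos x)) (toℕ (pos (α S x))))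
      ≡⟨ crossing-sum (λ _ → 1) ⟩
    sum (λ i → crossing i * 1)
      ≡⟨ trans (sum-cong-≗ (λ i → trans (ℕₚ.*-identityʳ (crossing i)) (sym (crossing-suc i)))) (sym (totalWeight-sum (λ i → crossing i ∸ 1))) ⟩
    totalWeight weights ∎
    where
    open ≡-Reasoning
    at : ∀ x → Dec (First S x) → edgeFlag x * (baseAt true x + baseAt false x) ≡ edgeFlag x * along {r} (λ _ → 1) (toℕ (pos x)) (toℕ (pos (α S x)))
    at x (yes f) = cong (λ z → edgeFlag x * z) (base-both (AtFirst.tilted-true x f))
    at x (no nf) = trans (cong (_* (baseAt true x + baseAt false x)) (cong indicator (dec-false (first? S x) nf)))
      (sym (cong (_* along {r} (λ _ → 1) (toℕ (pos x)) (toℕ (pos (α S x)))) (cong indicator (dec-false (first? S x) nf))))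

-- Counting

open S-Solver using (solve; _:=_; _:+_; _:*_; :-_; con)

gather : {A B : Set} → (A → List B) → List A → List B
gather f []       = []
gather f (x ∷ xs) = f x ++ gather f xs

∈-gather⁻ : {A B : Set} (f : A → List B) {xs : List A} {y : B} → y ∈ gather f xs → Σ[ x ∈ A ] (x ∈ xs × y ∈ f x)
∈-gather⁻ f {x ∷ xs} m with ∈-++⁻ (f x) m
... | inj₁ i = x , here refl , i
... | inj₂ i = let x′ , j , k = ∈-gather⁻ f i in x′ , there j , k

∈-gather⁺ : {A B : Set} (f : A → List B) {xs : List A} {x : A} {y : B} → x ∈ xs → y ∈ f x → y ∈ gather f xs
∈-gather⁺ f             (here refl) i = ∈-++⁺ˡ i
∈-gather⁺ f {x′ ∷ xs}   (there m)   i = ∈-++⁺ʳ (f x′) (∈-gather⁺ f m i)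

gather-unique : {A B : Set} (f : A → List B) {xs : List A} → Unique xs → (∀ x → Unique (f x)) →
                (∀ {x x′ y} → y ∈ f x → y ∈ f x′ → x ≡ x′) → Unique (gather f xs)
gather-unique f []      u sep = []
gather-unique f {x ∷ xs} (a ∷ us) u sep = Uniqueₚ.++⁺ (u x) (gather-unique f us u sep) (λ (i , j) →
  let x′ , m , k = ∈-gather⁻ f j in All.lookup a m (sep i k))

length-gather : {A B : Set} (f : A → List B) (xs : List A) → length (gather f xs) ≡ sumℕ (map (length ∘ f) xs)
length-gather f []       = refl
length-gather f (x ∷ xs) = trans (Listₚ.length-++ (f x)) (cong (λ z → length (f x) + z) (length-gather f xs))

map-unique : {A B : Set} (f : A → B) {xs : List A} → (∀ {x y} → x ∈ xs → y ∈ xs → f x ≡ f y → x ≡ y) → Unique xs → Unique (map f xs)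
map-unique f inj [] = []
map-unique f {x ∷ xs} inj (a ∷ u) = All.tabulate (λ m e → let y , i , q = ∈-map⁻ f m in
    All.lookup a i (inj (here refl) (there i) (trans e q))) ∷ map-unique f (λ i j → inj (there i) (there j)) u

delayList : {A : Set} → ℕ → (ℕ → List A) → ℕ → List A
delayList zero    f k       = f k
delayList (suc a) f zero    = []
delayList (suc a) f (suc k) = delayList a f k

length-delay : {A : Set} (a : ℕ) (f : ℕ → List A) → ∀ k → length (delayList a f k) ≡ delay a (length ∘ f) k
length-delay zero    f k       = refl
length-delay (suc a) f zero    = refl
length-delay (suc a) f (suc k) = length-delay a f k

∈-delay⁻ : {A : Set} {x : A} (a : ℕ) (f : ℕ → List A) → ∀ k → x ∈ delayList a f k → Σ[ K ∈ ℕ ] (K + a ≡ k × x ∈ f K)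
∈-delay⁻ zero    f k       m = k , ℕₚ.+-identityʳ k , m
∈-delay⁻ (suc a) f (suc k) m = let K , e , i = ∈-delay⁻ a f k m in K , trans (ℕₚ.+-suc K a) (cong suc e) , i

∈-delay⁺ : {A : Set} {x : A} (a : ℕ) (f : ℕ → List A) → ∀ K → x ∈ f K → x ∈ delayList a f (K + a)
∈-delay⁺ zero    f K m rewrite ℕₚ.+-identityʳ K = m
∈-delay⁺ (suc a) f K m rewrite ℕₚ.+-suc K a = ∈-delay⁺ a f K m

delay-unique : {A : Set} (a : ℕ) (f : ℕ → List A) → (∀ K → Unique (f K)) → ∀ k → Unique (delayList a f k)
delay-unique zero    f u k       = u k
delay-unique (suc a) f u zero    = []
delay-unique (suc a) f u (suc k) = delay-unique a f u k

delay-vanish : ∀ a f k → (∀ K → K ≤ k → f K ≡ 0) → delay a f k ≡ 0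
delay-vanish zero    f k       z = z k ℕₚ.≤-refl
delay-vanish (suc a) f zero    z = refl
delay-vanish (suc a) f (suc k) z = delay-vanish a f k (λ K le → z K (ℕₚ.m≤n⇒m≤1+n le))

Good : BMap → Set
Good S = Valid S × FourValent S × (∀ h → 3 ≤ intDeg S h)

kind? : (K K′ : Kind) → Dec (K ≡ K′)
kind? edge edge = yes refl
kind? edge leaf = no (λ ())
kind? edge bud  = no (λ ())
kind? leaf edge = no (λ ())
kind? leaf leaf = yes refl
kind? leaf bud  = no (λ ())
kind? bud  edge = no (λ ())
kind? bud  leaf = no (λ ())
kind? bud  bud  = yes refl

good? : ∀ S → Dec (Good S)
good? S = valid? ×-dec four? ×-dec Finₚ.all? (λ h → 3 ℕ.≤? intDeg S h)
  where
  valid? : Dec (Valid S)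
  valid? = Finₚ.all? (λ h → α S (α S h) Fin.≟ h)
     ×-dec Finₚ.all? (λ h → kind? (κ S h) edge →-dec ¬? (α S h Fin.≟ h))
     ×-dec Finₚ.all? (λ h → ¬? (kind? (κ S h) edge) →-dec (α S h Fin.≟ h))
     ×-dec kind? (κ S zero) bud
  four? : Dec (FourValent S)
  four? = Finₚ.all? (λ h → (iter (σ S) 4 h Fin.≟ h) ×-dec dec-map
      (λ { (p₁ , p₂ , p₃) → λ { 1 _ _ → p₁ ; 2 _ _ → p₂ ; 3 _ _ → p₃ ; (suc (suc (suc (suc j)))) _ (s≤s (s≤s (s≤s (s≤s ())))) } })
      (λ p → p 1 (s≤s z≤n) (s≤s (s≤s z≤n)) , p 2 (s≤s z≤n) (s≤s (s≤s (s≤s z≤n))) , p 3 (s≤s z≤n) (s≤s (s≤s (s≤s (s≤s z≤n)))))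
      (¬? (iter (σ S) 1 h Fin.≟ h) ×-dec ¬? (iter (σ S) 2 h Fin.≟ h) ×-dec ¬? (iter (σ S) 3 h Fin.≟ h)))

class-good : ∀ S n ν π k M → RClass S n ν π k M → Good S
class-good S n ν π k M (inR , _ , e , emb , _) = Sch.valid-S , Sch.four-S , Sch.deg-S
  where module Sch = Decoding.Scheme M inR S e emb

opposite-< : ∀ {n} {i j : Fin n} → i Fin.< j → opposite j Fin.< opposite i
opposite-< {n} {i} {j} lt = subst₂ _<_ (sym (Finₚ.opposite-prop j)) (sym (Finₚ.opposite-prop i))
  (ℕₚ.∸-monoʳ-< (s≤s lt) (Finₚ.toℕ<n j))

Conclusion : (S : BMap) (n : ℕ) (ν : HE S → Fin n) (π : Fin n → HE S) → Set
Conclusion S n ν π =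
    Σ[ c₁ ∈ (ℕ → ℕ) ] Σ[ c₂ ∈ (ℕ → ℕ) ]
    ((∀ k → Counts (RClass S n ν π k) (c₁ k))
    × (∀ k → Counts (RClass S n ν (λ i → π (opposite i)) k) (c₂ k))
    × Σ[ P₁ ∈ List ℤ ] Σ[ Q₁ ∈ List ℤ ] Σ[ P₂ ∈ List ℤ ] Σ[ Q₂ ∈ List ℤ ]
    (RatRep P₁ Q₁ (subD c₁) × RatRep P₂ Q₂ (subD c₂)
    × ReflectEq P₁ Q₁ P₂ Q₂))

-- The structure of a member is inherited by its scheme, so otherwise both classes are empty and
-- both series are 0/1.
no-members : ∀ S n ν π → ¬ Good S → Conclusion S n ν π
no-members S n ν π bad = (λ _ → 0) , (λ _ → 0) , (λ k → none π k) , (λ k → none (λ i → π (opposite i)) k)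
  , [] , (+ 1 ∷ []) , [] , (+ 1 ∷ []) , zero-rep , zero-rep , zero-reflect
  where
  none : ∀ π k → Counts (RClass S n ν π k) 0
  none π k = [] , refl , [] , [] , (λ M m → ⊥-elim (bad (class-good S n ν π k M m)))
  zero-rep : RatRep [] (+ 1 ∷ []) (subD (λ _ → 0))
  zero-rep = (0 , λ ()) , λ k → trans (coeff-[1] (subD (λ _ → 0)) k) (subD-0 k)
  rev-0 : revPoly 1 [] ≈ 0ˢ
  rev-0 0             = refl
  rev-0 1             = refl
  rev-0 (suc (suc k)) = refl
  zero-reflect : ReflectEq [] (+ 1 ∷ []) [] (+ 1 ∷ [])
  zero-reflect k = trans (⋆-cong {g = coeff (+ 1 ∷ [])} rev-0 ≈-refl k) (trans (⋆-zeroˡ (coeff (+ 1 ∷ [])) k)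
    (sym (trans (⋆-comm (revPoly 1 (+ 1 ∷ [])) (coeff []) k) (coeff-[] (revPoly 1 (+ 1 ∷ [])) k))))

module Counting (S : BMap) (valid : Valid S) (four : FourValent S) (deg : ∀ x → 3 ≤ intDeg S x)
  (r : ℕ) (ν : HE S → Fin (suc r)) (π : Fin (suc r) → HE S)
  (naming : Naming S (suc r) ν) (enum : VertexEnum S (suc r) π)
  (rl : HE S → ℤ) (relative : RelLabeling S rl)
  (consistent : ∀ x → κ S x ≡ edge → Type0 S rl x → Type1 S rl (α S x) → ν x Fin.< ν (α S x)) where

  open Class S valid four deg r ν π naming enum rl relative consistent
  open Weight S valid four deg r ν π naming enum rl relative consistent

  private
    a : ℕ
    a = leaves S + 1
    E : ℕ
    E = sum edgeFlag

  counted : Bool → Vec ℕ r → ℕ → List BMap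
  counted dir g k = map (build dir g) (delayList a (words (spec dir g)) k)

  -- Every unit of `dot weights g` demands a vertex on some path and hence a leaf, so gap vectors
  -- with budget k suffice for maps counted at t^k.
  members : Bool → ℕ → List BMap
  members dir k = gather (λ g → counted dir g k) (gaps weights k)

  series : Bool → ℕ → ℕ
  series dir k = sumℕ (map (λ g → delay a (countWords (spec dir g)) k) (gaps weights k))

  private
    counted⁻ : ∀ dir g k {M} → M ∈ counted dir g k →
      Σ[ ws ∈ Vec (List Arr) (suc (BMap.m S)) ] (M ≡ build dir g ws × Fit (spec dir g) ws × totalLength ws + a ≡ k)
    counted⁻ dir g k m with ∈-map⁻ (build dir g) m
    ... | ws , i , q with ∈-delay⁻ a (words (spec dir g)) k i
    ... | K , e , j = let f , l = words-sound (spec dir g) K j in ws , q , f , trans (cong (_+ a) l) e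

    same : ∀ dir {g g′ ws ws′} → Fit (spec dir g) ws → Fit (spec dir g′) ws′ → build dir g ws ≡ build dir g′ ws′ → g ≡ g′ × ws ≡ ws′
    same dir {g} {g′} {ws} {ws′} F F′ q = certificate-unique {dir} {build dir g ws} {g} {g′} {ws} {ws′} F F′ (build-certificate dir g ws F)
      (subst (λ M → Certificate dir M g′ ws′) (sym q) (build-certificate dir g′ ws′ F′))

  members-count : ∀ dir k → Counts (Member dir k) (series dir k)
  members-count dir k = members dir k , size , unique , All.tabulate sound , complete
    where
    size : length (members dir k) ≡ series dir k
    size = trans (length-gather (λ g → counted dir g k) (gaps weights k)) (cong sumℕ (Listₚ.map-cong (λ g →
      trans (Listₚ.length-map (build dir g) (delayList a (words (spec dir g)) k)) (length-delay a (words (spec dir g)) k)) (gaps weights k)))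
    unique : Unique (members dir k)
    unique = gather-unique (λ g → counted dir g k) (gaps-unique weights k)
      (λ g → map-unique (build dir g) (λ {ws} {ws′} i j q → proj₂ (same dir {g} {g} {ws} {ws′} (fit g i) (fit g j) q)) (delay-unique a (words (spec dir g)) (words-unique (spec dir g)) k))
      (λ {g} {g′} i j → let ws , q , F , _ = counted⁻ dir g k i; ws′ , q′ , F′ , _ = counted⁻ dir g′ k j in proj₁ (same dir {g} {g′} {ws} {ws′} F F′ (trans (sym q) q′)))
      where
      fit : ∀ g {ws} → ws ∈ delayList a (words (spec dir g)) k → Fit (spec dir g) ws
      fit g i with ∈-delay⁻ a (words (spec dir g)) k i
      ... | K , _ , j = proj₁ (words-sound (spec dir g) K j)
    sound : ∀ {M} → M ∈ members dir k → Member dir k M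
    sound m with ∈-gather⁻ (λ g → counted dir g k) {gaps weights k} m
    ... | g , _ , i with counted⁻ dir g k i
    ... | ws , q , F , l = subst (Member dir k) (sym q) (build-member dir g ws k F l)
    complete : ∀ M → Member dir k M → M ∈ members dir k
    complete M mem with member-built dir k M mem
    ... | g , ws , F , l , q = ∈-gather⁺ (λ g → counted dir g k)
      -- The budget suffices: the weight of g is at most the total displacement, this at most the
      -- total length of the words, and that at most k.
      (gaps-complete weights k g (ℕₚ.≤-trans (ℕₚ.m≤n+m (dot weights g) (baseTotal dir)) (ℕₚ.≤-trans (ℕₚ.≤-reflexive (sym (spec-span dir g)))
        (ℕₚ.≤-trans (span≤length (spec dir g) ws F) (subst (totalLength ws ≤_) l (ℕₚ.m≤m+n (totalLength ws) a))))))
      (subst (_∈ counted dir g k) (sym q) (∈-map⁺ (build dir g) (subst (λ k → ws ∈ delayList a (words (spec dir g)) k) l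
        (∈-delay⁺ a (words (spec dir g)) (totalLength ws) (words-complete (spec dir g) (totalLength ws) ws F refl)))))

  -- The words for gaps g contribute t^a D^(base + c·g) times `bridge` to the power E. Only D^(c·g)
  -- depends on g, so the sum over g is a `gapSum`.
  series-gapSum : ∀ dir → subD (series dir) ≈ gapSum weights (pow tD a ⊛ (Dk (baseTotal dir) ⊛ pow bridge E))
  series-gapSum dir = subD-gapSum weights (λ g → delay a (countWords (spec dir g))) _
    (λ g k lt → delay-vanish a (countWords (spec dir g)) k (λ K le → countWords-short (spec dir g) K
      (ℕₚ.≤-<-trans le (ℕₚ.<-≤-trans lt (ℕₚ.≤-trans (ℕₚ.m≤n+m (dot weights g) (baseTotal dir)) (ℕₚ.≤-reflexive (sym (spec-span dir g))))))))
    (λ g → ≈-trans (subD-delay a (countWords (spec dir g))) (≈-trans (⋆-cong {f = pow tD a} ≈-refl (walk-part g))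
      (rearrange (pow tD a) (Dk (baseTotal dir)) (Dk (dot weights g)) (pow bridge E))))
    where
    rearrange : ∀ t b d w → t ⊛ (b ⊛ d ⊛ w) ≈ d ⊛ (t ⊛ (b ⊛ w))
    rearrange = solve 4 (λ t b d w → t :* (b :* d :* w) := d :* (t :* (b :* w))) ≈-refl
    walk-part : ∀ g → subD (countWords (spec dir g)) ≈ Dk (baseTotal dir) ⊛ Dk (dot weights g) ⊛ pow bridge E
    walk-part g = ≈-trans (subD-words (spec dir g)) (≈-trans
      (λ n → cong₂ (λ s e → (Dk s ⊛ pow bridge e) n) (spec-span dir g) (spec-edges dir g))
      (⋆-cong {g = pow bridge E} (Dk-+ (baseTotal dir) (dot weights g)) ≈-refl))

  -- Increasing along the reversed enumeration means decreasing along π, with ties broken by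
  -- decreasing names: the same π with the direction `false`.
  member-opposite : ∀ k M → Member false k M → RClass S (suc r) ν (λ i → π (opposite i)) k M
  member-opposite k M (inR , l , e , emb , ord) = inR , l , e , emb , λ i j lt → go {i} {j} (ord (opposite j) (opposite i) (opposite-< lt))
    where
    go : ∀ {i j} → Ltᶻ false (height M S e (π (opposite j))) (height M S e (π (opposite i)))
         ⊎ (height M S e (π (opposite j)) ≡ height M S e (π (opposite i)) × ltᵈ false (name (opposite j)) (name (opposite i))) →
         (height M S e (π (opposite i)) ℤ.< height M S e (π (opposite j)))
         ⊎ (height M S e (π (opposite i)) ≡ height M S e (π (opposite j)) × name (opposite i) Fin.< name (opposite j))
    go (inj₁ p) = inj₁ p
    go (inj₂ (p , q)) = inj₂ (sym p , q)

  opposite-member : ∀ k M → RClass S (suc r) ν (λ i → π (opposite i)) k M → Member false k M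
  opposite-member k M (inR , l , e , emb , ord) = inR , l , e , emb , λ i j lt →
    subst₂ (Goal i j) (Finₚ.opposite-involutive i) (Finₚ.opposite-involutive j) (go i j (ord (opposite j) (opposite i) (opposite-< lt)))
    where
    Goal : Fin (suc r) → Fin (suc r) → Fin (suc r) → Fin (suc r) → Set
    Goal _ _ i j = Ltᶻ false (height M S e (π i)) (height M S e (π j)) ⊎ (height M S e (π i) ≡ height M S e (π j) × ltᵈ false (name i) (name j))
    go : ∀ i j → (height M S e (π (opposite (opposite j))) ℤ.< height M S e (π (opposite (opposite i))))
         ⊎ (height M S e (π (opposite (opposite j))) ≡ height M S e (π (opposite (opposite i)))
            × name (opposite (opposite j)) Fin.< name (opposite (opposite i))) → Goal i j (opposite (opposite i)) (opposite (opposite j))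
    go i j (inj₁ p) = inj₁ p
    go i j (inj₂ (p , q)) = inj₂ (sym p , q)

  conclusion : Conclusion S (suc r) ν π
  conclusion = series true , series false , members-count true , opposite-count
    , numerator (baseTotal true) , denominator , numerator (baseTotal false) , denominator
    , ratRep (baseTotal true) (subD (series true)) (series-gapSum true)
    , ratRep (baseTotal false) (subD (series false)) (series-gapSum false)
    , reflectEq (baseTotal true) (baseTotal false) base-sum (proj₁ (euler-parity r refl)) (proj₂ (euler-parity r refl))
    where
    open Assembly a E weights
    opposite-count : ∀ k → Counts (RClass S (suc r) ν (λ i → π (opposite i)) k) (series false k)
    opposite-count k = let xs , l , u , s , c = members-count false k in
      xs , l , u , All.map (λ {M} → member-opposite k M) s , λ M m → c M (opposite-member k M m)

theorem6p1 : (s : BMap) (n : ℕ) (ν : HE s → Fin n) (π : Fin n → HE s) →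
    Naming s n ν → Consistent s n ν → VertexEnum s n π →
    Σ[ c₁ ∈ (ℕ → ℕ) ] Σ[ c₂ ∈ (ℕ → ℕ) ]
    ((∀ k → Counts (RClass s n ν π k) (c₁ k))
    × (∀ k → Counts (RClass s n ν (λ i → π (opposite i)) k) (c₂ k))
    × Σ[ P₁ ∈ List ℤ ] Σ[ Q₁ ∈ List ℤ ] Σ[ P₂ ∈ List ℤ ] Σ[ Q₂ ∈ List ℤ ]
    (RatRep P₁ Q₁ (subD c₁) × RatRep P₂ Q₂ (subD c₂)
    × ReflectEq P₁ Q₁ P₂ Q₂))
-- The root half-edge always exists and its vertex has a name, so there is at least one vertex.
theorem6p1 s zero    ν π naming cons enum with () ← ν zero
theorem6p1 s (suc r) ν π naming (rl , relative , consistent) enum = decide (good? s)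
  where
  decide : Dec (Good s) → Conclusion s (suc r) ν π
  decide (yes (valid , four , deg)) = Counting.conclusion s valid four deg r ν π naming enum rl relative consistent
  decide (no bad)                   = no-members s (suc r) ν π bad
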